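{- Let $q$ be a power of the prime $p$ and $n\ge1$ such that $(q,n)$ is regular; write $n=p^an'$ with $p\nmid n'$. Then the number of elements of $\mathbb{F}_{q^n}$ that are completely normal over $\mathbb{F}_q$ equals \[\prod_{k\in\mathcal{N}}\Big(q^{\mathrm{ord}_k(q)/\tau_k}-1\Big)^{\tau_k\varphi(k)/\mathrm{ord}_k(q)}\,q^{(p^a-1)\varphi(k)}\ \cdot\ \prod_{k\in\mathcal{E}}\Big(q^{2\,\mathrm{ord}_k(q)/\tau_k}-4q^{\mathrm{ord}_k(q)/\tau_k}+3\Big)^{\tau_k\varphi(k)/(2\,\mathrm{ord}_k(q))}\,q^{(p^a-1)\varphi(k)},\] where the second product is $1$ if $\mathcal{E}$ is empty.
   Context: $\varphi$ is Euler's totient function; $\mathrm{rad}(m)$ is the product of primes dividing $m$; $\mathrm{ord}_m(q)$ the multiplicative order of $q$ mod $m$; $(q,n)$ is regular if $\gcd(\mathrm{ord}_{\mathrm{rad}(n')}(q),n)=1$. A divisor $k=2^c\ell$ ($\ell$ odd) of $n'$ is exceptional if $q\equiv3\pmod 4$, $c\ge3$ and $\mathrm{ord}_{2^c}(q)=2$; $\mathcal{E}$ is the set of exceptional and $\mathcal{N}$ the set of non-exceptional divisors of $n'$. For $k\mid n'$ write $\mathrm{ord}_k(q)/\mathrm{ord}_{\mathrm{rad}(k)}(q)=\prod_{r\mid k,\,r\text{ prime}}r^{\alpha(r)}$ and set $\tau_k=\prod_r r^{\lfloor\alpha(r)/2\rfloor}$ ($\tau_1=1$). With $\sigma:v\mapsto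 v^q$, $v\in\mathbb{F}_{q^n}$ is completely normal over $\mathbb{F}_q$ if for every divisor $d$ of $n$ the elements $\sigma^{dj}(v)$, $0\le j<n/d$, form an $\mathbb{F}_{q^d}$-basis of $\mathbb{F}_{q^n}$. -}

module Defs where

open import Level using (Level; _⊔_) renaming (suc to lsuc)
open import Data.Nat using (ℕ; zero; suc; _+_; _*_; _∸_; _^_; _≤_; _≡ᵇ_; _<ᵇ_)
open import Data.Nat.DivMod using (_/_; _%_)
open import Data.Nat.Divisibility using (_∣_; _∣?_)
open import Data.Nat.GCD using (gcd)
open import Data.Nat.Primality using (Prime; prime?)
open import Data.Bool using (Bool; true; false; _∧_; if_then_else_)
open import Data.Fin using (Fin; toℕ) renaming (zero to fzero; suc to fsuc)
open import Data.List using (List; []; _∷_; length; filter; map; foldr; applyUpTo)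
open import Data.List.Relation.Unary.All using (All)
open import Data.List.Relation.Unary.Any using (Any)
open import Data.List.Relation.Unary.AllPairs using (AllPairs)
open import Data.Product using (Σ; ∃; _×_)
open import Data.Unit.Polymorphic using (⊤)
open import Relation.Nullary using (¬_; ⌊_⌋)
open import Relation.Nullary.Decidable using (_×-dec_)
open import Relation.Binary.PropositionalEquality using (_≡_)
open import Algebra.Bundles using (CommutativeRing)

-- total division (m ÷ 0 = 0; only used with nonzero divisors)
_÷_ : ℕ → ℕ → ℕ
m ÷ zero  = 0
m ÷ suc b = m / suc b

oneTo : ℕ → List ℕ
oneTo m = applyUpTo suc m

prod : List ℕ → ℕ
prod = foldr _*_ 1

divisors : ℕ → List ℕ
divisors m = filter (λ d → d ∣? m) (oneTo m)

primeDivisors : ℕ → List ℕ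
primeDivisors m = filter (λ r → prime? r ×-dec r ∣? m) (oneTo m)

φ : ℕ → ℕ
φ m = length (filter (λ i → gcd i m Data.Nat.≟ 1) (oneTo m))

rad : ℕ → ℕ
rad m = prod (primeDivisors m)

val : ℕ → ℕ → ℕ
val r m = length (filter (λ c → r ^ c ∣? m) (oneTo m))

-- multiplicative order of q modulo m: the least k ≥ 1 with q^k ≡ 1 (mod m)
-- (searched in 1..m, which suffices when gcd(q,m)=1; ord 0 q = 0 by convention)
ord : ℕ → ℕ → ℕ
ord zero    q = 0
ord (suc m) q with filter (λ k → (q ^ k) % suc m Data.Nat.≟ 1 % suc m) (oneTo (suc m))
... | []    = 0
... | k ∷ _ = k

Regular : ℕ → ℕ → ℕ → Set
Regular q n n' = gcd (ord (rad n') q) n ≡ 1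

τ : ℕ → ℕ → ℕ
τ q k = prod (map (λ r → r ^ (val r (ord k q ÷ ord (rad k) q) / 2)) (primeDivisors k))

exceptional : ℕ → ℕ → Bool
exceptional q k = (q % 4 ≡ᵇ 3) ∧ (2 <ᵇ val 2 k) ∧ (ord (2 ^ val 2 k) q ≡ᵇ 2)

factor : ℕ → ℕ → ℕ → ℕ
factor q pa k =
  let o = ord k q ; t = τ q k ; x = o ÷ t in
  if exceptional q k
  then ((q ^ (2 * x) + 3) ∸ 4 * q ^ x) ^ ((t * φ k) ÷ (2 * o)) * q ^ ((pa ∸ 1) * φ k)
  else (q ^ x ∸ 1) ^ ((t * φ k) ÷ o) * q ^ ((pa ∸ 1) * φ k)

-- the closed formula: product over all divisors k of n'
-- (splitting into the products over 𝓝 and over 𝓔)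
formula : ℕ → ℕ → ℕ → ℕ
formula q pa n' = prod (map (factor q pa) (divisors n'))

record Field (c ℓ : Level) : Set (lsuc (c ⊔ ℓ)) where
  field
    ring : CommutativeRing c ℓ
  open CommutativeRing ring public
    using (Carrier; _≈_; 0#; 1#) renaming (_*_ to _*ᴷ_; _+_ to _+ᴷ_)
  field
    1≉0     : ¬ (1# ≈ 0#)
    inverse : ∀ x → ¬ (x ≈ 0#) → ∃ λ y → (x *ᴷ y) ≈ 1#

module FieldTheory {c ℓ} (K : Field c ℓ) where
  open Field K

  pow : Carrier → ℕ → Carrier
  pow x zero    = 1#
  pow x (suc k) = x *ᴷ pow x k

  lincomb : (m : ℕ) → (Fin m → Carrier) → (Fin m → Carrier) → Carrier
  lincomb zero    a b = 0#
  lincomb (suc m) a b = a fzero *ᴷ b fzero +ᴷ lincomb m (λ j → a (fsuc j)) (λ j → b (fsuc j))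

  HasCard : (Carrier → Set (c ⊔ ℓ)) → ℕ → Set (c ⊔ ℓ)
  HasCard P N = Σ (List Carrier) λ xs →
    (length xs ≡ N) × AllPairs (λ x y → ¬ (x ≈ y)) xs × All P xs
    × (∀ x → P x → Any (λ y → x ≈ y) xs)

  -- the subfield 𝔽_Q = { x : x^Q = x }  (Q a power of q)
  InSub : ℕ → Carrier → Set ℓ
  InSub Q x = pow x Q ≈ x

  IsBasisOver : ℕ → (m : ℕ) → (Fin m → Carrier) → Set (c ⊔ ℓ)
  IsBasisOver Q m b =
    (∀ (a : Fin m → Carrier) → (∀ j → InSub Q (a j)) →
       lincomb m a b ≈ 0# → ∀ j → a j ≈ 0#)
    × (∀ x → ∃ λ (a : Fin m → Carrier) → (∀ j → InSub Q (a j)) × (lincomb m a b ≈ x))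

  CompletelyNormal : ℕ → ℕ → Carrier → Set (c ⊔ ℓ)
  CompletelyNormal q n v =
    ∀ d → d ∣ n → IsBasisOver (q ^ d) (n ÷ d) (λ j → pow v (q ^ (d * toℕ j)))

{-# OPTIONS --safe #-}
module Submission where

-- For p ∤ n, an element v of 𝔽_{q^n} is normal over 𝔽_{q^d} exactly when no nonzero idempotent of the twisted group ring
-- 𝔽_{q^d}[σ^d] kills it: operators satisfy x^M = x for a suitable power M of q, hence every one of them generates the same
-- left ideal as an idempotent. Comparing coefficients in e = e^{q^i}, the coefficient of an idempotent e at index q^i j is the
-- q^i-th power of the one at j. Regularity then forces every idempotent of 𝔽_{q^d}[σ^d] below the k-th cyclotomic component to
-- have coefficients in 𝔽_{q^τ} and support in the powers of σ^τ, τ = τ_k; for exceptional k it may instead lie in 𝔽_{q^{2τ}}[σ^{2τ}].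
-- The component is thus cut into images of minimal idempotents of one commutative ring, of size q^{ord_k(q)/τ}, and v must
-- be nonzero in each. For exceptional k a common piece has size x² with x = q^{ord_k(q)/τ} and splits in two ways, once over
-- each ring, giving four subgroups of size x meeting pairwise in 0 to be avoided: x² − 4x + 3 choices.
-- If p ∣ n, v is completely normal in 𝔽_{q^n} iff its trace to 𝔽_{q^{n/p}} is, and the fibres of the trace have q^{n − n/p} elements.

module Cardinality where

  open import Data.Nat using (ℕ; zero; suc; _+_; _*_; _^_; _≤_; z≤n; s≤s)
  open import Data.Nat.Properties
  open import Data.List using (List; []; _∷_; length; map; _++_; filter; cartesianProduct)
  open import Data.List.Properties using (length-map; length-++)
  open import Data.List.Membership.Propositional using (_∈_)
  open import Data.List.Membership.Propositional.Properties
  open import Data.List.Relation.Unary.Any using (here; there)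
  open import Data.List.Relation.Unary.All as All using (All; []; _∷_)
  open import Data.List.Relation.Unary.AllPairs using (AllPairs; []; _∷_)
  open import Data.List.Relation.Unary.Unique.Propositional using (Unique)
  import Data.List.Relation.Unary.Unique.Propositional.Properties as Uniq
  open import Data.List.Relation.Binary.Permutation.Propositional using (_↭_; ↭-refl; ↭-trans; prep)
  open import Data.List.Relation.Binary.Permutation.Propositional.Properties using (∈-resp-↭; shift; ↭-length)
  open import Data.Vec as Vec using (Vec; []; _∷_)
  import Data.Vec.Relation.Unary.All as VAll
  open import Data.Product using (Σ; ∃; _×_; _,_; proj₁; proj₂)
  open import Data.Sum using (_⊎_; inj₁; inj₂)
  open import Data.Empty using (⊥; ⊥-elim)
  open import Relation.Nullary using (¬_; yes; no)
  open import Relation.Nullary.Decidable using (¬?)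
  open import Relation.Unary using (Decidable)
  open import Relation.Binary.PropositionalEquality

  private variable
    A B : Set
    P Q : A → Set
    m l : ℕ

  length-cartesianProduct : (xs : List A) (ys : List B) → length (cartesianProduct xs ys) ≡ length xs * length ys
  length-cartesianProduct [] ys = refl
  length-cartesianProduct (x ∷ xs) ys = trans (length-++ (map (x ,_) ys))
    (cong₂ _+_ (length-map (x ,_) ys) (length-cartesianProduct xs ys))

  unique-⊆-↭ : {xs ys : List A} → Unique xs → (∀ {x} → x ∈ xs → x ∈ ys) →
    Σ (List A) λ zs → ys ↭ xs ++ zs
  unique-⊆-↭ {ys = ys} [] s = ys , ↭-refl
  unique-⊆-↭ {xs = x ∷ xs} (x∉ ∷ u) s with ∈-∃++ (s (here refl))
  ... | as , bs , refl with unique-⊆-↭ {ys = as ++ bs} u sub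
    where
    sub : ∀ {y} → y ∈ xs → y ∈ as ++ bs
    sub {y} y∈ with ∈-resp-↭ (shift x as bs) (s (there y∈))
    ... | here refl = ⊥-elim (All.lookup x∉ y∈ refl)
    ... | there z = z
  ... | zs , perm = zs , ↭-trans (shift x as bs) (prep x perm)

  unique-⊆-≤ : {xs ys : List A} → Unique xs → (∀ {x} → x ∈ xs → x ∈ ys) → length xs ≤ length ys
  unique-⊆-≤ {xs = xs} {ys} u s with unique-⊆-↭ u s
  ... | zs , perm = begin
    length xs ≤⟨ m≤m+n _ _ ⟩
    length xs + length zs ≡⟨ length-++ xs ⟨
    length (xs ++ zs) ≡⟨ ↭-length perm ⟨
    length ys ∎
    where open ≤-Reasoning

  unique-⊆-full : {xs ys : List A} → Unique xs → (∀ {x} → x ∈ xs → x ∈ ys) →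
    length ys ≤ length xs → ys ↭ xs
  unique-⊆-full {xs = xs} {ys} u s le with unique-⊆-↭ u s
  ... | [] , perm = subst (ys ↭_) (++-identityʳ′ xs) perm
    where
    open import Data.List.Properties using () renaming (++-identityʳ to ++-identityʳ′)
  ... | z ∷ zs , perm = ⊥-elim (<-irrefl refl (begin-strict
    length xs <⟨ m<m+n _ (s≤s z≤n) ⟩
    length xs + length (z ∷ zs) ≡⟨ length-++ xs ⟨
    length (xs ++ z ∷ zs) ≡⟨ ↭-length perm ⟨
    length ys ≤⟨ le ⟩
    length xs ∎))
    where open ≤-Reasoning

  unique-map-on : {f : A → B} {xs : List A} → (∀ {x y} → x ∈ xs → y ∈ xs → f x ≡ f y → x ≡ y) →
    Unique xs → Unique (map f xs)
  unique-map-on inj [] = []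
  unique-map-on {f = f} {x ∷ xs} inj (x∉ ∷ u) =
    All.tabulate (λ {y} y∈ eq → let (z , z∈ , e) = ∈-map⁻ f y∈ in
      All.lookup x∉ z∈ (inj (here refl) (there z∈) (trans eq e)))
    ∷ unique-map-on (λ a b → inj (there a) (there b)) u

  record Card {A : Set} (P : A → Set) (N : ℕ) : Set where
    constructor mkCard
    field
      elems    : List A
      size     : length elems ≡ N
      uniq     : Unique elems
      sound    : ∀ {x} → x ∈ elems → P x
      complete : ∀ {x} → P x → x ∈ elems

  open Card public

  card-inj : (f : A → B) → (∀ {x} → P x → Q (f x)) →
    (∀ {x y} → P x → P y → f x ≡ f y → x ≡ y) → Card P m → Card Q l → m ≤ l
  card-inj {Q = Q} f pq inj c d =
    subst₂ _≤_ (trans (length-map f (elems c)) (size c)) (size d)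
     (unique-⊆-≤ (unique-map-on (λ a b → inj (sound c a) (sound c b)) (uniq c))
      (λ y∈ → let (z , z∈ , e) = ∈-map⁻ f y∈ in complete d (subst Q (sym e) (pq (sound c z∈)))))

  card-surj : (f : A → B) → (∀ {x} → P x → Q (f x)) →
    (∀ {x y} → P x → P y → f x ≡ f y → x ≡ y) → Card P m → Card Q l → l ≤ m →
    ∀ {y} → Q y → ∃ λ x → P x × f x ≡ y
  card-surj {Q = Q} f pq inj c d le qy =
    let perm = unique-⊆-full (unique-map-on (λ a b → inj (sound c a) (sound c b)) (uniq c))
           (λ y∈ → let (z , z∈ , e) = ∈-map⁻ f y∈ in complete d (subst Q (sym e) (pq (sound c z∈))))
           (subst₂ _≤_ (sym (size d)) (sym (trans (length-map f (elems c)) (size c))) le)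
        (x , x∈ , e) = ∈-map⁻ f (∈-resp-↭ perm (complete d qy))
    in x , sound c x∈ , sym e

  card-unique : {P Q : A → Set} → Card P m → Card Q l → (∀ {x} → P x → Q x) → (∀ {x} → Q x → P x) → m ≡ l
  card-unique c d pq qp = ≤-antisym (card-inj (λ x → x) pq (λ _ _ e → e) c d) (card-inj (λ x → x) qp (λ _ _ e → e) d c)

  card-image : (f : A → B) → (∀ {x} → P x → Q (f x)) →
    (∀ {x y} → P x → P y → f x ≡ f y → x ≡ y) → (∀ {y} → Q y → ∃ λ x → P x × f x ≡ y) →
    Card P m → Card Q m
  card-image {Q = Q} f pq inj sur c = mkCard (map f (elems c)) (trans (length-map f (elems c)) (size c))
    (unique-map-on (λ a b → inj (sound c a) (sound c b)) (uniq c))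
    (λ y∈ → let (z , z∈ , e) = ∈-map⁻ f y∈ in subst Q (sym e) (pq (sound c z∈)))
    (λ qy → let (x , px , e) = sur qy in subst (_∈ _) e (∈-map⁺ f (complete c px)))

  card-bij : (f : A → B) (g : B → A) → (∀ {x} → P x → Q (f x)) → (∀ {y} → Q y → P (g y)) →
    (∀ {x} → P x → g (f x) ≡ x) → (∀ {y} → Q y → f (g y) ≡ y) → Card P m → Card Q m
  card-bij f g pq qp gf fg = card-image f pq
    (λ px py e → trans (sym (gf px)) (trans (cong g e) (gf py)))
    (λ qy → g _ , qp qy , fg qy)

  card-cong : {P Q : A → Set} → (∀ {x} → P x → Q x) → (∀ {x} → Q x → P x) → Card P m → Card Q m
  card-cong pq qp c = mkCard (elems c) (size c) (uniq c) (λ z → pq (sound c z)) (λ z → complete c (qp z))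

  card-× : Card P m → Card Q l → Card (λ (z : A × B) → P (proj₁ z) × Q (proj₂ z)) (m * l)
  card-× c d = mkCard (cartesianProduct (elems c) (elems d))
    (trans (length-cartesianProduct (elems c) (elems d)) (cong₂ _*_ (size c) (size d)))
    (Uniq.cartesianProduct⁺ (uniq c) (uniq d))
    (λ z → let (a , b) = ∈-cartesianProduct⁻ (elems c) (elems d) z in sound c a , sound d b)
    (λ (a , b) → ∈-cartesianProduct⁺ (complete c a) (complete d b))

  card-⊎ : {P Q : A → Set} → (∀ {x} → P x → Q x → ⊥) → Card P m → Card Q l → Card (λ x → P x ⊎ Q x) (m + l)
  card-⊎ {P = P} {Q} dis c d = mkCard (elems c ++ elems d)
    (trans (length-++ (elems c)) (cong₂ _+_ (size c) (size d)))
    (Uniq.++⁺ (uniq c) (uniq d) (λ (a , b) → dis (sound c a) (sound d b)))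
    snd (λ { (inj₁ a) → ∈-++⁺ˡ (complete c a) ; (inj₂ b) → ∈-++⁺ʳ (elems c) (complete d b) })
    where
    snd : ∀ {x} → x ∈ elems c ++ elems d → P x ⊎ Q x
    snd z with ∈-++⁻ (elems c) z
    ... | inj₁ a = inj₁ (sound c a)
    ... | inj₂ b = inj₂ (sound d b)

  card-filter : {P Q : A → Set} → Decidable Q → Card P m → ∃ λ k → Card (λ x → P x × Q x) k
  card-filter Q? c = _ , mkCard (filter Q? (elems c)) refl (Uniq.filter⁺ Q? (uniq c))
    (λ z → let (a , b) = ∈-filter⁻ Q? z in sound c a , b)
    (λ (a , b) → ∈-filter⁺ Q? (complete c a) b)

  card-minus : {P Q : A → Set} → (∀ {x} → Q x → P x) → Decidable Q → Card P m → Card Q l →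
    ∃ λ k → Card (λ x → P x × ¬ Q x) k × l + k ≡ m
  card-minus qp Q? c d with card-filter (λ x → ¬? (Q? x)) c
  ... | k , e = k , e , card-unique (card-⊎ (λ q (_ , nq) → nq q) d e) c
    (λ { (inj₁ q) → qp q ; (inj₂ (p , _)) → p })
    (λ {x} p → split x p)
    where
    split : ∀ x → _ → _
    split x p with Q? x
    ... | yes q = inj₁ q
    ... | no nq = inj₂ (p , nq)

  card-one : (a : A) → Card (λ x → x ≡ a) 1
  card-one a = mkCard (a ∷ []) refl ([] ∷ []) (λ { (here e) → e }) here

  card-Vec : {P : A → Set} → Card P m → ∀ k → Card (λ (v : Vec A k) → VAll.All P v) (m ^ k)
  card-Vec c zero = card-cong (λ { refl → VAll.[] }) (λ { VAll.[] → refl }) (card-one [])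
  card-Vec c (suc k) = card-bij (λ (x , v) → x ∷ v) (λ { (x ∷ v) → x , v })
    (λ (a , b) → a VAll.∷ b) (λ { (a VAll.∷ b) → a , b }) (λ _ → refl) (λ { {_ ∷ _} _ → refl })
    (card-× c (card-Vec c k))

module Arithmetic where

  open import Data.Nat
  open import Data.Nat.Properties
  open import Data.Nat.Divisibility
  open import Data.Nat.GCD using (gcd; gcd[m,n]∣m; gcd[m,n]∣n; gcd-greatest; gcd-GCD; module Bézout)
  open import Data.Nat.Coprimality as Cop using (Coprime; coprime-divisor; coprime⇒gcd≡1)
  open import Data.Nat.Primality
  open import Data.Nat.Primality.Factorisation using (factorise; PrimeFactorisation)
  open import Data.Nat.Tactic.RingSolver using (solve-∀)
  open import Data.List using (List; []; _∷_; map)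
  import Data.Nat.ListAction as L
  open import Data.List.Relation.Unary.All using (All; []; _∷_)
  import Data.List.Relation.Unary.All as All
  open import Data.List.Relation.Unary.Any using (here; there)
  open import Data.List.Membership.Propositional using (_∈_)
  open import Data.List.Relation.Unary.AllPairs using ([]; _∷_)
  open import Data.List.Relation.Unary.Unique.Propositional using (Unique)
  open import Data.Product using (∃; _×_; _,_; proj₂)
  open import Data.Sum using (_⊎_; inj₁; inj₂)
  open import Data.Empty using (⊥; ⊥-elim)
  open import Relation.Nullary using (¬_; yes; no)
  open import Relation.Binary.PropositionalEquality
  open import Defs using (prod)

  prime≥2 : ∀ {s} → Prime s → 2 ≤ s
  prime≥2 P = nonTrivial⇒n>1 _ {{prime⇒nonTrivial P}}

  prime≥1 : ∀ {s} → Prime s → 1 ≤ s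
  prime≥1 P = ≤-trans (s≤s z≤n) (prime≥2 P)

  prime∤1 : ∀ {s} → Prime s → ¬ s ∣ 1
  prime∤1 P d with ∣1⇒≡1 d | prime≥2 P
  ... | refl | s≤s ()

  prime∣prime : ∀ {s r} → Prime s → Prime r → s ∣ r → s ≡ r
  prime∣prime P R d with prime⇒irreducible R d
  ... | inj₁ refl = ⊥-elim (prime∤1 P (∣-refl))
  ... | inj₂ e = e

  prime∣^ : ∀ {s} r b → Prime s → s ∣ r ^ b → s ∣ r
  prime∣^ r zero P d = ⊥-elim (prime∤1 P d)
  prime∣^ r (suc b) P d with euclidsLemma r (r ^ b) P d
  ... | inj₁ x = x
  ... | inj₂ x = prime∣^ r b P x

  primeInd : (P : ℕ → Set) → P 1 → (∀ s w → Prime s → 1 ≤ w → P w → P (s * w)) → ∀ w → 1 ≤ w → P w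
  primeInd P p1 ps w w≥1 = subst P (sym isFactorisation) (go factors factorsPrime .proj₂)
    where
    open PrimeFactorisation (factorise w {{>-nonZero w≥1}})
    go : ∀ L → All Prime L → 1 ≤ L.product L × P (L.product L)
    go [] [] = ≤-refl , p1
    go (s ∷ L) (S ∷ A) with go L A
    ... | l , x = *-mono-≤ (prime≥1 S) l , ps s _ S l x

  primeFactor : ∀ d → 2 ≤ d → ∃ λ s → Prime s × s ∣ d
  primeFactor d h with factorise d {{>-nonZero (≤-trans (s≤s z≤n) h)}}
  ... | record { factors = [] ; isFactorisation = refl } = ⊥-elim (1+n≰n h)
  ... | record { factors = s ∷ L ; isFactorisation = refl ; factorsPrime = S ∷ _ } = s , S , m∣m*n _

  ∣⇒≥1 : ∀ {a b} → 1 ≤ b → a ∣ b → 1 ≤ a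
  ∣⇒≥1 {zero} h d = ⊥-elim (n≮0 (subst (1 ≤_) (0∣⇒≡0 d) h))
  ∣⇒≥1 {suc a} h d = s≤s z≤n

  coprime-primes : ∀ {a b} → 1 ≤ a → (∀ s → Prime s → s ∣ a → s ∣ b → ⊥) → Coprime a b
  coprime-primes h f {d} (da , db) with 2 ≤? d
  ... | yes l = let (s , S , sd) = primeFactor d l in ⊥-elim (f s S (∣-trans sd da) (∣-trans sd db))
  ... | no l with d | ∣⇒≥1 h da
  ... | suc zero | _ = refl
  ... | suc (suc d) | _ = ⊥-elim (l (s≤s (s≤s z≤n)))

  coprime-∣ : ∀ {a b c d} → Coprime a b → c ∣ a → d ∣ b → Coprime c d
  coprime-∣ C x y (u , v) = C (∣-trans u x , ∣-trans v y)

  coprime-*∣ : ∀ {a b c} → Coprime a b → a ∣ c → b ∣ c → a * b ∣ c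
  coprime-*∣ {a} {b} C a∣c (divides k refl) with coprime-divisor C (subst (a ∣_) (*-comm k b) a∣c)
  ... | divides l refl = divides l (*-assoc l a b)

  coprime-*ʳ : ∀ {a b c} → 1 ≤ a → Coprime a b → Coprime a c → Coprime a (b * c)
  coprime-*ʳ {a} {b} {c} h C D = coprime-primes h λ s S sa sbc → case (euclidsLemma b c S sbc) S sa
    where
    case : ∀ {s} → s ∣ b ⊎ s ∣ c → Prime s → s ∣ a → ⊥
    case {s} (inj₁ x) S sa = prime∤1 S (subst (s ∣_) (C (sa , x)) ∣-refl)
    case {s} (inj₂ x) S sa = prime∤1 S (subst (s ∣_) (D (sa , x)) ∣-refl)

  prime-coprime : ∀ {r m} → Prime r → ¬ r ∣ m → Coprime r m
  prime-coprime R h = coprime-primes (prime≥1 R) λ s S a b → h (subst (_∣ _) (prime∣prime S R a) b)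

  prime^-coprime : ∀ {r m} b → Prime r → ¬ r ∣ m → Coprime (r ^ b) m
  prime^-coprime {r} b R h = coprime-primes (m^n>0 r {{prime⇒nonZero R}} b)
    λ s S a c → h (subst (_∣ _) (prime∣prime S R (prime∣^ r b S a)) c)

  ^-mono-∣ : ∀ r {a b} → a ≤ b → r ^ a ∣ r ^ b
  ^-mono-∣ r {a} {b} h = subst (λ z → r ^ a ∣ r ^ z) (m+[n∸m]≡n h)
    (subst (r ^ a ∣_) (sym (^-distribˡ-+-* r a (b ∸ a))) (m∣m*n _))

  n<2^n : ∀ n → n < 2 ^ n
  n<2^n zero = s≤s z≤n
  n<2^n (suc n) = ≤-trans (+-mono-≤ (m^n>0 2 n) (n<2^n n)) (≤-reflexive (cong (2 ^ n +_) (sym (+-identityʳ _))))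

  n<r^n : ∀ {r} → Prime r → ∀ n → n < r ^ n
  n<r^n P n = ≤-trans (n<2^n n) (^-monoˡ-≤ n (prime≥2 P))

  jump : ∀ r x b → ¬ r ^ b ∣ x → ∃ λ j → j < b × r ^ j ∣ x × ¬ r ^ suc j ∣ x
  jump r x zero h = ⊥-elim (h (1∣ x))
  jump r x (suc b) h with (r ^ b) ∣? x
  ... | yes d = b , ≤-refl , d , h
  ... | no d = let (j , l , u , v) = jump r x b d in j , m≤n⇒m≤1+n l , u , v

  maxPower : ∀ {r} x → Prime r → 1 ≤ x → ∃ λ v → v < x × r ^ v ∣ x × ¬ r ^ suc v ∣ x
  maxPower {r} x R h = jump r x x λ d → <-irrefl refl (<-≤-trans (n<r^n R x) (∣⇒≤ {{>-nonZero h}} d))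

  -- The witness is the full power in x of a prime dividing x / gcd(x, y).
  ∣-or-primePower : ∀ x y → 1 ≤ x → x ∣ y ⊎ ∃ λ r → ∃ λ b → Prime r × r ^ b ∣ x × ¬ r ^ b ∣ y
  ∣-or-primePower x y h with gcd x y in eq | gcd[m,n]∣m x y | gcd[m,n]∣n x y
  ... | g | divides c refl | gy with 2 ≤? c
  ... | no l with c | h
  ... | suc zero | _ = inj₁ (subst (_∣ y) (sym (+-identityʳ g)) gy)
  ... | suc (suc c) | _ = ⊥-elim (l (s≤s (s≤s z≤n)))
  ∣-or-primePower x y h | g | divides c refl | gy | yes l with primeFactor c l
  ... | r , R , divides c′ refl with maxPower (c′ * r * g) R h
  ... | v , _ , a , b = inj₂ (r , v , R , a , λ y∣ →
    let r^v∣g = subst (r ^ v ∣_) eq (gcd-greatest a y∣) in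
    b (subst (r ^ suc v ∣_) (sym (*-assoc c′ r g)) (∣n⇒∣m*n c′ (*-monoʳ-∣ r r^v∣g))))

  ∣-primePowers : ∀ x y → 1 ≤ x → (∀ r b → Prime r → r ^ b ∣ x → r ^ b ∣ y) → x ∣ y
  ∣-primePowers x y h f with ∣-or-primePower x y h
  ... | inj₁ d = d
  ... | inj₂ (r , b , R , u , v) = ⊥-elim (v (f r b R u))

  primePower-*-cancel : ∀ {r x y} b → Prime r → ¬ r ∣ y → r ^ b ∣ x * y → r ^ b ∣ x
  primePower-*-cancel {r} {x} {y} b R h d = coprime-divisor (prime^-coprime b R h) (subst (r ^ b ∣_) (*-comm x y) d)

  primePower-* : ∀ {r x y} a b → Prime r → ¬ r ^ suc a ∣ x → ¬ r ^ suc b ∣ y → ¬ r ^ suc (a + b) ∣ x * y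
  primePower-* {r} {x} {y} a b R hx hy d with jump r x (suc a) hx | jump r y (suc b) hy
  ... | i , i<a , divides x′ refl , nx | j , j<b , divides y′ refl , ny =
    <-irrefl refl (≤-trans (s≤s (+-mono-≤ (≤-pred i<a) (≤-pred j<b))) le)
    where
    instance _ = prime⇒nonZero R
    nx′ : ¬ r ∣ x′
    nx′ z = nx (*-monoˡ-∣ (r ^ i) z)
    ny′ : ¬ r ∣ y′
    ny′ z = ny (*-monoˡ-∣ (r ^ j) z)
    nxy : ¬ r ∣ x′ * y′
    nxy z with euclidsLemma x′ y′ R z
    ... | inj₁ a = nx′ a
    ... | inj₂ a = ny′ a
    eq : x′ * r ^ i * (y′ * r ^ j) ≡ r ^ (i + j) * (x′ * y′)
    eq = trans (lem x′ (r ^ i) y′ (r ^ j)) (cong (_* (x′ * y′)) (sym (^-distribˡ-+-* r i j)))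
      where
      lem : ∀ a b c d → a * b * (c * d) ≡ b * d * (a * c)
      lem = solve-∀
    d′ : r ^ suc (a + b) ∣ r ^ (i + j)
    d′ = primePower-*-cancel (suc (a + b)) R nxy (subst (r ^ suc (a + b) ∣_) eq d)
    le : suc (a + b) ≤ i + j
    le with suc (a + b) ≤? i + j
    ... | yes z = z
    ... | no z = ⊥-elim (<-irrefl refl (<-≤-trans (^-monoʳ-< r (prime≥2 R) (≰⇒> z)) (∣⇒≤ {{m^n≢0 r (i + j)}} d′)))

  ^∣^⇒≤ : ∀ {r} a b → Prime r → r ^ a ∣ r ^ b → a ≤ b
  ^∣^⇒≤ {r} a b R d with a ≤? b
  ... | yes z = z
  ... | no z = ⊥-elim (<-irrefl refl (<-≤-trans (^-monoʳ-< r (prime≥2 R) (≰⇒> z)) (∣⇒≤ {{m^n≢0 r b {{prime⇒nonZero R}}}} d)))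

  ∈⇒∣prod : ∀ {r} {L : List ℕ} (f : ℕ → ℕ) → r ∈ L → f r ∣ prod (map f L)
  ∈⇒∣prod f (here refl) = m∣m*n _
  ∈⇒∣prod {L = s ∷ _} f (there x) = ∣n⇒∣m*n (f s) (∈⇒∣prod f x)

  primePower∣prod : ∀ {r} {L : List ℕ} (f : ℕ → ℕ) b → Prime r → All Prime L → Unique L →
    r ^ b ∣ prod (map (λ s → s ^ f s) L) → b ≡ 0 ⊎ (r ∈ L × b ≤ f r)
  primePower∣prod f zero R A U d = inj₁ refl
  primePower∣prod {r} {[]} f (suc b) R A U d = ⊥-elim (prime∤1 R (∣-trans (m∣m*n _) d))
  primePower∣prod {r} {s ∷ L} f (suc b) R (S ∷ A) (s∉ ∷ U) d with r ≟ s
  ... | yes refl = inj₂ (here refl , ^∣^⇒≤ (suc b) (f r) R (primePower-*-cancel (suc b) R no∣ d))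
    where
    no∣ : ¬ r ∣ prod (map (λ s → s ^ f s) L)
    no∣ z with primePower∣prod f 1 R A U (subst (_∣ _) (sym (*-identityʳ r)) z)
    ... | inj₂ (r∈ , _) = All.lookup s∉ r∈ refl
  ... | no ne with primePower∣prod f (suc b) R A U
        (primePower-*-cancel (suc b) R (λ z → ne (prime∣prime R S (prime∣^ s (f s) R z))) (subst (r ^ suc b ∣_) (*-comm (s ^ f s) _) d))
  ... | inj₂ (x , y) = inj₂ (there x , y)

  -- y ≡ 1 (mod m), for y ≥ 1
  One : ℕ → ℕ → Set
  One m y = m ∣ pred y

  geo : ℕ → ℕ → ℕ
  geo z zero = 0
  geo z (suc r) = geo z r + suc z ^ r

  ^-geo : ∀ z r → suc z ^ r ≡ suc (z * geo z r)
  ^-geo z zero = cong suc (sym (*-zeroʳ z))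
  ^-geo z (suc r) = trans (cong (λ w → w + z * suc z ^ r) (^-geo z r)) (lem z (geo z r) (suc z ^ r))
    where
    lem : ∀ z g w → suc (z * g) + z * w ≡ suc (z * (g + w))
    lem = solve-∀

  geo-mod : ∀ z r → ∃ λ k → geo z r ≡ r + z * k
  geo-mod z zero = 0 , sym (*-zeroʳ z)
  geo-mod z (suc r) with geo-mod z r
  ... | k , e = k + geo z r , trans (cong₂ _+_ e (^-geo z r)) (lem z r k (geo z r))
    where
    lem : ∀ z r k g → r + z * k + suc (z * g) ≡ suc r + z * (k + g)
    lem = solve-∀

  tri : ℕ → ℕ
  tri zero = 0
  tri (suc r) = tri r + r

  tri-2 : ∀ r → 2 * tri r + r ≡ r * r
  tri-2 zero = refl
  tri-2 (suc r) = trans (lem (tri r) r) (trans (cong (λ w → w + suc (2 * r)) (tri-2 r)) (lem2 r))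
    where
    lem : ∀ t r → 2 * (t + r) + suc r ≡ 2 * t + r + suc (2 * r)
    lem = solve-∀
    lem2 : ∀ r → r * r + suc (2 * r) ≡ suc r * suc r
    lem2 = solve-∀

  geo-mod² : ∀ z r → ∃ λ k → geo z r ≡ r + z * tri r + z * z * k
  geo-mod² z zero = 0 , lem z
    where
    lem : ∀ z → 0 ≡ z * 0 + z * z * 0
    lem = solve-∀
  geo-mod² z (suc r) with geo-mod² z r | geo-mod z r
  ... | k , e | k′ , e′ = k + k′ ,
    trans (cong₂ _+_ e (trans (^-geo z r) (cong (λ w → suc (z * w)) e′))) (lem z r (tri r) k k′)
    where
    lem : ∀ z r t k k′ → r + z * t + z * z * k + suc (z * (r + z * k′)) ≡ suc r + z * (t + r) + z * z * (k + k′)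
    lem = solve-∀

  geo-prime : ∀ z r → Prime r → r ∣ z → (r ≡ 2 → 4 ∣ z) → ∃ λ k → geo z r ≡ r * (1 + r * k)
  geo-prime z r R r∣z h with r ≟ 2
  ... | yes refl with h refl
  ... | divides w refl = w , lem w
    where
    lem : ∀ w → suc (suc (w * 4) * 1) ≡ 2 * (1 + 2 * w)
    lem = solve-∀
  geo-prime z r R (divides w refl) h | no r≢2 with geo-mod² z r | r∣tri
    where
    r∣tri : r ∣ tri r
    r∣tri with euclidsLemma 2 (tri r) R (∣m+n∣m⇒∣n (subst (r ∣_) (trans (sym (tri-2 r)) (+-comm _ r)) (m∣m*n r)) ∣-refl)
    ... | inj₁ x = ⊥-elim (r≢2 (prime∣prime R prime[2] x))
    ... | inj₂ x = x
  ... | k , e | divides t f = w * t + w * w * k , trans e (trans (cong (λ u → r + w * r * u + w * r * (w * r) * k) f) (lem r w t k))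
    where
    lem : ∀ r w t k → r + w * r * (t * r) + w * r * (w * r) * k ≡ r * (1 + r * (w * t + w * w * k))
    lem = solve-∀

  One-^ : ∀ m y r → 1 ≤ y → One m y → One m (y ^ r)
  One-^ m (suc z) r h d = subst (λ w → m ∣ pred w) (sym (^-geo z r)) (∣m⇒∣m*n _ d)

  One-cancel : ∀ m y y′ → 1 ≤ y → 1 ≤ y′ → One m y → One m (y * y′) → One m y′
  One-cancel m (suc z) (suc z′) _ _ d d′ = ∣m+n∣m⇒∣n (subst (m ∣_) (+-comm z′ _) d′) (∣m⇒∣m*n (suc z′) d)

  One-lift : ∀ w → 1 ≤ w → ∀ R y → 1 ≤ y → (∀ s → Prime s → s ∣ w → s ∣ R) → One R y → One (R * w) (y ^ w)
  One-lift = primeInd _ base step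
    where
    base : ∀ R y → 1 ≤ y → _ → One R y → One (R * 1) (y ^ 1)
    base R y _ _ d = subst₂ _∣_ (sym (*-identityʳ R)) (cong pred (sym (*-identityʳ y))) d
    step : ∀ s w → Prime s → 1 ≤ w →
      (∀ R y → 1 ≤ y → (∀ s → Prime s → s ∣ w → s ∣ R) → One R y → One (R * w) (y ^ w)) →
      ∀ R y → 1 ≤ y → (∀ r → Prime r → r ∣ s * w → r ∣ R) → One R y → One (R * (s * w)) (y ^ (s * w))
    step s w S w≥1 ih R y@(suc z) _ h d =
      subst₂ One (*-assoc R s w) (^-*-assoc y s w)
        (ih (R * s) (y ^ s) (m^n>0 y s) (λ r P x → ∣m⇒∣m*n s (h r P (∣n⇒∣m*n s x)))
          (subst (λ v → R * s ∣ pred v) (sym (^-geo z s)) (*-pres-∣ d s∣geo)))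
      where
      s∣geo : s ∣ geo z s
      s∣geo with geo-mod z s
      ... | k , e = subst (s ∣_) (sym e) (∣m∣n⇒∣m+n ∣-refl (∣m⇒∣m*n k (∣-trans (h s S (m∣m*n w)) d)))

  One-descend-prime : ∀ r m y → Prime r → 1 ≤ y → 1 ≤ m → r ∣ m → (∀ s → Prime s → s ∣ m → One s y) →
    (r ≡ 2 → One 4 y) → One (m * r) (y ^ r) → One m y
  One-descend-prime r m (suc z) R _ m≥1 r∣m h h4 d with geo-prime z r R (h r R r∣m) h4
  ... | k , e = coprime-divisor cop (subst (m ∣_) (*-comm z _) m∣zG)
    where
    G = 1 + r * k
    instance _ = prime⇒nonZero R
    m∣zG : m ∣ z * G
    m∣zG = *-cancelʳ-∣ r (subst (m * r ∣_) (trans (cong pred (^-geo z r)) (trans (cong (z *_) e) (lem z r G))) d)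
      where
      lem : ∀ z r g → z * (r * g) ≡ z * g * r
      lem = solve-∀
    cop : Coprime m G
    cop = coprime-primes m≥1 λ s S sm sG → go s S sm sG
      where
      go : ∀ s → Prime s → s ∣ m → s ∣ G → ⊥
      go s S sm sG with geo-mod z r
      ... | k′ , e′ with prime∣prime S R (∣m+n∣m⇒∣n (subst (s ∣_) (trans (trans (sym e) e′) (+-comm r _)) (∣n⇒∣m*n r sG)) (∣m⇒∣m*n k′ (h s S sm)))
      ... | refl = prime∤1 R (∣m+n∣m⇒∣n (subst (r ∣_) (+-comm 1 (r * k)) sG) (m∣m*n k))

  One-descend : ∀ w → 1 ≤ w → ∀ m y → 1 ≤ y → 1 ≤ m → (∀ s → Prime s → s ∣ w → s ∣ m) →
    (∀ s → Prime s → s ∣ m → One s y) → (2 ∣ w → One 4 y) → One (m * w) (y ^ w) → One m y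
  One-descend = primeInd _
    (λ m y _ _ _ _ _ d → subst₂ One (*-identityʳ m) (*-identityʳ y) d) step
    where
    step : ∀ s w → Prime s → 1 ≤ w → (∀ m y → 1 ≤ y → 1 ≤ m → (∀ s → Prime s → s ∣ w → s ∣ m) →
      (∀ s → Prime s → s ∣ m → One s y) → (2 ∣ w → One 4 y) → One (m * w) (y ^ w) → One m y) →
      ∀ m y → 1 ≤ y → 1 ≤ m → (∀ r → Prime r → r ∣ s * w → r ∣ m) →
      (∀ s → Prime s → s ∣ m → One s y) → (2 ∣ s * w → One 4 y) → One (m * (s * w)) (y ^ (s * w)) → One m y
    step s w S w≥1 ih m y@(suc z) y≥1 m≥1 h1 h2 h3 d =
      One-descend-prime s m y S y≥1 m≥1 (h1 s S (m∣m*n w)) h2 (λ { refl → h3 (m∣m*n w) })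
       (ih (m * s) (y ^ s) (m^n>0 y s) (*-mono-≤ m≥1 (prime≥1 S))
         (λ r R x → ∣m⇒∣m*n s (h1 r R (∣n⇒∣m*n s x)))
         (λ r R x → One-^ r y s y≥1 (h2 r R (ms r R x)))
         (λ x → One-^ 4 y s y≥1 (h3 (∣n⇒∣m*n s x)))
         (subst₂ One (sym (*-assoc m s w)) (sym (^-*-assoc y s w)) d))
      where
      ms : ∀ r → Prime r → r ∣ m * s → r ∣ m
      ms r R x with euclidsLemma m s R x
      ... | inj₁ a = a
      ... | inj₂ a = subst (_∣ m) (sym (prime∣prime R S a)) (h1 s S (m∣m*n w))

  Cong : ℕ → ℕ → ℕ → Set
  Cong N a b = ∃ λ x → ∃ λ y → a + x * N ≡ b + y * N

  linear-solve : ∀ d o s → 1 ≤ o → gcd d o ∣ s → ∃ λ v → ∃ λ w → ∃ λ w′ → d * v + o * w ≡ s + o * w′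
  linear-solve d o@(suc o′) s _ (divides c refl) with Bézout.identity (gcd-GCD d o)
  ... | Bézout.Identity.+- x y e = c * x , 0 , c * y , trans (lem1 d c x o) (trans (cong (c *_) (sym e)) (lem2 (gcd d o) c y o))
    where
    lem1 : ∀ d c x o → d * (c * x) + o * 0 ≡ c * (x * d)
    lem1 = solve-∀
    lem2 : ∀ g c y o → c * (g + y * o) ≡ c * g + o * (c * y)
    lem2 = solve-∀
  ... | Bézout.Identity.-+ x y e = c * x * o′ , c * y , d * c * x ,
    trans (lem1 d c x o′ y) (trans (cong (λ w → d * (c * x * o′) + c * w) (sym e)) (lem2 d c x o′ (gcd d o)))
    where
    lem1 : ∀ d c x o y → d * (c * x * o) + suc o * (c * y) ≡ d * (c * x * o) + c * (y * suc o)
    lem1 = solve-∀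
    lem2 : ∀ d c x o g → d * (c * x * o) + c * (g + x * d) ≡ c * g + suc o * (d * c * x)
    lem2 = solve-∀

  Cong-* : ∀ {N a b} c → Cong N a b → Cong N (a * c) (b * c)
  Cong-* {N} {a} {b} c (x , y , e) = x * c , y * c ,
    trans (lem a x N c) (trans (cong (_* c) e) (sym (lem b y N c)))
    where
    lem : ∀ a x N c → a * c + x * c * N ≡ (a + x * N) * c
    lem = solve-∀

  One⇒Cong : ∀ {N y} a → 1 ≤ y → One N y → Cong N a (y * a)
  One⇒Cong {N} {suc z} a _ (divides k refl) = k * a , 0 , lem a k N
    where
    lem : ∀ a k N → a + k * a * N ≡ a + k * N * a + 0
    lem = solve-∀

  Cong-sym : ∀ {N a b} → Cong N a b → Cong N b a
  Cong-sym (x , y , e) = y , x , sym e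

  Cong-trans : ∀ {N a b c} → Cong N a b → Cong N b c → Cong N a c
  Cong-trans {N} {a} {b} {c} (x , y , e) (x′ , y′ , e′) = x + x′ , y + y′ ,
    trans (lem a x x′ N) (trans (cong (_+ x′ * N) e) (trans (lem3 b y x′ N) (trans (cong (_+ y * N) e′) (lem2 c y y′ N))))
    where
    lem : ∀ a x x′ N → a + (x + x′) * N ≡ a + x * N + x′ * N
    lem = solve-∀
    lem3 : ∀ b y x′ N → b + y * N + x′ * N ≡ b + x′ * N + y * N
    lem3 = solve-∀
    lem2 : ∀ c y y′ N → c + y′ * N + y * N ≡ c + (y + y′) * N
    lem2 = solve-∀

  Cong-^ : ∀ {N q o} a b w w′ → 1 ≤ q → One N (q ^ o) → a + o * w ≡ b + o * w′ → Cong N (q ^ a) (q ^ b)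
  Cong-^ {N} {q} {o} a b w w′ h d e = Cong-trans (c a w)
    (subst (λ z → Cong N z (q ^ b)) (trans (sym (pw b w′)) (trans (cong (q ^_) (sym e)) (pw a w))) (Cong-sym (c b w′)))
    where
    instance _ = >-nonZero h
    pw : ∀ a w → q ^ (a + o * w) ≡ (q ^ o) ^ w * q ^ a
    pw a w = trans (^-distribˡ-+-* q a (o * w)) (trans (*-comm (q ^ a) _) (cong (_* q ^ a) (sym (^-*-assoc q o w))))
    c : ∀ a w → Cong N (q ^ a) ((q ^ o) ^ w * q ^ a)
    c a w = One⇒Cong (q ^ a) (m^n>0 (q ^ o) {{m^n≢0 q o}} w) (One-^ N (q ^ o) w (m^n>0 q o) d)

  One-radical : ∀ q o M → 1 ≤ q → 1 ≤ M → (∀ s → Prime s → s ∣ M → One s (q ^ o)) → One M (q ^ (o * M))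
  One-radical q o M q≥1 M≥1 h =
    ∣-trans (n∣m*n R) (subst (One (R * M)) (^-*-assoc q o M)
      (One-lift M M≥1 R (q ^ o) (m^n>0 q o) (λ s S d → gcd-greatest d (h s S d)) (gcd[m,n]∣n M _)))
    where
    instance _ = >-nonZero q≥1
    R = gcd M (pred (q ^ o))

  power-root : ∀ q o g M → 1 ≤ q → 1 ≤ o → 1 ≤ M → 1 ≤ g → (∀ s → Prime s → s ∣ M → One s (q ^ o)) →
    Coprime g o → Coprime g M → ∃ λ v → Cong M (q ^ (g * v)) q
  power-root q o g M q≥1 o≥1 M≥1 g≥1 h c c′ with linear-solve g (o * M) 1 (*-mono-≤ o≥1 M≥1)
      (∣-reflexive (coprime⇒gcd≡1 (coprime-*ʳ g≥1 c c′)))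
  ... | v , w , w′ , e = v , subst (Cong M _) (*-identityʳ q) (Cong-^ {o = o * M} (g * v) 1 w w′ q≥1 (One-radical q o M q≥1 M≥1 h) e)

module Orders where

  open import Defs
  open Arithmetic
  open Cardinality
  open import Data.Nat
  open import Data.Nat.Properties
  open import Data.Nat.Divisibility
  open import Data.Nat.DivMod
  open import Data.Nat.Coprimality as Cop using (Coprime; coprime-divisor; gcd≡1⇒coprime)
  open import Data.Nat.Primality
  open import Data.Fin using (Fin; toℕ; fromℕ<)
  import Data.Fin.Properties as Fin
  open import Data.List using (List; []; _∷_; filter; length; applyUpTo)
  open import Data.List.Properties using (length-applyUpTo; map-id; map-cong)
  open import Data.List.Relation.Unary.All using (All; []; _∷_)
  import Data.List.Relation.Unary.All as All
  import Data.List.Relation.Unary.All.Properties as AllP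
  open import Data.List.Relation.Unary.Any using (here)
  open import Data.List.Membership.Propositional using (_∈_)
  open import Data.List.Membership.Propositional.Properties
  open import Data.List.Relation.Unary.Unique.Propositional using (Unique)
  import Data.List.Relation.Unary.Unique.Propositional.Properties as Uniq
  open import Data.Product using (_×_; _,_; proj₁; proj₂)
  open import Data.Sum using (inj₂)
  open import Data.Empty using (⊥; ⊥-elim)
  open import Relation.Nullary using (¬_; yes; no)
  open import Relation.Nullary.Decidable using (_×-dec_)
  open import Relation.Unary using (Decidable)
  open import Relation.Binary.PropositionalEquality

  ∈-oneTo⁺ : ∀ {i m} → 1 ≤ i → i ≤ m → i ∈ oneTo m
  ∈-oneTo⁺ {suc i} _ (s≤s h) = ∈-applyUpTo⁺ suc (s≤s h)

  ∈-oneTo⁻ : ∀ {i m} → i ∈ oneTo m → 1 ≤ i × i ≤ m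
  ∈-oneTo⁻ z with ∈-applyUpTo⁻ suc z
  ... | j , l , refl = s≤s z≤n , l

  oneTo-unique : ∀ m → Unique (oneTo m)
  oneTo-unique m = Uniq.applyUpTo⁺₁ suc m (λ l _ e → <⇒≢ l (suc-injective e))

  ∈-divisors⁺ : ∀ {d m} → 1 ≤ m → d ∣ m → d ∈ divisors m
  ∈-divisors⁺ h d = ∈-filter⁺ (_∣? _) (∈-oneTo⁺ (∣⇒≥1 h d) (∣⇒≤ {{>-nonZero h}} d)) d

  ∈-divisors⁻ : ∀ {d m} → d ∈ divisors m → d ∣ m
  ∈-divisors⁻ {m = m} z = proj₂ (∈-filter⁻ (_∣? m) {xs = oneTo m} z)

  divisors-unique : ∀ m → Unique (divisors m)
  divisors-unique m = Uniq.filter⁺ (_∣? m) (oneTo-unique m)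

  ∈-primeDivisors⁺ : ∀ {r m} → 1 ≤ m → Prime r → r ∣ m → r ∈ primeDivisors m
  ∈-primeDivisors⁺ {r} {m} h R d = ∈-filter⁺ (λ r → prime? r ×-dec r ∣? m) (∈-oneTo⁺ (∣⇒≥1 h d) (∣⇒≤ {{>-nonZero h}} d)) (R , d)

  ∈-primeDivisors⁻ : ∀ {r m} → r ∈ primeDivisors m → Prime r × r ∣ m
  ∈-primeDivisors⁻ {m = m} z = proj₂ (∈-filter⁻ (λ r → prime? r ×-dec r ∣? m) {xs = oneTo m} z)

  primeDivisors-prime : ∀ m → All Prime (primeDivisors m)
  primeDivisors-prime m = All.tabulate (λ z → proj₁ (∈-primeDivisors⁻ {m = m} z))

  primeDivisors-unique : ∀ m → Unique (primeDivisors m)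
  primeDivisors-unique m = Uniq.filter⁺ (λ r → prime? r ×-dec r ∣? m) (oneTo-unique m)

  length-filter-initial : ∀ {P : ℕ → Set} (P? : Decidable P) v m → v ≤ m →
    (∀ {c} → 1 ≤ c → P c → c ≤ v) → (∀ {c} → c ≤ v → P c) → length (filter P? (oneTo m)) ≡ v
  length-filter-initial P? v m v≤m f g = trans
    (card-unique (mkCard _ refl (Uniq.filter⁺ P? (oneTo-unique m)) (λ z → z) (λ z → z))
                 (mkCard (oneTo v) refl (oneTo-unique v) (λ z → z) (λ z → z))
       (λ z → let (a , b) = ∈-filter⁻ P? {xs = oneTo m} z ; (l , _) = ∈-oneTo⁻ a in ∈-oneTo⁺ l (f l b))
       (λ z → let (l , u) = ∈-oneTo⁻ z in ∈-filter⁺ P? (∈-oneTo⁺ l (≤-trans u v≤m)) (g u)))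
    (length-applyUpTo suc v)

  val-∣ : ∀ {r} m → Prime r → 1 ≤ m → r ^ val r m ∣ m × ¬ r ^ suc (val r m) ∣ m
  val-∣ {r} m R h with maxPower m R h
  ... | v , v<m , a , b = subst (λ w → r ^ w ∣ m × ¬ r ^ suc w ∣ m) (sym eq) (a , b)
    where
    lt : ∀ {c} → r ^ c ∣ m → c ≤ v
    lt {c} d with c ≤? v
    ... | yes l = l
    ... | no l = ⊥-elim (b (∣-trans (^-mono-∣ r (≰⇒> l)) d))
    eq : val r m ≡ v
    eq = length-filter-initial (λ c → r ^ c ∣? m) v m (<⇒≤ v<m) (λ _ → lt) (λ l → ∣-trans (^-mono-∣ r l) a)

  filter-head-least : ∀ {P : ℕ → Set} (P? : Decidable P) f m → (∀ {i j} → i < j → f i < f j) → ∀ {k rest} →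
    filter P? (applyUpTo f m) ≡ k ∷ rest → ∀ i → f i < k → ¬ P (f i)
  filter-head-least P? f zero mono () i l
  filter-head-least P? f (suc m) mono e i l p with P? (f 0)
  filter-head-least P? f (suc m) mono refl i l p | yes p0 with i
  ... | zero = <-irrefl refl l
  ... | suc i = <-asym l (mono (s≤s z≤n))
  filter-head-least P? f (suc m) mono e zero l p | no p0 = p0 p
  filter-head-least P? f (suc m) mono e (suc i) l p | no p0 = filter-head-least P? (λ i → f (suc i)) m (λ z → mono (s≤s z)) e i l p

  %≡⇒∣∸ : ∀ a b m .{{_ : NonZero m}} → b ≤ a → a % m ≡ b % m → m ∣ a ∸ b
  %≡⇒∣∸ a b m le e = subst (m ∣_) (sym eq) (∣m+n∣m⇒∣n' )
    where
    eq : a ∸ b ≡ (a / m) * m ∸ (b / m) * m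
    eq = trans (cong₂ _∸_ (m≡m%n+[m/n]*n a m) (m≡m%n+[m/n]*n b m))
         (trans (cong (λ w → w + a / m * m ∸ (b % m + b / m * m)) e) ([m+n]∸[m+o]≡n∸o (b % m) _ _))
    ∣m+n∣m⇒∣n' : m ∣ (a / m) * m ∸ (b / m) * m
    ∣m+n∣m⇒∣n' = divides (a / m ∸ b / m) (sym (*-distribʳ-∸ m (a / m) (b / m)))

  ∣∸⇒%≡ : ∀ a b m .{{_ : NonZero m}} → b ≤ a → m ∣ a ∸ b → a % m ≡ b % m
  ∣∸⇒%≡ a b m le (divides k e) = trans (cong (_% m) (trans (sym (m+[n∸m]≡n le)) (cong (b +_) e))) ([m+kn]%n≡m%n b k m)

  record OrderSpec (k q o : ℕ) : Set where
    field
      pos   : 1 ≤ o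
      one   : One k (q ^ o)
      least : ∀ u → One k (q ^ u) → o ∣ u

  open OrderSpec public

  ordSpec : ∀ k q → 1 ≤ k → 1 ≤ q → Coprime k q → OrderSpec k q (ord k q)
  ordSpec (suc m) q _ q≥1 cop with filter (λ k → (q ^ k) % suc m ≟ 1 % suc m) (oneTo (suc m)) in eq
  ... | [] = ⊥-elim none
    where
    instance _ = >-nonZero q≥1
    f : Fin (suc (suc m)) → Fin (suc m)
    f i = fromℕ< (m%n<n (q ^ toℕ i) (suc m))
    none : ⊥
    none with Fin.pigeonhole (n<1+n (suc m)) f
    ... | i , j , i<j , e = case (subst (toℕ j ∸ toℕ i ∈_) eq mem)
      where
      e′ : q ^ toℕ i % suc m ≡ q ^ toℕ j % suc m
      e′ = Fin.fromℕ<-injective _ _ _ _ e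
      d = toℕ j ∸ toℕ i
      div : suc m ∣ q ^ toℕ j ∸ q ^ toℕ i
      div = %≡⇒∣∸ (q ^ toℕ j) (q ^ toℕ i) (suc m) (^-monoʳ-≤ q (<⇒≤ i<j)) (sym e′)
      fac : q ^ toℕ j ∸ q ^ toℕ i ≡ q ^ toℕ i * (q ^ d ∸ 1)
      fac = trans (cong (λ w → q ^ w ∸ q ^ toℕ i) (sym (m+[n∸m]≡n (<⇒≤ i<j))))
            (trans (cong (_∸ q ^ toℕ i) (^-distribˡ-+-* q (toℕ i) d))
            (trans (cong (q ^ toℕ i * q ^ d ∸_) (sym (*-identityʳ (q ^ toℕ i)))) (sym (*-distribˡ-∸ (q ^ toℕ i) (q ^ d) 1))))
      copow : ∀ t → Coprime (suc m) (q ^ t)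
      copow zero (_ , z) = ∣1⇒≡1 z
      copow (suc t) = coprime-*ʳ (s≤s z≤n) cop (copow t)
      mem : d ∈ filter (λ k → (q ^ k) % suc m ≟ 1 % suc m) (oneTo (suc m))
      mem = ∈-filter⁺ (λ k → (q ^ k) % suc m ≟ 1 % suc m) (∈-oneTo⁺ (m<n⇒0<n∸m i<j) (≤-trans (m∸n≤m (toℕ j) (toℕ i)) (≤-pred (Fin.toℕ<n j))))
        (∣∸⇒%≡ (q ^ d) 1 (suc m) (m^n>0 q d) (coprime-divisor (copow (toℕ i)) (subst (suc m ∣_) fac div)))
      case : d ∈ [] → ⊥
      case ()
  ... | k ∷ rest = record { pos = proj₁ range ; one = one′ ; least = least′ }
    where
    instance _ = >-nonZero q≥1
    memk = ∈-filter⁻ (λ k → (q ^ k) % suc m ≟ 1 % suc m) {xs = oneTo (suc m)} (subst (k ∈_) (sym eq) (here refl))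
    range = ∈-oneTo⁻ (proj₁ memk)
    one′ : One (suc m) (q ^ k)
    one′ = %≡⇒∣∸ (q ^ k) 1 (suc m) (m^n>0 q k) (proj₂ memk)
    least′ : ∀ u → One (suc m) (q ^ u) → k ∣ u
    least′ u d = m%n≡0⇒n∣m u k zero′
      where
      instance _ = >-nonZero (proj₁ range)
      oneR : One (suc m) (q ^ (u % k))
      oneR = One-cancel (suc m) ((q ^ k) ^ (u / k)) (q ^ (u % k)) (m^n>0 (q ^ k) {{m^n≢0 q k}} (u / k)) (m^n>0 q (u % k))
        (One-^ (suc m) (q ^ k) (u / k) (m^n>0 q k) one′)
        (subst (One (suc m)) (trans (cong (q ^_) (m≡m%n+[m/n]*n u k)) (trans (^-distribˡ-+-* q (u % k) _)
          (trans (*-comm (q ^ (u % k)) _) (cong (_* q ^ (u % k)) (trans (cong (q ^_) (*-comm (u / k) k)) (sym (^-*-assoc q k (u / k)))))))) d)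
      zero′ : u % k ≡ 0
      zero′ with u % k | oneR | m%n<n u k
      ... | zero | _ | _ = refl
      ... | suc w | r | l = ⊥-elim (filter-head-least (λ k → (q ^ k) % suc m ≟ 1 % suc m) suc (suc m) s≤s eq w l
          (∣∸⇒%≡ (q ^ suc w) 1 (suc m) (m^n>0 q (suc w)) r))

  rad-∣ : ∀ {r m} → 1 ≤ m → Prime r → r ∣ m → r ∣ rad m
  rad-∣ {r} {m} h R d = subst (λ L → r ∣ prod L) (map-id (primeDivisors m))
    (∈⇒∣prod (λ x → x) (∈-primeDivisors⁺ h R d))

  rad-primes : ∀ {r m} → Prime r → r ∣ rad m → r ∣ m
  rad-primes {r} {m} R d with primePower∣prod (λ _ → 1) 1 R (primeDivisors-prime m) (primeDivisors-unique m)
      (subst₂ (λ x L → x ∣ prod L) (sym (*-identityʳ r)) (trans (sym (map-id (primeDivisors m))) (map-cong (λ s → sym (*-identityʳ s)) (primeDivisors m))) d)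
  ... | inj₂ (r∈ , _) = proj₂ (∈-primeDivisors⁻ {m = m} r∈)

  rad≥1 : ∀ m → 1 ≤ rad m
  rad≥1 m = go (primeDivisors-prime m)
    where
    go : ∀ {L} → All Prime L → 1 ≤ prod L
    go [] = ≤-refl
    go (P ∷ A) = *-mono-≤ (prime≥1 P) (go A)

  -- For regular (q, n) one can take o = ord_{rad(n')}(q).
  record Reg (q n n' : ℕ) : Set where
    field
      q≥1  : 1 ≤ q
      n≥1  : 1 ≤ n
      n'≥1 : 1 ≤ n'
      n'∣n : n' ∣ n
      q-coprime : Coprime n' q
      o    : ℕ
      o≥1  : 1 ≤ o
      o-one : ∀ s → Prime s → s ∣ n' → One s (q ^ o)
      o-coprime : Coprime o n

  regular⇒Reg : ∀ {q n n'} → 1 ≤ q → 1 ≤ n → 1 ≤ n' → n' ∣ n → Coprime n' q → Regular q n n' → Reg q n n'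
  regular⇒Reg {q} {n} {n'} q≥1 n≥1 n'≥1 n'∣n c reg = record
    { q≥1 = q≥1 ; n≥1 = n≥1 ; n'≥1 = n'≥1 ; n'∣n = n'∣n ; q-coprime = c ; o = ord (rad n') q
    ; o≥1 = pos sp ; o-one = λ s S d → ∣-trans (rad-∣ n'≥1 S d) (one sp) ; o-coprime = gcd≡1⇒coprime reg }
    where
    sp : OrderSpec (rad n') q (ord (rad n') q)
    sp = ordSpec (rad n') q (rad≥1 n') q≥1 (coprime-primes (rad≥1 n')
      λ s S a b → prime∤1 S (subst (s ∣_) (c (rad-primes S a , b)) ∣-refl))

module ComponentArithmetic where

  open import Defs
  open Arithmetic
  open Orders
  open import Data.Nat
  open import Data.Nat.Properties
  open import Data.Nat.Divisibility
  open import Data.Nat.DivMod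
  open import Data.Nat.GCD using (gcd; gcd[m,n]∣m; gcd[m,n]∣n)
  open import Data.Nat.Coprimality as Cop using (coprime-divisor)
  open import Data.Nat.Primality
  open import Data.Nat.Tactic.RingSolver using (solve-∀)
  open import Data.List.Properties using (map-id; map-cong)
  open import Data.Product using (∃; _×_; _,_; proj₁; proj₂)
  open import Data.Sum using (_⊎_; inj₁; inj₂)
  open import Data.Empty using (⊥; ⊥-elim)
  open import Data.Bool as Bool using (true; false)
  open import Data.Bool.Properties using (T-≡; T-∧)
  open import Function.Bundles using (Equivalence)
  open import Relation.Nullary using (¬_; yes; no)
  open import Relation.Binary.PropositionalEquality

  ÷-∣ : ∀ {a b} → 1 ≤ b → b ∣ a → a ÷ b * b ≡ a
  ÷-∣ {a} {suc b} _ d = m/n*n≡m d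

  *-÷ : ∀ a {b} → 1 ≤ b → (a * b) ÷ b ≡ a
  *-÷ a {suc b} _ = m*n/n≡m a (suc b)

  primePower-≤ : ∀ {r a x} b → ¬ r ^ suc a ∣ x → r ^ b ∣ x → b ≤ a
  primePower-≤ {r} {a} b h d with b ≤? a
  ... | yes l = l
  ... | no l = ⊥-elim (h (∣-trans (^-mono-∣ r (≰⇒> l)) d))

  rad-least : ∀ {m x} → 1 ≤ m → (∀ s → Prime s → s ∣ m → s ∣ x) → rad m ∣ x
  rad-least {m} {x} h f = ∣-primePowers (rad m) x (rad≥1 m) go
    where
    go : ∀ r b → Prime r → r ^ b ∣ rad m → r ^ b ∣ x
    go r b R d with primePower∣prod (λ _ → 1) b R (primeDivisors-prime m) (primeDivisors-unique m)
      (subst (λ L → r ^ b ∣ prod L) (trans (sym (map-id (primeDivisors m))) (map-cong (λ s → sym (*-identityʳ s)) (primeDivisors m))) d)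
    ... | inj₁ refl = 1∣ x
    ... | inj₂ (r∈ , b≤1) = ∣-trans (^-mono-∣ r b≤1) (subst (_∣ x) (sym (*-identityʳ r))
            (f r R (proj₂ (∈-primeDivisors⁻ {m = m} r∈))))

  n<2[n/2]+2 : ∀ n → n ≤ suc (n / 2 + n / 2)
  n<2[n/2]+2 n = begin
    n ≡⟨ m≡m%n+[m/n]*n n 2 ⟩
    n % 2 + n / 2 * 2 ≤⟨ +-monoˡ-≤ (n / 2 * 2) (≤-pred (m%n<n n 2)) ⟩
    1 + n / 2 * 2 ≡⟨ lem (n / 2) ⟩
    suc (n / 2 + n / 2) ∎
    where
    open ≤-Reasoning
    lem : ∀ x → 1 + x * 2 ≡ suc (x + x)
    lem = solve-∀

  2[n/2]≤n : ∀ n → n / 2 + n / 2 ≤ n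
  2[n/2]≤n n = subst (_≤ n) (lem (n / 2)) (m/n*n≤m n 2)
    where
    lem : ∀ x → x * 2 ≡ x + x
    lem = solve-∀

  zeros-or-sum≥2 : ∀ t i → (t ≡ 0 × i ≡ 0) ⊎ 2 ≤ suc t + i
  zeros-or-sum≥2 zero zero = inj₁ (refl , refl)
  zeros-or-sum≥2 zero (suc i) = inj₂ (s≤s (s≤s z≤n))
  zeros-or-sum≥2 (suc t) i = inj₂ (s≤s (s≤s z≤n))

  prime-absorb : ∀ {r a i p} → Prime r → 1 ≤ a → ¬ r ∣ i → a ∣ p → a * r ∣ p * i → a * r ∣ p
  prime-absorb {r} {a} {i} R a≥1 r∤i (divides y refl) x
    with euclidsLemma y i R (*-cancelˡ-∣ a {{>-nonZero a≥1}} (subst (a * r ∣_) (lem y a i) x))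
    where
    lem : ∀ y a i → y * a * i ≡ a * (y * i)
    lem = solve-∀
  ... | inj₁ r∣y = subst (a * r ∣_) (*-comm a y) (*-monoʳ-∣ a r∣y)
  ... | inj₂ r∣i = ⊥-elim (r∤i r∣i)

  module Divisor {q n n'} (reg : Reg q n n') {k} (k∣n' : k ∣ n') where
    open Reg reg

    instance
      q-nonZero : NonZero q
      q-nonZero = >-nonZero q≥1

    k∣n : k ∣ n
    k∣n = ∣-trans k∣n' n'∣n

    k≥1 : 1 ≤ k
    k≥1 = ∣⇒≥1 n'≥1 k∣n'

    instance
      k-nonZero : NonZero k
      k-nonZero = >-nonZero k≥1

    q^≥1 : ∀ u → 1 ≤ q ^ u
    q^≥1 = m^n>0 q

    orderOf : ∀ m → m ∣ k → OrderSpec m q (ord m q)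
    orderOf m d = ordSpec m q (∣⇒≥1 k≥1 d) q≥1 (coprime-∣ q-coprime (∣-trans d k∣n') ∣-refl)

    One-exp : ∀ {m} u v → u ∣ v → One m (q ^ u) → One m (q ^ v)
    One-exp {m} u v (divides w e) d = subst (One m) (trans (^-*-assoc q u w) (cong (q ^_) (trans (*-comm u w) (sym e)))) (One-^ m (q ^ u) w (q^≥1 u) d)

    ord-mono₀ : ∀ {m m'} → m ∣ m' → m' ∣ k → ord m q ∣ ord m' q
    ord-mono₀ {m} {m'} d d' = least (orderOf m (∣-trans d d')) _ (∣-trans d (one (orderOf m' d')))

    K = ord k q
    K₀ = ord (rad k) q

    rad∣k : rad k ∣ k
    rad∣k = rad-least k≥1 (λ _ _ d → d)

    spK = orderOf k ∣-refl
    spK₀ = orderOf (rad k) rad∣k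

    K≥1 : 1 ≤ K
    K≥1 = pos spK

    K₀∣K : K₀ ∣ K
    K₀∣K = ord-mono₀ rad∣k ∣-refl

    r∤K₀ : ∀ {r} → Prime r → r ∣ k → ¬ r ∣ K₀
    r∤K₀ {r} R r∣k d = prime∤1 R (subst (r ∣_) (o-coprime (∣-trans d K₀∣o , ∣-trans r∣k k∣n)) ∣-refl)
      where
      K₀∣o : K₀ ∣ o
      K₀∣o = least spK₀ o (rad-least k≥1 (λ s S d → o-one s S (∣-trans d k∣n')))

    e : ℕ → ℕ
    e r = val r (K ÷ K₀) / 2

    T = τ q k

    K-eq : K ÷ K₀ * K₀ ≡ K
    K-eq = ÷-∣ (pos spK₀) K₀∣K

    w≥1 : 1 ≤ K ÷ K₀
    w≥1 = ∣⇒≥1 K≥1 (subst (K ÷ K₀ ∣_) K-eq (m∣m*n K₀))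

    r²ᵉ∣K : ∀ {r} → Prime r → r ^ (e r + e r) ∣ K
    r²ᵉ∣K {r} R = ∣-trans (^-mono-∣ r (2[n/2]≤n (val r (K ÷ K₀))))
      (subst (r ^ val r (K ÷ K₀) ∣_) K-eq (∣m⇒∣m*n K₀ (proj₁ (val-∣ (K ÷ K₀) R w≥1))))

    r²ᵉ⁺²∤K : ∀ {r} → Prime r → r ∣ k → ¬ r ^ suc (suc (e r + e r)) ∣ K
    r²ᵉ⁺²∤K {r} R r∣k d = proj₂ (val-∣ (K ÷ K₀) R w≥1)
      (primePower-*-cancel (suc v) R (r∤K₀ R r∣k) (subst (r ^ suc v ∣_) (sym K-eq)
        (∣-trans (^-mono-∣ r (s≤s (n<2[n/2]+2 v))) d)))
      where v = val r (K ÷ K₀)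

    τ-local : ∀ {r} b → Prime r → r ^ b ∣ T → b ≡ 0 ⊎ (r ∣ k × b ≤ e r)
    τ-local b R d with primePower∣prod e b R (primeDivisors-prime k) (primeDivisors-unique k) d
    ... | inj₁ z = inj₁ z
    ... | inj₂ (r∈ , l) = inj₂ (proj₂ (∈-primeDivisors⁻ {m = k} r∈) , l)

    τ-power : ∀ {r} → Prime r → r ∣ k → r ^ e r ∣ T
    τ-power R d = ∈⇒∣prod (λ r → r ^ e r) (∈-primeDivisors⁺ k≥1 R d)

    r²ᵉ⁺¹∣k : ∀ {r} → Prime r → r ∣ k → r ^ suc (e r + e r) ∣ k
    r²ᵉ⁺¹∣k {r} R r∣k with rad∣k
    ... | divides w eq = subst (r ^ suc (e r + e r) ∣_) (trans (*-comm (rad k) w) (sym eq)) (*-pres-∣ (rad-∣ k≥1 R r∣k)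
          (primePower-*-cancel (e r + e r) R (r∤K₀ R r∣k) (∣-trans (r²ᵉ∣K R) (subst (K ∣_) (*-comm K₀ w) K∣))))
      where
      w≥1' : 1 ≤ w
      w≥1' = ∣⇒≥1 k≥1 (divides (rad k) (trans eq (*-comm w _)))
      K∣ : K ∣ K₀ * w
      K∣ = least spK (K₀ * w) (subst₂ One (trans (*-comm (rad k) w) (sym eq)) (^-*-assoc q K₀ w)
        (One-lift w w≥1' (rad k) (q ^ K₀) (q^≥1 K₀) (λ s S d → rad-∣ k≥1 S (∣-trans d (divides (rad k) (trans eq (*-comm w _))))) (one spK₀)))

    τ≥1 : 1 ≤ T
    τ≥1 with T in eq
    ... | suc _ = s≤s z≤n
    ... | zero = ⊥-elim (no0 (subst (λ z → 2 ^ suc (e 2) ∣ z) (sym eq) (_ ∣0)))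
      where
      no0 : ¬ 2 ^ suc (e 2) ∣ T
      no0 x with τ-local (suc (e 2)) prime[2] x
      ... | inj₂ (_ , l) = 1+n≰n l

    module Core (ordq : ℕ → ℕ) (orderOf : ∀ m → m ∣ k → OrderSpec m q (ordq m)) (K T c : ℕ) (e : ℕ → ℕ) (spK : OrderSpec k q K)
      (r²ᵉ∣K : ∀ {r} → Prime r → r ^ (e r + e r) ∣ K)
      (r²ᵉ⁺²∤K : ∀ {r} → Prime r → r ∣ k → ¬ r ^ suc (suc (e r + e r)) ∣ K)
      (r²ᵉ⁺¹∣k : ∀ {r} → Prime r → r ∣ k → r ^ suc (e r + e r) ∣ k)
      (τ≥1 : 1 ≤ T)
      (τ-local : ∀ {r} b → Prime r → r ^ b ∣ T → b ≡ 0 ⊎ (r ∣ k × b ≤ e r))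
      (τ-power : ∀ {r} → Prime r → r ∣ k → r ^ e r ∣ T)
      (2^c∣k : 2 ^ c ∣ k) (2^1+c∤k : ¬ 2 ^ suc c ∣ k)
      where

      ord-mono : ∀ {m m'} → m ∣ m' → m' ∣ k → ordq m ∣ ordq m'
      ord-mono {m} {m'} d d' = least (orderOf m (∣-trans d d')) _ (∣-trans d (one (orderOf m' d')))

      One-drop : ∀ s h g → Prime s → s ∣ k → g ∣ n → One s (q ^ (h * g)) → One s (q ^ h)
      One-drop s h g S s∣k g∣n d = One-exp os h
          (coprime-divisor (coprime-∣ o-coprime os∣o g∣n) (subst (os ∣_) (*-comm h g) (least sp _ d)))
          (one sp)
        where
        sp = orderOf s s∣k
        os = ordq s
        os∣o : os ∣ o
        os∣o = least sp o (o-one s S (∣-trans s∣k k∣n'))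

      private
        K≥1′ : 1 ≤ K
        K≥1′ = pos spK

      ord∣K : ∀ {m} → m ∣ k → ordq m ∣ K
      ord∣K d = least (orderOf _ d) K (∣-trans d (one spK))

      τ-prime : ∀ {r} → Prime r → r ∣ T → r ∣ k × 1 ≤ e r
      τ-prime {r} R d with τ-local 1 R (subst (_∣ T) (sym (*-identityʳ r)) d)
      ... | inj₂ z = z

      τ-max : ∀ {r} → Prime r → r ∣ k → ¬ r ^ suc (e r) ∣ T
      τ-max {r} R d x with τ-local (suc (e r)) R x
      ... | inj₂ (_ , l) = 1+n≰n l

      τr∣k : ∀ r → Prime r → r ∣ k → T * r ∣ k
      τr∣k r R r∣k = ∣-primePowers (T * r) k (*-mono-≤ τ≥1 (prime≥1 R)) go
        where
        go : ∀ s b → Prime s → s ^ b ∣ T * r → s ^ b ∣ k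
        go s b S d with s ≟ r
        ... | yes refl = ∣-trans (^-mono-∣ s (≤-trans (primePower-≤ {s} {e s + 1} b (primePower-* (e s) 1 S (τ-max S r∣k)
                (λ z → prime∤1 S (*-cancelˡ-∣ s {{prime⇒nonZero S}} (subst₂ _∣_ (cong (s *_) (*-identityʳ s)) (sym (*-identityʳ s)) z)))) d)
                (≤-trans (≤-reflexive (+-comm (e s) 1)) (s≤s (m≤m+n (e s) (e s)))))) (r²ᵉ⁺¹∣k S r∣k)
        ... | no ne with τ-local b S (primePower-*-cancel b S (λ z → ne (prime∣prime S R z)) d)
        ... | inj₁ refl = 1∣ k
        ... | inj₂ (s∣k , l) = ∣-trans (^-mono-∣ s (≤-trans l (≤-trans (m≤m+n (e s) (e s)) (n≤1+n _)))) (r²ᵉ⁺¹∣k S s∣k)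

      τ∣k : T ∣ k
      τ∣k = ∣-primePowers T k τ≥1 go
        where
        go : ∀ s b → Prime s → s ^ b ∣ T → s ^ b ∣ k
        go s b S d with τ-local b S d
        ... | inj₁ refl = 1∣ k
        ... | inj₂ (s∣k , l) = ∣-trans (^-mono-∣ s (≤-trans l (≤-trans (m≤m+n (e s) (e s)) (n≤1+n _)))) (r²ᵉ⁺¹∣k S s∣k)

      τ²∣K : T * T ∣ K
      τ²∣K = ∣-primePowers (T * T) K (*-mono-≤ τ≥1 τ≥1) go
        where
        go : ∀ s b → Prime s → s ^ b ∣ T * T → s ^ b ∣ K
        go s zero S d = 1∣ K
        go s (suc b) S d = ∣-trans (^-mono-∣ s (primePower-≤ {s} {e s + e s} (suc b) (primePower-* (e s) (e s) S (τ-max S s∣k) (τ-max S s∣k)) d)) (r²ᵉ∣K S)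
          where
          s∣k : s ∣ k
          s∣k with euclidsLemma T T S (∣-trans (m∣m*n _) d)
          ... | inj₁ x = proj₁ (τ-prime S x)
          ... | inj₂ x = proj₁ (τ-prime S x)

      instance
        T-nonZero : NonZero T
        T-nonZero = >-nonZero τ≥1

      D : ℕ
      D = quotient τ²∣K

      K≡τ²D : K ≡ T * T * D
      K≡τ²D = m∣n⇒n≡m*quotient τ²∣K

      D≥1 : 1 ≤ D
      D≥1 = ∣⇒≥1 K≥1′ (subst (D ∣_) (sym K≡τ²D) (n∣m*n (T * T)))

      private
        m = quotient τ∣k
        k≡mT : k ≡ m * T
        k≡mT = _∣_.equality τ∣k
        m≥1 : 1 ≤ m
        m≥1 = ∣⇒≥1 k≥1 (subst (m ∣_) (sym k≡mT) (m∣m*n T))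
        prime-m : ∀ s → Prime s → s ∣ T → s ∣ m
        prime-m s S d = *-cancelˡ-∣ T (subst (T * s ∣_) (trans k≡mT (*-comm m T)) (τr∣k s S (proj₁ (τ-prime S d))))
        pw : ∀ u → q ^ (T * u * T) ≡ (q ^ (T * u)) ^ T
        pw u = sym (^-*-assoc q (T * u) T)
        reord : ∀ u → T * u * T ≡ T * T * u
        reord u = lem T u
          where
          lem : ∀ t u → t * u * t ≡ t * t * u
          lem = solve-∀

      One-2-q : 2 ∣ k → One 2 q
      One-2-q 2∣k with q % 2 in eq | m%n<n q 2
      ... | zero | _ = ⊥-elim (prime∤1 prime[2] (subst (2 ∣_) (q-coprime (∣-trans 2∣k k∣n' , m%n≡0⇒n∣m q 2 eq)) ∣-refl))
      ... | suc zero | _ = %≡⇒∣∸ q 1 2 q≥1 eq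
      ... | suc (suc _) | s≤s (s≤s ())

      One-4-q² : 2 ∣ k → ∀ u → 2 ∣ u → One 4 (q ^ u)
      One-4-q² 2∣k u d = One-exp 2 u d (One-lift 2 (s≤s z≤n) 2 q q≥1 (λ _ _ z → z) (One-2-q 2∣k))

      D-order⇒ : ∀ u → k ∣ T * pred (q ^ (T * u)) → D ∣ u
      D-order⇒ u d = *-cancelˡ-∣ (T * T) {{m*n≢0 T T}} (subst₂ _∣_ K≡τ²D (reord u) (least spK (T * u * T)
          (subst₂ One (sym k≡mT) (sym (pw u)) (One-lift T τ≥1 m (q ^ (T * u)) (q^≥1 (T * u)) prime-m
            (*-cancelˡ-∣ T (subst (_∣ T * pred (q ^ (T * u))) (trans k≡mT (*-comm m T)) d))))))

      D-order⇐ : ∀ u → D ∣ u → k ∣ T * pred (q ^ (T * u))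
      D-order⇐ u d = subst (_∣ T * pred (q ^ (T * u))) (trans (*-comm T m) (sym k≡mT)) (*-monoʳ-∣ T
          (One-descend T τ≥1 m (q ^ (T * u)) (q^≥1 (T * u)) m≥1 prime-m
            (λ s S s∣m → One-drop s (T * u) T S (s∣k s∣m) (∣-trans τ∣k k∣n) (∣-trans (s∣k s∣m) one-k))
            (λ 2∣T → One-4-q² (proj₁ (τ-prime prime[2] 2∣T)) (T * u) (∣m⇒∣m*n u 2∣T))
            (subst₂ One k≡mT (pw u) one-k)))
        where
        s∣k : ∀ {s} → s ∣ m → s ∣ k
        s∣k z = subst (_ ∣_) (sym k≡mT) (∣m⇒∣m*n T z)
        one-k : One k (q ^ (T * u * T))
        one-k = One-exp K (T * u * T) (subst₂ _∣_ (sym K≡τ²D) (sym (reord u)) (*-monoʳ-∣ (T * T) d)) (one spK)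

      Mover : ℕ → ℕ → Set
      Mover d i = ∃ λ u → ∃ λ r → ∃ λ k' → Prime r × k ≡ k' * r × k' ∣ pred (q ^ (d * u)) * i
        × ¬ k ∣ pred (q ^ (d * u)) * i × One r (q ^ (d * u))

      mover : ∀ d i → 1 ≤ d → d ∣ i → ¬ T ∣ i → Mover d i
      mover d i d≥1 d∣i h with ∣-or-primePower T i τ≥1
      ... | inj₁ x = ⊥-elim (h x)
      ... | inj₂ (r , b , R , r^b∣T , nb) with τ-local b R r^b∣T | jump r i b nb
      ... | inj₁ refl | (_ , () , _)
      ... | inj₂ (r∣k , b≤e) | (j , j<b , divides i' i-eq , nj) with jump r d (suc j) (λ z → nj (∣-trans z d∣i))
      ... | δ , δ<1+j , divides G d-eq , nδ = go (∣-trans (^-mono-∣ r {suc j} {suc (e r + e r)} (≤-trans j<e (m≤n⇒m≤1+n (m≤m+n (e r) (e r))))) (r²ᵉ⁺¹∣k R r∣k))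
        where
        instance _ = prime⇒nonZero R
        j<e : suc j ≤ e r
        j<e = ≤-trans j<b b≤e
        r∤G : ¬ r ∣ G
        r∤G z = nδ (subst (r ^ suc δ ∣_) (sym d-eq) (*-monoˡ-∣ (r ^ δ) z))
        r∤i' : ¬ r ∣ i'
        r∤i' z = nj (subst (r ^ suc j ∣_) (sym i-eq) (*-monoˡ-∣ (r ^ j) z))
        2e = e r + e r
        go : r ^ suc j ∣ k → Mover d i
        go (divides K₁ k-eq) = β , r , K₁ * r ^ j , R , k-eq' , res₁ , res₂ , ∣-trans r∣K₁ oneK₁
          where
          K₀' = K₁ * r
          k-eq₀ : k ≡ K₀' * r ^ j
          k-eq₀ = trans k-eq (sym (*-assoc K₁ r (r ^ j)))
          k-eq' : k ≡ K₁ * r ^ j * r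
          k-eq' = trans k-eq (lem K₁ r (r ^ j))
            where
            lem : ∀ a r x → a * (r * x) ≡ a * x * r
            lem = solve-∀
          K₁∣k : K₁ ∣ k
          K₁∣k = divides (r ^ suc j) (trans k-eq (*-comm K₁ _))
          K₀'∣k : K₀' ∣ k
          K₀'∣k = divides (r ^ j) (trans k-eq₀ (*-comm K₀' _))
          K₁≥1 : 1 ≤ K₁
          K₁≥1 = ∣⇒≥1 k≥1 K₁∣k
          instance _ = >-nonZero K₁≥1
          r∣K₁ : r ∣ K₁
          r∣K₁ = *-cancelʳ-∣ (r ^ suc j) {{m^n≢0 r (suc j)}} (subst (r ^ suc (suc j) ∣_) k-eq
            (∣-trans (^-mono-∣ r (s≤s (≤-trans j<e (m≤m+n (e r) (e r))))) (r²ᵉ⁺¹∣k R r∣k)))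
          a' = ordq K₀'
          b' = ordq K₁
          spa = orderOf K₀' K₀'∣k
          spb = orderOf K₁ K₁∣k
          r^∣a' : r ^ (2e ∸ j) ∣ a'
          r^∣a' = *-cancelʳ-∣ (r ^ j) {{m^n≢0 r j}} (subst (_∣ a' * r ^ j)
              (trans (cong (r ^_) (sym (m∸n+n≡m {2e} {j} (≤-trans (<⇒≤ j<e) (m≤m+n (e r) (e r)))))) (^-distribˡ-+-* r (2e ∸ j) j))
              (∣-trans (r²ᵉ∣K R) (least spK _ (subst₂ One (sym k-eq₀) (^-*-assoc q a' (r ^ j))
                (One-lift (r ^ j) (m^n>0 r j) K₀' (q ^ a') (q^≥1 a')
                  (λ s S z → subst (_∣ K₀') (sym (prime∣prime S R (prime∣^ r j S z))) (n∣m*n K₁)) (one spa))))))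
          2e∸j≥ : suc (suc j) ≤ 2e ∸ j
          2e∸j≥ = begin
            suc (suc j) ≤⟨ +-mono-≤ {1} (≤-refl {1}) j<e ⟩
            1 + e r ≡⟨ m+n∸n≡m (1 + e r) j ⟨
            1 + e r + j ∸ j ≡⟨ cong (_∸ j) (lem (e r) j) ⟩
            e r + suc j ∸ j ≤⟨ ∸-monoˡ-≤ j (+-monoʳ-≤ (e r) j<e) ⟩
            2e ∸ j ∎
            where
            open ≤-Reasoning
            lem : ∀ a j → 1 + a + j ≡ a + suc j
            lem = solve-∀
          r^j+2∣a' : r ^ suc (suc j) ∣ a'
          r^j+2∣a' = ∣-trans (^-mono-∣ r 2e∸j≥) r^∣a'
          r∣a' : r ∣ a'
          r∣a' = ∣-trans (m∣m*n (r ^ suc j)) r^j+2∣a'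
          h' = quotient r∣a'
          a'≡ : a' ≡ h' * r
          a'≡ = _∣_.equality r∣a'
          r^j+1∣h' : r ^ suc j ∣ h'
          r^j+1∣h' = *-cancelʳ-∣ r (subst₂ _∣_ (*-comm r (r ^ suc j)) a'≡ r^j+2∣a')
          h'≥1 : 1 ≤ h'
          h'≥1 = ∣⇒≥1 (pos spa) (subst (h' ∣_) (sym a'≡) (m∣m*n r))
          b'∣h' : b' ∣ h'
          b'∣h' = least spb h' (One-descend-prime r K₁ (q ^ h') R (q^≥1 h') K₁≥1 r∣K₁
              (λ s S s∣ → One-drop s h' r S (∣-trans s∣ K₁∣k) (∣-trans r∣k k∣n)
                 (subst (λ z → One s (q ^ z)) a'≡ (∣-trans (∣-trans s∣ (m∣m*n r)) (one spa))))
              (λ { refl → One-4-q² r∣k h' (∣-trans (m∣m*n (2 ^ j)) r^j+1∣h') })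
              (subst (One K₀') (trans (cong (q ^_) a'≡) (sym (^-*-assoc q h' r))) (one spa)))
          h'∣b'r : a' ∣ b' * r
          h'∣b'r = least spa _ (subst (One K₀') (^-*-assoc q b' r) (One-lift r (prime≥1 R) K₁ (q ^ b') (q^≥1 b')
                     (λ s S z → subst (_∣ K₁) (sym (prime∣prime S R z)) r∣K₁) (one spb)))
          r^δ∣b' : r ^ δ ∣ b'
          r^δ∣b' = ∣-trans (^-mono-∣ r (<⇒≤ δ<1+j)) (∣-trans r^j+1∣h' (*-cancelʳ-∣ r (subst (_∣ b' * r) a'≡ h'∣b'r)))
          β = quotient r^δ∣b'
          b'≡ : b' ≡ β * r ^ δ
          b'≡ = _∣_.equality r^δ∣b'
          dβ : d * β ≡ b' * G
          dβ = trans (cong (_* β) d-eq) (trans (lem G (r ^ δ) β) (cong (_* G) (sym b'≡)))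
            where
            lem : ∀ g x b → g * x * b ≡ b * x * g
            lem = solve-∀
          oneK₁ : One K₁ (q ^ (d * β))
          oneK₁ = One-exp b' _ (subst (b' ∣_) (sym dβ) (m∣m*n G)) (one spb)
          notK₀ : ¬ One K₀' (q ^ (d * β))
          notK₀ z = r∤G (*-cancelˡ-∣ h' {{>-nonZero h'≥1}} (∣-trans (subst₂ _∣_ a'≡ dβ (least spa _ z)) (*-monoˡ-∣ G b'∣h')))
          res₁ : K₁ * r ^ j ∣ pred (q ^ (d * β)) * i
          res₁ = *-pres-∣ oneK₁ (divides i' i-eq)
          res₂ : ¬ k ∣ pred (q ^ (d * β)) * i
          res₂ z = notK₀ (prime-absorb R K₁≥1 r∤i' oneK₁ K₀∣)
            where
            K₀∣ : K₀' ∣ pred (q ^ (d * β)) * i'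
            K₀∣ = *-cancelʳ-∣ (r ^ j) {{m^n≢0 r j}} (subst₂ _∣_ k-eq₀ (trans (cong (pred (q ^ (d * β)) *_) i-eq) (sym (*-assoc (pred (q ^ (d * β))) i' (r ^ j)))) z)

      order-local : ∀ d m → k ≡ d * m → (∀ s → Prime s → s ∣ d → s ∣ m) → ∀ r b → Prime r →
        (r ≡ 2 → e r ≡ 0 → 2 ∣ d → 2 ∣ ordq m → One 4 q) → r ^ b ∣ d → r ^ b ∣ ordq m → b ≡ 0 ⊎ (r ∣ k × b ≤ e r)
      order-local d m k≡ pd r zero R h4 x y = inj₁ refl
      order-local d m k≡ pd r b@(suc b') R h4 x y with b ≤? e r
      ... | yes l = inj₂ (subst (r ∣_) (sym k≡) (∣m⇒∣m*n m (∣-trans (m∣m*n (r ^ b')) x)) , l)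
      ... | no b≰e = ⊥-elim (go (∣-trans (^-mono-∣ r (≰⇒> b≰e)) x))
        where
        instance _ = prime⇒nonZero R
        t = e r
        r∣d : r ∣ d
        r∣d = ∣-trans (m∣m*n (r ^ b')) x
        r∣k : r ∣ k
        r∣k = subst (r ∣_) (sym k≡) (∣m⇒∣m*n m r∣d)
        go : r ^ suc t ∣ d → ⊥
        go (divides d' d≡) = r²ᵉ⁺²∤K R r∣k (∣-trans (subst₂ (λ a b → r ^ a ∣ ordq b) (lem1 t) (sym k≡M) (chain (suc t) ≤-refl)) (ord∣K ∣-refl))
          where
          lem1 : ∀ t → suc t + suc t ≡ suc (suc (t + t))
          lem1 = solve-∀
          M : ℕ → ℕ
          M i = d' * m * r ^ i
          k≡M : k ≡ M (suc t)
          k≡M = trans k≡ (trans (cong (_* m) d≡) (lem d' (r ^ suc t) m))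
            where
            lem : ∀ a x m → a * x * m ≡ a * m * x
            lem = solve-∀
          M∣k : ∀ i → i ≤ suc t → M i ∣ k
          M∣k i l = subst (M i ∣_) (sym k≡M) (*-monoʳ-∣ (d' * m) (^-mono-∣ r l))
          chain : ∀ i → i ≤ suc t → r ^ (suc t + i) ∣ ordq (M i)
          chain zero l = subst₂ _∣_ (cong (r ^_) (sym (+-identityʳ (suc t)))) refl (∣-trans (∣-trans (^-mono-∣ r (≰⇒> b≰e)) y)
               (ord-mono (subst (m ∣_) (sym (*-identityʳ (d' * m))) (n∣m*n d')) (M∣k 0 z≤n)))
          chain (suc i) l = subst₂ _∣_ (cong (r ^_) (sym (+-suc (suc t) i))) (sym a₁≡)
              (subst (_∣ h * r) (*-comm (r ^ (suc t + i)) r) (*-monoˡ-∣ r (∣-trans (chain i (≤-trans (n≤1+n i) l)) b₁∣h)))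
            where
            Ms≡ : M (suc i) ≡ M i * r
            Ms≡ = lem (d' * m) r (r ^ i)
              where
              lem : ∀ a r x → a * (r * x) ≡ a * x * r
              lem = solve-∀
            Ms∣k = M∣k (suc i) l
            Mi∣k = M∣k i (≤-trans (n≤1+n i) l)
            Mi∣Ms : M i ∣ M (suc i)
            Mi∣Ms = subst (M i ∣_) (sym Ms≡) (m∣m*n r)
            b₁ = ordq (M i)
            a₁ = ordq (M (suc i))
            spa = orderOf (M (suc i)) Ms∣k
            b₁∣a₁ : b₁ ∣ a₁
            b₁∣a₁ = ord-mono Mi∣Ms Ms∣k
            r∣a₁ : r ∣ a₁
            r∣a₁ = ∣-trans (m∣m*n _) (∣-trans (chain i (≤-trans (n≤1+n i) l)) b₁∣a₁)
            h = quotient r∣a₁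
            a₁≡ : a₁ ≡ h * r
            a₁≡ = _∣_.equality r∣a₁
            four : r ≡ 2 → One 4 (q ^ h)
            four refl with zeros-or-sum≥2 t i
            ... | inj₁ (e0 , refl) = One-^ 4 q h q≥1 (h4 refl e0 r∣d (∣-trans (m∣m*n (2 ^ b')) y))
            ... | inj₂ le = One-4-q² r∣k h (*-cancelʳ-∣ 2 (subst (4 ∣_) a₁≡ (∣-trans (^-mono-∣ 2 le) (∣-trans (chain i (≤-trans (n≤1+n i) l)) b₁∣a₁))))
            b₁∣h : b₁ ∣ h
            b₁∣h = least (orderOf (M i) Mi∣k) h (One-descend-prime r (M i) (q ^ h) R (q^≥1 h) (∣⇒≥1 k≥1 Mi∣k)
              (∣m⇒∣m*n (r ^ i) (∣n⇒∣m*n d' (pd r R r∣d)))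
              (λ s S s∣ → One-drop s h r S (∣-trans s∣ Mi∣k) (∣-trans r∣k k∣n)
                 (subst (λ z → One s (q ^ z)) a₁≡ (∣-trans (∣-trans s∣ Mi∣Ms) (one spa))))
              four (subst₂ One Ms≡ (trans (cong (q ^_) a₁≡) (sym (^-*-assoc q h r))) (one spa)))

      -- For an idempotent of 𝔽_{q^d}[σ^d] on the k-th component, fixes puts its coefficients in 𝔽_{q^s} and moves its support in the powers of σ^s.
      record Target (d m s : ℕ) : Set where
        field
          fixes : gcd d (ordq m) ∣ s
          moves : ∀ i → d ∣ i → ¬ s ∣ i → Mover d i

      order-odd-part : ∀ m → m ∣ k → ¬ 2 ∣ m → 2 ∣ n → ∃ λ u → ¬ 2 ∣ u × One m (q ^ u)
      order-odd-part m m∣k odd 2∣n = o * m , no2 , One-radical q o m q≥1 (∣⇒≥1 k≥1 m∣k) (λ s S d → o-one s S (∣-trans d (∣-trans m∣k k∣n')))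
        where
        no2 : ¬ 2 ∣ o * m
        no2 z with euclidsLemma o m prime[2] z
        ... | inj₁ x = prime∤1 prime[2] (subst (2 ∣_) (o-coprime (x , 2∣n)) ∣-refl)
        ... | inj₂ x = odd x

      odd-cases : ∀ {y} → ¬ 2 ∣ y → y % 4 ≡ 1 ⊎ y % 4 ≡ 3
      odd-cases {y} odd with y % 4 in eq | m%n<n y 4
      ... | 0 | _ = ⊥-elim (odd (∣-trans (divides 2 refl) (m%n≡0⇒n∣m y 4 eq)))
      ... | 1 | _ = inj₁ refl
      ... | 2 | _ = ⊥-elim (odd (subst (2 ∣_) (sym (trans (m≡m%n+[m/n]*n y 4) (cong (_+ y / 4 * 4) eq)))
                       (∣m∣n⇒∣m+n (divides 1 refl) (∣n⇒∣m*n (y / 4) (divides 2 refl)))))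
      ... | 3 | _ = inj₂ refl
      ... | suc (suc (suc (suc _))) | s≤s (s≤s (s≤s (s≤s ())))

      2∤q : 2 ∣ k → ¬ 2 ∣ q
      2∤q 2∣k z = prime∤1 prime[2] (subst (2 ∣_) (q-coprime (∣-trans 2∣k k∣n' , z)) ∣-refl)

      nonexceptional-4 : (q % 4 ≡ 3 → 2 < c → ordq (2 ^ c) ≡ 2 → ⊥) → e 2 ≡ 0 → ∀ d m → k ≡ d * m → (∀ s → Prime s → s ∣ d → s ∣ m) →
        2 ∣ d → 2 ∣ ordq m → One 4 q
      nonexceptional-4 ne e0 d m k≡ pd 2∣d 2∣om with odd-cases (2∤q 2∣k)
        where
        2∣k : 2 ∣ k
        2∣k = subst (2 ∣_) (sym k≡) (∣m⇒∣m*n m 2∣d)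
      ... | inj₁ q1 = %≡⇒∣∸ q 1 4 q≥1 q1
      ... | inj₂ q3 with 2 <? c | ordq (2 ^ c) ≟ 2
      ... | yes c3 | yes o2 = ⊥-elim (ne q3 c3 o2)
      ... | yes c3 | no o≢2 = go
        where
        2∣k : 2 ∣ k
        2∣k = subst (2 ∣_) (sym k≡) (∣m⇒∣m*n m 2∣d)
        oc = ordq (2 ^ c)
        spc = orderOf (2 ^ c) 2^c∣k
        4∤oc : ¬ 4 ∣ oc
        4∤oc z = subst (λ x → ¬ 2 ^ suc (suc (x + x)) ∣ K) e0 (r²ᵉ⁺²∤K prime[2] 2∣k) (∣-trans z (ord∣K 2^c∣k))
        oc∣ : oc ∣ 2 ^ (c ∸ 1)
        oc∣ = least spc _ (subst (λ z → One (2 ^ z) (q ^ (2 ^ (c ∸ 1)))) (m+[n∸m]≡n {1} {c} (≤-trans (s≤s z≤n) c3))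
                (One-lift (2 ^ (c ∸ 1)) (m^n>0 2 (c ∸ 1)) 2 q q≥1 (λ s S z → prime∣^ 2 (c ∸ 1) S z) (One-2-q 2∣k)))
        go : One 4 q
        go with maxPower oc prime[2] (pos spc)
        ... | v , _ , divides w eq , nv = fin v eq (primePower-≤ {2} {1} v 4∤oc (divides w eq))
          where
          2∤w : ¬ 2 ∣ w
          2∤w z = nv (subst (2 ^ suc v ∣_) (sym eq) (*-monoˡ-∣ (2 ^ v) z))
          w≡1 : w ≡ 1
          w≡1 = prime^-coprime (c ∸ 1) prime[2] 2∤w (∣-trans (subst (w ∣_) (sym eq) (m∣m*n _)) oc∣ , ∣-refl)
          fin : ∀ v → oc ≡ w * 2 ^ v → v ≤ 1 → One 4 q
          fin zero eq _ = ∣-trans (^-mono-∣ 2 {2} {c} (<⇒≤ c3)) (subst (One (2 ^ c)) (trans (cong (q ^_) (trans eq (trans (*-identityʳ w) w≡1))) (*-identityʳ q)) (one spc))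
          fin (suc zero) eq _ = ⊥-elim (o≢2 (trans eq (cong (_* 2) w≡1)))
          fin (suc (suc v)) eq (s≤s ())
      ... | no c≤2 | _ = ⊥-elim (u-odd (∣-trans 2∣om (least (orderOf m m∣k) u one-m)))
        where
        2∣k : 2 ∣ k
        2∣k = subst (2 ∣_) (sym k≡) (∣m⇒∣m*n m 2∣d)
        m∣k : m ∣ k
        m∣k = subst (m ∣_) (sym k≡) (n∣m*n d)
        2∣m = pd 2 prime[2] 2∣d
        m' = quotient 2∣m
        m≡ : m ≡ m' * 2
        m≡ = _∣_.equality 2∣m
        m'-odd : ¬ 2 ∣ m'
        m'-odd z = c≤2 (≰⇒> λ le → 2^1+c∤k (∣-trans (^-mono-∣ 2 {suc (c)} {3} (s≤s le))
           (subst (8 ∣_) (sym k≡) (*-pres-∣ {2} {d} {4} {m} 2∣d (subst (4 ∣_) (sym m≡) (*-pres-∣ {2} {m'} {2} {2} z ∣-refl))))))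
        od = order-odd-part m' (∣-trans (subst (m' ∣_) (sym m≡) (m∣m*n 2)) m∣k) m'-odd (∣-trans 2∣k k∣n)
        u = proj₁ od
        u-odd = proj₁ (proj₂ od)
        one-m : One m (q ^ u)
        one-m = subst (λ z → One z (q ^ u)) (trans (*-comm 2 m') (sym m≡))
          (coprime-*∣ (prime-coprime prime[2] m'-odd) (One-^ 2 q u q≥1 (One-2-q 2∣k)) (proj₂ (proj₂ od)))

      gcd≥1 : ∀ d m → k ≡ d * m → 1 ≤ gcd d (ordq m)
      gcd≥1 d m k≡ = ∣⇒≥1 (∣⇒≥1 k≥1 (subst (d ∣_) (sym k≡) (m∣m*n m))) (gcd[m,n]∣m d _)

      local-τ : ∀ {r b} → Prime r → b ≡ 0 ⊎ (r ∣ k × b ≤ e r) → r ^ b ∣ T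
      local-τ R (inj₁ refl) = 1∣ T
      local-τ {r} R (inj₂ (r∣k , l)) = ∣-trans (^-mono-∣ r l) (τ-power R r∣k)

      nonexceptional-target : (q % 4 ≡ 3 → 2 < c → ordq (2 ^ c) ≡ 2 → ⊥) → ∀ d m → k ≡ d * m → (∀ s → Prime s → s ∣ d → s ∣ m) → Target d m T
      nonexceptional-target ne d m k≡ pd = record
        { fixes = ∣-primePowers _ T (gcd≥1 d m k≡) λ r b R x → local-τ R (order-local d m k≡ pd r b R
            (λ { refl e0 → nonexceptional-4 ne e0 d m k≡ pd })
            (∣-trans x (gcd[m,n]∣m d _)) (∣-trans x (gcd[m,n]∣n d _)))
        ; moves = λ i → mover d i (∣⇒≥1 k≥1 (subst (d ∣_) (sym k≡) (m∣m*n m))) }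

      module Exceptional (q%4≡3 : q % 4 ≡ 3) (c≥3 : 2 < c) (oc≡2 : ordq (2 ^ c) ≡ 2) where
        one-2^c : One (2 ^ c) (q ^ 2)
        one-2^c = subst (λ z → One (2 ^ c) (q ^ z)) oc≡2 (one (orderOf (2 ^ c) 2^c∣k))

        2∣k : 2 ∣ k
        2∣k = ∣-trans (^-mono-∣ 2 {1} {c} (≤-trans (s≤s z≤n) c≥3)) 2^c∣k

        private
          ℓ = quotient 2^c∣k
          k≡ℓ2^c : k ≡ ℓ * 2 ^ c
          k≡ℓ2^c = _∣_.equality 2^c∣k
          ℓ-odd : ¬ 2 ∣ ℓ
          ℓ-odd z = 2^1+c∤k (subst (2 ^ suc c ∣_) (sym k≡ℓ2^c) (*-monoˡ-∣ (2 ^ c) z))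
          join : ∀ {x} → 2 ^ c ∣ x → ℓ ∣ x → k ∣ x
          join a b = subst (_∣ _) (trans (*-comm (2 ^ c) ℓ) (sym k≡ℓ2^c)) (coprime-*∣ (prime^-coprime c prime[2] ℓ-odd) a b)

        4∤K : ¬ 4 ∣ K
        4∤K z with order-odd-part ℓ (subst (ℓ ∣_) (sym k≡ℓ2^c) (m∣m*n _)) ℓ-odd (∣-trans 2∣k k∣n)
        ... | u , odd , d = odd (*-cancelˡ-∣ 2 (∣-trans z (least spK (2 * u) (join (One-exp 2 (2 * u) (m∣m*n u) one-2^c) (One-exp u (2 * u) (n∣m*n 2) d)))))

        τ-odd : ¬ 2 ∣ T
        τ-odd z with τ-prime prime[2] z
        ... | _ , l = 4∤K (∣-trans (^-mono-∣ 2 {2} {e 2 + e 2} (+-mono-≤ l l)) (r²ᵉ∣K prime[2]))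

        2τr∣k : ∀ r → Prime r → r ∣ k → 2 * T * r ∣ k
        2τr∣k r R r∣k with r ≟ 2
        ... | yes refl = subst (_∣ k) (lem T) (coprime-*∣ (prime^-coprime 2 prime[2] τ-odd) (∣-trans (^-mono-∣ 2 {2} {c} (<⇒≤ c≥3)) 2^c∣k) τ∣k)
          where
          lem : ∀ t → 2 ^ 2 * t ≡ 2 * t * 2
          lem = solve-∀
        ... | no ne = subst (_∣ k) (sym (*-assoc 2 T r)) (coprime-*∣ (prime-coprime prime[2] odd) 2∣k (τr∣k r R r∣k))
          where
          odd : ¬ 2 ∣ T * r
          odd z with euclidsLemma T r prime[2] z
          ... | inj₁ x = τ-odd x
          ... | inj₂ x = ne (sym (prime∣prime prime[2] R x))

        2τ∣k : 2 * T ∣ k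
        2τ∣k = ∣-trans (m∣m*n 2) (2τr∣k 2 prime[2] 2∣k)

        even-exp : ∀ u → One 4 (q ^ u) → 2 ∣ u
        even-exp u d with u % 2 in eq | m%n<n u 2
        ... | zero | _ = m%n≡0⇒n∣m u 2 eq
        ... | suc (suc _) | s≤s (s≤s ())
        ... | suc zero | _ = ⊥-elim (absurd (trans (sym q%4≡3) (∣∸⇒%≡ q 1 4 q≥1 one4)))
          where
          absurd : 3 ≡ 1 → ⊥
          absurd ()
          v = u / 2
          one4 : One 4 q
          one4 = One-cancel 4 ((q ^ 2) ^ v) q (m^n>0 (q ^ 2) {{m^n≢0 q 2}} v) q≥1
            (One-^ 4 (q ^ 2) v (q^≥1 2) (One-4-q² 2∣k 2 ∣-refl))
            (subst (One 4) (trans (cong (q ^_) (trans (m≡m%n+[m/n]*n u 2) (cong (_+ v * 2) eq)))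
              (trans (*-comm q _) (cong (_* q) (trans (cong (q ^_) (*-comm v 2)) (sym (^-*-assoc q 2 v)))))) d)

        half⇒ : ∀ u → k ∣ 2 * T * pred (q ^ (T * u)) → k ∣ T * pred (q ^ (T * u))
        half⇒ u d = join (∣n⇒∣m*n T (One-exp 2 (T * u) 2∣Tu one-2^c)) (coprime-divisor (Cop.sym (prime-coprime prime[2] ℓ-odd))
            (∣-trans (subst (ℓ ∣_) (sym k≡ℓ2^c) (m∣m*n _)) d'))
          where
          x = pred (q ^ (T * u))
          d' : k ∣ 2 * (T * x)
          d' = subst (k ∣_) (*-assoc 2 T x) d
          4∣x : 4 ∣ x
          4∣x = coprime-divisor (prime^-coprime 2 prime[2] τ-odd) (*-cancelˡ-∣ {4} {T * x} 2 (∣-trans (^-mono-∣ 2 {3} {c} c≥3) (∣-trans 2^c∣k d')))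
          2∣Tu : 2 ∣ T * u
          2∣Tu = even-exp (T * u) 4∣x

        2∣D : 2 ∣ D
        2∣D = coprime-divisor (prime-coprime prime[2] τ-odd) (even-exp (T * D)
           (coprime-divisor (prime^-coprime 2 prime[2] τ-odd) (∣-trans (^-mono-∣ 2 {2} {c} (<⇒≤ c≥3)) (∣-trans 2^c∣k (D-order⇐ D ∣-refl)))))

        exceptional-target-odd : ∀ d m → ¬ 2 ∣ d → k ≡ d * m → (∀ s → Prime s → s ∣ d → s ∣ m) → Target d m T
        exceptional-target-odd d m odd k≡ pd = record
          { fixes = ∣-primePowers _ T (gcd≥1 d m k≡) λ r b R x → local-τ R (order-local d m k≡ pd r b R
              (λ { refl _ z → ⊥-elim (odd z) })
              (∣-trans x (gcd[m,n]∣m d _)) (∣-trans x (gcd[m,n]∣n d _)))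
          ; moves = λ i → mover d i (∣⇒≥1 k≥1 (subst (d ∣_) (sym k≡) (m∣m*n m))) }

        exceptional-target-even : ∀ d m → 2 ∣ d → k ≡ d * m → (∀ s → Prime s → s ∣ d → s ∣ m) → Target d m (2 * T)
        exceptional-target-even d m 2∣d k≡ pd = record
          { fixes = ∣-primePowers _ (2 * T) (gcd≥1 d m k≡) loc
          ; moves = λ i d∣i h → mover d i (∣⇒≥1 k≥1 (subst (d ∣_) (sym k≡) (m∣m*n m))) d∣i
              (λ z → h (coprime-*∣ (prime-coprime prime[2] τ-odd) (∣-trans 2∣d d∣i) z)) }
          where
          loc : ∀ r b → Prime r → r ^ b ∣ gcd d (ordq m) → r ^ b ∣ 2 * T
          loc r b R x with r ≟ 2
          ... | yes refl = ∣-trans (^-mono-∣ 2 (primePower-≤ {2} {1} b 4∤K (∣-trans x (∣-trans (gcd[m,n]∣n d _)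
                  (ord∣K (subst (m ∣_) (sym k≡) (n∣m*n d))))))) (m∣m*n T)
          ... | no ne = ∣n⇒∣m*n 2 (local-τ R (order-local d m k≡ pd r b R (λ z → ⊥-elim (ne z))
              (∣-trans x (gcd[m,n]∣m d _)) (∣-trans x (gcd[m,n]∣n d _))))

    module C = Core (λ m → ord m q) orderOf K T (val 2 k) e spK r²ᵉ∣K r²ᵉ⁺²∤K r²ᵉ⁺¹∣k τ≥1 τ-local τ-power
      (proj₁ (val-∣ k prime[2] k≥1)) (proj₂ (val-∣ k prime[2] k≥1))

    nonexceptional : exceptional q k ≡ false → q % 4 ≡ 3 → 2 < val 2 k → ord (2 ^ val 2 k) q ≡ 2 → ⊥
    nonexceptional ne q3 c3 o2 = absurd (trans (sym ne) ex)
      where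
      ex : exceptional q k ≡ true
      ex rewrite q3 | Equivalence.to T-≡ (<⇒<ᵇ c3) | o2 = refl
      absurd : false ≡ true → ⊥
      absurd ()

    exceptional-parts : exceptional q k ≡ true → q % 4 ≡ 3 × 2 < val 2 k × ord (2 ^ val 2 k) q ≡ 2
    exceptional-parts ex = ≡ᵇ⇒≡ (q % 4) 3 (proj₁ parts) , <ᵇ⇒< 2 (val 2 k) (proj₁ parts') , ≡ᵇ⇒≡ (ord (2 ^ val 2 k) q) 2 (proj₂ parts')
      where
      parts = Equivalence.to (T-∧ {q % 4 ≡ᵇ 3}) (Equivalence.from T-≡ ex)
      parts' = Equivalence.to (T-∧ {2 <ᵇ val 2 k}) (proj₂ parts)

module Totient where

  open import Defs
  open Arithmetic
  open Orders
  open ComponentArithmetic using (÷-∣; *-÷)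
  open Cardinality
  open import Data.Nat
  open import Data.Nat.Properties
  open import Data.Nat.Divisibility
  open import Data.Nat.GCD using (gcd; gcd[m,n]∣m; gcd[m,n]∣n; c*gcd[m,n]≡gcd[cm,cn])
  open import Data.Nat.ListAction using (sum)
  open import Data.Nat.Tactic.RingSolver using (solve-∀)
  open import Data.List using (List; []; _∷_; map)
  open import Data.List.Properties using (length-applyUpTo)
  open import Data.List.Relation.Unary.All as All using (All; []; _∷_)
  open import Data.List.Relation.Unary.Any using (here; there)
  open import Data.List.Membership.Propositional using (_∈_)
  open import Data.List.Membership.Propositional.Properties
  open import Data.List.Relation.Unary.AllPairs using ([]; _∷_)
  open import Data.List.Relation.Unary.Unique.Propositional using (Unique)
  import Data.List.Relation.Unary.Unique.Propositional.Properties as Uniq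
  open import Data.Product using (_×_; _,_; proj₁)
  open import Data.Sum using (inj₁; inj₂)
  open import Relation.Binary.PropositionalEquality
  open import Relation.Nullary using (¬_)

  card-fibres : {A : Set} {P : A → Set} (key : A → ℕ) (f : ℕ → ℕ) (ds : List ℕ) → Unique ds →
    (∀ {d} → d ∈ ds → Card (λ x → P x × key x ≡ d) (f d)) → Card (λ x → P x × key x ∈ ds) (sum (map f ds))
  card-fibres key f [] U c = mkCard [] refl [] (λ ()) (λ { (_ , ()) })
  card-fibres key f (d ∷ ds) (d∉ ∷ U) c = card-cong
    (λ { (inj₁ (p , e)) → p , here e ; (inj₂ (p , z)) → p , there z })
    (λ { (p , here e) → inj₁ (p , e) ; (p , there z) → inj₂ (p , z) })
    (card-⊎ (λ { (_ , refl) (_ , z) → All.lookup d∉ z refl }) (c (here refl)) (card-fibres key f ds U (λ z → c (there z))))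

  card-φ : ∀ m → Card (λ i → (1 ≤ i × i ≤ m) × gcd i m ≡ 1) (φ m)
  card-φ m = mkCard _ refl (Uniq.filter⁺ (λ i → gcd i m ≟ 1) (oneTo-unique m))
    (λ z → let (a , b) = ∈-filter⁻ (λ i → gcd i m ≟ 1) {xs = oneTo m} z in ∈-oneTo⁻ a , b)
    (λ ((a , b) , c) → ∈-filter⁺ (λ i → gcd i m ≟ 1) (∈-oneTo⁺ a b) c)

  φ-sum : ∀ m → 1 ≤ m → sum (map φ (divisors m)) ≡ m
  φ-sum m m≥1 = trans
    (card-unique (card-fibres (λ i → m ÷ gcd i m) φ (divisors m) (divisors-unique m) (λ z → fibre (∈-divisors⁻ {m = m} z)))
      (mkCard (oneTo m) refl (oneTo-unique m) ∈-oneTo⁻ (λ (a , b) → ∈-oneTo⁺ a b)) proj₁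
      (λ {i} p → p , ∈-divisors⁺ m≥1 (÷-divides (gcd[m,n]∣n i m))))
    (length-applyUpTo suc m)
    where
    ÷-divides : ∀ {g} → g ∣ m → m ÷ g ∣ m
    ÷-divides {g} d = subst (m ÷ g ∣_) (÷-∣ (∣⇒≥1 m≥1 d) d) (m∣m*n g)
    fibre : ∀ {d} → d ∣ m → Card (λ i → (1 ≤ i × i ≤ m) × m ÷ gcd i m ≡ d) (φ d)
    fibre {d} (divides g m≡) = card-image (λ i → g * i)
       (λ {i} ((a , b) , c) → (*-mono-≤ g≥1 a , subst (g * i ≤_) (sym m≡) (*-monoʳ-≤ g b)) ,
          trans (cong (m ÷_) (gc i c)) (trans (cong (_÷ g) (trans m≡ (*-comm g d))) (*-÷ d g≥1)))
       (λ {x} {y} _ _ e → *-cancelˡ-≡ x y g {{>-nonZero g≥1}} e) surj (card-φ d)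
      where
      g≥1 : 1 ≤ g
      g≥1 = ∣⇒≥1 m≥1 (divides d (trans m≡ (*-comm g d)))
      gc : ∀ i → gcd i d ≡ 1 → gcd (g * i) m ≡ g
      gc i c = trans (cong (gcd (g * i)) m≡) (trans (sym (c*gcd[m,n]≡gcd[cm,cn] g i d)) (trans (cong (g *_) c) (*-identityʳ g)))
      surj : ∀ {y} → (1 ≤ y × y ≤ m) × m ÷ gcd y m ≡ d → _
      surj {y} ((a , b) , c) with gcd[m,n]∣m y m
      ... | divides y' y≡ = y' , ((∣⇒≥1 a (divides g (trans y≡ (trans (cong (y' *_) G≡g) (*-comm y' g)))) ,
              *-cancelˡ-≤ g {{>-nonZero g≥1}} (subst₂ _≤_ y≡' m≡ b)) ,
              *-cancelˡ-≡ _ 1 g {{>-nonZero g≥1}} (trans (c*gcd[m,n]≡gcd[cm,cn] g y' d)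
                (trans (cong₂ gcd (sym y≡') (sym m≡)) (trans G≡g (sym (*-identityʳ g)))))) , sym y≡'
        where
        d≥1 : 1 ≤ d
        d≥1 = ∣⇒≥1 m≥1 (divides g m≡)
        G≥1 : 1 ≤ gcd y m
        G≥1 = ∣⇒≥1 m≥1 (gcd[m,n]∣n y m)
        G≡g : gcd y m ≡ g
        G≡g = *-cancelˡ-≡ _ g d {{>-nonZero d≥1}} (trans (cong (_* gcd y m) (sym c))
                (trans (÷-∣ G≥1 (gcd[m,n]∣n y m)) (trans m≡ (*-comm g d))))
        y≡' : y ≡ g * y'
        y≡' = trans y≡ (trans (cong (y' *_) G≡g) (*-comm y' g))

  prod-^ : ∀ q (f : ℕ → ℕ) L → prod (map (λ k → q ^ f k) L) ≡ q ^ sum (map f L)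
  prod-^ q f [] = refl
  prod-^ q f (x ∷ L) = trans (cong (q ^ f x *_) (prod-^ q f L)) (sym (^-distribˡ-+-* q (f x) _))

  prod-* : ∀ (f g : ℕ → ℕ) L → prod (map (λ k → f k * g k) L) ≡ prod (map f L) * prod (map g L)
  prod-* f g [] = refl
  prod-* f g (x ∷ L) = trans (cong (f x * g x *_) (prod-* f g L)) (lem (f x) (g x) _ _)
    where
    lem : ∀ a b c d → a * b * (c * d) ≡ a * c * (b * d)
    lem = solve-∀

  sum-*ˡ : ∀ c (f : ℕ → ℕ) L → sum (map (λ k → c * f k) L) ≡ c * sum (map f L)
  sum-*ˡ c f [] = sym (*-zeroʳ c)
  sum-*ˡ c f (x ∷ L) = trans (cong (c * f x +_) (sum-*ˡ c f L)) (sym (*-distribˡ-+ c (f x) _))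

  prod-cong-∈ : ∀ (f g : ℕ → ℕ) L → (∀ {k} → k ∈ L → f k ≡ g k) → prod (map f L) ≡ prod (map g L)
  prod-cong-∈ f g [] h = refl
  prod-cong-∈ f g (x ∷ L) h = cong₂ _*_ (h (here refl)) (prod-cong-∈ f g L (λ z → h (there z)))

  prod≥1 : ∀ (f : ℕ → ℕ) L → (∀ {k} → k ∈ L → 1 ≤ f k) → 1 ≤ prod (map f L)
  prod≥1 f [] h = ≤-refl
  prod≥1 f (x ∷ L) h = *-mono-≤ (h (here refl)) (prod≥1 f L (λ z → h (there z)))

  prod-cancel : ∀ (f g : ℕ → ℕ) m L → Unique L → m ∈ L → (∀ {k} → k ∈ L → 1 ≤ g k) →
    (∀ {k} → k ∈ L → ¬ k ≡ m → f k ≡ g k) → prod (map f L) ≡ prod (map g L) → f m ≡ g m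
  prod-cancel f g m (x ∷ L) (x∉ ∷ U) (here refl) pos h e =
    *-cancelʳ-≡ (f x) (g x) (prod (map g L)) {{>-nonZero (prod≥1 g L (λ z → pos (there z)))}}
     (trans (cong (f x *_) (sym (prod-cong-∈ f g L (λ z → h (there z) (λ { refl → All.lookup x∉ z refl }))))) e)
  prod-cancel f g m (x ∷ L) (x∉ ∷ U) (there z) pos h e = prod-cancel f g m L U z (λ w → pos (there w)) (λ w → h (there w))
    (*-cancelˡ-≡ _ _ (g x) {{>-nonZero (pos (here refl))}}
     (trans (cong (_* prod (map f L)) (sym (h (here refl) (λ { refl → All.lookup x∉ z refl })))) e))

  exponent-unique : ∀ q a m → 2 ≤ q → q ^ a ≡ q ^ m → a ≡ m
  exponent-unique q a m h e = ≤-antisym (le a m (≤-reflexive e)) (le m a (≤-reflexive (sym e)))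
    where
    le : ∀ a b → q ^ a ≤ q ^ b → a ≤ b
    le a b l = ≮⇒≥ λ lt → <⇒≱ (^-monoʳ-< q h lt) l

  formula-pa : ∀ q pa n' → 1 ≤ n' → formula q pa n' ≡ formula q 1 n' * q ^ ((pa ∸ 1) * n')
  formula-pa q pa n' h = trans (prod-cong-∈ (factor q pa) (λ k → factor q 1 k * q ^ ((pa ∸ 1) * φ k)) (divisors n') (λ {k} _ → fac k))
    (trans (prod-* (factor q 1) (λ k → q ^ ((pa ∸ 1) * φ k)) (divisors n'))
     (cong (formula q 1 n' *_) (trans (prod-^ q (λ k → (pa ∸ 1) * φ k) (divisors n'))
       (cong (q ^_) (trans (sum-*ˡ (pa ∸ 1) φ (divisors n')) (cong ((pa ∸ 1) *_) (φ-sum n' h)))))))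
    where
    open import Data.Bool using (true; false)
    lem : ∀ x y → x * y ≡ x * 1 * y
    lem x y = cong (_* y) (sym (*-identityʳ x))
    fac : ∀ k → factor q pa k ≡ factor q 1 k * q ^ ((pa ∸ 1) * φ k)
    fac k with exceptional q k
    ... | true = lem (((q ^ (2 * (ord k q ÷ τ q k)) + 3) ∸ 4 * q ^ (ord k q ÷ τ q k)) ^ ((τ q k * φ k) ÷ (2 * ord k q))) (q ^ ((pa ∸ 1) * φ k))
    ... | false = lem ((q ^ (ord k q ÷ τ q k) ∸ 1) ^ ((τ q k * φ k) ÷ ord k q)) (q ^ ((pa ∸ 1) * φ k))

module FiniteFields where

  open import Level using (0ℓ)
  open import Algebra.Bundles using (CommutativeRing)
  open import Algebra.Structures using (IsCommutativeRing)
  open import Data.Nat as ℕ using (ℕ; zero; suc; _≤_; _<_; z≤n; s≤s; _∸_; _!)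
  import Data.Nat.Properties as ℕₚ
  open import Data.Nat.Divisibility using (_∣_; divides; ∣⇒≤; m∣m*n)
  open import Data.Nat.DivMod using (m/n*n≡m)
  open import Data.Nat.GCD using (module Bézout)
  open import Data.Nat.Combinatorics using (_C_; nCk≡n!/k![n-k]!; k![n∸k]!∣n!)
  open import Data.Nat.Primality using (Prime; euclidsLemma)
  open import Data.Fin using (Fin; zero; suc; toℕ)
  import Data.Fin.Properties as Fin
  open import Data.List as List using (List; []; _∷_; map; length)
  open import Data.List.Membership.Propositional using (_∈_)
  open import Data.List.Membership.Propositional.Properties using (∈-map⁻)
  open import Data.List.Relation.Unary.Any using (here; there)
  open import Data.List.Relation.Unary.All using (All; []; _∷_)
  open import Data.List.Relation.Binary.Permutation.Propositional using (_↭_; refl; prep; swap) renaming (trans to ↭trans)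
  open import Data.Product using (∃; _×_; _,_; proj₂)
  open import Data.Sum using (_⊎_; inj₁; inj₂)
  open import Data.Empty using (⊥; ⊥-elim)
  open import Data.Unit using (⊤; tt)
  open import Relation.Nullary using (¬_; Dec; yes; no)
  open import Relation.Binary.PropositionalEquality as ≡ using (_≡_; refl; cong; cong₂; sym; trans; subst)
  open Arithmetic using (prime≥2; prime∤1)
  open Cardinality

  prime∤! : ∀ {p} → Prime p → ∀ k → k < p → ¬ p ∣ k !
  prime∤! P zero _ d = prime∤1 P d
  prime∤! P (suc k) l d with euclidsLemma (suc k) (k !) P d
  ... | inj₁ x = ℕₚ.<⇒≱ l (∣⇒≤ x)
  ... | inj₂ x = prime∤! P k (ℕₚ.<-trans (ℕₚ.n<1+n k) l) x

  prime∣C : ∀ {p} → Prime p → ∀ k → 1 ≤ k → k < p → p ∣ p C k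
  prime∣C {p} P k k≥1 k<p with euclidsLemma (p C k) (k ! ℕ.* (p ∸ k) !) P (subst (p ∣_) (sym eq) (p∣p! p (ℕₚ.≤-trans k≥1 (ℕₚ.<⇒≤ k<p))))
    where
    instance _ = k ℕₚ.!* (p ∸ k) !≢0
    eq : (p C k) ℕ.* (k ! ℕ.* (p ∸ k) !) ≡ p !
    eq = trans (cong (ℕ._* (k ! ℕ.* (p ∸ k) !)) (nCk≡n!/k![n-k]! (ℕₚ.<⇒≤ k<p))) (m/n*n≡m (k![n∸k]!∣n! (ℕₚ.<⇒≤ k<p)))
    p∣p! : ∀ p → 1 ≤ p → p ∣ p !
    p∣p! (suc p) _ = m∣m*n (p !)
  ... | inj₁ x = x
  ... | inj₂ x with euclidsLemma (k !) ((p ∸ k) !) P x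
  ... | inj₁ y = ⊥-elim (prime∤! P k k<p y)
  ... | inj₂ y = ⊥-elim (prime∤! P (p ∸ k) (ℕₚ.∸-monoʳ-< k≥1 (ℕₚ.<⇒≤ k<p)) y)

  module CharP {c ℓ} (R : CommutativeRing c ℓ) where
    open CommutativeRing R hiding (zero; _-_) renaming (sym to ≈-sym; trans to ≈-trans)
    open import Algebra.Properties.Semiring.Exp semiring using (_^_; ^-congˡ; ^-assocʳ)
    open import Algebra.Properties.Semiring.Mult semiring using (×-assocˡ) renaming (_×_ to _·_)
    open import Algebra.Properties.Semiring.Sum semiring using (sum; sum-init-last; sum-cong-≋; sum-replicate-zero)
    open import Algebra.Properties.CommutativeSemiring.Binomial commutativeSemiring using (binomialTerm; theorem)
    open import Relation.Binary.Reasoning.Setoid setoid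
    open import Data.Vec.Functional using (last; init; replicate)

    module _ (p : ℕ) (P : Prime p) (char : ∀ x → p · x ≈ 0#) where

      middle : ∀ x y k → 1 ≤ k → k < p → (p C k) · (x ^ k * y ^ (p ∸ k)) ≈ 0#
      middle x y k a b with prime∣C P k a b
      ... | divides m e = begin
        (p C k) · w ≡⟨ cong (_· w) (trans e (ℕₚ.*-comm m p)) ⟩
        (p ℕ.* m) · w ≈⟨ ×-assocˡ w p m ⟨
        p · (m · w) ≈⟨ char (m · w) ⟩
        0# ∎
        where w = x ^ k * y ^ (p ∸ k)

      frobenius-+ : ∀ x y → (x + y) ^ p ≈ x ^ p + y ^ p
      frobenius-+ x y = go p P (λ k → middle x y k) (theorem p x y)
        where
        go : ∀ p → Prime p → (∀ k → 1 ≤ k → k < p → (p C k) · (x ^ k * y ^ (p ∸ k)) ≈ 0#) →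
          (x + y) ^ p ≈ sum (binomialTerm x y p) → (x + y) ^ p ≈ x ^ p + y ^ p
        go zero P _ _ = ⊥-elim (ℕₚ.n≮0 (prime≥2 P))
        go (suc p′) P mid th = begin
          (x + y) ^ suc p′ ≈⟨ th ⟩
          f zero + sum g ≈⟨ +-cong head (sum-init-last g) ⟩
          y ^ suc p′ + (sum (init g) + last g) ≈⟨ +-congˡ (+-cong mids lasts) ⟩
          y ^ suc p′ + (0# + x ^ suc p′) ≈⟨ +-congˡ (+-identityˡ _) ⟩
          y ^ suc p′ + x ^ suc p′ ≈⟨ +-comm _ _ ⟩
          x ^ suc p′ + y ^ suc p′ ∎
          where
          f = binomialTerm x y (suc p′)
          g : Fin (suc p′) → Carrier
          g i = f (suc i)
          one· : ∀ z → 1 · z ≈ z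
          one· z = +-identityʳ z
          head : f zero ≈ y ^ suc p′
          head = ≈-trans (one· _) (*-identityˡ _)
          mids : sum (init g) ≈ 0#
          mids = ≈-trans (sum-cong-≋ {p′} {init g} {replicate p′ 0#} λ i → ≈-trans
                   (reflexive (cong (λ t → (suc p′ C t) · (x ^ t * y ^ (suc p′ ∸ t))) (cong suc (Fin.toℕ-inject₁ i))))
                   (mid (suc (toℕ i)) (s≤s z≤n) (s≤s (Fin.toℕ<n i)))) (sum-replicate-zero p′)
          lasts : last g ≈ x ^ suc p′
          lasts = begin
            last g ≡⟨ cong (λ t → (suc p′ C t) · (x ^ t * y ^ (suc p′ ∸ t))) (cong suc (Fin.toℕ-fromℕ p′)) ⟩
            (suc p′ C suc p′) · (x ^ suc p′ * y ^ (p′ ∸ p′)) ≡⟨ cong₂ (λ a b → a · (x ^ suc p′ * y ^ b)) (nCn≡1 (suc p′)) (ℕₚ.n∸n≡0 p′) ⟩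
            1 · (x ^ suc p′ * 1#) ≈⟨ one· _ ⟩
            x ^ suc p′ * 1# ≈⟨ *-identityʳ _ ⟩
            x ^ suc p′ ∎
            where open import Data.Nat.Combinatorics using (nCn≡1)

      frobenius^-+ : ∀ i x y → (x + y) ^ (p ℕ.^ i) ≈ x ^ (p ℕ.^ i) + y ^ (p ℕ.^ i)
      frobenius^-+ zero x y = ≈-trans (*-identityʳ _) (+-cong (≈-sym (*-identityʳ x)) (≈-sym (*-identityʳ y)))
      frobenius^-+ (suc i) x y = begin
        (x + y) ^ (p ℕ.* p ℕ.^ i) ≈⟨ ^-assocʳ (x + y) p (p ℕ.^ i) ⟨
        ((x + y) ^ p) ^ (p ℕ.^ i) ≈⟨ ^-congˡ (p ℕ.^ i) (frobenius-+ x y) ⟩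
        (x ^ p + y ^ p) ^ (p ℕ.^ i) ≈⟨ frobenius^-+ i (x ^ p) (y ^ p) ⟩
        (x ^ p) ^ (p ℕ.^ i) + (y ^ p) ^ (p ℕ.^ i) ≈⟨ +-cong (^-assocʳ x p (p ℕ.^ i)) (^-assocʳ y p (p ℕ.^ i)) ⟩
        x ^ (p ℕ.* p ℕ.^ i) + y ^ (p ℕ.* p ℕ.^ i) ∎

  record FinField : Set₁ where
    infixl 6 _+_
    infixl 7 _*_
    field
      F       : Set
      _+_ _*_ : F → F → F
      -_      : F → F
      0# 1#   : F
      isCommutativeRing : IsCommutativeRing _≡_ _+_ _*_ -_ 0# 1#
      1≢0     : ¬ 1# ≡ 0#
      inverse : ∀ x → ¬ x ≡ 0# → ∃ λ y → x * y ≡ 1#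
      _≟_     : (x y : F) → Dec (x ≡ y)
      order   : ℕ
      enum    : Card (λ (x : F) → ⊤) order

    ring : CommutativeRing 0ℓ 0ℓ
    ring = record { isCommutativeRing = isCommutativeRing }

  module BigOp {A : Set} {_∙_ : A → A → A} {ε : A}
    (∙-assoc : ∀ x y z → (x ∙ y) ∙ z ≡ x ∙ (y ∙ z)) (∙-comm : ∀ x y → x ∙ y ≡ y ∙ x) (∙-identityˡ : ∀ x → ε ∙ x ≡ x) where

    Big : {I : Set} → List I → (I → A) → A
    Big [] f = ε
    Big (i ∷ L) f = f i ∙ Big L f

    Big-↭ : {I : Set} {xs ys : List I} (f : I → A) → xs ↭ ys → Big xs f ≡ Big ys f
    Big-↭ f refl = refl
    Big-↭ f (prep x p) = cong (f x ∙_) (Big-↭ f p)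
    Big-↭ f (swap {xs} {ys} x y p) = trans (sym (∙-assoc (f x) (f y) _)) (trans (cong₂ _∙_ (∙-comm (f x) (f y)) (Big-↭ f p)) (∙-assoc (f y) (f x) _))
    Big-↭ f (↭trans p q) = trans (Big-↭ f p) (Big-↭ f q)

    Big-map : {I J : Set} (g : I → J) (L : List I) (f : J → A) → Big (map g L) f ≡ Big L (λ i → f (g i))
    Big-map g [] f = refl
    Big-map g (x ∷ L) f = cong (f (g x) ∙_) (Big-map g L f)

    Big-cong : {I : Set} (L : List I) {f g : I → A} → (∀ {i} → i ∈ L → f i ≡ g i) → Big L f ≡ Big L g
    Big-cong [] h = refl
    Big-cong (x ∷ L) h = cong₂ _∙_ (h (here refl)) (Big-cong L (λ z → h (there z)))

    Big-∙ : {I : Set} (L : List I) (f g : I → A) → Big L (λ i → f i ∙ g i) ≡ Big L f ∙ Big L g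
    Big-∙ [] f g = sym (∙-identityˡ ε)
    Big-∙ (x ∷ L) f g = trans (cong ((f x ∙ g x) ∙_) (Big-∙ L f g))
      (trans (∙-assoc (f x) (g x) _) (trans (cong (f x ∙_) (trans (sym (∙-assoc (g x) _ _)) (trans (cong (_∙ Big L g) (∙-comm (g x) _)) (∙-assoc _ (g x) _))))
        (sym (∙-assoc (f x) _ _))))

  module Basics (FF : FinField) where
    open FinField FF public
    open CommutativeRing ring public using (+-assoc; +-comm; +-identityˡ; +-identityʳ; *-assoc; *-comm; *-identityˡ; *-identityʳ;
      distribˡ; distribʳ; zeroˡ; zeroʳ; -‿inverseˡ; -‿inverseʳ; semiring; commutativeSemiring)
    open import Algebra.Properties.Ring (CommutativeRing.ring ring) public using (-‿distribˡ-*; -‿distribʳ-*; -0#≈0#; -‿+-comm; -‿involutive; +-cancelˡ; +-cancelʳ)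
    open import Algebra.Properties.Semiring.Exp semiring public using (_^_; ^-assocʳ)
    open import Algebra.Properties.CommutativeSemiring.Exp commutativeSemiring public using (^-distrib-*)
    open import Algebra.Properties.Semiring.Mult semiring public using (×-assocˡ; ×-assoc-*; ×1-homo-*) renaming (_×_ to _·_)

    module S = BigOp {F} {_+_} {0#} +-assoc +-comm +-identityˡ
    module Π = BigOp {F} {_*_} {1#} *-assoc *-comm *-identityˡ

    ∑ : {I : Set} → List I → (I → F) → F
    ∑ = S.Big

    infixl 6 _-_
    _-_ : F → F → F
    x - y = x + (- y)

    -‿cancel : ∀ {x y} → x - y ≡ 0# → x ≡ y
    -‿cancel {x} {y} e = trans (trans (sym (+-identityʳ x)) (trans (cong (x +_) (sym (-‿inverseˡ y))) (sym (+-assoc x (- y) y)))) (trans (cong (_+ y) e) (+-identityˡ y))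

    x-x : ∀ {x y} → x ≡ y → x - y ≡ 0#
    x-x {x} refl = -‿inverseʳ x

    *-cancelˡ : ∀ x {y z} → ¬ x ≡ 0# → x * y ≡ x * z → y ≡ z
    *-cancelˡ x {y} {z} ne e with inverse x ne
    ... | w , xw = trans (sym (lem y)) (trans (cong (w *_) e) (lem z))
      where
      lem : ∀ y → w * (x * y) ≡ y
      lem y = trans (sym (*-assoc w x y)) (trans (cong (_* y) (trans (*-comm w x) xw)) (*-identityˡ y))

    zero-product : ∀ x y → x * y ≡ 0# → x ≡ 0# ⊎ y ≡ 0#
    zero-product x y e with x ≟ 0#
    ... | yes z = inj₁ z
    ... | no z = inj₂ (*-cancelˡ x z (trans e (sym (zeroʳ x))))

    ^≢0 : ∀ x k → ¬ x ≡ 0# → ¬ x ^ k ≡ 0#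
    ^≢0 x zero ne = 1≢0
    ^≢0 x (suc k) ne e with zero-product x (x ^ k) e
    ... | inj₁ z = ne z
    ... | inj₂ z = ^≢0 x k ne z

    ∑-zero : {I : Set} (L : List I) → ∑ L (λ _ → 0#) ≡ 0#
    ∑-zero [] = refl
    ∑-zero (x ∷ L) = trans (+-identityˡ _) (∑-zero L)

    ∑-const : {I : Set} (L : List I) (y : F) → ∑ L (λ _ → y) ≡ length L · y
    ∑-const [] y = refl
    ∑-const (x ∷ L) y = cong (y +_) (∑-const L y)

    ∑-hom : {I : Set} (L : List I) (f : I → F) (h : F → F) → h 0# ≡ 0# → (∀ x y → h (x + y) ≡ h x + h y) → h (∑ L f) ≡ ∑ L (λ i → h (f i))
    ∑-hom [] f h h0 h+ = h0
    ∑-hom (x ∷ L) f h h0 h+ = trans (h+ (f x) _) (cong (h (f x) +_) (∑-hom L f h h0 h+))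

    ∑-*ˡ : {I : Set} (L : List I) (f : I → F) (a : F) → a * ∑ L f ≡ ∑ L (λ i → a * f i)
    ∑-*ˡ L f a = ∑-hom L f (a *_) (zeroʳ a) (distribˡ a)

    ∑-*ʳ : {I : Set} (L : List I) (f : I → F) (a : F) → ∑ L f * a ≡ ∑ L (λ i → f i * a)
    ∑-*ʳ L f a = ∑-hom L f (_* a) (zeroˡ a) (λ x y → distribʳ a x y)

    ∑-neg : {I : Set} (L : List I) (f : I → F) → - ∑ L f ≡ ∑ L (λ i → - f i)
    ∑-neg L f = ∑-hom L f -_ -0#≈0# (λ x y → sym (-‿+-comm x y))

    ∑-swap : {I J : Set} (L : List I) (M : List J) (f : I → J → F) → ∑ L (λ i → ∑ M (f i)) ≡ ∑ M (λ j → ∑ L (λ i → f i j))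
    ∑-swap [] M f = sym (∑-zero M)
    ∑-swap (x ∷ L) M f = trans (cong (∑ M (f x) +_) (∑-swap L M f)) (sym (S.Big-∙ M (f x) _))

    1^ : ∀ k → 1# ^ k ≡ 1#
    1^ zero = refl
    1^ (suc k) = trans (*-identityˡ _) (1^ k)

    0^ : ∀ k → 1 ≤ k → 0# ^ k ≡ 0#
    0^ (suc k) _ = zeroˡ _

    map-enum-↭ : (f : F → F) → (∀ {x y} → f x ≡ f y → x ≡ y) → elems enum ↭ map f (elems enum)
    map-enum-↭ f inj = unique-⊆-full (unique-map-on (λ _ _ → inj) (uniq enum)) (λ _ → complete enum tt)
      (ℕₚ.≤-reflexive (sym (Data.List.Properties.length-map f (elems enum))))
      where import Data.List.Properties

    order·x≡0 : ∀ y → order · y ≡ 0#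
    order·x≡0 y = +-cancelˡ (∑ E (λ x → x)) _ _ (sym (begin
      ∑ E (λ x → x) + 0# ≡⟨ +-identityʳ _ ⟩
      ∑ E (λ x → x) ≡⟨ S.Big-↭ (λ x → x) (map-enum-↭ (_+ y) (λ e → +-cancelʳ y _ _ e)) ⟩
      ∑ (map (_+ y) E) (λ x → x) ≡⟨ S.Big-map (_+ y) E (λ x → x) ⟩
      ∑ E (_+ y) ≡⟨ S.Big-∙ E (λ x → x) (λ _ → y) ⟩
      ∑ E (λ x → x) + ∑ E (λ _ → y) ≡⟨ cong (∑ E (λ x → x) +_) (trans (∑-const E y) (cong (_· y) (size enum))) ⟩
      ∑ E (λ x → x) + order · y ∎))
      where
      open ≡.≡-Reasoning
      E = elems enum

    nonzero : ∃ λ k → Card (λ x → ⊤ × ¬ x ≡ 0#) k × 1 ℕ.+ k ≡ order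
    nonzero = card-minus (λ _ → tt) (_≟ 0#) enum (card-one 0#)

    Π-nonzero : {I : Set} (L : List I) (f : I → F) → (∀ {i} → i ∈ L → ¬ f i ≡ 0#) → ¬ Π.Big L f ≡ 0#
    Π-nonzero [] f h = 1≢0
    Π-nonzero (x ∷ L) f h e with zero-product (f x) _ e
    ... | inj₁ z = h (here refl) z
    ... | inj₂ z = Π-nonzero L f (λ w → h (there w)) z

    Π-const : {I : Set} (L : List I) (y : F) → Π.Big L (λ _ → y) ≡ y ^ length L
    Π-const [] y = refl
    Π-const (x ∷ L) y = cong (y *_) (Π-const L y)

    x^order : ∀ x → x ^ order ≡ x
    x^order x with x ≟ 0# | nonzero
    ... | yes refl | k , _ , e = trans (0^ order (subst (1 ≤_) e (s≤s z≤n))) refl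
    ... | no ne | k , c , e = subst (λ n → x ^ n ≡ x) e (trans (cong (x *_) xk) (*-identityʳ x))
      where
      E = elems c
      perm : E ↭ map (x *_) E
      perm = unique-⊆-full (unique-map-on (λ _ _ → *-cancelˡ x ne) (uniq c))
        (λ y∈ → let (z , z∈ , eq) = ∈-map⁻ (x *_) y∈ in complete c (tt , λ y0 →
           case (zero-product x z (trans (sym eq) y0)) (proj₂ (sound c z∈))))
        (ℕₚ.≤-reflexive (sym (Data.List.Properties.length-map (x *_) E)))
        where
        import Data.List.Properties
        case : ∀ {z} → x ≡ 0# ⊎ z ≡ 0# → ¬ z ≡ 0# → ⊥
        case (inj₁ a) _ = ne a
        case (inj₂ a) b = b a
      Q = Π.Big E (λ y → y)
      xk : x ^ k ≡ 1#
      xk = *-cancelˡ Q (Π-nonzero E (λ y → y) (λ z → proj₂ (sound c z))) (begin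
        Q * x ^ k ≡⟨ *-comm Q _ ⟩
        x ^ k * Q ≡⟨ cong (λ n → x ^ n * Q) (size c) ⟨
        x ^ length E * Q ≡⟨ cong (_* Q) (Π-const E x) ⟨
        Π.Big E (λ _ → x) * Q ≡⟨ Π.Big-∙ E (λ _ → x) (λ y → y) ⟨
        Π.Big E (x *_) ≡⟨ Π.Big-map (x *_) E (λ y → y) ⟨
        Π.Big (map (x *_) E) (λ y → y) ≡⟨ Π.Big-↭ (λ y → y) perm ⟨
        Q ≡⟨ *-identityʳ Q ⟨
        Q * 1# ∎)
        where open ≡.≡-Reasoning

    power-·1 : ∀ p k → (p ℕ.^ k) · 1# ≡ (p · 1#) ^ k
    power-·1 p zero = +-identityʳ 1#
    power-·1 p (suc k) = trans (×1-homo-* p (p ℕ.^ k)) (cong ((p · 1#) *_) (power-·1 p k))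

    characteristic : ∀ p k → order ≡ p ℕ.^ k → ∀ x → p · x ≡ 0#
    characteristic p k e x with (p · 1#) ≟ 0#
    ... | yes z = trans (cong (p ·_) (sym (*-identityˡ x))) (trans (sym (×-assoc-* p 1# x)) (trans (cong (_* x) z) (zeroˡ x)))
    ... | no z = ⊥-elim (^≢0 (p · 1#) k z (trans (sym (power-·1 p k)) (trans (cong (_· 1#) (sym e)) (order·x≡0 1#))))

    nonzero-characteristic : ∀ p m → Prime p → (∀ x → p · x ≡ 0#) → ¬ p ∣ m → ¬ m · 1# ≡ 0#
    nonzero-characteristic p m P char h z with coprime-Bézout (prime-coprime P h)
      where
      open import Data.Nat.Coprimality using (coprime-Bézout)
      open Arithmetic using (prime-coprime)
    ... | Bézout.Identity.+- x y e = 1≢0 (begin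
        1# ≡⟨ +-identityʳ 1# ⟨
        1# + 0# ≡⟨ cong (1# +_) (mult y m z) ⟨
        1# + (y ℕ.* m) · 1# ≡⟨⟩
        (1 ℕ.+ y ℕ.* m) · 1# ≡⟨ cong (_· 1#) e ⟩
        (x ℕ.* p) · 1# ≡⟨ mult x p (char 1#) ⟩
        0# ∎)
      where
      open ≡.≡-Reasoning
      mult : ∀ a b → b · 1# ≡ 0# → (a ℕ.* b) · 1# ≡ 0#
      mult a b e = trans (×1-homo-* a b) (trans (cong ((a · 1#) *_) e) (zeroʳ _))
    ... | Bézout.Identity.-+ x y e = 1≢0 (begin
        1# ≡⟨ +-identityʳ 1# ⟨
        1# + 0# ≡⟨ cong (1# +_) (mult x p (char 1#)) ⟨
        (1 ℕ.+ x ℕ.* p) · 1# ≡⟨ cong (_· 1#) e ⟩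
        (y ℕ.* m) · 1# ≡⟨ mult y m z ⟩
        0# ∎)
      where
      open ≡.≡-Reasoning
      mult : ∀ a b → b · 1# ≡ 0# → (a ℕ.* b) · 1# ≡ 0#
      mult a b e = trans (×1-homo-* a b) (trans (cong ((a · 1#) *_) e) (zeroʳ _))

module RootBound where

  open import Algebra.Bundles using (CommutativeRing)
  open import Data.Nat as ℕ using (ℕ; zero; suc; _≤_; s≤s)
  import Data.Nat.Properties as ℕₚ
  open import Data.List using (List; []; _∷_; length; _++_; replicate)
  open import Data.List.Properties using (length-++; length-replicate)
  open import Data.List.Relation.Unary.All as All using (All; []; _∷_)
  import Data.List.Relation.Unary.All.Properties as AllP
  open import Data.List.Relation.Unary.AllPairs using (AllPairs; []; _∷_)
  open import Relation.Binary.PropositionalEquality as ≡ using (_≡_; cong)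

  module Poly {c ℓ} (R : CommutativeRing c ℓ) where
    open CommutativeRing R hiding (zero)
    open import Algebra.Properties.Semiring.Exp semiring using (_^_)
    open import Algebra.Properties.Ring (CommutativeRing.ring R) using (-‿distribʳ-*)
    open import Relation.Binary.Reasoning.Setoid setoid

    eval : List Carrier → Carrier → Carrier
    eval [] x = 0#
    eval (a ∷ as) x = a + x * eval as x

    quot : Carrier → List Carrier → List Carrier
    quot x [] = []
    quot x (a ∷ []) = []
    quot x (a ∷ as@(_ ∷ _)) = eval as x ∷ quot x as

    quot-length : ∀ x a as → length (quot x (a ∷ as)) ≡ length as
    quot-length x a [] = ≡.refl
    quot-length x a (b ∷ as) = cong suc (quot-length x b as)

    quot-eval : ∀ x as y → eval as y ≈ (y - x) * eval (quot x as) y + eval as x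
    quot-eval x [] y = sym (trans (+-identityʳ _) (zeroʳ _))
    quot-eval x (a ∷ []) y = begin
      a + y * 0# ≈⟨ +-congˡ (trans (zeroʳ y) (sym (zeroʳ x))) ⟩
      a + x * 0# ≈⟨ +-identityˡ _ ⟨
      0# + (a + x * 0#) ≈⟨ +-congʳ (zeroʳ (y - x)) ⟨
      (y - x) * 0# + (a + x * 0#) ∎
    quot-eval x (a ∷ as@(_ ∷ _)) y = begin
      a + y * eval as y ≈⟨ +-congˡ (*-congˡ (quot-eval x as y)) ⟩
      a + y * (d * Q + E) ≈⟨ +-congˡ (distribˡ y _ _) ⟩
      a + (y * (d * Q) + y * E) ≈⟨ +-congˡ (+-congˡ yE) ⟩
      a + (y * (d * Q) + (d * E + x * E)) ≈⟨ +-congˡ (+-assoc _ _ _) ⟨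
      a + ((y * (d * Q) + d * E) + x * E) ≈⟨ +-congˡ (+-congʳ (+-congʳ (trans (sym (*-assoc y d Q)) (trans (*-congʳ (*-comm y d)) (*-assoc d y Q))))) ⟩
      a + ((d * (y * Q) + d * E) + x * E) ≈⟨ +-congˡ (+-congʳ (trans (sym (distribˡ d _ _)) (*-congˡ (+-comm _ _)))) ⟩
      a + (d * (E + y * Q) + x * E) ≈⟨ trans (sym (+-assoc _ _ _)) (trans (+-congʳ (+-comm _ _)) (+-assoc _ _ _)) ⟩
      d * (E + y * Q) + (a + x * E) ∎
      where
      d = y - x
      Q = eval (quot x as) y
      E = eval as x
      yE : y * E ≈ d * E + x * E
      yE = trans (*-congʳ (trans (sym (+-identityʳ y)) (trans (+-congˡ (sym (-‿inverseˡ x))) (sym (+-assoc y _ x))))) (distribʳ E d x)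

    module _ {i} (I : Carrier → Set i) (I0 : I 0#) (I+ : ∀ {x y} → I x → I y → I (x + y)) (I* : ∀ {y} x → I y → I (x * y)) where

      eval-I : ∀ as x → All I as → I (eval as x)
      eval-I [] x [] = I0
      eval-I (a ∷ as) x (p ∷ ps) = I+ p (I* x (eval-I as x ps))

      quot-I : ∀ x as → All I as → All I (quot x as)
      quot-I x [] _ = []
      quot-I x (a ∷ []) _ = []
      quot-I x (a ∷ as@(_ ∷ _)) (_ ∷ ps) = eval-I as x ps ∷ quot-I x as ps

      Cancellable : Carrier → Carrier → Set _
      Cancellable x y = ∀ z → I z → (y - x) * z ≈ 0# → z ≈ 0#

      quot-zero : ∀ x as → All (_≈ 0#) (quot x as) → eval as x ≈ 0# → All (_≈ 0#) as
      quot-zero x [] _ _ = []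
      quot-zero x (a ∷ []) _ e = trans (sym (trans (+-congˡ (zeroʳ x)) (+-identityʳ a))) e ∷ []
      quot-zero x (a ∷ as@(_ ∷ _)) (h ∷ hs) e =
        trans (sym (trans (+-congˡ (trans (*-congˡ h) (zeroʳ x))) (+-identityʳ a))) e ∷ quot-zero x as hs h

      roots⇒zero : ∀ xs as → length as ≤ length xs → AllPairs Cancellable xs → All I as →
        All (λ x → eval as x ≈ 0#) xs → All (_≈ 0#) as
      roots⇒zero xs [] _ _ _ _ = []
      roots⇒zero (x ∷ xs) (a ∷ as) (s≤s l) (c ∷ cs) is (r ∷ rs) =
        quot-zero x (a ∷ as) (roots⇒zero xs (quot x (a ∷ as)) (≡.subst (_≤ length xs) (≡.sym (quot-length x a as)) l) cs
          (quot-I x (a ∷ as) is) (go c rs)) r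
        where
        go : ∀ {ys} → All (Cancellable x) ys → All (λ y → eval (a ∷ as) y ≈ 0#) ys → All (λ y → eval (quot x (a ∷ as)) y ≈ 0#) ys
        go [] [] = []
        go {y ∷ _} (k ∷ ks) (e ∷ es) = k _ (eval-I (quot x (a ∷ as)) y (quot-I x (a ∷ as) is))
          (trans (sym (trans (+-congˡ r) (+-identityʳ _))) (trans (sym (quot-eval x (a ∷ as) y)) e)) ∷ go ks es

    eval-shift : ∀ k as x → eval (replicate k 0# ++ as) x ≈ x ^ k * eval as x
    eval-shift zero as x = sym (*-identityˡ _)
    eval-shift (suc k) as x = begin
      0# + x * eval (replicate k 0# ++ as) x ≈⟨ +-identityˡ _ ⟩
      x * eval (replicate k 0# ++ as) x ≈⟨ *-congˡ (eval-shift k as x) ⟩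
      x * (x ^ k * eval as x) ≈⟨ *-assoc _ _ _ ⟨
      x ^ suc k * eval as x ∎

    -- a (T^(m + 2) − T)
    trinomial : ℕ → Carrier → List Carrier
    trinomial m a = 0# ∷ (- a) ∷ (replicate m 0# ++ a ∷ [])

    trinomial-length : ∀ m a → length (trinomial m a) ≡ suc (suc (suc m))
    trinomial-length m a = cong (λ k → suc (suc k)) (≡.trans (length-++ (replicate m 0#)) (≡.trans (cong (ℕ._+ 1) (length-replicate m)) (ℕₚ.+-comm m 1)))

    trinomial-eval : ∀ m a x → x ^ suc (suc m) * a ≈ x * a → eval (trinomial m a) x ≈ 0#
    trinomial-eval m a x e = begin
      0# + x * (- a + x * eval (replicate m 0# ++ a ∷ []) x) ≈⟨ +-identityˡ _ ⟩
      x * (- a + x * eval (replicate m 0# ++ a ∷ []) x) ≈⟨ distribˡ x _ _ ⟩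
      x * - a + x * (x * eval (replicate m 0# ++ a ∷ []) x) ≈⟨ +-cong (sym (-‿distribʳ-* x a)) (*-congˡ (*-congˡ (trans (eval-shift m (a ∷ []) x) (*-congˡ (trans (+-congˡ (zeroʳ x)) (+-identityʳ a)))))) ⟩
      - (x * a) + x * (x * (x ^ m * a)) ≈⟨ +-congˡ (trans (*-congˡ (sym (*-assoc _ _ _))) (sym (*-assoc _ _ _))) ⟩
      - (x * a) + x ^ suc (suc m) * a ≈⟨ +-congˡ e ⟩
      - (x * a) + x * a ≈⟨ -‿inverseˡ _ ⟩
      0# ∎

    trinomial-last : ∀ {p} {P : Carrier → Set p} m a → All P (trinomial m a) → P a
    trinomial-last m a (_ ∷ _ ∷ ps) with AllP.++⁻ʳ (replicate m 0#) ps
    ... | z ∷ [] = z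

    -- 1 + T^(z+1) + T^(2(z+1)) + …, j + 1 terms
    geometric : ℕ → ℕ → List Carrier
    geometric z zero = 1# ∷ []
    geometric z (suc j) = 1# ∷ (replicate z 0# ++ geometric z j)

    geometric-length : ∀ z j → length (geometric z j) ≡ suc (j ℕ.* suc z)
    geometric-length z zero = ≡.refl
    geometric-length z (suc j) = cong suc (≡.trans (length-++ (replicate z 0#)) (≡.trans (≡.cong₂ ℕ._+_ (length-replicate z) (geometric-length z j)) (ℕₚ.+-suc z (j ℕ.* suc z))))

    geometric-eval : ∀ z j x → (x ^ suc z - 1#) * eval (geometric z j) x ≈ (x ^ suc z) ^ suc j - 1#
    geometric-eval z zero x = trans (*-congˡ (trans (+-congˡ (zeroʳ x)) (+-identityʳ 1#))) (trans (*-identityʳ _) (+-congʳ (sym (*-identityʳ _))))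
    geometric-eval z (suc j) x = begin
      (X - 1#) * (1# + x * eval (replicate z 0# ++ geometric z j) x) ≈⟨ *-congˡ (+-congˡ (trans (*-congˡ (eval-shift z (geometric z j) x)) (sym (*-assoc _ _ _)))) ⟩
      (X - 1#) * (1# + X * G) ≈⟨ distribˡ _ _ _ ⟩
      (X - 1#) * 1# + (X - 1#) * (X * G) ≈⟨ +-cong (*-identityʳ _) (trans (sym (*-assoc _ _ _)) (trans (*-congʳ (*-comm _ _)) (*-assoc _ _ _))) ⟩
      (X - 1#) + X * ((X - 1#) * G) ≈⟨ +-congˡ (*-congˡ (geometric-eval z j x)) ⟩
      (X - 1#) + X * (X ^ suc j - 1#) ≈⟨ +-congˡ (trans (distribˡ _ _ _) (+-congˡ (trans (sym (-‿distribʳ-* X 1#)) (-‿cong (*-identityʳ X))))) ⟩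
      (X - 1#) + (X ^ suc (suc j) - X) ≈⟨ +-comm _ _ ⟩
      (X ^ suc (suc j) - X) + (X - 1#) ≈⟨ trans (+-assoc _ _ _) (+-congˡ (trans (sym (+-assoc _ _ _)) (trans (+-congʳ (-‿inverseˡ X)) (+-identityˡ _)))) ⟩
      X ^ suc (suc j) - 1# ∎
      where
      X = x ^ suc z
      G = eval (geometric z j) x

module TwistedGroupRing where

  open import Level using (0ℓ)
  open import Algebra.Bundles using (CommutativeRing)
  open import Data.Nat as ℕ using (ℕ; zero; suc; _≤_; _<_; z≤n; s≤s; _∸_; pred; NonZero; >-nonZero)
  import Data.Nat.Properties as ℕₚ
  open import Data.Nat.Divisibility using (_∣_; divides; ∣⇒≤; ∣-trans; m∣m*n)
  open import Data.Nat.GCD using (gcd; gcd-GCD; module Bézout)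
  open import Data.Nat.Primality using (Prime; prime⇒nonZero)
  open import Data.List using (List; []; _∷_; length; downFrom; map)
  open import Data.List.Membership.Propositional using (_∈_; find; lose)
  open import Data.List.Membership.Propositional.Properties using (∈-downFrom⁻; ∈-downFrom⁺)
  open import Data.List.Relation.Unary.Any as Any using (here; there; Any)
  open import Data.List.Relation.Unary.All as All using (All; []; _∷_)
  open import Data.List.Relation.Unary.AllPairs as AllPairs using (AllPairs; []; _∷_)
  open import Data.List.Relation.Unary.Unique.Propositional using (Unique)
  open import Data.Product using (_,_; proj₂; Σ; ∃; _×_; proj₁)
  open import Data.Sum using (_⊎_; inj₁; inj₂)
  open import Data.Empty using (⊥-elim; ⊥)
  open import Data.Unit using (⊤; tt)
  open import Relation.Nullary using (¬_; yes; no; Dec)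
  open import Relation.Binary.PropositionalEquality
  open import Data.Nat.DivMod using (_%_; _/_; m≡m%n+[m/n]*n; m%n<n; m<n⇒m%n≡m; [m+kn]%n≡m%n)
  open import Data.Nat.Coprimality using (Coprime; coprime-divisor)
  open import Data.Nat.Tactic.RingSolver using (solve-∀)
  import Data.List.Relation.Unary.Unique.Propositional.Properties as Uniq
  open import Data.List.Properties using (length-map)
  import Data.List.Relation.Unary.All.Properties as AllP
  import Data.List.Relation.Unary.AllPairs.Properties as APP
  open import Data.Vec as Vec using (Vec; []; _∷_)
  import Data.Vec.Relation.Unary.All as VAll
  open import Relation.Nullary.Decidable using (_×-dec_; ¬?; map′)
  open Arithmetic using (prime≥2; ∣⇒≥1; ^-geo; geo; One; One-^; Cong)
  open Cardinality
  open FiniteFields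
  open RootBound
  open Orders using (%≡⇒∣∸; pos; one; ordSpec)
  open import Defs using (ord)

  record Extension : Set₁ where
    constructor extension
    field
      FF : FinField
      p e n : ℕ
      P : Prime p
      e≥1 : 1 ≤ e
      n≥1 : 1 ≤ n
      q : ℕ
      q≡ : q ≡ p ℕ.^ e
      order≡ : FinField.order FF ≡ q ℕ.^ n


  module Setting (Ω : Extension) where

    open Extension Ω public
    open Basics FF public

    module Pol = Poly ring

    instance
      q-nonZero : NonZero q
      q-nonZero = subst NonZero (sym q≡) (ℕₚ.m^n≢0 p e {{prime⇒nonZero P}})

    q≥2 : 2 ≤ q
    q≥2 = subst (2 ≤_) (sym q≡) (ℕₚ.≤-trans (prime≥2 P) (ℕₚ.≤-trans (ℕₚ.≤-reflexive (sym (ℕₚ.*-identityʳ p))) (ℕₚ.^-monoʳ-≤ p {{prime⇒nonZero P}} e≥1)))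

    q^≥2 : ∀ d → 1 ≤ d → 2 ≤ q ℕ.^ d
    q^≥2 d h = ℕₚ.≤-trans q≥2 (ℕₚ.≤-trans (ℕₚ.≤-reflexive (sym (ℕₚ.*-identityʳ q))) (ℕₚ.^-monoʳ-≤ q h))

    char : ∀ x → p · x ≡ 0#
    char = characteristic p (e ℕ.* n) (trans order≡ (trans (cong (ℕ._^ n) q≡) (ℕₚ.^-*-assoc p e n)))

    q^≡ : ∀ i → q ℕ.^ i ≡ p ℕ.^ (e ℕ.* i)
    q^≡ i = trans (cong (ℕ._^ i) q≡) (ℕₚ.^-*-assoc p e i)

    abstract
      S : ℕ → F → F
      S i x = x ^ (q ℕ.^ i)

      S-def : ∀ i x → S i x ≡ x ^ (q ℕ.^ i)
      S-def i x = refl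

      S-0 : ∀ x → S 0 x ≡ x
      S-0 x = *-identityʳ x

      S-+ : ∀ i j x → S (i ℕ.+ j) x ≡ S i (S j x)
      S-+ i j x = trans (cong (x ^_) (trans (ℕₚ.^-distribˡ-+-* q i j) (ℕₚ.*-comm (q ℕ.^ i) _))) (sym (^-assocʳ x (q ℕ.^ j) (q ℕ.^ i)))

      S-add : ∀ i x y → S i (x + y) ≡ S i x + S i y
      S-add i x y = subst (λ m → (x + y) ^ m ≡ x ^ m + y ^ m) (sym (q^≡ i)) (CharP.frobenius^-+ ring p P char (e ℕ.* i) x y)

      S-mul : ∀ i x y → S i (x * y) ≡ S i x * S i y
      S-mul i x y = ^-distrib-* x y (q ℕ.^ i)

      S-n : ∀ x → S n x ≡ x
      S-n x = subst (λ m → x ^ m ≡ x) order≡ (x^order x)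

      S-0# : ∀ i → S i 0# ≡ 0#
      S-0# i = 0^ (q ℕ.^ i) (ℕₚ.m^n>0 q i)

      S-1# : ∀ i → S i 1# ≡ 1#
      S-1# i = 1^ (q ℕ.^ i)

    S-neg : ∀ i x → S i (- x) ≡ - S i x
    S-neg i x = -‿cancel (trans (cong (S i (- x) +_) (-‿involutive (S i x))) (trans (sym (S-add i (- x) x)) (trans (cong (S i) (-‿inverseˡ x)) (S-0# i))))

    S-*n : ∀ k x → S (k ℕ.* n) x ≡ x
    S-*n zero x = S-0 x
    S-*n (suc k) x = trans (S-+ n (k ℕ.* n) x) (trans (S-n _) (S-*n k x))

    S-comm : ∀ i j x → S i (S j x) ≡ S j (S i x)
    S-comm i j x = trans (sym (S-+ i j x)) (trans (cong (λ k → S k x) (ℕₚ.+-comm i j)) (S-+ j i x))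

    S-inverse : ∀ i x → S ((n ∸ 1) ℕ.* i) (S i x) ≡ x
    S-inverse i x = trans (sym (S-+ ((n ∸ 1) ℕ.* i) i x)) (trans (cong (λ k → S k x) eq) (S-*n i x))
      where
      eq : (n ∸ 1) ℕ.* i ℕ.+ i ≡ i ℕ.* n
      eq = trans (ℕₚ.+-comm _ i) (trans (cong (ℕ._* i) (ℕₚ.m+[n∸m]≡n n≥1)) (ℕₚ.*-comm n i))

    S-inj : ∀ i {x y} → S i x ≡ S i y → x ≡ y
    S-inj i {x} {y} h = trans (sym (S-inverse i x)) (trans (cong (S ((n ∸ 1) ℕ.* i)) h) (S-inverse i y))

    Fix : ℕ → F → Set
    Fix i x = S i x ≡ x

    Fix-* : ∀ i k {x} → Fix i x → Fix (k ℕ.* i) x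
    Fix-* i zero {x} h = S-0 x
    Fix-* i (suc k) {x} h = trans (S-+ i (k ℕ.* i) x) (trans (cong (S i) (Fix-* i k h)) h)

    Fix-∣ : ∀ {i j x} → i ∣ j → Fix i x → Fix j x
    Fix-∣ {i} (divides k refl) h = Fix-* i k h

    Fix-gcd : ∀ i j {x} → Fix i x → Fix j x → Fix (gcd i j) x
    Fix-gcd i j {x} h h′ with Bézout.identity (gcd-GCD i j)
    ... | Bézout.Identity.+- a b eq = trans (cong (S (gcd i j)) (sym (Fix-* j b h′))) (trans (sym (S-+ (gcd i j) (b ℕ.* j) x)) (trans (cong (λ k → S k x) eq) (Fix-* i a h)))
    ... | Bézout.Identity.-+ a b eq = trans (cong (S (gcd i j)) (sym (Fix-* i a h))) (trans (sym (S-+ (gcd i j) (a ℕ.* i) x)) (trans (cong (λ k → S k x) eq) (Fix-* j b h′)))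

    Fix-+ : ∀ {i x y} → Fix i x → Fix i y → Fix i (x + y)
    Fix-+ {i} h h′ = trans (S-add i _ _) (cong₂ _+_ h h′)

    Fix-mul : ∀ {i x y} → Fix i x → Fix i y → Fix i (x * y)
    Fix-mul {i} h h′ = trans (S-mul i _ _) (cong₂ _*_ h h′)

    Fix-neg : ∀ {i x} → Fix i x → Fix i (- x)
    Fix-neg {i} h = trans (S-neg i _) (cong -_ h)

    Fix-S : ∀ {i x} j → Fix i x → Fix i (S j x)
    Fix-S {i} {x} j h = trans (S-comm i j x) (cong (S j) h)

    Fix-inv : ∀ {i x y} → ¬ x ≡ 0# → x * y ≡ 1# → Fix i x → Fix i y
    Fix-inv {i} {x} {y} ne xy h = *-cancelˡ x ne (trans (trans (cong (_* S i y) (sym h)) (trans (sym (S-mul i x y)) (trans (cong (S i) xy) (S-1# i)))) (sym xy))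

    Fix-·1 : ∀ i m → Fix i (m · 1#)
    Fix-·1 i zero = S-0# i
    Fix-·1 i (suc m) = Fix-+ (S-1# i) (Fix-·1 i m)

    Fix-∑ : ∀ {i} {I : Set} (L : List I) (f : I → F) → (∀ {j} → j ∈ L → Fix i (f j)) → Fix i (∑ L f)
    Fix-∑ {i} [] f h = S-0# i
    Fix-∑ (x ∷ L) f h = Fix-+ (h (here refl)) (Fix-∑ L f (λ z → h (there z)))

    S-∑ : ∀ i {I : Set} (L : List I) (f : I → F) → S i (∑ L f) ≡ ∑ L (λ j → S i (f j))
    S-∑ i L f = ∑-hom L f (S i) (S-0# i) (S-add i)

    roots : ∀ {xs as} → Unique xs → All (λ x → Pol.eval as x ≡ 0#) xs → length as ≤ length xs → All (_≡ 0#) as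
    roots {xs} {as} u r l = Pol.roots⇒zero (λ _ → ⊤) tt (λ _ _ → tt) (λ _ _ → tt) xs as l
      (AllPairs.map (λ {x} {y} ne z _ eq → case x y z ne (zero-product _ z eq)) u) (All.tabulate (λ _ → tt)) r
      where
      case : ∀ x y z → ¬ x ≡ y → y - x ≡ 0# ⊎ z ≡ 0# → z ≡ 0#
      case x y z ne (inj₁ h) = ⊥-elim (ne (sym (-‿cancel h)))
      case x y z ne (inj₂ h) = h

    card-Fix-≤ : ∀ d → 1 ≤ d → ∀ {k} → Card (Fix d) k → k ≤ q ℕ.^ d
    card-Fix-≤ d d≥1 {k} c = go (q ℕ.^ d) refl (q^≥2 d d≥1)
      where
      go : ∀ m → q ℕ.^ d ≡ m → 2 ≤ m → k ≤ m
      go (suc (suc m)) eq (s≤s (s≤s _)) = ℕₚ.≮⇒≥ λ lt → 1≢0 (Pol.trinomial-last m 1#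
        (roots {elems c} {Pol.trinomial m 1#} (uniq c)
          (All.tabulate (λ {x} x∈ → Pol.trinomial-eval m 1# x (cong (_* 1#) (trans (trans (cong (x ^_) (sym eq)) (sym (S-def d x))) (sound c x∈)))))
          (subst₂ _≤_ (sym (Pol.trinomial-length m 1#)) (sym (size c)) lt)))

    card-Fix : ∀ d → d ∣ n → Card (Fix d) (q ℕ.^ d)
    card-Fix d d∣n@(divides N n≡) with card-filter (λ x → S d x ≟ x) enum
    ... | k , c with card-minus (λ _ → tt) (λ x → S d x ≟ x) enum (card-cong proj₂ (tt ,_) c)
    ... | k′ , c′ , k+k′ = subst (Card (Fix d)) (ℕₚ.≤-antisym (card-Fix-≤ d d≥1 cF) lower) cF
      where
      d≥1 = ∣⇒≥1 n≥1 d∣n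
      cF : Card (Fix d) k
      cF = card-cong proj₂ (tt ,_) c
      z = pred (q ℕ.^ d)
      Q≡ : q ℕ.^ d ≡ suc z
      Q≡ = sym (ℕₚ.suc-pred (q ℕ.^ d) {{ℕₚ.m^n≢0 q d}})
      z≥1 : 1 ≤ z
      z≥1 = ℕₚ.≤-pred (subst (2 ≤_) Q≡ (q^≥2 d d≥1))
      M = geo z N
      qn≡ : q ℕ.^ n ≡ suc (z ℕ.* M)
      qn≡ = trans (cong (q ℕ.^_) (trans n≡ (ℕₚ.*-comm N d))) (trans (sym (ℕₚ.^-*-assoc q d N)) (trans (cong (ℕ._^ N) Q≡) (^-geo z N)))
      M≥1 : 1 ≤ M
      M≥1 with M | qn≡
      ... | suc _ | _ = s≤s z≤n
      ... | zero | e0 = ⊥-elim (ℕₚ.<⇒≢ (q^≥2 n n≥1) (sym (trans e0 (cong suc (ℕₚ.*-zeroʳ z)))))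
      lower : q ℕ.^ d ≤ k
      lower = go z refl M refl z≥1 M≥1
        where
        go : ∀ z′ → z ≡ z′ → ∀ M′ → M ≡ M′ → 1 ≤ z′ → 1 ≤ M′ → q ℕ.^ d ≤ k
        go (suc z′) ez (suc j) eM _ _ = ℕₚ.+-cancelʳ-≤ (j ℕ.* suc z′) (q ℕ.^ d) k (begin
           q ℕ.^ d ℕ.+ j ℕ.* suc z′ ≡⟨ cong (ℕ._+ j ℕ.* suc z′) (trans Q≡ (cong suc ez)) ⟩
           suc (suc j ℕ.* suc z′) ≡⟨ cong suc (ℕₚ.*-comm (suc j) (suc z′)) ⟩
           suc (suc z′ ℕ.* suc j) ≡⟨ cong suc (cong₂ ℕ._*_ (sym ez) (sym eM)) ⟩
           suc (z ℕ.* M) ≡⟨ trans (sym qn≡) (sym order≡) ⟩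
           order ≡⟨ k+k′ ⟨
           k ℕ.+ k′ ≤⟨ ℕₚ.+-monoʳ-≤ k bound ⟩
           k ℕ.+ j ℕ.* suc z′ ∎)
          where
          open ℕₚ.≤-Reasoning
          root : ∀ x → ¬ Fix d x → Pol.eval (Pol.geometric z′ j) x ≡ 0#
          root x nf = *-cancelˡ (x ^ suc z′ - 1#) (λ h → nf (trans (S-def d x) (trans (cong (x ^_) (trans Q≡ (cong suc ez)))
                (trans (cong (x *_) (-‿cancel h)) (*-identityʳ x)))))
              (trans (trans (Pol.geometric-eval z′ j x) (x-x xM)) (sym (zeroʳ _)))
            where
            x≢0 : ¬ x ≡ 0#
            x≢0 refl = nf (S-0# d)
            xM : (x ^ suc z′) ^ suc j ≡ 1#
            xM = trans (^-assocʳ x (suc z′) (suc j)) (*-cancelˡ x x≢0 (trans (trans (cong (x ^_) (sym (trans (trans order≡ qn≡) (cong suc (cong₂ ℕ._*_ ez eM))))) (x^order x)) (sym (*-identityʳ x))))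
          bound : k′ ≤ j ℕ.* suc z′
          bound = ℕₚ.≮⇒≥ λ lt → 1≢0 (All.head (head1 z′ j (roots {elems c′} {Pol.geometric z′ j} (uniq c′)
             (All.tabulate (λ {x} x∈ → root x (proj₂ (sound c′ x∈)))) (subst₂ _≤_ (sym (Pol.geometric-length z′ j)) (sym (size c′)) lt))))
            where
            head1 : ∀ z j → All (_≡ 0#) (Pol.geometric z j) → All (_≡ 0#) (1# ∷ [])
            head1 z zero h = h
            head1 z (suc j) (h ∷ _) = h ∷ []

    not-identity : ∀ i → 1 ≤ i → i < n → ¬ (∀ x → S i x ≡ x)
    not-identity i i≥1 i<n h = ℕₚ.<⇒≱ (ℕₚ.^-monoʳ-< q q≥2 i<n)
      (card-Fix-≤ i i≥1 (subst (Card (Fix i)) order≡ (card-cong (λ _ → h _) (λ _ → tt) enum)))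

    independence : ∀ t N → N ℕ.* t ≡ n → ∀ m → m ≤ N → (c : ℕ → F) →
      (∀ x → ∑ (downFrom m) (λ j → c j * S (t ℕ.* j) x) ≡ 0#) → ∀ j → j < m → c j ≡ 0#
    independence t N Nt≡n (suc m) m<N c h j j<m = go (ℕₚ.m≤n⇒m<n∨m≡n (ℕₚ.≤-pred j<m))
      where
      L = downFrom m
      t≥1 : 1 ≤ t
      t≥1 = ∣⇒≥1 n≥1 (divides N (sym Nt≡n))
      rel : ∀ y x → ∑ L (λ j → c j * (S (t ℕ.* j) y - S (t ℕ.* m) y) * S (t ℕ.* j) x) ≡ 0#
      rel y x = trans (S.Big-cong L (λ {j} _ → term j)) (trans (S.Big-∙ L (λ j → c j * S (t ℕ.* j) (y * x)) (λ j → - (Y * (c j * S (t ℕ.* j) x))))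
         (trans (cong₂ _+_ (top (y * x)) (trans (sym (∑-neg L _)) (cong -_ (trans (sym (∑-*ˡ L _ Y)) (cong (Y *_) (top x))))))
          (trans (cong (λ w → - (c m * w) + - (Y * - (c m * S (t ℕ.* m) x))) (S-mul (t ℕ.* m) y x)) fin)))
        where
        Y = S (t ℕ.* m) y
        top : ∀ x → ∑ L (λ j → c j * S (t ℕ.* j) x) ≡ - (c m * S (t ℕ.* m) x)
        top x = -‿cancel (trans (cong (∑ L (λ j → c j * S (t ℕ.* j) x) +_) (-‿involutive _)) (trans (+-comm _ _) (h x)))
        fin : - (c m * (Y * S (t ℕ.* m) x)) + - (Y * - (c m * S (t ℕ.* m) x)) ≡ 0#
        fin = trans (cong (- (c m * (Y * S (t ℕ.* m) x)) +_) (trans (cong -_ (sym (-‿distribʳ-* Y _))) (-‿involutive _)))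
          (trans (cong (- (c m * (Y * S (t ℕ.* m) x)) +_) (trans (sym (*-assoc Y (c m) _)) (trans (cong (_* S (t ℕ.* m) x) (*-comm Y (c m))) (*-assoc (c m) Y _)))) (-‿inverseˡ _))
        term : ∀ j → c j * (S (t ℕ.* j) y - Y) * S (t ℕ.* j) x ≡ c j * S (t ℕ.* j) (y * x) + - (Y * (c j * S (t ℕ.* j) x))
        term j = begin
          c j * (Z - Y) * X ≡⟨ cong (_* X) (distribˡ (c j) Z (- Y)) ⟩
          (c j * Z + c j * - Y) * X ≡⟨ distribʳ X _ _ ⟩
          c j * Z * X + c j * - Y * X ≡⟨ cong₂ _+_ (trans (*-assoc (c j) Z X) (cong (c j *_) (sym (S-mul (t ℕ.* j) y x)))) (trans (cong (_* X) (sym (-‿distribʳ-* (c j) Y))) (trans (sym (-‿distribˡ-* (c j * Y) X)) (cong -_ (trans (cong (_* X) (*-comm (c j) Y)) (*-assoc Y (c j) X))))) ⟩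
          c j * S (t ℕ.* j) (y * x) + - (Y * (c j * X)) ∎
          where
          open ≡-Reasoning
          Z = S (t ℕ.* j) y
          X = S (t ℕ.* j) x
      below : ∀ j → j < m → c j ≡ 0#
      below j j<m with c j ≟ 0#
      ... | yes z = z
      ... | no ne = ⊥-elim (not-identity (t ℕ.* (m ∸ j)) (ℕₚ.*-mono-≤ t≥1 (ℕₚ.m<n⇒0<n∸m j<m))
          (ℕₚ.<-≤-trans (ℕₚ.*-monoʳ-< t {{>-nonZero t≥1}} (ℕₚ.≤-<-trans (ℕₚ.m∸n≤m m j) m<N)) (ℕₚ.≤-reflexive (trans (ℕₚ.*-comm t N) Nt≡n)))
          (λ y → S-inj (t ℕ.* j) (sym (trans (-‿cancel (*-cancelˡ (c j) ne (trans (independence t N Nt≡n m (ℕₚ.<⇒≤ m<N) (λ j → c j * (S (t ℕ.* j) y - S (t ℕ.* m) y)) (rel y) j j<m) (sym (zeroʳ (c j))))))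
              (trans (cong (λ k → S k y) (trans (cong (t ℕ.*_) (sym (ℕₚ.m+[n∸m]≡n (ℕₚ.<⇒≤ j<m)))) (ℕₚ.*-distribˡ-+ t j (m ∸ j)))) (S-+ (t ℕ.* j) (t ℕ.* (m ∸ j)) y))))))
      go : j < m ⊎ j ≡ m → c j ≡ 0#
      go (inj₁ l) = below j l
      go (inj₂ refl) = trans (sym (trans (cong (c j *_) (S-1# (t ℕ.* j))) (*-identityʳ (c j))))
         (trans (sym (trans (cong (c j * S (t ℕ.* j) 1# +_) (trans (S.Big-cong L (λ {i} i∈ → trans (cong (_* S (t ℕ.* i) 1#) (below i (∈-downFrom⁻ i∈))) (zeroˡ _))) (∑-zero L))) (+-identityʳ _))) (h 1#))

    Op : Set
    Op = F → F

    infix 4 _≐_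
    _≐_ : Op → Op → Set
    f ≐ g = ∀ x → f x ≡ g x

    -- The twisted group ring 𝔽_{q^s}[σ^t], as operators on the field.
    data InA (s t : ℕ) : Op → Set where
      scal : ∀ {a} → Fix s a → InA s t (a *_)
      frob : InA s t (S t)
      add  : ∀ {f g} → InA s t f → InA s t g → InA s t (λ x → f x + g x)
      comp : ∀ {f g} → InA s t f → InA s t g → InA s t (λ x → f (g x))
      ext  : ∀ {f g} → f ≐ g → InA s t f → InA s t g

    idA : ∀ {s t} → InA s t (λ x → x)
    idA {s} = ext *-identityˡ (scal (S-1# s))

    zeroA : ∀ {s t} → InA s t (λ _ → 0#)
    zeroA {s} = ext zeroˡ (scal (S-0# s))

    negA : ∀ {s t f} → InA s t f → InA s t (λ x → - f x)
    negA {s} {f = f} i = ext (λ x → trans (sym (-‿distribˡ-* 1# (f x))) (cong -_ (*-identityˡ (f x)))) (comp (scal (Fix-neg (S-1# s))) i)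

    subA : ∀ {s t f g} → InA s t f → InA s t g → InA s t (λ x → f x - g x)
    subA i j = add i (negA j)

    iterA : ∀ {s t} j → InA s t (S (t ℕ.* j))
    iterA {s} {t} zero = ext (λ x → sym (trans (cong (λ k → S k x) (ℕₚ.*-zeroʳ t)) (S-0 x))) idA
    iterA {s} {t} (suc j) = ext (λ x → trans (sym (S-+ t (t ℕ.* j) x)) (cong (λ k → S k x) (sym (ℕₚ.*-suc t j)))) (comp frob (iterA j))

    S∈A : ∀ {s t m} → t ∣ m → InA s t (S m)
    S∈A {s} {t} (divides k refl) = subst (λ z → InA s t (S z)) (ℕₚ.*-comm t k) (iterA k)

    ∑A : ∀ {s t} {I : Set} (L : List I) (f : I → Op) → (∀ {i} → i ∈ L → InA s t (f i)) → InA s t (λ x → ∑ L (λ i → f i x))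
    ∑A [] f h = zeroA
    ∑A (i ∷ L) f h = add (h (here refl)) (∑A L f (λ z → h (there z)))

    A-mono : ∀ {s t s′ t′ f} → s ∣ s′ → t′ ∣ t → InA s t f → InA s′ t′ f
    A-mono a b (scal h) = scal (Fix-∣ a h)
    A-mono a b frob = S∈A b
    A-mono a b (add i j) = add (A-mono a b i) (A-mono a b j)
    A-mono a b (comp i j) = comp (A-mono a b i) (A-mono a b j)
    A-mono a b (ext x i) = ext x (A-mono a b i)

    A-+ : ∀ {s t f} → InA s t f → ∀ x y → f (x + y) ≡ f x + f y
    A-+ (scal {a} h) x y = distribˡ a x y
    A-+ {t = t} frob x y = S-add t x y
    A-+ (add {f} {g} i j) x y = trans (cong₂ _+_ (A-+ i x y) (A-+ j x y))
      (trans (+-assoc (f x) (f y) _) (trans (cong (f x +_) (trans (sym (+-assoc (f y) (g x) _)) (trans (cong (_+ g y) (+-comm (f y) (g x))) (+-assoc (g x) _ _)))) (sym (+-assoc (f x) _ _))))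
    A-+ (comp {f} {g} i j) x y = trans (cong f (A-+ j x y)) (A-+ i (g x) (g y))
    A-+ (ext e i) x y = trans (sym (e _)) (trans (A-+ i x y) (cong₂ _+_ (e x) (e y)))

    A-0 : ∀ {s t f} → InA s t f → f 0# ≡ 0#
    A-0 {f = f} i = +-cancelˡ (f 0#) _ _ (trans (sym (A-+ i 0# 0#)) (trans (cong f (+-identityˡ 0#)) (sym (+-identityʳ _))))

    A-neg : ∀ {s t f} → InA s t f → ∀ x → f (- x) ≡ - f x
    A-neg {f = f} i x = -‿cancel (trans (cong (f (- x) +_) (-‿involutive _)) (trans (sym (A-+ i (- x) x)) (trans (cong f (-‿inverseˡ x)) (A-0 i))))

    A-sub : ∀ {s t f} → InA s t f → ∀ x y → f (x - y) ≡ f x - f y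
    A-sub i x y = trans (A-+ i x (- y)) (cong (_ +_) (A-neg i y))

    A-comm : ∀ {s t s′ t′ f g} → s ∣ t′ → s′ ∣ t → InA s t f → InA s′ t′ g → ∀ x → f (g x) ≡ g (f x)
    A-comm a b (scal {c} h) (scal {d} k) x = trans (sym (*-assoc c d x)) (trans (cong (_* x) (*-comm c d)) (*-assoc d c x))
    A-comm {t′ = t′} a b (scal {c} h) frob x = sym (trans (S-mul t′ c x) (cong (_* S t′ x) (Fix-∣ a h)))
    A-comm {t = t} a b frob (scal {d} k) x = trans (S-mul t d x) (cong (_* S t x) (Fix-∣ b k))
    A-comm {t = t} {t′ = t′} a b frob frob x = S-comm t t′ x
    A-comm a b i (add {f} {g} k l) x = trans (A-+ i (f x) (g x)) (cong₂ _+_ (A-comm a b i k x) (A-comm a b i l x))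
    A-comm a b i (comp {f} {g} k l) x = trans (A-comm a b i k (g x)) (cong f (A-comm a b i l x))
    A-comm {f = f} a b i (ext e k) x = trans (cong f (sym (e x))) (trans (A-comm a b i k x) (e (f x)))
    A-comm {g = g} a b (add i j) k@(scal _) x = trans (cong₂ _+_ (A-comm a b i k x) (A-comm a b j k x)) (sym (A-+ k _ _))
    A-comm {g = g} a b (comp {f} {f′} i j) k@(scal _) x = trans (cong f (A-comm a b j k x)) (A-comm a b i k (f′ x))
    A-comm {g = g} a b (ext e i) k@(scal _) x = trans (sym (e (g x))) (trans (A-comm a b i k x) (cong g (e x)))
    A-comm {g = g} a b (add i j) k@frob x = trans (cong₂ _+_ (A-comm a b i k x) (A-comm a b j k x)) (sym (A-+ k _ _))
    A-comm {g = g} a b (comp {f} {f′} i j) k@frob x = trans (cong f (A-comm a b j k x)) (A-comm a b i k (f′ x))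
    A-comm {g = g} a b (ext e i) k@frob x = trans (sym (e (g x))) (trans (A-comm a b i k x) (cong g (e x)))

    A-comm₁ : ∀ {s t f g} → s ∣ t → InA s t f → InA s t g → ∀ x → f (g x) ≡ g (f x)
    A-comm₁ d = A-comm d d

    comb : ℕ → ℕ → (ℕ → F) → Op
    comb t N c x = ∑ (downFrom N) (λ j → c j * S (t ℕ.* j) x)

    NF : ℕ → ℕ → ℕ → Op → Set
    NF s t N f = Σ (ℕ → F) λ c → (∀ j → Fix s (c j)) × f ≐ comb t N c

    ∑-head : ∀ M (g : ℕ → F) → ∑ (downFrom (suc M)) g ≡ g 0 + ∑ (downFrom M) (λ j → g (suc j))
    ∑-head zero g = refl
    ∑-head (suc M) g = trans (cong (g (suc M) +_) (∑-head M g)) (trans (sym (+-assoc _ _ _)) (trans (cong (_+ ∑ (downFrom M) (λ j → g (suc j))) (+-comm _ _)) (+-assoc _ _ _)))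

    ∑-append : ∀ a b (g : ℕ → F) → ∑ (downFrom (a ℕ.+ b)) g ≡ ∑ (downFrom a) (λ j → g (j ℕ.+ b)) + ∑ (downFrom b) g
    ∑-append zero b g = sym (+-identityˡ _)
    ∑-append (suc a) b g = trans (cong (g (a ℕ.+ b) +_) (∑-append a b g)) (sym (+-assoc _ _ _))

    ∑-blocks : ∀ M N (g : ℕ → F) → ∑ (downFrom (M ℕ.* N)) g ≡ ∑ (downFrom M) (λ i → ∑ (downFrom N) (λ j → g (j ℕ.+ i ℕ.* N)))
    ∑-blocks zero N g = refl
    ∑-blocks (suc M) N g = trans (∑-append N (M ℕ.* N) g) (cong (∑ (downFrom N) (λ j → g (j ℕ.+ M ℕ.* N)) +_) (∑-blocks M N g))

    ∑-orbit-Fix : ∀ k M {y} → Fix (k ℕ.* M) y → Fix k (∑ (downFrom M) (λ i → S (k ℕ.* i) y))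
    ∑-orbit-Fix k zero h = S-0# k
    ∑-orbit-Fix k (suc M) {y} h = trans (S-∑ k (downFrom (suc M)) _) (trans (S.Big-cong (downFrom (suc M)) (λ {j} _ → trans (sym (S-+ k (k ℕ.* j) y)) (cong (λ w → S w y) (sym (ℕₚ.*-suc k j)))))
      (trans (cong (_+ ∑ (downFrom M) (λ j → S (k ℕ.* suc j) y)) (trans h (sym (trans (cong (λ w → S w y) (ℕₚ.*-zeroʳ k)) (S-0 y)))))
        (sym (∑-head M (λ j → S (k ℕ.* j) y)))))

    nf-comp : ∀ {s t} N → s ∣ t → N ℕ.* t ≡ n → ∀ {f g} → InA s t f → NF s t N g → NF s t N (λ x → f (g x))
    nf-comp {s} {t} N s∣t Nt (scal {a} h) (c , fx , eq) = (λ j → a * c j) , (λ j → Fix-mul h (fx j)) , λ x →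
      trans (cong (a *_) (eq x)) (trans (∑-*ˡ (downFrom N) _ a) (S.Big-cong (downFrom N) (λ {j} _ → sym (*-assoc a (c j) _))))
    nf-comp {s} {t} zero s∣t Nt frob _ = ⊥-elim (ℕₚ.<⇒≢ n≥1 Nt)
    nf-comp {s} {t} N@(suc M) s∣t Nt {g = g} frob (c , fx , eq) = c′ , fx′ , λ x → trans (cong (S t) (eq x)) (trans (S-∑ t (downFrom N) _)
        (trans (S.Big-cong (downFrom N) (λ {j} _ → trans (S-mul t (c j) _) (cong₂ _*_ (Fix-∣ s∣t (fx j)) (step x j))))
        (trans (cong (λ z → c M * z + ∑ (downFrom M) (λ j → c j * S (t ℕ.* suc j) x)) (trans (cong (λ k → S k x) (trans (ℕₚ.*-comm t N) Nt)) (trans (S-n x) (sym (trans (cong (λ k → S k x) (ℕₚ.*-zeroʳ t)) (S-0 x))))))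
          (sym (∑-head M (λ j → c′ j * S (t ℕ.* j) x))))))
      where
      c′ : ℕ → F
      c′ zero = c M
      c′ (suc j) = c j
      fx′ : ∀ j → Fix s (c′ j)
      fx′ zero = fx M
      fx′ (suc j) = fx j
      step : ∀ x j → S t (S (t ℕ.* j) x) ≡ S (t ℕ.* suc j) x
      step x j = trans (sym (S-+ t (t ℕ.* j) x)) (cong (λ k → S k x) (sym (ℕₚ.*-suc t j)))
    nf-comp N s∣t Nt (add i j) z with nf-comp N s∣t Nt i z | nf-comp N s∣t Nt j z
    ... | c , fx , eq | d , fy , eq′ = (λ j → c j + d j) , (λ j → Fix-+ (fx j) (fy j)) , λ x →
      trans (cong₂ _+_ (eq x) (eq′ x)) (trans (sym (S.Big-∙ (downFrom N) _ _)) (S.Big-cong (downFrom N) (λ {j} _ → sym (distribʳ _ (c j) (d j)))))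
    nf-comp N s∣t Nt (comp i j) z = nf-comp N s∣t Nt i (nf-comp N s∣t Nt j z)
    nf-comp N s∣t Nt {g = g} (ext e i) z with nf-comp N s∣t Nt i z
    ... | c , fx , eq = c , fx , λ x → trans (sym (e (g x))) (eq x)

    nf-id : ∀ {s t} N → N ℕ.* t ≡ n → NF s t N (λ x → x)
    nf-id zero Nt = ⊥-elim (ℕₚ.<⇒≢ n≥1 Nt)
    nf-id {s} {t} (suc M) Nt = c , fx , λ x → sym (trans (∑-head M _)
        (trans (cong₂ _+_ (trans (*-identityˡ _) (trans (cong (λ k → S k x) (ℕₚ.*-zeroʳ t)) (S-0 x))) (trans (S.Big-cong (downFrom M) (λ _ → zeroˡ _)) (∑-zero (downFrom M)))) (+-identityʳ x)))
      where
      c : ℕ → F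
      c zero = 1#
      c (suc j) = 0#
      fx : ∀ j → Fix s (c j)
      fx zero = S-1# s
      fx (suc j) = S-0# s

    nf : ∀ {s t} N → s ∣ t → N ℕ.* t ≡ n → ∀ {f} → InA s t f → NF s t N f
    nf N s∣t Nt i = nf-comp N s∣t Nt i (nf-id N Nt)

    combA : ∀ {s t} N c → (∀ j → j < N → Fix s (c j)) → InA s t (comb t N c)
    combA {t = t} N c h = ∑A (downFrom N) (λ j x → c j * S (t ℕ.* j) x) (λ {j} j∈ → comp (scal (h j (∈-downFrom⁻ j∈))) (iterA j))

    comb-unique : ∀ t N → N ℕ.* t ≡ n → ∀ c d → comb t N c ≐ comb t N d → ∀ j → j < N → c j ≡ d j
    comb-unique t N Nt c d h j l = -‿cancel (independence t N Nt N ℕₚ.≤-refl (λ j → c j - d j) (λ x →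
      trans (S.Big-cong (downFrom N) (λ {j} _ → trans (distribʳ (S (t ℕ.* j) x) (c j) (- d j)) (cong (c j * S (t ℕ.* j) x +_) (sym (-‿distribˡ-* (d j) _)))))
        (trans (S.Big-∙ (downFrom N) _ _) (trans (cong (comb t N c x +_) (sym (∑-neg (downFrom N) _))) (x-x (h x))))) j l)

    module RingA (s t : ℕ) (s∣t : s ∣ t) where
      El : Set
      El = Σ Op (InA s t)

      ringA : CommutativeRing 0ℓ 0ℓ
      ringA = record
        { Carrier = El ; _≈_ = λ f g → proj₁ f ≐ proj₁ g
        ; _+_ = λ (f , i) (g , j) → (λ x → f x + g x) , add i j
        ; _*_ = λ (f , i) (g , j) → (λ x → f (g x)) , comp i j
        ; -_ = λ (f , i) → (λ x → - f x) , negA i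
        ; 0# = _ , zeroA ; 1# = _ , idA
        ; isCommutativeRing = record
          { isRing = record
            { +-isAbelianGroup = record
              { isGroup = record
                { isMonoid = record
                  { isSemigroup = record
                    { isMagma = record { isEquivalence = record { refl = λ x → refl ; sym = λ h x → sym (h x) ; trans = λ h k x → trans (h x) (k x) }
                                       ; ∙-cong = λ h k x → cong₂ _+_ (h x) (k x) }
                    ; assoc = λ f g h x → +-assoc _ _ _ }
                  ; identity = (λ f x → +-identityˡ _) , (λ f x → +-identityʳ _) }
                ; inverse = (λ f x → -‿inverseˡ _) , (λ f x → -‿inverseʳ _)
                ; ⁻¹-cong = λ h x → cong -_ (h x) }
              ; comm = λ f g x → +-comm _ _ }
            ; *-cong = λ {f} {g} {h} {k} a b x → trans (cong (proj₁ f) (b x)) (a (proj₁ k x))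
            ; *-assoc = λ f g h x → refl
            ; *-identity = (λ f x → refl) , (λ f x → refl)
            ; distrib = (λ f g h x → A-+ (proj₂ f) _ _) , (λ f g h x → refl) }
          ; *-comm = λ f g → A-comm₁ s∣t (proj₂ f) (proj₂ g) } }

      open CommutativeRing ringA using () renaming (semiring to semiringA; _+_ to _+A_)
      open import Algebra.Properties.Semiring.Exp semiringA public using () renaming (_^_ to _^A_; ^-congˡ to ^A-congˡ)
      open import Algebra.Properties.Semiring.Mult semiringA using () renaming (_×_ to _·A_)

      ·A-eval : ∀ m (f : El) x → proj₁ (m ·A f) x ≡ m · proj₁ f x
      ·A-eval zero f x = refl
      ·A-eval (suc m) f x = cong (proj₁ f x +_) (·A-eval m f x)

      monomial-^ : ∀ a j (h : Fix s a) k x → proj₁ ((_ , comp (scal h) (iterA {s} {t} j)) ^A k) x ≡ a ^ k * S (t ℕ.* (k ℕ.* j)) x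
      monomial-^ a j h zero x = sym (trans (*-identityˡ _) (trans (cong (λ k → S k x) (ℕₚ.*-zeroʳ t)) (S-0 x)))
      monomial-^ a j h (suc k) x = begin
        a * S (t ℕ.* j) (proj₁ ((_ , comp (scal h) (iterA {s} {t} j)) ^A k) x) ≡⟨ cong (λ z → a * S (t ℕ.* j) z) (monomial-^ a j h k x) ⟩
        a * S (t ℕ.* j) (a ^ k * S (t ℕ.* (k ℕ.* j)) x) ≡⟨ cong (a *_) (S-mul (t ℕ.* j) (a ^ k) _) ⟩
        a * (S (t ℕ.* j) (a ^ k) * S (t ℕ.* j) (S (t ℕ.* (k ℕ.* j)) x)) ≡⟨ cong₂ (λ y z → a * (y * z)) (fixk k) (trans (sym (S-+ (t ℕ.* j) _ x)) (cong (λ i → S i x) (sym (ℕₚ.*-distribˡ-+ t j (k ℕ.* j))))) ⟩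
        a * (a ^ k * S (t ℕ.* (suc k ℕ.* j)) x) ≡⟨ *-assoc a (a ^ k) _ ⟨
        a * a ^ k * S (t ℕ.* (suc k ℕ.* j)) x ∎
        where
        open ≡-Reasoning
        fixk : ∀ k → S (t ℕ.* j) (a ^ k) ≡ a ^ k
        fixk zero = S-1# (t ℕ.* j)
        fixk (suc k) = Fix-mul (Fix-∣ (∣-trans s∣t (m∣m*n j)) h) (fixk k)

      combEl : (L : List ℕ) (c : ℕ → F) → (∀ j → Fix s (c j)) → El
      combEl L c h = (λ x → ∑ L (λ j → c j * S (t ℕ.* j) x)) , ∑A L (λ j x → c j * S (t ℕ.* j) x) (λ {j} _ → comp (scal (h j)) (iterA j))

      frobenius-power : ∀ i (L : List ℕ) c (h : ∀ j → Fix s (c j)) x →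
        proj₁ (combEl L c h ^A (q ℕ.^ i)) x ≡ ∑ L (λ j → S i (c j) * S (t ℕ.* (q ℕ.^ i ℕ.* j)) x)
      frobenius-power i [] c h x = zero^ (q ℕ.^ i) (ℕₚ.m^n>0 q i)
        where
        zero^ : ∀ k → 1 ≤ k → proj₁ ((_ , zeroA) ^A k) x ≡ 0#
        zero^ (suc k) _ = refl
      frobenius-power i (j ∷ L) c h x = trans (frobA (_ , comp (scal (h j)) (iterA j)) (combEl L c h) x) (cong₂ _+_ (trans (monomial-^ (c j) j (h j) (q ℕ.^ i) x) (cong (_* S (t ℕ.* (q ℕ.^ i ℕ.* j)) x) (sym (S-def i (c j)))))
        (frobenius-power i L c h x))
        where
        frobA : ∀ (f g : El) → ∀ x → proj₁ ((f +A g) ^A (q ℕ.^ i)) x ≡ proj₁ (f ^A (q ℕ.^ i)) x + proj₁ (g ^A (q ℕ.^ i)) x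
        frobA f g = subst (λ m → ∀ x → proj₁ ((f +A g) ^A m) x ≡ proj₁ (f ^A m) x + proj₁ (g ^A m) x) (sym (q^≡ i))
          (CharP.frobenius^-+ ringA p P (λ f x → trans (·A-eval p f x) (char _)) (e ℕ.* i) f g)

      nf-power : ∀ N i (f : El) ((c , h , eq) : NF s t N (proj₁ f)) x →
        proj₁ (f ^A (q ℕ.^ i)) x ≡ ∑ (downFrom N) (λ j → S i (c j) * S (t ℕ.* (q ℕ.^ i ℕ.* j)) x)
      nf-power N i f (c , h , eq) x = trans (^A-congˡ (q ℕ.^ i) {f} {combEl (downFrom N) c h} eq x) (frobenius-power i (downFrom N) c h x)

      idempotent-^ : ∀ (f : El) → (∀ x → proj₁ f (proj₁ f x) ≡ proj₁ f x) → ∀ k → 1 ≤ k → ∀ x → proj₁ (f ^A k) x ≡ proj₁ f x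
      idempotent-^ f h (suc zero) _ x = refl
      idempotent-^ f h (suc (suc k)) _ x = trans (cong (proj₁ f) (idempotent-^ f h (suc k) (s≤s z≤n) x)) (h x)

      power-reduce : ∀ N → N ℕ.* t ≡ n → ∀ i → s ∣ i → One N (q ℕ.^ i) → ∀ (f : El) x → proj₁ (f ^A (q ℕ.^ i)) x ≡ proj₁ f x
      power-reduce N Nt i s∣i (divides k qi) f x = trans (nf-power N i f z x) (trans (S.Big-cong (downFrom N) (λ {j} _ → cong₂ _*_ (Fix-∣ s∣i (h j)) (red j))) (sym (eq x)))
        where
        z = nf N s∣t Nt (proj₂ f)
        c = proj₁ z
        h = proj₁ (proj₂ z)
        eq = proj₂ (proj₂ z)
        qi≡ : q ℕ.^ i ≡ suc (k ℕ.* N)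
        qi≡ = trans (sym (ℕₚ.suc-pred (q ℕ.^ i) {{ℕₚ.m^n≢0 q i}})) (cong suc qi)
        red : ∀ j → S (t ℕ.* (q ℕ.^ i ℕ.* j)) x ≡ S (t ℕ.* j) x
        red j = trans (cong (λ w → S w x) (trans (cong (λ w → t ℕ.* (w ℕ.* j)) qi≡) (trans (lem t k N j) (cong (λ w → t ℕ.* j ℕ.+ (k ℕ.* j) ℕ.* w) Nt))))
                (trans (S-+ (t ℕ.* j) _ x) (cong (S (t ℕ.* j)) (S-*n (k ℕ.* j) x)))
          where
          lem : ∀ t k N j → t ℕ.* (suc (k ℕ.* N) ℕ.* j) ≡ t ℕ.* j ℕ.+ (k ℕ.* j) ℕ.* (N ℕ.* t)
          lem = solve-∀

      -- x^M = x for a suitable power M of q, whence x is von Neumann regular with quasi-inverse x^(M-2).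
      regular : ∀ N → N ℕ.* t ≡ n → Coprime N q → 1 ≤ s → ∀ f → InA s t f → ∃ λ g → InA s t g × (∀ x → f (g (f x)) ≡ f x)
      regular N Nt cop s≥1 f i = go (q ℕ.^ E) refl (q^≥2 E (ℕₚ.*-mono-≤ s≥1 (pos sp)))
        where
        N≥1 = ∣⇒≥1 n≥1 (divides t (sym (trans (ℕₚ.*-comm t N) Nt)))
        sp = ordSpec N q N≥1 (ℕₚ.≤-trans (s≤s z≤n) q≥2) cop
        E = s ℕ.* ord N q
        oneE : One N (q ℕ.^ E)
        oneE = subst (One N) (trans (ℕₚ.^-*-assoc q (ord N q) s) (cong (q ℕ.^_) (ℕₚ.*-comm (ord N q) s))) (One-^ N (q ℕ.^ ord N q) s (ℕₚ.m^n>0 q (ord N q)) (one sp))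
        go : ∀ M → q ℕ.^ E ≡ M → 2 ≤ M → ∃ λ g → InA s t g × (∀ x → f (g (f x)) ≡ f x)
        go (suc (suc m)) eq (s≤s (s≤s _)) = proj₁ g , proj₂ g , λ x → trans (cong f (A-comm₁ s∣t (proj₂ g) i x))
            (trans (cong (λ k → proj₁ ((f , i) ^A k) x) (sym eq)) (power-reduce N Nt E (m∣m*n _) oneE (f , i) x))
          where g = (f , i) ^A m

    δ : ℕ → ℕ → F → F
    δ i j a with i ℕ.≟ j
    ... | yes _ = a
    ... | no _ = 0#

    δ-≢ : ∀ {i j} a → ¬ i ≡ j → δ i j a ≡ 0#
    δ-≢ {i} {j} a ne with i ℕ.≟ j
    ... | yes e = ⊥-elim (ne e)
    ... | no _ = refl

    δ-≡ : ∀ i a → δ i i a ≡ a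
    δ-≡ i a with i ℕ.≟ i
    ... | yes _ = refl
    ... | no ne = ⊥-elim (ne refl)

    ∑-single : {I : Set} (L : List I) (π : I → ℕ) (g : I → F) (m : I) → Unique L → m ∈ L → (∀ {j} → j ∈ L → π j ≡ π m → j ≡ m) →
      ∑ L (λ j → δ (π j) (π m) (g j)) ≡ g m
    ∑-single (x ∷ L) π g .x (x∉ ∷ u) (here refl) inj = trans (cong₂ _+_ (δ-≡ (π x) (g x))
      (trans (S.Big-cong L (λ {j} j∈ → δ-≢ (g j) (λ e → All.lookup x∉ j∈ (sym (inj (there j∈) e))))) (∑-zero L))) (+-identityʳ _)
    ∑-single (x ∷ L) π g m (x∉ ∷ u) (there z) inj = trans (cong₂ _+_ (δ-≢ (g x) (λ e → All.lookup x∉ z (inj (here refl) e)))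
      (∑-single L π g m u z (λ j∈ → inj (there j∈)))) (+-identityˡ _)

    collect : {I : Set} (t N : ℕ) (a : I → F) (π : I → ℕ) (L : List I) → (∀ j → π j < N) → ∀ x →
      ∑ L (λ j → a j * S (t ℕ.* π j) x) ≡ comb t N (λ m → ∑ L (λ j → δ (π j) m (a j))) x
    collect t N a π L lt x = trans (S.Big-cong L (λ {j} _ → one-term j)) (trans (∑-swap L (downFrom N) _) (S.Big-cong (downFrom N) (λ {m} _ → sym (∑-*ʳ L _ _))))
      where
      one-term : ∀ j → a j * S (t ℕ.* π j) x ≡ ∑ (downFrom N) (λ m → δ (π j) m (a j) * S (t ℕ.* m) x)
      one-term j = sym (trans (S.Big-cong (downFrom N) (λ {m} _ → flip m))
          (∑-single (downFrom N) (λ m → m) (λ m → a j * S (t ℕ.* m) x) (π j) (Uniq.downFrom⁺ N) (∈-downFrom⁺ (lt j)) (λ _ e → e)))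
        where
        flip : ∀ m → δ (π j) m (a j) * S (t ℕ.* m) x ≡ δ m (π j) (a j * S (t ℕ.* m) x)
        flip m with π j ℕ.≟ m
        ... | yes e = sym (trans (cong (λ k → δ m k (a j * S (t ℕ.* m) x)) e) (δ-≡ m _))
        ... | no ne = trans (zeroˡ _) (sym (δ-≢ _ (λ e → ne (sym e))))

    *%-injective : ∀ N .{{_ : NonZero N}} a → Coprime N a → ∀ {i j} → i < N → j < N → (a ℕ.* i) % N ≡ (a ℕ.* j) % N → i ≡ j
    *%-injective N a cop {i} {j} i<N j<N h with ℕₚ.≤-total i j
    ... | inj₁ l = sym (ℕₚ.≤-antisym (ℕₚ.m∸n≡0⇒m≤n (small (coprime-divisor cop (subst (N ∣_) (sym (ℕₚ.*-distribˡ-∸ a j i)) (%≡⇒∣∸ _ _ N (ℕₚ.*-monoʳ-≤ a l) (sym h)))) (ℕₚ.≤-<-trans (ℕₚ.m∸n≤m j i) j<N))) l)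
      where
      small : ∀ {d} → N ∣ d → d < N → d ≡ 0
      small {zero} _ _ = refl
      small {suc d} x y = ⊥-elim (ℕₚ.<⇒≱ y (∣⇒≤ x))
    ... | inj₂ l = ℕₚ.≤-antisym (ℕₚ.m∸n≡0⇒m≤n (small (coprime-divisor cop (subst (N ∣_) (sym (ℕₚ.*-distribˡ-∸ a i j)) (%≡⇒∣∸ _ _ N (ℕₚ.*-monoʳ-≤ a l) h))) (ℕₚ.≤-<-trans (ℕₚ.m∸n≤m i j) i<N))) l
      where
      small : ∀ {d} → N ∣ d → d < N → d ≡ 0
      small {zero} _ _ = refl
      small {suc d} x y = ⊥-elim (ℕₚ.<⇒≱ y (∣⇒≤ x))

    S-% : ∀ t N .{{_ : NonZero N}} → N ℕ.* t ≡ n → ∀ j x → S (t ℕ.* j) x ≡ S (t ℕ.* (j % N)) x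
    S-% t N Nt j x = trans (cong (λ w → S w x) (trans (cong (t ℕ.*_) (m≡m%n+[m/n]*n j N)) (trans (lem t (j % N) (j / N) N) (cong (λ w → t ℕ.* (j % N) ℕ.+ (j / N) ℕ.* w) Nt))))
        (trans (S-+ (t ℕ.* (j % N)) _ x) (cong (S (t ℕ.* (j % N))) (S-*n (j / N) x)))
      where
      lem : ∀ t a b N → t ℕ.* (a ℕ.+ b ℕ.* N) ≡ t ℕ.* a ℕ.+ b ℕ.* (N ℕ.* t)
      lem = solve-∀

    -- Comparing coefficients in e^(q^i) = e.
    idempotent-coefficients : ∀ {s t} N .{{_ : NonZero N}} → s ∣ t → N ℕ.* t ≡ n → Coprime N q → ∀ f → InA s t f → (∀ x → f (f x) ≡ f x) →
      (z : NF s t N f) → ∀ i j → S i (proj₁ z (j % N)) ≡ proj₁ z ((q ℕ.^ i ℕ.* j) % N)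
    idempotent-coefficients {s} {t} N s∣t Nt cop f fA idem z@(c , h , eq) i j = sym (begin
      c (π j) ≡⟨ comb-unique t N Nt c (λ m → ∑ L (λ j → δ (π j) m (S i (c j)))) (λ x → trans (sym (eq x)) (trans (sym (idempotent-^ (f , fA) idem (q ℕ.^ i) (ℕₚ.m^n>0 q i) x))
           (trans (nf-power N i (f , fA) z x) (trans (S.Big-cong L (λ {j} _ → cong (S i (c j) *_) (S-% t N Nt (q ℕ.^ i ℕ.* j) x))) (collect t N (λ j → S i (c j)) π L (λ j → m%n<n _ N) x))))) (π j) (m%n<n _ N) ⟩
      ∑ L (λ m → δ (π m) (π j) (S i (c m))) ≡⟨ cong (λ w → ∑ L (λ m → δ (π m) w (S i (c m)))) πj ⟩
      ∑ L (λ m → δ (π m) (π (j % N)) (S i (c m))) ≡⟨ ∑-single L π (λ m → S i (c m)) (j % N) (Uniq.downFrom⁺ N) (∈-downFrom⁺ (m%n<n j N))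
         (λ m∈ e → *%-injective N (q ℕ.^ i) (copow i) (∈-downFrom⁻ m∈) (m%n<n j N) e) ⟩
      S i (c (j % N)) ∎)
      where
      open ≡-Reasoning
      open RingA s t s∣t
      L = downFrom N
      π : ℕ → ℕ
      π j = (q ℕ.^ i ℕ.* j) % N
      πj : π j ≡ π (j % N)
      πj = trans (cong (_% N) (trans (cong (q ℕ.^ i ℕ.*_) (m≡m%n+[m/n]*n j N)) (lem (q ℕ.^ i) (j % N) (j / N) N))) ([m+kn]%n≡m%n (q ℕ.^ i ℕ.* (j % N)) (q ℕ.^ i ℕ.* (j / N)) N)
        where
        lem : ∀ a r b N → a ℕ.* (r ℕ.+ b ℕ.* N) ≡ a ℕ.* r ℕ.+ a ℕ.* b ℕ.* N
        lem = solve-∀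
      copow : ∀ i → Coprime N (q ℕ.^ i)
      copow zero (_ , d) = ℕₚ.≤-antisym (∣⇒≤ d) (∣⇒≥1 (s≤s z≤n) d)
      copow (suc i) = coprime-*ʳ (ℕ.>-nonZero⁻¹ N) cop (copow i)
        where open Arithmetic using (coprime-*ʳ)

    module Coeff {s t} (N : ℕ) {{N≢0 : NonZero N}} (s∣t : s ∣ t) (Nt : N ℕ.* t ≡ n) {f : Op} (fA : InA s t f) where
      abstract
        private
          z : NF s t N f
          z = nf N s∣t Nt fA
          c : ℕ → F
          c = proj₁ z

        coeff : ℕ → F
        coeff j = c (j % N)

        coeff-Fix : ∀ j → Fix s (coeff j)
        coeff-Fix j = proj₁ (proj₂ z) (j % N)

        coeff-N : ∀ j k → coeff (j ℕ.+ k ℕ.* N) ≡ coeff j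
        coeff-N j k = cong c ([m+kn]%n≡m%n j k N)

        coeff-eq : f ≐ comb t N coeff
        coeff-eq x = trans (proj₂ (proj₂ z) x) (S.Big-cong (downFrom N) (λ {j} j∈ → cong (λ w → c w * S (t ℕ.* j) x) (sym (m<n⇒m%n≡m (∈-downFrom⁻ j∈)))))

        coeff-power : Coprime N q → (∀ x → f (f x) ≡ f x) → ∀ i j → S i (coeff j) ≡ coeff (q ℕ.^ i ℕ.* j)
        coeff-power cop ff = idempotent-coefficients N s∣t Nt cop f fA ff z

        coeff-unique : ∀ d → f ≐ comb t N d → ∀ j → j < N → coeff j ≡ d j
        coeff-unique d h j l = trans (cong c (m<n⇒m%n≡m l)) (comb-unique t N Nt c d (λ x → trans (sym (proj₂ (proj₂ z) x)) (h x)) j l)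

        coeff-% : ∀ j → coeff j ≡ coeff (j % N)
        coeff-% j = cong c (sym (m<n⇒m%n≡m (m%n<n j N)))

      shift₁ : ∀ (g : ℕ → F) → g N ≡ g 0 → ∑ (downFrom N) (λ j → g (suc j)) ≡ ∑ (downFrom N) g
      shift₁ = go N
        where
        go : ∀ N (g : ℕ → F) → g N ≡ g 0 → ∑ (downFrom N) (λ j → g (suc j)) ≡ ∑ (downFrom N) g
        go zero g h = refl
        go (suc M) g h = trans (cong (_+ ∑ (downFrom M) (λ j → g (suc j))) h) (sym (∑-head M g))

      shift : ∀ a (g : ℕ → F) → (∀ j → g (j ℕ.+ N) ≡ g j) → ∑ (downFrom N) (λ j → g (j ℕ.+ a)) ≡ ∑ (downFrom N) g
      shift zero g h = S.Big-cong (downFrom N) (λ {j} _ → cong g (ℕₚ.+-identityʳ j))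
      shift (suc a) g h = trans (S.Big-cong (downFrom N) (λ {j} _ → cong g (ℕₚ.+-suc j a)))
        (trans (shift₁ (λ j → g (j ℕ.+ a)) (trans (cong g (ℕₚ.+-comm N a)) (h a))) (shift a g h))

      coeff-shift : ∀ a x → f (S (t ℕ.* a) x) ≡ comb t N (λ j → coeff (j ℕ.+ (N ∸ 1) ℕ.* a)) x
      coeff-shift a x = begin
        f (S (t ℕ.* a) x) ≡⟨ coeff-eq _ ⟩
        ∑ (downFrom N) (λ j → coeff j * S (t ℕ.* j) (S (t ℕ.* a) x)) ≡⟨ S.Big-cong (downFrom N) (λ {j} _ → cong₂ _*_ (sym (trans (cong coeff (back j)) (coeff-N j a))) (trans (sym (S-+ (t ℕ.* j) (t ℕ.* a) x)) (cong (λ w → S w x) (sym (ℕₚ.*-distribˡ-+ t j a))))) ⟩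
        ∑ (downFrom N) (λ j → g (j ℕ.+ a)) ≡⟨ shift a g per ⟩
        ∑ (downFrom N) g ∎
        where
        open ≡-Reasoning
        b = (N ∸ 1) ℕ.* a
        g : ℕ → F
        g j = coeff (j ℕ.+ b) * S (t ℕ.* j) x
        N≥1 : 1 ≤ N
        N≥1 = ℕ.>-nonZero⁻¹ N
        back : ∀ j → j ℕ.+ a ℕ.+ b ≡ j ℕ.+ a ℕ.* N
        back j = trans (ℕₚ.+-assoc j a b) (cong (j ℕ.+_) (trans (cong (λ w → a ℕ.+ w) (ℕₚ.*-comm (N ∸ 1) a)) (trans (sym (ℕₚ.*-suc a (N ∸ 1))) (cong (a ℕ.*_) (ℕₚ.m+[n∸m]≡n N≥1)))))
        per : ∀ j → g (j ℕ.+ N) ≡ g j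
        per j = cong₂ _*_ (trans (cong coeff (lem j N b)) (coeff-N (j ℕ.+ b) 1)) (trans (cong (λ w → S w x) (trans (ℕₚ.*-distribˡ-+ t j N) (cong (t ℕ.* j ℕ.+_) (trans (ℕₚ.*-comm t N) (trans Nt (sym (ℕₚ.*-identityˡ n))))))) (trans (S-+ (t ℕ.* j) _ x) (cong (S (t ℕ.* j)) (S-*n 1 x))))
          where
          lem : ∀ j N b → j ℕ.+ N ℕ.+ b ≡ j ℕ.+ b ℕ.+ 1 ℕ.* N
          lem = solve-∀

      comb-coeff : ∀ (d : ℕ → F) → (∀ j k → d (j ℕ.+ k ℕ.* N) ≡ d j) → f ≐ comb t N d → ∀ j → coeff j ≡ d j
      comb-coeff d per h j = trans (coeff-% j) (trans (coeff-unique d h (j % N) (m%n<n j N))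
        (trans (sym (per (j % N) (j / N))) (cong d (sym (m≡m%n+[m/n]*n j N)))))

      coeff-period : ∀ a → (∀ x → f (S (t ℕ.* a) x) ≡ f x) → ∀ j → coeff (j ℕ.+ a) ≡ coeff j
      coeff-period a h j = sym (trans (sym (coeff-N j a)) (trans (cong coeff (sym (back j))) (sym (comb-coeff (λ j → coeff (j ℕ.+ b)) (λ j k → trans (cong coeff (lem j (k ℕ.* N) b)) (coeff-N (j ℕ.+ b) k)) (λ x → trans (sym (h x)) (coeff-shift a x)) (j ℕ.+ a)))))
        where
        b = (N ∸ 1) ℕ.* a
        lem : ∀ j k b → j ℕ.+ k ℕ.+ b ≡ j ℕ.+ b ℕ.+ k
        lem = solve-∀
        back : ∀ j → j ℕ.+ a ℕ.+ b ≡ j ℕ.+ a ℕ.* N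
        back j = trans (ℕₚ.+-assoc j a b) (cong (j ℕ.+_) (trans (cong (λ w → a ℕ.+ w) (ℕₚ.*-comm (N ∸ 1) a)) (trans (sym (ℕₚ.*-suc a (N ∸ 1))) (cong (a ℕ.*_) (ℕₚ.m+[n∸m]≡n (ℕ.>-nonZero⁻¹ N))))))

      coeff-Cong : ∀ m → (∀ j → coeff (j ℕ.+ m) ≡ coeff j) → ∀ {a b} → Cong m a b → coeff a ≡ coeff b
      coeff-Cong m h {a} {b} (x , y , e) = trans (sym (mult x a)) (trans (cong coeff e) (mult y b))
        where
        mult : ∀ x a → coeff (a ℕ.+ x ℕ.* m) ≡ coeff a
        mult zero a = cong coeff (ℕₚ.+-identityʳ a)
        mult (suc x) a = trans (cong coeff (trans (cong (a ℕ.+_) (ℕₚ.+-comm m _)) (sym (ℕₚ.+-assoc a _ m)))) (trans (h (a ℕ.+ x ℕ.* m)) (mult x a))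

    Free : ℕ → ℕ → F → Set
    Free d N v = ∀ (c : ℕ → F) → (∀ j → j < N → Fix d (c j)) → ∑ (downFrom N) (λ j → c j * S (d ℕ.* j) v) ≡ 0# → ∀ j → j < N → c j ≡ 0#

    CN : F → Set
    CN v = ∀ d N → N ℕ.* d ≡ n → Free d N v

    at : ∀ {N} → Vec F N → ℕ → F
    at [] j = 0#
    at (x ∷ v) zero = x
    at (x ∷ v) (suc j) = at v j

    tab : ∀ N → (ℕ → F) → Vec F N
    tab zero c = []
    tab (suc N) c = c 0 ∷ tab N (λ j → c (suc j))

    at-tab : ∀ N c j → j < N → at (tab N c) j ≡ c j
    at-tab (suc N) c zero _ = refl
    at-tab (suc N) c (suc j) (s≤s l) = at-tab N (λ j → c (suc j)) j l

    at-All : ∀ {Q : F → Set} {N} {v : Vec F N} → Q 0# → VAll.All Q v → ∀ j → Q (at v j)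
    at-All h VAll.[] j = h
    at-All h (x VAll.∷ a) zero = x
    at-All h (x VAll.∷ a) (suc j) = at-All h a j

    tab-All : ∀ {Q : F → Set} N {c} → (∀ j → Q (c j)) → VAll.All Q (tab N c)
    tab-All zero h = VAll.[]
    tab-All (suc N) h = h 0 VAll.∷ tab-All N (λ j → h (suc j))

    at-ext : ∀ {N} (v w : Vec F N) → (∀ j → j < N → at v j ≡ at w j) → v ≡ w
    at-ext [] [] h = refl
    at-ext (x ∷ v) (y ∷ w) h = cong₂ _∷_ (h 0 (s≤s z≤n)) (at-ext v w (λ j l → h (suc j) (s≤s l)))

    ≐? : ∀ f g → Dec (f ≐ g)
    ≐? f g = map′ (λ a x → All.lookup a (complete enum tt)) (λ h → All.tabulate (λ {x} _ → h x)) (All.all? (λ x → f x ≟ g x) (elems enum))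

    zeroOp : Op
    zeroOp _ = 0#

    nonzero-witness : ∀ {f} → ¬ f ≐ zeroOp → ∃ λ x → ¬ f x ≡ 0#
    nonzero-witness {f} h with Any.any? (λ x → ¬? (f x ≟ 0#)) (elems enum)
    ... | yes a = let (x , _ , z) = find a in x , z
    ... | no na = ⊥-elim (h (λ x → case (f x ≟ 0#) (λ ne → na (lose (complete enum tt) ne))))
      where
      case : ∀ {y} → Dec (y ≡ 0#) → (¬ y ≡ 0# → ⊥) → y ≡ 0#
      case (yes z) _ = z
      case (no z) k = ⊥-elim (k z)

    Idem : ℕ → ℕ → Op → Set
    Idem s t f = InA s t f × (∀ x → f (f x) ≡ f x)

    infix 4 _≼_
    _≼_ : Op → Op → Set
    f ≼ g = ∀ x → f (g x) ≡ f x

    Im : Op → F → Set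
    Im f x = f x ≡ x

    card-Im : ∀ f → ∃ λ m → Card (Im f) m
    card-Im f with card-filter (λ x → f x ≟ x) enum
    ... | m , c = m , card-cong proj₂ (tt ,_) c

    Minimal : ℕ → ℕ → Op → Set
    Minimal s t f = ¬ f ≐ zeroOp × (∀ g → Idem s t g → g ≼ f → g ≐ zeroOp ⊎ g ≐ f)

    module WithA (s t N : ℕ) (s∣t : s ∣ t) (Nt : N ℕ.* t ≡ n) where

      s∣n : s ∣ n
      s∣n = ∣-trans s∣t (divides N (sym Nt))

      abstract
        coefficientVectors : Card (λ (v : Vec F N) → VAll.All (Fix s) v) ((q ℕ.^ s) ℕ.^ N)
        coefficientVectors = card-Vec (card-Fix s s∣n) N

      vecA : ∀ {v : Vec F N} → VAll.All (Fix s) v → InA s t (comb t N (at v))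
      vecA h = combA N _ (λ j _ → at-All (S-0# s) h j)

      vec-of : ∀ {f} → InA s t f → Σ (Vec F N) λ v → VAll.All (Fix s) v × f ≐ comb t N (at v)
      vec-of i with nf N s∣t Nt i
      ... | c , h , eq = tab N c , tab-All N h , λ x → trans (eq x) (S.Big-cong (downFrom N) (λ {j} j∈ → cong (_* S (t ℕ.* j) x) (sym (at-tab N c j (∈-downFrom⁻ j∈)))))

      ProperPart : Op → Vec F N → Set
      ProperPart f v = (λ x → g (g x)) ≐ g × g ≼ f × ¬ g ≐ zeroOp × ¬ g ≐ f
        where g = comb t N (at v)

      properPart? : ∀ f v → Dec (ProperPart f v)
      properPart? f v = ≐? (λ x → g (g x)) g ×-dec (≐? (λ x → g (f x)) g ×-dec (¬? (≐? g zeroOp) ×-dec ¬? (≐? g f)))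
        where g = comb t N (at v)

      splits : ∀ f → Idem s t f → ¬ f ≐ zeroOp → Minimal s t f ⊎ ∃ λ g → Idem s t g × g ≼ f × ¬ g ≐ zeroOp × ¬ g ≐ f
      splits f (fA , ff) nz = search (Any.any? (properPart? f) (elems coefficientVectors))
        where
        module _ (na : ¬ Any (ProperPart f) (elems coefficientVectors)) where
          test : ∀ g → Idem s t g → g ≼ f → Dec (g ≐ zeroOp) → Dec (g ≐ f) → g ≐ zeroOp ⊎ g ≐ f
          test g gI le (yes z) _ = inj₁ z
          test g gI le (no z) (yes w) = inj₂ w
          test g (gA , gg) le (no z) (no w) = ⊥-elim (na (lose (complete coefficientVectors (proj₁ (proj₂ (vec-of gA))))
              ( (λ x → trans (sym (eq _)) (trans (cong g (sym (eq x))) (trans (gg x) (eq x))))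
              , (λ x → trans (sym (eq (f x))) (trans (le x) (eq x)))
              , (λ k → z (λ x → trans (eq x) (k x))) , (λ k → w (λ x → trans (eq x) (k x))))))
            where
            eq = proj₂ (proj₂ (vec-of gA))
        search : Dec (Any (ProperPart f) (elems coefficientVectors)) → Minimal s t f ⊎ ∃ λ g → Idem s t g × g ≼ f × ¬ g ≐ zeroOp × ¬ g ≐ f
        search (yes a) = let (v , v∈ , idem , le , nz′ , ne) = find a in inj₂ (comb t N (at v) , (vecA (sound coefficientVectors v∈) , idem) , le , nz′ , ne)
        search (no na) = inj₁ (nz , λ g gI le → test na g gI le (≐? g zeroOp) (≐? g f))

      complement : ∀ {f g} → Idem s t f → Idem s t g → g ≼ f → Idem s t (λ x → f x - g x)
      complement {f} {g} (fA , ff) (gA , gg) le = subA fA gA , λ x → begin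
        f (f x - g x) - g (f x - g x) ≡⟨ cong₂ _-_ (A-sub fA _ _) (A-sub gA _ _) ⟩
        (f (f x) - f (g x)) - (g (f x) - g (g x)) ≡⟨ cong₂ _-_ (cong₂ _-_ (ff x) (trans (A-comm₁ s∣t fA gA x) (le x))) (x-x (trans (le x) (sym (gg x)))) ⟩
        (f x - g x) - 0# ≡⟨ trans (cong ((f x - g x) +_) -0#≈0#) (+-identityʳ _) ⟩
        f x - g x ∎
        where open ≡-Reasoning

      im-mono : ∀ {f g} → Idem s t f → Idem s t g → g ≼ f → ∀ {x} → Im g x → Im f x
      im-mono {f} {g} (fA , _) (gA , _) le {x} h = trans (cong f (sym h)) (trans (A-comm₁ s∣t fA gA x) (trans (le x) h))

      im-strict : ∀ {f g a b} → Idem s t f → Idem s t g → g ≼ f → ¬ g ≐ f → Card (Im f) a → Card (Im g) b → b < a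
      im-strict {f} {g} {a} {b} fI gI le ne cf cg = ℕₚ.≰⇒> λ a≤b → ne (λ x →
        let (y , yg , y≡) = card-surj (λ x → x) (im-mono fI gI le) (λ _ _ e → e) cg cf a≤b {f x} (proj₂ fI x)
        in trans (sym (le x)) (trans (cong g (sym y≡)) (trans yg y≡)))

      idem-ind : (Pr : Op → Set) → (∀ {f} → f ≐ zeroOp → Pr f) → (∀ f → Idem s t f → Minimal s t f → Pr f) →
        (∀ f g h → Idem s t f → Idem s t g → Idem s t h → g ≼ f → h ≼ f → (∀ x → g (h x) ≡ 0#) → (∀ x → h (g x) ≡ 0#) →
           (∀ x → f x ≡ g x + h x) → Pr g → Pr h → Pr f) →
        ∀ f → Idem s t f → Pr f
      idem-ind Pr P0 Pmin Pjoin f fI = go (proj₁ (card-Im f)) f fI (proj₂ (card-Im f)) ℕₚ.≤-refl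
        where
        go : ∀ m f → Idem s t f → ∀ {a} → Card (Im f) a → a ≤ m → Pr f
        go zero f fI {zero} c l with complete c (A-0 (proj₁ fI))
        ... | z with elems c | size c
        go zero f fI {zero} c l | () | [] | _
        go (suc m) f fI {a} c l with ≐? f zeroOp
        ... | yes z = P0 z
        ... | no nz with splits f fI nz
        ... | inj₁ mi = Pmin f fI mi
        ... | inj₂ (g , gI , le , gnz , gne) = Pjoin f g h fI gI hI le h≼f gh hg fgh
            (go m g gI (proj₂ (card-Im g)) (ℕₚ.≤-pred (ℕₚ.≤-trans (im-strict fI gI le gne c (proj₂ (card-Im g))) l)))
            (go m h hI (proj₂ (card-Im h)) (ℕₚ.≤-pred (ℕₚ.≤-trans (im-strict fI hI h≼f hne c (proj₂ (card-Im h))) l)))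
          where
          h : Op
          h x = f x - g x
          hI = complement fI gI le
          h≼f : h ≼ f
          h≼f x = cong₂ _-_ (proj₂ fI x) (le x)
          fg : ∀ x → f (g x) ≡ g x
          fg x = trans (A-comm₁ s∣t (proj₁ fI) (proj₁ gI) x) (le x)
          gh : ∀ x → g (h x) ≡ 0#
          gh x = trans (A-sub (proj₁ gI) _ _) (x-x (trans (le x) (sym (proj₂ gI x))))
          hg : ∀ x → h (g x) ≡ 0#
          hg x = x-x (trans (fg x) (sym (proj₂ gI x)))
          fgh : ∀ x → f x ≡ g x + h x
          fgh x = sym (trans (+-comm _ _) (trans (+-assoc _ _ _) (trans (cong (f x +_) (-‿inverseˡ (g x))) (+-identityʳ _))))
          hne : ¬ h ≐ f
          hne k = gnz (λ x → sym (trans (sym (gh x)) (trans (cong g (k x)) (le x))))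

      module Regular (cop : Coprime N q) (s≥1 : 1 ≤ s) where
        open RingA s t s∣t public
        module Ring = CommutativeRing ringA

        quasi-inverse : ∀ f → InA s t f → ∃ λ g → InA s t g × (∀ x → f (g (f x)) ≡ f x)
        quasi-inverse = regular N Nt cop s≥1

        generator : ∃ λ w → ∀ f → Idem s t f → ¬ f ≐ zeroOp → ¬ f w ≡ 0#
        generator with idem-ind Pr (λ {f} z → 0# , z 0# , λ g gI gz le → ⊥-elim (gz (λ x → trans (sym (le x)) (trans (cong g (z x)) (A-0 (proj₁ gI))))))
            minimal join (λ x → x) (idA , λ _ → refl)
          where
          Pr : Op → Set
          Pr f = ∃ λ w → Im f w × (∀ g → Idem s t g → ¬ g ≐ zeroOp → g ≼ f → ¬ g w ≡ 0#)
          minimal : ∀ f → Idem s t f → Minimal s t f → Pr f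
          minimal f fI (nz , mi) with nonzero-witness nz
          ... | x , fx = f x , proj₂ fI x , λ g gI gz le → case g (mi g gI le) gz
            where
            case : ∀ g → g ≐ zeroOp ⊎ g ≐ f → ¬ g ≐ zeroOp → ¬ g (f x) ≡ 0#
            case g (inj₁ z) gz = ⊥-elim (gz z)
            case g (inj₂ w) gz h = fx (trans (sym (proj₂ fI x)) (trans (sym (w (f x))) h))
          join : ∀ f g h → Idem s t f → Idem s t g → Idem s t h → g ≼ f → h ≼ f → (∀ x → g (h x) ≡ 0#) → (∀ x → h (g x) ≡ 0#) →
           (∀ x → f x ≡ g x + h x) → Pr g → Pr h → Pr f
          join f g h fI gI hI g≼ h≼ gh hg fgh (a , ga , an) (b , hb , bn) = a + b , imf , avoid
            where
            gA = proj₁ gI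
            hA = proj₁ hI
            g0 : g b ≡ 0#
            g0 = trans (cong g (sym hb)) (gh b)
            h0 : h a ≡ 0#
            h0 = trans (cong h (sym ga)) (hg a)
            gab : g (a + b) ≡ a
            gab = trans (A-+ gA a b) (trans (cong₂ _+_ ga g0) (+-identityʳ a))
            hab : h (a + b) ≡ b
            hab = trans (A-+ hA a b) (trans (cong₂ _+_ h0 hb) (+-identityˡ b))
            imf : f (a + b) ≡ a + b
            imf = trans (fgh _) (cong₂ _+_ gab hab)
            avoid : ∀ k → Idem s t k → ¬ k ≐ zeroOp → k ≼ f → ¬ k (a + b) ≡ 0#
            avoid k (kA , kk) kz k≼f z with ≐? (λ x → k (g x)) zeroOp
            ... | no ne = an (λ x → k (g x)) (comp kA gA , λ x → trans (cong k (trans (sym (A-comm₁ s∣t kA gA (g x))) (cong k (proj₂ gI x)))) (kk (g x)))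
                   ne (λ x → cong k (proj₂ gI x)) (trans (cong k (trans ga (sym gab))) (trans (A-comm₁ s∣t kA gA (a + b)) (trans (cong g z) (A-0 gA))))
            ... | yes e = bn k (kA , kk) kz (λ x → sym (trans (sym (k≼f x)) (trans (cong k (fgh x)) (trans (A-+ kA _ _) (trans (cong (_+ k (h x)) (e x)) (+-identityˡ _))))))
                   (trans (sym (trans (cong (_+ k b) (trans (cong k (sym ga)) (e a))) (+-identityˡ _))) (trans (sym (A-+ kA a b)) z))
        ... | w , _ , h = w , λ f fI nz → h f fI nz (λ x → refl)

        w₀ : F
        w₀ = proj₁ generator

        faithful : ∀ {f} → InA s t f → f w₀ ≡ 0# → f ≐ zeroOp
        faithful {f} fA h with quasi-inverse f fA
        ... | g , gA , fgf with ≐? (λ x → g (f x)) zeroOp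
        ... | yes z = λ x → trans (sym (fgf x)) (trans (cong f (z x)) (A-0 fA))
        ... | no nz = ⊥-elim (proj₂ generator (λ x → g (f x)) (comp gA fA , λ x → cong g (fgf x)) nz (trans (cong g h) (A-0 gA)))

        minimal-cancel : ∀ {f} → Idem s t f → Minimal s t f → ∀ a z → InA s t a → InA s t z → ¬ (λ x → a (f x)) ≐ zeroOp →
          (∀ x → z (f x) ≡ z x) → (∀ x → a (z x) ≡ 0#) → z ≐ zeroOp
        minimal-cancel {f} (fA , ff) (nz , mi) a z aA zA ane zf az x with quasi-inverse (λ x → a (f x)) (comp aA fA)
        ... | g , gA , bgb = trans (sym (zf x)) (trans (A-comm₁ s∣t zA fA x) (trans (sym (h≐f (mi h hI h≼f) (z x))) (trans (cong g (trans (cong a (trans (sym (A-comm₁ s∣t zA fA x)) (zf x))) (az x))) (A-0 gA))))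
          where
          h : Op
          h x = g (a (f x))
          hI : Idem s t h
          hI = comp gA (comp aA fA) , λ x → cong g (bgb x)
          h≼f : h ≼ f
          h≼f x = cong (λ y → g (a y)) (ff x)
          h≐f : h ≐ zeroOp ⊎ h ≐ f → h ≐ f
          h≐f (inj₂ e) = e
          h≐f (inj₁ e) = ⊥-elim (ane (λ x → trans (sym (bgb x)) (trans (cong (λ y → a (f y)) (e x)) (A-0 (comp aA fA)))))

        module AtMinimal {f : Op} (fI : Idem s t f) (fM : Minimal s t f) where
          private
            fA = proj₁ fI
            ff = proj₂ fI

          InIdeal : El → Set
          InIdeal z = ∀ x → proj₁ z (f x) ≡ proj₁ z x

          open Poly ringA using (eval; trinomial; trinomial-length; trinomial-eval; trinomial-last; eval-I; roots⇒zero; Cancellable)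

          I-0 : InIdeal Ring.0#
          I-0 x = refl
          I-+ : ∀ {a b} → InIdeal a → InIdeal b → InIdeal (a Ring.+ b)
          I-+ h k x = cong₂ _+_ (h x) (k x)
          I-* : ∀ {b} a → InIdeal b → InIdeal (a Ring.* b)
          I-* a h x = cong (proj₁ a) (h x)

          Canc : El → El → Set
          Canc = Cancellable InIdeal I-0 (λ {a} {b} → I-+ {a} {b}) (λ {b} a → I-* {b} a)

          canc : ∀ a b → ¬ (λ x → proj₁ b (f x) - proj₁ a (f x)) ≐ zeroOp → Canc a b
          canc a b ne z zI h = minimal-cancel fI fM (λ x → proj₁ b x - proj₁ a x) (proj₁ z) (subA (proj₂ b) (proj₂ a)) (proj₂ z) ne zI h

          ideal-roots : ∀ xs as → length as ≤ length xs → AllPairs Canc xs → All InIdeal as → All (λ x → eval as x Ring.≈ Ring.0#) xs → All (Ring._≈ Ring.0#) as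
          ideal-roots = roots⇒zero InIdeal I-0 (λ {a} {b} → I-+ {a} {b}) (λ {b} a → I-* {b} a)

          scalEl : ∀ {a} → Fix s a → El
          scalEl {a} h = (λ x → a * f x) , comp (scal h) fA

          poly : ∀ {L} (v : Vec F L) → VAll.All (Fix s) v → List El
          poly [] VAll.[] = []
          poly (a ∷ v) (h VAll.∷ hs) = scalEl h ∷ poly v hs

          poly-length : ∀ {L} (v : Vec F L) h → length (poly v h) ≡ L
          poly-length [] VAll.[] = refl
          poly-length (a ∷ v) (h VAll.∷ hs) = cong suc (poly-length v hs)

          poly-I : ∀ {L} (v : Vec F L) h → All InIdeal (poly v h)
          poly-I [] VAll.[] = []
          poly-I (a ∷ v) (h VAll.∷ hs) = (λ x → cong (a *_) (ff x)) ∷ poly-I v hs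

          poly-sub : ∀ {L} (v w : Vec F L) h k X x → proj₁ (eval (poly v h) X) x ≡ proj₁ (eval (poly w k) X) x →
            Σ (Vec F L) λ u → Σ (VAll.All (Fix s) u) λ l → proj₁ (eval (poly u l) X) x ≡ 0# × (∀ j → at u j ≡ at v j - at w j)
          poly-sub v w h k X x e = sub v w , subF h k , trans (ev v w h k) (x-x e) , atsub v w
            where
            sub : ∀ {L} (v w : Vec F L) → Vec F L
            sub [] [] = []
            sub (a ∷ v) (b ∷ w) = (a - b) ∷ sub v w
            subF : ∀ {L} {v w : Vec F L} → VAll.All (Fix s) v → VAll.All (Fix s) w → VAll.All (Fix s) (sub v w)
            subF VAll.[] VAll.[] = VAll.[]
            subF (a VAll.∷ v) (b VAll.∷ w) = Fix-+ a (Fix-neg b) VAll.∷ subF v w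
            atsub : ∀ {L} (v w : Vec F L) j → at (sub v w) j ≡ at v j - at w j
            atsub [] [] j = sym (x-x refl)
            atsub (a ∷ v) (b ∷ w) zero = refl
            atsub (a ∷ v) (b ∷ w) (suc j) = atsub v w j
            ev : ∀ {L} (v w : Vec F L) h k → proj₁ (eval (poly (sub v w) (subF h k)) X) x ≡ proj₁ (eval (poly v h) X) x - proj₁ (eval (poly w k) X) x
            ev [] [] VAll.[] VAll.[] = sym (x-x refl)
            ev (a ∷ v) (b ∷ w) (h VAll.∷ hs) (k VAll.∷ ks) = trans (cong₂ _+_ (trans (distribʳ (f x) a (- b)) (cong (a * f x +_) (sym (-‿distribˡ-* b (f x)))))
                (trans (cong (proj₁ X) (ev v w hs ks)) (A-sub (proj₂ X) _ _))) (lem (a * f x) (b * f x) _ _)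
              where
              lem : ∀ a b c d → (a - b) + (c - d) ≡ (a + c) - (b + d)
              lem a b c d = trans (+-assoc a (- b) _) (trans (cong (a +_) (trans (sym (+-assoc (- b) c _)) (trans (cong (_+ (- d)) (+-comm (- b) c)) (trans (+-assoc c _ _) (cong (c +_) (-‿+-comm b d)))))) (sym (+-assoc a c _)))

          poly-zero : ∀ {L} (v : Vec F L) h → All (Ring._≈ Ring.0#) (poly v h) → ∀ j → at v j ≡ 0#
          poly-zero [] VAll.[] z j = refl
          poly-zero (a ∷ v) (h VAll.∷ hs) (z ∷ zs) zero with nonzero-witness (proj₁ fM)
          ... | x , fx = case (zero-product a (f x) (z x))
            where
            case : a ≡ 0# ⊎ f x ≡ 0# → a ≡ 0#
            case (inj₁ e) = e
            case (inj₂ e) = ⊥-elim (fx e)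
          poly-zero (a ∷ v) (h VAll.∷ hs) (z ∷ zs) (suc j) = poly-zero v hs zs j

          record Endo : Set where
            field
              ⟦_⟧  : El → El
              hom≈ : ∀ {a b} → a Ring.≈ b → ⟦ a ⟧ Ring.≈ ⟦ b ⟧
              hom+ : ∀ a b → ⟦ a Ring.+ b ⟧ Ring.≈ (⟦ a ⟧ Ring.+ ⟦ b ⟧)
              hom* : ∀ a b → ⟦ a Ring.* b ⟧ Ring.≈ (⟦ a ⟧ Ring.* ⟦ b ⟧)
              hom0 : ⟦ Ring.0# ⟧ Ring.≈ Ring.0#
              fixf : ∀ {a} (h : Fix s a) → ⟦ scalEl h ⟧ Ring.≈ scalEl h
          open Endo public

          X : El
          X = S t , frob

          endo-eval : ∀ (φ : Endo) {L} (v : Vec F L) h x → proj₁ (⟦ φ ⟧ (eval (poly v h) X)) x ≡ proj₁ (eval (poly v h) (⟦ φ ⟧ X)) x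
          endo-eval φ [] VAll.[] x = hom0 φ x
          endo-eval φ (a ∷ v) (h VAll.∷ hs) x = trans (hom+ φ (scalEl h) (X Ring.* eval (poly v hs) X) x) (cong₂ _+_ (fixf φ h x)
            (trans (hom* φ X (eval (poly v hs) X) x) (cong (proj₁ (⟦ φ ⟧ X)) (endo-eval φ v hs x))))

          Separated : Endo → Endo → Set
          Separated φ ψ = ¬ (λ x → proj₁ (⟦ ψ ⟧ X) (f x) - proj₁ (⟦ φ ⟧ X) (f x)) ≐ zeroOp

          im-lower : ∀ (Φ : List Endo) → AllPairs Separated Φ → ∀ {m} → Card (Im f) m → (q ℕ.^ s) ℕ.^ length Φ ≤ m
          im-lower Φ sep c = card-inj {P = λ (z : Vec F (length Φ)) → VAll.All (Fix s) z} image im inj (card-Vec (card-Fix s s∣n) (length Φ)) c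
            where
            ev : (v : Vec F (length Φ)) → VAll.All (Fix s) v → El
            ev v h = eval (poly v h) X
            fixes? : ∀ {L} (v : Vec F L) → Dec (VAll.All (Fix s) v)
            fixes? = VAll.all? (λ x → S s x ≟ x)
            image : Vec F (length Φ) → F
            image v with fixes? v
            ... | yes h = proj₁ (ev v h) w₀
            ... | no _ = 0#
            ev-im : ∀ v h → f (proj₁ (ev v h) w₀) ≡ proj₁ (ev v h) w₀
            ev-im v h = trans (sym (A-comm₁ s∣t (proj₂ (ev v h)) fA w₀)) (eval-I InIdeal I-0 (λ {a} {b} → I-+ {a} {b}) (λ {b} a → I-* {b} a) (poly v h) X (poly-I v h) w₀)
            im : ∀ {v} → VAll.All (Fix s) v → Im f (image v)
            im {v} hv with fixes? v
            ... | yes h = ev-im v h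
            ... | no nh = ⊥-elim (nh hv)
            inj : ∀ {v w} → VAll.All (Fix s) v → VAll.All (Fix s) w → image v ≡ image w → v ≡ w
            inj {v} {w} hv hw e with fixes? v | fixes? w
            ... | no nh | _ = ⊥-elim (nh hv)
            ... | yes _ | no nh = ⊥-elim (nh hw)
            ... | yes h | yes k with poly-sub v w h k X w₀ e
            ... | u , l , z , at≡ = at-ext v w (λ j _ → -‿cancel (trans (sym (at≡ j)) (poly-zero u l allz j)))
              where
              evz : ∀ x → proj₁ (ev u l) x ≡ 0#
              evz = faithful (proj₂ (ev u l)) z
              allz : All (Ring._≈ Ring.0#) (poly u l)
              allz = ideal-roots (map (λ φ → ⟦ φ ⟧ X) Φ) (poly u l) (ℕₚ.≤-reflexive (trans (poly-length u l) (sym (length-map _ Φ))))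
                (APP.map⁺ (AllPairs.map (λ {φ} {ψ} ne → canc (⟦ φ ⟧ X) (⟦ ψ ⟧ X) ne) sep)) (poly-I u l)
                (AllP.map⁺ (All.tabulate (λ {φ} _ x → trans (sym (endo-eval φ u l x)) (trans (hom≈ φ {ev u l} {Ring.0#} evz x) (hom0 φ x)))))

          module _ (s≡t : s ≡ t) where

            -- The normal basis theorem, by comparing cardinalities.
            onto : ∀ y → ∃ λ (a : El) → proj₁ a w₀ ≡ y
            onto y with card-surj {P = λ (z : Vec F N) → VAll.All (Fix s) z} (λ v → comb t N (at v) w₀) (λ _ → tt) inj coefficientVectors enum
                (ℕₚ.≤-reflexive (trans order≡ (trans (cong (q ℕ.^_) (trans (sym Nt) (trans (ℕₚ.*-comm N t) (cong (ℕ._* N) (sym s≡t))))) (sym (ℕₚ.^-*-assoc q s N))))) {y} tt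
              where
              inj : ∀ {v w : Vec F N} → VAll.All (Fix s) v → VAll.All (Fix s) w → comb t N (at v) w₀ ≡ comb t N (at w) w₀ → v ≡ w
              inj {v} {w} h k e = at-ext v w (comb-unique t N Nt (at v) (at w) (λ x → -‿cancel (faithful (subA (vecA h) (vecA k)) (x-x e) x)))
            ... | v , h , e = (comb t N (at v) , vecA h) , e

            im-upper : ∀ E → 1 ≤ E → s ∣ E → (∀ x j → S (t ℕ.* (q ℕ.^ E ℕ.* j)) (f x) ≡ S (t ℕ.* j) (f x)) → ∀ {m} → Card (Im f) m → m ≤ q ℕ.^ E
            im-upper E E≥1 s∣E red {m} c = go (q ℕ.^ E) refl (q^≥2 E E≥1)
              where
              fEl : El
              fEl = f , fA
              pre : F → El
              pre y = proj₁ (onto y)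
              pre-f : ∀ y → Im f y → proj₁ (pre y) (f w₀) ≡ y
              pre-f y h = trans (A-comm₁ s∣t (proj₂ (pre y)) fA w₀) (trans (cong f (proj₂ (onto y))) h)
              power : ∀ (a : El) x → proj₁ (a ^A (q ℕ.^ E)) (f x) ≡ proj₁ a (f x)
              power a x with nf N s∣t Nt (proj₂ a)
              ... | z@(c , h , eq) = trans (nf-power N E a z (f x)) (trans (S.Big-cong (downFrom N) (λ {j} _ → cong₂ _*_ (Fix-∣ s∣E (h j)) (red x j))) (sym (eq (f x))))
              sepa : ∀ {y y′} → Im f y → Im f y′ → ¬ y ≡ y′ → Canc (pre y) (pre y′)
              sepa {y} {y′} h h′ ne = canc (pre y) (pre y′) (λ z → ne (sym (-‿cancel (trans (sym (cong₂ _-_ (pre-f y′ h′) (pre-f y h))) (z w₀)))))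
              pairs : ∀ {ys} → AllPairs (λ y y′ → ¬ y ≡ y′) ys → (∀ {y} → y ∈ ys → Im f y) → AllPairs (λ y y′ → Canc (pre y) (pre y′)) ys
              pairs [] h = []
              pairs (a ∷ as) h = All.tabulate (λ y∈ → sepa (h (here refl)) (h (there y∈)) (All.lookup a y∈)) ∷ pairs as (λ z → h (there z))
              go : ∀ M → q ℕ.^ E ≡ M → 2 ≤ M → m ≤ M
              go (suc (suc k)) eq (s≤s (s≤s _)) = ℕₚ.≮⇒≥ λ lt → proj₁ fM (trinomial-last {P = Ring._≈ Ring.0#} k fEl
                (ideal-roots (map pre (elems c)) (trinomial k fEl) (subst₂ _≤_ (sym (trinomial-length k fEl)) (sym (trans (length-map pre (elems c)) (size c))) lt)
                  (APP.map⁺ (pairs (uniq c) (sound c)))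
                  tri-I
                  (AllP.map⁺ (All.tabulate (λ {y} _ → trinomial-eval k fEl (pre y) (λ x → trans (cong (λ w → proj₁ (pre y ^A w) (f x)) (sym eq)) (power (pre y) x)))))))
                where
                tri-I : All InIdeal (trinomial k fEl)
                tri-I = (λ x → refl) ∷ (λ x → cong -_ (ff x)) ∷ AllP.++⁺ (AllP.replicate⁺ k (λ x → refl)) ((λ x → ff x) ∷ [])

module CoprimeDegree where

  open import Data.Nat as ℕ using (ℕ; zero; suc; _≤_; _<_; z≤n; s≤s; >-nonZero; _∸_; pred)
  import Data.Nat.Properties as ℕₚ
  open import Data.Nat.Divisibility using (_∣_; _∣?_; divides; ∣⇒≤; ∣-refl; ∣-trans; m∣m*n; 1∣_; ∣m⇒∣m*n; n∣m*n; *-monoˡ-∣; *-monoʳ-∣; *-cancelˡ-∣; quotient; ∣n⇒∣m*n; *-cancelʳ-∣)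
  open import Data.Nat.GCD using (gcd; gcd[m,n]∣m; gcd[m,n]∣n)
  open import Data.Nat.Primality using (Prime; prime⇒nonZero; euclidsLemma; prime[2])
  open import Data.Nat.Induction using (<-rec)
  open import Data.Nat.Tactic.RingSolver using (solve-∀)
  open import Data.List using (List; []; _∷_; length; downFrom; map; foldr; cartesianProduct; _++_)
  open import Data.List.Properties using (length-downFrom; length-map; length-++)
  open import Data.List.Membership.Propositional using (_∈_; find; lose)
  open import Data.List.Relation.Unary.Any as Any using (here; there; Any)
  open import Data.List.Relation.Unary.All as All using (All; []; _∷_)
  open import Data.List.Relation.Unary.AllPairs as AllPairs using ([]; _∷_; AllPairs)
  open import Data.List.Relation.Unary.Unique.Propositional using (Unique)
  open import Data.Product using (∃; _×_; _,_; proj₁; proj₂)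
  open import Data.Empty using (⊥-elim; ⊥)
  open import Data.Unit using (⊤; tt)
  open import Relation.Nullary using (¬_; yes; no; Dec)
  open import Relation.Binary.PropositionalEquality
  open import Data.Nat.DivMod using (_%_; _/_; m≡m%n+[m/n]*n; m%n<n; m<n⇒m%n≡m; [m+kn]%n≡m%n)
  open import Data.Nat.Coprimality as Cop using (Coprime; coprime-divisor)
  open import Data.List.Membership.Propositional.Properties using (∈-downFrom⁺; ∈-downFrom⁻; ∈-cartesianProduct⁺; ∈-cartesianProduct⁻)
  import Data.List.Relation.Unary.Unique.Propositional.Properties as Uniq
  open import Data.Sum using (_⊎_; inj₁; inj₂)
  open import Relation.Nullary.Decidable using (_×-dec_; ¬?; _⊎-dec_)
  import Data.List.Relation.Unary.AllPairs.Properties as APP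
  import Data.List.Relation.Unary.All.Properties as AllP
  open import Data.Bool using (Bool; true; false)
  open import Defs using (prod; divisors; primeDivisors; φ; _÷_; ord; τ; exceptional; factor; formula)
  open Arithmetic
  open Orders
  open ComponentArithmetic
  open Totient
  open Cardinality
  open FiniteFields
  open TwistedGroupRing

  coprime-split : ∀ m d → 1 ≤ d → ∃ λ d₀ → ∃ λ d₁ → d ≡ d₀ ℕ.* d₁ × Coprime d₁ m × (∀ s → Prime s → s ∣ d₀ → s ∣ m)
  coprime-split m = primeInd _ (1 , 1 , refl , (λ (a , _) → ℕₚ.≤-antisym (∣⇒≤ a) (∣⇒≥1 (s≤s z≤n) a)) , λ s S d → ⊥-elim (prime∤1 S d)) step
    where
    step : ∀ s w → Prime s → 1 ≤ w → (∃ λ d₀ → ∃ λ d₁ → w ≡ d₀ ℕ.* d₁ × Coprime d₁ m × (∀ s → Prime s → s ∣ d₀ → s ∣ m)) →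
      ∃ λ d₀ → ∃ λ d₁ → s ℕ.* w ≡ d₀ ℕ.* d₁ × Coprime d₁ m × (∀ s → Prime s → s ∣ d₀ → s ∣ m)
    step s w S w≥1 (d₀ , d₁ , refl , c , h) with s ∣? m
    ... | yes s∣m = s ℕ.* d₀ , d₁ , sym (ℕₚ.*-assoc s d₀ d₁) , c , λ r R x → case (euclidsLemma s d₀ R x) R
      where
      case : ∀ {r} → r ∣ s ⊎ r ∣ d₀ → Prime r → r ∣ m
      case (inj₁ a) R = subst (_∣ m) (sym (prime∣prime R S a)) s∣m
      case (inj₂ a) R = h _ R a
    ... | no s∤m = d₀ , s ℕ.* d₁ , lem s d₀ d₁ , coprime-primes (ℕₚ.*-mono-≤ (prime≥1 S) (∣⇒≥1 w≥1 (n∣m*n d₀))) (λ r R x y → case (euclidsLemma s d₁ R x) R y) , h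
      where
      lem : ∀ s a b → s ℕ.* (a ℕ.* b) ≡ a ℕ.* (s ℕ.* b)
      lem = solve-∀
      case : ∀ {r} → r ∣ s ⊎ r ∣ d₁ → Prime r → r ∣ m → ⊥
      case (inj₁ a) R y = s∤m (subst (_∣ m) (prime∣prime R S a) y)
      case {r} (inj₂ a) R y = prime∤1 R (subst (r ∣_) (c (a , y)) ∣-refl)

  even-or-odd : ∀ j → (∃ λ c → j ≡ c ℕ.* 2) ⊎ (∃ λ c → j ≡ suc (c ℕ.* 2))
  even-or-odd zero = inj₁ (0 , refl)
  even-or-odd (suc j) with even-or-odd j
  ... | inj₁ (c , e) = inj₂ (c , cong suc e)
  ... | inj₂ (c , e) = inj₁ (suc c , cong suc e)

  factor-nonexceptional : ∀ q k → exceptional q k ≡ false →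
    factor q 1 k ≡ (q ℕ.^ (ord k q ÷ τ q k) ∸ 1) ℕ.^ ((τ q k ℕ.* φ k) ÷ ord k q) ℕ.* 1
  factor-nonexceptional q k h rewrite h = refl

  factor-exceptional : ∀ q k → exceptional q k ≡ true →
    factor q 1 k ≡ ((q ℕ.^ (2 ℕ.* (ord k q ÷ τ q k)) ℕ.+ 3) ∸ 4 ℕ.* q ℕ.^ (ord k q ÷ τ q k)) ℕ.^ ((τ q k ℕ.* φ k) ÷ (2 ℕ.* ord k q)) ℕ.* 1
  factor-exceptional q k h rewrite h = refl

  module CoprimeCase (Ω : Extension) (p∤n : ¬ Extension.p Ω ∣ Extension.n Ω) (reg : Reg (Extension.q Ω) (Extension.n Ω) (Extension.n Ω)) where

    open Setting Ω public

    recip : F → F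
    recip x with x ≟ 0#
    ... | yes _ = 0#
    ... | no ne = proj₁ (inverse x ne)

    recip-spec : ∀ x → ¬ x ≡ 0# → x * recip x ≡ 1#
    recip-spec x h with x ≟ 0#
    ... | yes z = ⊥-elim (h z)
    ... | no ne = proj₂ (inverse x ne)

    Avg : ℕ → Op
    Avg m x = recip ((n ÷ m) · 1#) * ∑ (downFrom (n ÷ m)) (λ j → S (m ℕ.* j) x)

    ÷*≡ : ∀ {m} → m ∣ n → n ÷ m ℕ.* m ≡ n
    ÷*≡ d = ÷-∣ (∣⇒≥1 n≥1 d) d

    M·1≢0 : ∀ {m} → m ∣ n → ¬ (n ÷ m) · 1# ≡ 0#
    M·1≢0 {m} d = nonzero-characteristic p (n ÷ m) P char (λ z → p∤n (∣-trans z (subst (n ÷ m ∣_) (÷*≡ d) (m∣m*n m))))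

    recip-Fix : ∀ {m} → m ∣ n → ∀ i → Fix i (recip ((n ÷ m) · 1#))
    recip-Fix {m} d i = Fix-inv (M·1≢0 d) (recip-spec _ (M·1≢0 d)) (Fix-·1 i (n ÷ m))

    Avg∈A : ∀ {s t m} → m ∣ n → t ∣ m → InA s t (Avg m)
    Avg∈A {s} {t} {m} d t∣m = comp (scal (recip-Fix d s)) (∑A (downFrom (n ÷ m)) (λ j x → S (m ℕ.* j) x) (λ {j} _ → S∈A (∣m⇒∣m*n j t∣m)))

    Avg-Fix : ∀ {m} → m ∣ n → ∀ x → Fix m (Avg m x)
    Avg-Fix {m} d x = trans (S-mul m _ _) (cong₂ _*_ (recip-Fix d m) (∑-orbit-Fix m (n ÷ m) (subst (λ w → Fix w x) (sym (trans (ℕₚ.*-comm m (n ÷ m)) (÷*≡ d))) (S-n x))))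

    Avg-id : ∀ {m x} → m ∣ n → Fix m x → Avg m x ≡ x
    Avg-id {m} {x} d h = begin
      r * ∑ (downFrom M) (λ j → S (m ℕ.* j) x) ≡⟨ cong (r *_) (S.Big-cong (downFrom M) (λ {j} _ → Fix-∣ (m∣m*n j) h)) ⟩
      r * ∑ (downFrom M) (λ _ → x) ≡⟨ cong (r *_) (∑-const (downFrom M) x) ⟩
      r * (length (downFrom M) · x) ≡⟨ cong (λ k → r * (k · x)) (length-downFrom M) ⟩
      r * (M · x) ≡⟨ cong (r *_) (trans (cong (M ·_) (sym (*-identityˡ x))) (sym (×-assoc-* M 1# x))) ⟩
      r * (M · 1# * x) ≡⟨ *-assoc _ _ _ ⟨
      r * (M · 1#) * x ≡⟨ cong (_* x) (trans (*-comm r _) (recip-spec _ (M·1≢0 d))) ⟩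
      1# * x ≡⟨ *-identityˡ x ⟩
      x ∎
      where
      open ≡-Reasoning
      M = n ÷ m
      r = recip (M · 1#)

    commute₁ : ∀ {f g} → InA 1 1 f → InA 1 1 g → ∀ x → f (g x) ≡ g (f x)
    commute₁ = A-comm ∣-refl ∣-refl

    Avg-gcd : ∀ {l m} → l ∣ n → m ∣ n → ∀ x → Avg l (Avg m x) ≡ Avg (gcd l m) x
    Avg-gcd {l} {m} dl dm x = begin
      y ≡⟨ Avg-id dg (Fix-gcd l m (Avg-Fix dl _) (subst (Fix m) (sym (commute₁ (Avg∈A dl (1∣ l)) (Avg∈A dm (1∣ m)) x)) (Avg-Fix dm _))) ⟨
      Avg g y ≡⟨ commute₁ (Avg∈A dg (1∣ g)) (Avg∈A dl (1∣ l)) _ ⟩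
      Avg l (Avg g (Avg m x)) ≡⟨ cong (Avg l) (commute₁ (Avg∈A dg (1∣ g)) (Avg∈A dm (1∣ m)) x) ⟩
      Avg l (Avg m (Avg g x)) ≡⟨ cong (Avg l) (Avg-id dm (Fix-∣ (gcd[m,n]∣n l m) (Avg-Fix dg x))) ⟩
      Avg l (Avg g x) ≡⟨ Avg-id dl (Fix-∣ (gcd[m,n]∣m l m) (Avg-Fix dg x)) ⟩
      Avg g x ∎
      where
      open ≡-Reasoning
      g = gcd l m
      y = Avg l (Avg m x)
      dg : g ∣ n
      dg = ∣-trans (gcd[m,n]∣m l m) dl

    Avg-absorb : ∀ {l m} → m ∣ n → l ∣ m → ∀ x → Avg l (Avg m x) ≡ Avg l x
    Avg-absorb {l} {m} dm l∣m x = trans (commute₁ (Avg∈A dl (1∣ l)) (Avg∈A dm (1∣ m)) x) (Avg-id dm (Fix-∣ l∣m (Avg-Fix dl x)))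
      where
      dl : l ∣ n
      dl = ∣-trans l∣m dm

    -- The projection onto the k-th cyclotomic component, ∏_{r ∣ k} (Avg k − Avg (k / r)).
    strip : ℕ → List ℕ → Op
    strip k L x = foldr (λ r acc → acc - Avg (k ÷ r) acc) x L

    E : ℕ → Op
    E k x = strip k (primeDivisors k) (Avg k x)

    ÷-divisor : ∀ {k r} → 1 ≤ k → r ∣ k → k ÷ r ∣ k
    ÷-divisor {k} {r} h d = subst (k ÷ r ∣_) (÷-∣ (∣⇒≥1 h d) d) (m∣m*n r)

    module Comp {k} (k∣n : k ∣ n) where
      k≥1 : 1 ≤ k
      k≥1 = ∣⇒≥1 n≥1 k∣n

      ÷r∣n : ∀ {r} → r ∣ k → k ÷ r ∣ n
      ÷r∣n d = ∣-trans (÷-divisor k≥1 d) k∣n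

      strip∈A : ∀ {s t} L → All (λ r → r ∣ k × t ∣ k ÷ r) L → InA s t (strip k L)
      strip∈A [] [] = idA
      strip∈A (r ∷ L) ((d , t∣) ∷ h) = subA (strip∈A L h) (comp (Avg∈A (÷r∣n d) t∣) (strip∈A L h))

      E∈A : ∀ {s t} → t ∣ k → (∀ r → Prime r → r ∣ k → t ∣ k ÷ r) → InA s t (E k)
      E∈A t∣k h = comp (strip∈A (primeDivisors k) (All.tabulate (λ z → let (R , d) = ∈-primeDivisors⁻ {m = k} z in d , h _ R d))) (Avg∈A k∣n t∣k)

      E∈A₁ : InA 1 1 (E k)
      E∈A₁ = E∈A (1∣ k) (λ r _ _ → 1∣ _)

      E-Avg : ∀ x → E k (Avg k x) ≡ E k x
      E-Avg x = cong (strip k (primeDivisors k)) (Avg-id k∣n (Avg-Fix k∣n x))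

      Avg-E : ∀ x → Avg k (E k x) ≡ E k x
      Avg-E x = trans (commute₁ (Avg∈A k∣n (1∣ k)) E∈A₁ x) (E-Avg x)

      E-Fix : ∀ x → Fix k (E k x)
      E-Fix x = subst (Fix k) (Avg-E x) (Avg-Fix k∣n _)

      strip-kill : ∀ {r} L → All (_∣ k) L → r ∈ L → ∀ x → Avg (k ÷ r) (strip k L x) ≡ 0#
      strip-kill {r} (.r ∷ L) (d ∷ ds) (here refl) x = trans (A-sub (Avg∈A {1} (÷r∣n d) (1∣ _)) _ _) (x-x (sym (Avg-id (÷r∣n d) (Avg-Fix (÷r∣n d) _))))
      strip-kill {r} (s ∷ L) (d ∷ ds) (there z) x = trans (A-sub (Avg∈A {1} (÷r∣n (All.lookup ds z)) (1∣ _)) _ _)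
        (trans (cong₂ _-_ ih (trans (commute₁ (Avg∈A (÷r∣n (All.lookup ds z)) (1∣ _)) (Avg∈A (÷r∣n d) (1∣ _)) _) (trans (cong (Avg (k ÷ s)) ih) (A-0 (Avg∈A {1} (÷r∣n d) (1∣ _)))))) (x-x refl))
        where ih = strip-kill L ds z x

      Avg÷-E : ∀ r → Prime r → r ∣ k → ∀ x → Avg (k ÷ r) (E k x) ≡ 0#
      Avg÷-E r R d x = strip-kill (primeDivisors k) (All.tabulate (λ z → proj₂ (∈-primeDivisors⁻ {m = k} z))) (∈-primeDivisors⁺ k≥1 R d) (Avg k x)

      proper-divisor : ∀ {g} → g ∣ k → ¬ g ≡ k → ∃ λ r → Prime r × r ∣ k × g ∣ k ÷ r
      proper-divisor {g} (divides c k≡) ne with 2 ℕ.≤? c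
      ... | yes l with primeFactor c l
      ... | r , R , divides c′ refl = r , R , divides (c′ ℕ.* g) (trans k≡ (lem c′ r g)) ,
            divides c′ (trans (cong (_÷ r) (trans k≡ (lem c′ r g))) (*-÷ (c′ ℕ.* g) (ℕₚ.≤-trans (s≤s z≤n) (prime≥2 R))))
        where
        lem : ∀ c r g → c ℕ.* r ℕ.* g ≡ c ℕ.* g ℕ.* r
        lem = solve-∀
      proper-divisor {g} (divides zero k≡) ne | no l = ⊥-elim (ℕₚ.<⇒≢ k≥1 (sym k≡))
      proper-divisor {g} (divides (suc zero) k≡) ne | no l = ⊥-elim (ne (sym (trans k≡ (ℕₚ.+-identityʳ g))))
      proper-divisor {g} (divides (suc (suc c)) k≡) ne | no l = ⊥-elim (l (s≤s (s≤s z≤n)))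

      E-kill : ∀ {l} → l ∣ n → ¬ k ∣ l → ∀ x → Avg l (E k x) ≡ 0#
      E-kill {l} l∣n k∤l x with proper-divisor (gcd[m,n]∣n l k) (λ z → k∤l (subst (_∣ l) z (gcd[m,n]∣m l k)))
      ... | r , R , r∣k , g∣ = begin
        Avg l (E k x) ≡⟨ cong (Avg l) (Avg-E x) ⟨
        Avg l (Avg k (E k x)) ≡⟨ Avg-gcd l∣n k∣n _ ⟩
        Avg g (E k x) ≡⟨ Avg-absorb (÷r∣n r∣k) g∣ _ ⟨
        Avg g (Avg (k ÷ r) (E k x)) ≡⟨ cong (Avg g) (Avg÷-E r R r∣k x) ⟩
        Avg g 0# ≡⟨ A-0 (Avg∈A {1} (∣-trans (gcd[m,n]∣m l k) l∣n) (1∣ g)) ⟩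
        0# ∎
        where
        open ≡-Reasoning
        g = gcd l k

      E-fixed : ∀ {y} → Fix k y → (∀ r → Prime r → r ∣ k → Avg (k ÷ r) y ≡ 0#) → E k y ≡ y
      E-fixed {y} h z = trans (cong (strip k (primeDivisors k)) (Avg-id k∣n h)) (go (primeDivisors k) (All.tabulate (λ w → let (R , d) = ∈-primeDivisors⁻ {m = k} w in z _ R d)))
        where
        go : ∀ L → All (λ r → Avg (k ÷ r) y ≡ 0#) L → strip k L y ≡ y
        go [] [] = refl
        go (r ∷ L) (a ∷ as) = trans (cong (λ w → w - Avg (k ÷ r) w) (go L as)) (trans (cong (λ w → y - w) a) (trans (cong (y +_) -0#≈0#) (+-identityʳ y)))

      E-idem : ∀ x → E k (E k x) ≡ E k x
      E-idem x = E-fixed (E-Fix x) (λ r R d → Avg÷-E r R d x)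

    E-orth : ∀ {k l} → k ∣ n → l ∣ n → ¬ k ≡ l → ∀ x → E l (E k x) ≡ 0#
    E-orth {k} {l} k∣n l∣n ne x with k ∣? l
    ... | no k∤l = trans (sym (Comp.E-Avg l∣n _)) (trans (cong (E l) (Comp.E-kill k∣n l∣n k∤l x)) (A-0 (Comp.E∈A₁ l∣n)))
    ... | yes k∣l = trans (commute₁ (Comp.E∈A₁ l∣n) (Comp.E∈A₁ k∣n) x) (trans (sym (Comp.E-Avg k∣n _))
          (trans (cong (E k) (Comp.E-kill l∣n k∣n (λ l∣k → ne (∣-antisym k∣l l∣k)) x)) (A-0 (Comp.E∈A₁ k∣n))))
      where open import Data.Nat.Divisibility using (∣-antisym)

    ∑-A : ∀ {s t f} → InA s t f → {I : Set} (L : List I) (g : I → F) → f (∑ L g) ≡ ∑ L (λ i → f (g i))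
    ∑-A {f = f} i L g = ∑-hom L g f (A-0 i) (A-+ i)

    ∑-pick : ∀ (L : List ℕ) (g : ℕ → F) k → Unique L → k ∈ L → (∀ {j} → j ∈ L → ¬ j ≡ k → g j ≡ 0#) → ∑ L g ≡ g k
    ∑-pick (x ∷ L) g .x (x∉ ∷ u) (here refl) h = trans (cong (g x +_) (trans (S.Big-cong L (λ z → h (there z) (λ e → All.lookup x∉ z (sym e)))) (∑-zero L))) (+-identityʳ _)
    ∑-pick (x ∷ L) g k (x∉ ∷ u) (there z) h = trans (cong₂ _+_ (h (here refl) (λ e → All.lookup x∉ z e)) (∑-pick L g k u z (λ w → h (there w)))) (+-identityˡ _)

    E-sum : ∀ {m} → m ∣ n → ∀ x → Fix m x → ∑ (divisors m) (λ k → E k x) ≡ x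
    E-sum {m} m∣n x fx = sym (-‿cancel (trans (sym (Avg-id m∣n zFix)) (<-rec Pr step m ∣-refl)))
      where
      L = divisors m
      m≥1 = ∣⇒≥1 n≥1 m∣n
      div : ∀ {k} → k ∈ L → k ∣ m
      div z = ∈-divisors⁻ {m = m} z
      z = x - ∑ L (λ k → E k x)
      zFix : Fix m z
      zFix = Fix-+ fx (Fix-neg (Fix-∑ L _ (λ {k} k∈ → Fix-∣ (div k∈) (Comp.E-Fix (∣-trans (div k∈) m∣n) x))))
      Pr : ℕ → Set
      Pr l = l ∣ m → Avg l z ≡ 0#
      step : ∀ l → (∀ {l′} → l′ < l → Pr l′) → Pr l
      step l ih l∣m = trans (sym (C.E-fixed (Avg-Fix l∣n z) lower)) (trans (C.E-Avg z) Ez)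
        where
        l∣n = ∣-trans l∣m m∣n
        module C = Comp l∣n
        lower : ∀ r → Prime r → r ∣ l → Avg (l ÷ r) (Avg l z) ≡ 0#
        lower r R r∣l = trans (Avg-absorb l∣n (÷-divisor C.k≥1 r∣l) z) (ih (÷-< C.k≥1 R r∣l) (∣-trans (÷-divisor C.k≥1 r∣l) l∣m))
          where
          ÷-< : ∀ {k r} → 1 ≤ k → Prime r → r ∣ k → k ÷ r < k
          ÷-< {k} {r} k≥1 R d = subst (k ÷ r <_) (÷-∣ (∣⇒≥1 k≥1 d) d) (ℕₚ.m<m*n (k ÷ r) r {{>-nonZero (∣⇒≥1 k≥1 (÷-divisor k≥1 d))}} (prime≥2 R))
        Ez : E l z ≡ 0#
        Ez = trans (A-sub C.E∈A₁ x _) (x-x (sym (trans (∑-A C.E∈A₁ L (λ k → E k x))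
           (trans (∑-pick L (λ k → E l (E k x)) l (divisors-unique m) (∈-divisors⁺ m≥1 l∣m) (λ k∈ ne → E-orth (∣-trans (div k∈) m∣n) l∣n ne x)) (C.E-idem x)))))

    card-components : (ks : List ℕ) → Unique ks → (∀ {k} → k ∈ ks → k ∣ n) → (G : ℕ → F → Set) (N : ℕ → ℕ) →
      (∀ {k} → k ∈ ks → Card (λ y → E k y ≡ y × G k y) (N k)) →
      Card (λ x → ∑ ks (λ k → E k x) ≡ x × (∀ {k} → k ∈ ks → G k (E k x))) (prod (map N ks))
    card-components [] u d G N c = card-cong (λ { refl → refl , λ () }) (λ (e , _) → sym e) (card-one 0#)
    card-components (k ∷ ks) (k∉ ∷ u) d G N c = card-bij (λ (y , z) → y + z) (λ x → E k x , x - E k x) fwd bwd inv₁ inv₂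
        (card-× (c (here refl)) (card-components ks u (λ z → d (there z)) G N (λ z → c (there z))))
      where
      module C = Comp (d (here refl))
      orth : ∀ {l} → l ∈ ks → ∀ x → E l (E k x) ≡ 0#
      orth l∈ = E-orth (d (here refl)) (d (there l∈)) (All.lookup k∉ l∈)
      orth′ : ∀ {l} → l ∈ ks → ∀ x → E k (E l x) ≡ 0#
      orth′ l∈ = E-orth (d (there l∈)) (d (here refl)) (λ e → All.lookup k∉ l∈ (sym e))
      Ek0 : ∀ {z} → ∑ ks (λ l → E l z) ≡ z → E k z ≡ 0#
      Ek0 {z} h = trans (cong (E k) (sym h)) (trans (∑-A C.E∈A₁ ks (λ l → E l z)) (trans (S.Big-cong ks (λ l∈ → orth′ l∈ z)) (∑-zero ks)))
      Eky : ∀ {y z} → E k y ≡ y → ∑ ks (λ l → E l z) ≡ z → E k (y + z) ≡ y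
      Eky {y} {z} hy hz = trans (A-+ C.E∈A₁ y z) (trans (cong₂ _+_ hy (Ek0 hz)) (+-identityʳ y))
      Elz : ∀ {y z l} → E k y ≡ y → l ∈ ks → E l (y + z) ≡ E l z
      Elz {y} {z} {l} hy l∈ = trans (A-+ (Comp.E∈A₁ (d (there l∈))) y z) (trans (cong (_+ E l z) (trans (cong (E l) (sym hy)) (orth l∈ y))) (+-identityˡ _))
      Elx : ∀ {x l} → l ∈ ks → E l (x - E k x) ≡ E l x
      Elx {x} {l} l∈ = trans (A-sub (Comp.E∈A₁ (d (there l∈))) x _) (trans (cong (λ w → E l x - w) (orth l∈ x)) (trans (cong (E l x +_) -0#≈0#) (+-identityʳ _)))
      fwd : ∀ {w} → (E k (proj₁ w) ≡ proj₁ w × G k (proj₁ w)) × (∑ ks (λ l → E l (proj₂ w)) ≡ proj₂ w × (∀ {l} → l ∈ ks → G l (E l (proj₂ w)))) →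
        ∑ (k ∷ ks) (λ l → E l (proj₁ w + proj₂ w)) ≡ proj₁ w + proj₂ w × (∀ {l} → l ∈ k ∷ ks → G l (E l (proj₁ w + proj₂ w)))
      fwd {y , z} ((hy , gy) , (hz , gz)) = cong₂ _+_ (Eky hy hz) (trans (S.Big-cong ks (λ l∈ → Elz hy l∈)) hz) ,
        λ { (here refl) → subst (G k) (sym (Eky hy hz)) gy ; (there l∈) → subst (G _) (sym (Elz hy l∈)) (gz l∈) }
      bwd : ∀ {x} → ∑ (k ∷ ks) (λ l → E l x) ≡ x × (∀ {l} → l ∈ k ∷ ks → G l (E l x)) →
        (E k (E k x) ≡ E k x × G k (E k x)) × (∑ ks (λ l → E l (x - E k x)) ≡ x - E k x × (∀ {l} → l ∈ ks → G l (E l (x - E k x))))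
      bwd {x} (hx , g) = (C.E-idem x , g (here refl)) , (trans (S.Big-cong ks (λ l∈ → Elx l∈)) rest , λ l∈ → subst (G _) (sym (Elx l∈)) (g (there l∈)))
        where
        rest : ∑ ks (λ l → E l x) ≡ x - E k x
        rest = sym (trans (cong (_- E k x) (trans (sym hx) (+-comm (E k x) _))) (trans (+-assoc _ _ _) (trans (cong (∑ ks (λ l → E l x) +_) (-‿inverseʳ (E k x))) (+-identityʳ _))))
      inv₁ : ∀ {w} → (E k (proj₁ w) ≡ proj₁ w × G k (proj₁ w)) × (∑ ks (λ l → E l (proj₂ w)) ≡ proj₂ w × (∀ {l} → l ∈ ks → G l (E l (proj₂ w)))) →
        (E k (proj₁ w + proj₂ w) , (proj₁ w + proj₂ w) - E k (proj₁ w + proj₂ w)) ≡ w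
      inv₁ {y , z} ((hy , gy) , (hz , gz)) = cong₂ _,_ (Eky hy hz) (trans (cong (λ w → (y + z) - w) (Eky hy hz)) (trans (cong (_- y) (+-comm y z)) (trans (+-assoc z y _) (trans (cong (z +_) (-‿inverseʳ y)) (+-identityʳ z)))))
      inv₂ : ∀ {x} → ∑ (k ∷ ks) (λ l → E l x) ≡ x × (∀ {l} → l ∈ k ∷ ks → G l (E l x)) → E k x + (x - E k x) ≡ x
      inv₂ {x} _ = trans (+-comm _ _) (trans (+-assoc x _ _) (trans (cong (x +_) (-‿inverseˡ (E k x))) (+-identityʳ x)))

    card-E : ∀ k → k ∣ n → Card (Im (E k)) (q ℕ.^ φ k)
    card-E k k∣n = subst (Card (Im (E k))) (<-rec Pr step k k∣n) (proj₂ (card-Im (E k)))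
      where
      X : ℕ → ℕ
      X k = proj₁ (card-Im (E k))
      Pr : ℕ → Set
      Pr k = k ∣ n → X k ≡ q ℕ.^ φ k
      step : ∀ m → (∀ {m′} → m′ < m → Pr m′) → Pr m
      step m ih m∣n = prod-cancel X (λ k → q ℕ.^ φ k) m (divisors m) (divisors-unique m) (∈-divisors⁺ m≥1 ∣-refl)
          (λ {k} _ → ℕₚ.m^n>0 q (φ k)) (λ k∈ ne → ih (ℕₚ.≤∧≢⇒< (∣⇒≤ {{>-nonZero m≥1}} (div k∈)) ne) (∣-trans (div k∈) m∣n))
          (trans (card-unique total (card-Fix m m∣n) fixed (λ {x} h → E-sum m∣n x h , λ _ → tt))
            (trans (cong (q ℕ.^_) (sym (φ-sum m m≥1))) (sym (prod-^ q φ (divisors m)))))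
        where
        m≥1 = ∣⇒≥1 n≥1 m∣n
        div : ∀ {k} → k ∈ divisors m → k ∣ m
        div z = ∈-divisors⁻ {m = m} z
        total : Card (λ x → ∑ (divisors m) (λ k → E k x) ≡ x × (∀ {k} → k ∈ divisors m → ⊤)) (prod (map X (divisors m)))
        total = card-components (divisors m) (divisors-unique m) (λ z → ∣-trans (div z) m∣n) (λ _ _ → ⊤) X
          (λ {k} _ → card-cong (λ h → h , tt) proj₁ (proj₂ (card-Im (E k))))
        fixed : ∀ {x} → ∑ (divisors m) (λ k → E k x) ≡ x × (∀ {k} → k ∈ divisors m → ⊤) → Fix m x
        fixed {x} (h , _) = subst (Fix m) h (Fix-∑ (divisors m) _ (λ k∈ → Fix-∣ (div k∈) (Comp.E-Fix (∣-trans (div k∈) m∣n) x)))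

    open Reg reg using (q≥1; o; o≥1; o-one; o-coprime; q-coprime)

    minimal-level : ∀ (Z : ℕ → Set) → (∀ m → Dec (Z m)) → ∀ N → 1 ≤ N → ¬ Z N → ∃ λ m → m ∣ N × ¬ Z m × (∀ l → l ∣ m → ¬ l ≡ m → Z l)
    minimal-level Z Z? = <-rec _ step
      where
      step : ∀ N → (∀ {m} → m < N → 1 ≤ m → ¬ Z m → ∃ λ l → l ∣ m × ¬ Z l × (∀ k → k ∣ l → ¬ k ≡ l → Z k)) →
        1 ≤ N → ¬ Z N → ∃ λ m → m ∣ N × ¬ Z m × (∀ l → l ∣ m → ¬ l ≡ m → Z l)
      step N ih N≥1 nz = search (Any.any? (λ m → ¬? (Z? m) ×-dec ¬? (m ℕ.≟ N)) (divisors N))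
        where
        search : Dec (Any (λ m → ¬ Z m × ¬ m ≡ N) (divisors N)) → ∃ λ m → m ∣ N × ¬ Z m × (∀ l → l ∣ m → ¬ l ≡ m → Z l)
        search (yes a) with find a
        ... | m , m∈ , nzm , ne with ih (ℕₚ.≤∧≢⇒< (∣⇒≤ {{>-nonZero N≥1}} (∈-divisors⁻ {m = N} m∈)) ne) (∣⇒≥1 N≥1 (∈-divisors⁻ {m = N} m∈)) nzm
        ... | l , l∣m , h = l , ∣-trans l∣m (∈-divisors⁻ {m = N} m∈) , h
        search (no na) = N , ∣-refl , nz , λ l l∣N ne → case (Z? l) (λ nzl → na (lose (∈-divisors⁺ N≥1 l∣N) (nzl , ne)))
          where
          case : ∀ {A : Set} → Dec A → (¬ A → ⊥) → A
          case (yes a) _ = a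
          case (no na) k = ⊥-elim (k na)

    record Reduced (f : Op) : Set where
      field
        d m     : ℕ
        m∣      : d ℕ.* m ∣ n
        primes  : ∀ s → Prime s → s ∣ d → s ∣ m
        f′      : Op
        f′I     : Idem d d f′
        nonzero′ : ¬ f′ ≐ zeroOp
        f′≼f    : f′ ≼ f
        f′≼E    : f′ ≼ E (d ℕ.* m)

    module ReduceAt (d N : ℕ) (Nd : N ℕ.* d ≡ n) (f : Op) (fI : Idem d d f) (m : ℕ) (m∣N : m ∣ N)
      (f₁≢0 : ¬ (λ x → f (Avg (d ℕ.* m) x)) ≐ zeroOp)
      (below : ∀ l → l ∣ m → ¬ l ≡ m → (λ x → f (Avg (d ℕ.* l) x)) ≐ zeroOp)
      (d₀ d₁ : ℕ) (d≡ : d ≡ d₀ ℕ.* d₁) (d₁m : Coprime d₁ m) (primes₀ : ∀ s → Prime s → s ∣ d₀ → s ∣ m) where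
      private
        N≥1 : 1 ≤ N
        N≥1 = ∣⇒≥1 n≥1 (divides d (trans (sym Nd) (ℕₚ.*-comm N d)))
        d≥1 : 1 ≤ d
        d≥1 = ∣⇒≥1 n≥1 (divides N (sym Nd))
        instance _ = >-nonZero N≥1
        fA = proj₁ fI
        ff = proj₂ fI
        m≥1 : 1 ≤ m
        m≥1 = ∣⇒≥1 N≥1 m∣N
        dm∣n : ∀ {l} → l ∣ m → d ℕ.* l ∣ n
        dm∣n l∣m = subst (d ℕ.* _ ∣_) (trans (ℕₚ.*-comm d N) Nd) (*-monoʳ-∣ d (∣-trans l∣m m∣N))
        f₁ : Op
        f₁ x = f (Avg (d ℕ.* m) x)
        dm∣ = dm∣n ∣-refl
        f₁A : InA d d f₁
        f₁A = comp fA (Avg∈A dm∣ (m∣m*n m))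
        f₁f : ∀ x → f₁ (f x) ≡ f₁ x
        f₁f x = trans (cong f (A-comm₁ ∣-refl (Avg∈A dm∣ (m∣m*n m)) fA x)) (ff _)
        f₁Avg : ∀ x → f₁ (Avg (d ℕ.* m) x) ≡ f₁ x
        f₁Avg x = cong f (Avg-id dm∣ (Avg-Fix dm∣ x))
        f₁f₁ : ∀ x → f₁ (f₁ x) ≡ f₁ x
        f₁f₁ x = trans (f₁f _) (f₁Avg x)
        d₀∣d : d₀ ∣ d
        d₀∣d = subst (d₀ ∣_) (sym d≡) (m∣m*n d₁)
        d₁∣d : d₁ ∣ d
        d₁∣d = subst (d₁ ∣_) (sym d≡) (n∣m*n d₀)
        d∣n : d ∣ n
        d∣n = divides N (sym Nd)
        d₁≥1 = ∣⇒≥1 d≥1 d₁∣d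
        N∣n : N ∣ n
        N∣n = divides d (trans (sym Nd) (ℕₚ.*-comm N d))
        copN : Coprime N q
        copN = coprime-∣ q-coprime N∣n ∣-refl
        open Coeff N ∣-refl Nd f₁A
        period : ∀ j → coeff (j ℕ.+ m) ≡ coeff j
        period = coeff-period m λ x → cong f (trans (A-comm (1∣ d) (1∣ d) (Avg∈A {1} dm∣ (m∣m*n m)) (S∈A {1} (m∣m*n m)) x) (Avg-Fix dm∣ x))
        k = d₀ ℕ.* m
        k∣n : k ∣ n
        k∣n = ∣-trans (*-monoˡ-∣ m d₀∣d) dm∣
        fix₀ : ∀ j → Fix d₀ (coeff j)
        fix₀ j = go (power-root (q ℕ.^ d₀) o d₁ m (ℕₚ.m^n>0 q d₀) o≥1 m≥1 d₁≥1
            (λ s S s∣m → subst (One s) (trans (ℕₚ.^-*-assoc q o d₀) (trans (cong (q ℕ.^_) (ℕₚ.*-comm o d₀)) (sym (ℕₚ.^-*-assoc q d₀ o)))) (One-^ s (q ℕ.^ o) d₀ (ℕₚ.m^n>0 q o) (o-one s S (∣-trans s∣m (∣-trans m∣N N∣n)))))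
            (Cop.sym (coprime-∣ o-coprime ∣-refl (∣-trans d₁∣d d∣n))) d₁m)
         where
         go : (∃ λ v → Cong m ((q ℕ.^ d₀) ℕ.^ (d₁ ℕ.* v)) (q ℕ.^ d₀)) → Fix d₀ (coeff j)
         go (v , cg) = begin
          S d₀ (coeff j) ≡⟨ coeff-power copN f₁f₁ d₀ j ⟩
          coeff (q ℕ.^ d₀ ℕ.* j) ≡⟨ coeff-Cong m period (Cong-* j (Cong-sym cg)) ⟩
          coeff ((q ℕ.^ d₀) ℕ.^ (d₁ ℕ.* v) ℕ.* j) ≡⟨ cong (λ w → coeff (w ℕ.* j)) (trans (ℕₚ.^-*-assoc q d₀ (d₁ ℕ.* v)) (cong (q ℕ.^_) (trans (sym (ℕₚ.*-assoc d₀ d₁ v)) (cong (ℕ._* v) (sym d≡))))) ⟩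
          coeff (q ℕ.^ (d ℕ.* v) ℕ.* j) ≡⟨ coeff-power copN f₁f₁ (d ℕ.* v) j ⟨
          S (d ℕ.* v) (coeff j) ≡⟨ Fix-∣ (m∣m*n v) (coeff-Fix j) ⟩
          coeff j ∎
          where open ≡-Reasoning
        f₁A₀ : InA d₀ d f₁
        f₁A₀ = ext (λ x → sym (coeff-eq x)) (combA N coeff (λ j _ → fix₀ j))
        f₁Avgk : ∀ x → f₁ (Avg k x) ≡ Avg k (f₁ x)
        f₁Avgk = A-comm ∣-refl (1∣ d) f₁A₀ (Avg∈A {1} k∣n (m∣m*n m))
        f′ : Op
        f′ x = f₁ (Avg k x)
        -- the relative trace from the fixed field of σ^(dm) to that of σ^(d₀m), up to a scalar
        T : Op
        T x = ∑ (downFrom d₁) (λ i → S (k ℕ.* i) x)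
        TA : InA 1 1 T
        TA = ∑A (downFrom d₁) (λ i x → S (k ℕ.* i) x) (λ _ → S∈A (1∣ _))
        T-Fix : ∀ {y} → Fix (d ℕ.* m) y → Fix k (T y)
        T-Fix {y} h = ∑-orbit-Fix k d₁ (subst (λ w → Fix w y) (sym (trans (lem d₀ m d₁) (cong (ℕ._* m) (sym d≡)))) h)
          where
          lem : ∀ a m b → a ℕ.* m ℕ.* b ≡ a ℕ.* b ℕ.* m
          lem = solve-∀
        f′≢0 : ¬ f′ ≐ zeroOp
        f′≢0 z = f₁≢0 λ x → trans (coeff-eq x) (trans (S.Big-cong (downFrom N) (λ {j} j∈ → trans (cong (_* S (d ℕ.* j) x) (coeff0 j (∈-downFrom⁻ j∈))) (zeroˡ _))) (∑-zero (downFrom N)))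
          where
          f₁T : ∀ x → f₁ (T x) ≡ 0#
          f₁T x = begin
            f₁ (T x) ≡⟨ f₁Avg (T x) ⟨
            f₁ (Avg (d ℕ.* m) (T x)) ≡⟨ cong f₁ (commute₁ (Avg∈A dm∣ (1∣ _)) TA x) ⟩
            f₁ (T (Avg (d ℕ.* m) x)) ≡⟨ cong f₁ (Avg-id k∣n (T-Fix (Avg-Fix dm∣ x))) ⟨
            f′ (T (Avg (d ℕ.* m) x)) ≡⟨ z _ ⟩
            0# ∎
            where open ≡-Reasoning
          N′ = N ℕ.* d₁
          N′≡ : N′ ℕ.* d₀ ≡ n
          N′≡ = trans (lem N d₁ d₀) (trans (cong (N ℕ.*_) (sym d≡)) Nd)
            where
            lem : ∀ N a b → N ℕ.* a ℕ.* b ≡ N ℕ.* (b ℕ.* a)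
            lem = solve-∀
          instance _ = >-nonZero (ℕₚ.*-mono-≤ N≥1 d₁≥1)
          I = ℕ × ℕ
          L : List I
          L = cartesianProduct (downFrom N) (downFrom d₁)
          π : I → ℕ
          π (j , i) = (d₁ ℕ.* j ℕ.+ m ℕ.* i) % N′
          ∑-pairs : ∀ {A B : Set} (xs : List A) (ys : List B) (g : A × B → F) → ∑ (cartesianProduct xs ys) g ≡ ∑ xs (λ a → ∑ ys (λ b → g (a , b)))
          ∑-pairs [] ys g = refl
          ∑-pairs (x ∷ xs) ys g = trans (∑-++ (map (x ,_) ys) _ g) (cong₂ _+_ (S.Big-map (x ,_) ys g) (∑-pairs xs ys g))
            where
            ∑-++ : ∀ {C : Set} (us vs : List C) (g : C → F) → ∑ (us ++ vs) g ≡ ∑ us g + ∑ vs g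
            ∑-++ [] vs g = sym (+-identityˡ _)
            ∑-++ (u ∷ us) vs g = trans (cong (g u +_) (∑-++ us vs g)) (sym (+-assoc _ _ _))
          expand : ∀ x → f₁ (T x) ≡ ∑ L (λ (j , i) → coeff j * S (d₀ ℕ.* π (j , i)) x)
          expand x = trans (coeff-eq (T x)) (trans (S.Big-cong (downFrom N) (λ {j} _ → trans (cong (coeff j *_) (S-∑ (d ℕ.* j) (downFrom d₁) _)) (trans (∑-*ˡ (downFrom d₁) _ (coeff j))
              (S.Big-cong (downFrom d₁) (λ {i} _ → cong (coeff j *_) (trans (sym (S-+ (d ℕ.* j) (k ℕ.* i) x)) (trans (cong (λ w → S w x) (trans (cong (λ w → w ℕ.* j ℕ.+ k ℕ.* i) d≡) (lem d₀ d₁ j m i))) (S-% d₀ N′ N′≡ _ x))))))))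
              (sym (∑-pairs (downFrom N) (downFrom d₁) _)))
            where
            lem : ∀ a b j m i → a ℕ.* b ℕ.* j ℕ.+ a ℕ.* m ℕ.* i ≡ a ℕ.* (b ℕ.* j ℕ.+ m ℕ.* i)
            lem = solve-∀
          π-inj : ∀ {j i j₀} → j < N → i < d₁ → j₀ < N → π (j , i) ≡ π (j₀ , 0) → (j , i) ≡ (j₀ , 0)
          π-inj {j} {i} {j₀} jl il j₀l eq = cong₂ _,_ j≡ i≡0
            where
            cg : d₁ ℕ.* j ℕ.+ m ℕ.* i ℕ.+ ((d₁ ℕ.* j₀ ℕ.+ m ℕ.* 0) / N′) ℕ.* N′ ≡ d₁ ℕ.* j₀ ℕ.+ m ℕ.* 0 ℕ.+ ((d₁ ℕ.* j ℕ.+ m ℕ.* i) / N′) ℕ.* N′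
            cg = go (d₁ ℕ.* j ℕ.+ m ℕ.* i) (d₁ ℕ.* j₀ ℕ.+ m ℕ.* 0) eq
              where
              go : ∀ A B → A % N′ ≡ B % N′ → A ℕ.+ (B / N′) ℕ.* N′ ≡ B ℕ.+ (A / N′) ℕ.* N′
              go A B e = trans (cong (ℕ._+ (B / N′) ℕ.* N′) (trans (m≡m%n+[m/n]*n A N′) (cong (ℕ._+ (A / N′) ℕ.* N′) e)))
                 (trans (lem (B % N′) ((A / N′) ℕ.* N′) ((B / N′) ℕ.* N′)) (cong (ℕ._+ (A / N′) ℕ.* N′) (sym (m≡m%n+[m/n]*n B N′))))
                where
                lem : ∀ a b c → a ℕ.+ b ℕ.+ c ≡ a ℕ.+ c ℕ.+ b
                lem = solve-∀
            A′ = (d₁ ℕ.* j₀ ℕ.+ m ℕ.* 0) / N′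
            B′ = (d₁ ℕ.* j ℕ.+ m ℕ.* i) / N′
            cg′ : m ℕ.* i ℕ.+ d₁ ℕ.* (j ℕ.+ A′ ℕ.* N) ≡ d₁ ℕ.* (j₀ ℕ.+ B′ ℕ.* N)
            cg′ = trans (lem1 d₁ j m i A′ N) (trans cg (lem2 d₁ j₀ m B′ N))
              where
              lem1 : ∀ d j m i A N → m ℕ.* i ℕ.+ d ℕ.* (j ℕ.+ A ℕ.* N) ≡ d ℕ.* j ℕ.+ m ℕ.* i ℕ.+ A ℕ.* (N ℕ.* d)
              lem1 = solve-∀
              lem2 : ∀ d j m A N → d ℕ.* j ℕ.+ m ℕ.* 0 ℕ.+ A ℕ.* (N ℕ.* d) ≡ d ℕ.* (j ℕ.+ A ℕ.* N)
              lem2 = solve-∀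
            i≡0 : i ≡ 0
            i≡0 = small (coprime-divisor d₁m (∣m+n∣m⇒∣n (subst (d₁ ∣_) (trans (sym cg′) (ℕₚ.+-comm (m ℕ.* i) _)) (m∣m*n _)) (m∣m*n _))) il
              where
              open import Data.Nat.Divisibility using (∣m+n∣m⇒∣n)
              small : ∀ {i} → d₁ ∣ i → i < d₁ → i ≡ 0
              small {zero} _ _ = refl
              small {suc i} a b = ⊥-elim (ℕₚ.<⇒≱ b (∣⇒≤ a))
            j≡ : j ≡ j₀
            j≡ = trans (sym (m<n⇒m%n≡m jl)) (trans (sym ([m+kn]%n≡m%n j A′ N)) (trans (cong (_% N) jj) (trans ([m+kn]%n≡m%n j₀ B′ N) (m<n⇒m%n≡m j₀l))))
              where
              jj : j ℕ.+ A′ ℕ.* N ≡ j₀ ℕ.+ B′ ℕ.* N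
              jj = ℕₚ.*-cancelˡ-≡ _ _ d₁ {{>-nonZero d₁≥1}} (trans (cong (ℕ._+ d₁ ℕ.* (j ℕ.+ A′ ℕ.* N)) (sym (trans (cong (m ℕ.*_) i≡0) (ℕₚ.*-zeroʳ m)))) cg′)
          coeff0 : ∀ j → j < N → coeff j ≡ 0#
          coeff0 j₀ l = trans (sym (∑-single L π (λ (j , i) → coeff j) (j₀ , 0) (Uniq.cartesianProduct⁺ (Uniq.downFrom⁺ N) (Uniq.downFrom⁺ d₁))
               (∈-cartesianProduct⁺ (∈-downFrom⁺ l) (∈-downFrom⁺ d₁≥1)) (λ {ji} ji∈ e → let (a , b) = ∈-cartesianProduct⁻ (downFrom N) (downFrom d₁) ji∈ in π-inj (∈-downFrom⁻ a) (∈-downFrom⁻ b) l e)))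
             (comb-unique d₀ N′ N′≡ (λ w → ∑ L (λ ji → δ (π ji) w (coeff (proj₁ ji)))) (λ _ → 0#)
               (λ x → trans (sym (collect d₀ N′ (λ ji → coeff (proj₁ ji)) π L (λ ji → m%n<n (d₁ ℕ.* proj₁ ji ℕ.+ m ℕ.* proj₂ ji) N′) x))
                 (trans (sym (expand x)) (trans (f₁T x) (sym (trans (S.Big-cong (downFrom N′) (λ _ → zeroˡ _)) (∑-zero (downFrom N′))))))) (π (j₀ , 0)) (m%n<n _ N′))
        f′E : ∀ x → f′ (E k x) ≡ f′ x
        f′E x = sym (trans (cong f′ (sym (E-sum ∣-refl x (S-n x)))) (trans (∑-A f′A (divisors n) (λ l → E l x))
            (∑-pick (divisors n) (λ l → f′ (E l x)) k (divisors-unique n) (∈-divisors⁺ n≥1 k∣n) (λ {l} l∈ ne → other l (∈-divisors⁻ {m = n} l∈) ne))))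
          where
          f′A : InA d₀ d₀ f′
          f′A = comp (A-mono ∣-refl d₀∣d f₁A₀) (Avg∈A k∣n (m∣m*n m))
          other : ∀ l → l ∣ n → ¬ l ≡ k → f′ (E l x) ≡ 0#
          other l l∣n ne = dec (l ∣? k)
            where
            onto : (∃ λ r → Prime r × r ∣ k × l ∣ k ÷ r) → f′ (E l x) ≡ 0#
            dec : Dec (l ∣ k) → f′ (E l x) ≡ 0#
            dec (no l∤k) = trans (cong f₁ (Comp.E-kill l∣n k∣n l∤k x)) (A-0 f₁A)
            dec (yes l∣k) = onto (Comp.proper-divisor k∣n l∣k ne)
            onto (r , R , r∣k , l∣) = begin
              f₁ (Avg k (E l x)) ≡⟨ cong (λ w → f₁ (Avg k w)) (Avg-id k′∣n (Fix-∣ l∣ (Comp.E-Fix l∣n x))) ⟨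
              f₁ (Avg k (Avg k′ (E l x))) ≡⟨ cong f₁ (Avg-id k∣n (Fix-∣ k′∣k (Avg-Fix k′∣n _))) ⟩
              f₁ (Avg k′ (E l x)) ≡⟨ cong f₁ (Avg-id dm′∣n (subst (λ w → Fix w y) d₁k′ (Fix-∣ (n∣m*n d₁) (Avg-Fix k′∣n _)))) ⟨
              f (Avg (d ℕ.* m) (Avg (d ℕ.* m′) y)) ≡⟨ cong f (Avg-id dm∣ (Fix-∣ (*-monoʳ-∣ d m′∣m) (Avg-Fix dm′∣n y))) ⟩
              f (Avg (d ℕ.* m′) y) ≡⟨ below m′ m′∣m m′≢m y ⟩
              0# ∎
              where
              open ≡-Reasoning
              k′ = k ÷ r
              y = Avg k′ (E l x)
              r∣m : r ∣ m
              r∣m = either (euclidsLemma d₀ m R r∣k)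
                where
                either : r ∣ d₀ ⊎ r ∣ m → r ∣ m
                either (inj₁ a) = primes₀ r R a
                either (inj₂ a) = a
              m′ = quotient r∣m
              m≡ : m ≡ m′ ℕ.* r
              m≡ = _∣_.equality r∣m
              m′∣m : m′ ∣ m
              m′∣m = subst (m′ ∣_) (sym m≡) (m∣m*n r)
              m′≢m : ¬ m′ ≡ m
              m′≢m e = ℕₚ.<⇒≢ (subst (m′ <_) (sym m≡) (ℕₚ.m<m*n m′ r {{>-nonZero (∣⇒≥1 m≥1 m′∣m)}} (prime≥2 R))) e
              k′≡ : k′ ≡ d₀ ℕ.* m′
              k′≡ = trans (cong (_÷ r) (trans (cong (d₀ ℕ.*_) m≡) (sym (ℕₚ.*-assoc d₀ m′ r)))) (*-÷ (d₀ ℕ.* m′) (prime≥1 R))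
              k′∣k : k′ ∣ k
              k′∣k = subst (_∣ k) (sym k′≡) (*-monoʳ-∣ d₀ m′∣m)
              k′∣n = ∣-trans k′∣k k∣n
              dm′∣n = dm∣n m′∣m
              d₁k′ : d₁ ℕ.* k′ ≡ d ℕ.* m′
              d₁k′ = trans (cong (d₁ ℕ.*_) k′≡) (trans (lem d₁ d₀ m′) (cong (ℕ._* m′) (sym d≡)))
                where
                lem : ∀ a b c → a ℕ.* (b ℕ.* c) ≡ b ℕ.* a ℕ.* c
                lem = solve-∀

      reduced : Reduced f
      reduced = record
        { d = d₀ ; m = m ; m∣ = k∣n ; primes = primes₀ ; f′ = f′
        ; f′I = comp (A-mono ∣-refl d₀∣d f₁A₀) (Avg∈A k∣n (m∣m*n m)) ,
            λ x → trans (cong f₁ (sym (f₁Avgk (Avg k x)))) (trans (f₁f₁ _) (cong f₁ (Avg-id k∣n (Avg-Fix k∣n x))))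
        ; nonzero′ = f′≢0
        ; f′≼f = λ x → trans (f₁Avgk (f x)) (trans (cong (Avg k) (f₁f x)) (sym (f₁Avgk x)))
        ; f′≼E = f′E }

    reduce : ∀ d N → N ℕ.* d ≡ n → ∀ f → Idem d d f → ¬ f ≐ zeroOp → Reduced f
    reduce d N Nd f fI f≢0 = finish (minimal-level (λ m → (λ x → f (Avg (d ℕ.* m) x)) ≐ zeroOp) (λ m → ≐? _ _) N
        (∣⇒≥1 n≥1 (divides d (trans (sym Nd) (ℕₚ.*-comm N d))))
        (λ z → f≢0 (λ x → trans (cong f (sym (trans (cong (λ k → Avg k x) (trans (ℕₚ.*-comm d N) Nd)) (Avg-id ∣-refl (S-n x))))) (z x))))
      where
      finish : (∃ λ m → m ∣ N × ¬ (λ x → f (Avg (d ℕ.* m) x)) ≐ zeroOp × (∀ l → l ∣ m → ¬ l ≡ m → (λ x → f (Avg (d ℕ.* l) x)) ≐ zeroOp)) → Reduced f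
      finish (m , m∣N , nz , below) = let (d₀ , d₁ , d≡ , cop , pr) = coprime-split m d (∣⇒≥1 n≥1 (divides N (sym Nd))) in
        ReduceAt.reduced d N Nd f fI m m∣N nz below d₀ d₁ d≡ cop pr

    module Concentrate {k} (k∣n : k ∣ n) (d m s : ℕ) (k≡ : k ≡ d ℕ.* m) (primes : ∀ r → Prime r → r ∣ d → r ∣ m)
      (target : Divisor.C.Target reg k∣n d m s) (s∣n : s ∣ n) (f : Op) (fI : Idem d d f) (f≼E : f ≼ E k) where
      open Divisor.C reg k∣n using (module Target; Mover)
      private
        module Cmp = Comp k∣n
        dm∣n : d ℕ.* m ∣ n
        dm∣n = subst (_∣ n) k≡ k∣n
        d∣n : d ∣ n
        d∣n = ∣-trans (m∣m*n m) dm∣n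
        m∣k : m ∣ k
        m∣k = subst (m ∣_) (sym k≡) (n∣m*n d)
        N = quotient d∣n
        Nd : N ℕ.* d ≡ n
        Nd = sym (_∣_.equality d∣n)
        d≥1 = ∣⇒≥1 n≥1 d∣n
        m≥1 = ∣⇒≥1 Cmp.k≥1 m∣k
        N∣n : N ∣ n
        N∣n = divides d (trans (sym Nd) (ℕₚ.*-comm N d))
        instance _ = >-nonZero (∣⇒≥1 n≥1 N∣n)
        fA = proj₁ fI
        ff = proj₂ fI
        copN : Coprime N q
        copN = coprime-∣ q-coprime N∣n ∣-refl
        open Coeff N ∣-refl Nd fA
        period : ∀ j → coeff (j ℕ.+ m) ≡ coeff j
        period = coeff-period m λ x → trans (sym (f≼E _)) (trans (cong f (trans (commute₁ Cmp.E∈A₁ (S∈A (1∣ _)) x) (subst (λ w → Fix w (E k x)) k≡ (Cmp.E-Fix x)))) (f≼E x))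
        power : ∀ i j → S i (coeff j) ≡ coeff (q ℕ.^ i ℕ.* j)
        power = coeff-power copN ff
        fixes : ∀ j → Fix s (coeff j)
        fixes j = go (linear-solve d (ord m q) s (pos (Divisor.orderOf reg k∣n m m∣k)) (Target.fixes target))
         where
         go : (∃ λ v → ∃ λ w → ∃ λ w′ → d ℕ.* v ℕ.+ ord m q ℕ.* w ≡ s ℕ.+ ord m q ℕ.* w′) → Fix s (coeff j)
         go (v , w , w′ , eq) = begin
          S s (coeff j) ≡⟨ power s j ⟩
          coeff (q ℕ.^ s ℕ.* j) ≡⟨ coeff-Cong m period (Cong-* j (Cong-sym (Cong-^ {o = ord m q} (d ℕ.* v) s w w′ q≥1 (one (Divisor.orderOf reg k∣n m m∣k)) eq))) ⟩
          coeff (q ℕ.^ (d ℕ.* v) ℕ.* j) ≡⟨ power (d ℕ.* v) j ⟨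
          S (d ℕ.* v) (coeff j) ≡⟨ Fix-∣ (m∣m*n v) (coeff-Fix j) ⟩
          coeff j ∎
          where open ≡-Reasoning
        module Move (j u r k′ : ℕ) (R : Prime r) (k≡k′r : k ≡ k′ ℕ.* r) (k′∣ : k′ ∣ pred (q ℕ.^ (d ℕ.* u)) ℕ.* (d ℕ.* j))
          (k∤ : ¬ k ∣ pred (q ℕ.^ (d ℕ.* u)) ℕ.* (d ℕ.* j)) (one-r : One r (q ℕ.^ (d ℕ.* u))) where
          y = q ℕ.^ (d ℕ.* u)
          y≡ : y ≡ suc (pred y)
          y≡ = sym (ℕₚ.suc-pred y {{ℕₚ.m^n≢0 q (d ℕ.* u)}})
          r∣m : r ∣ m
          r∣m with euclidsLemma d m R (subst (r ∣_) k≡ (subst (r ∣_) (sym k≡k′r) (n∣m*n k′)))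
          ... | inj₁ a = primes r R a
          ... | inj₂ a = a
          m′ = quotient r∣m
          m≡ : m ≡ m′ ℕ.* r
          m≡ = _∣_.equality r∣m
          k′≡ : k′ ≡ d ℕ.* m′
          k′≡ = ℕₚ.*-cancelʳ-≡ k′ (d ℕ.* m′) r {{prime⇒nonZero R}} (trans (sym k≡k′r) (trans k≡ (trans (cong (d ℕ.*_) m≡) (sym (ℕₚ.*-assoc d m′ r)))))
          swap : ∀ a → a ℕ.* (d ℕ.* j) ≡ d ℕ.* (a ℕ.* j)
          swap a = lem a d j
            where
            lem : ∀ a d j → a ℕ.* (d ℕ.* j) ≡ d ℕ.* (a ℕ.* j)
            lem = solve-∀
          m′∣ : m′ ∣ pred y ℕ.* j
          m′∣ = *-cancelˡ-∣ d {{>-nonZero d≥1}} (subst₂ _∣_ k′≡ (swap (pred y)) k′∣)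
          z = quotient m′∣
          z≡ : pred y ℕ.* j ≡ z ℕ.* m′
          z≡ = _∣_.equality m′∣
          r∤z : ¬ r ∣ z
          r∤z h = k∤ (subst₂ _∣_ (sym k≡) (sym (swap (pred y))) (*-monoʳ-∣ d (subst₂ _∣_ (trans (ℕₚ.*-comm r m′) (sym m≡)) (sym z≡) (*-monoˡ-∣ m′ h))))
          step : ∀ a → coeff (j ℕ.+ z ℕ.* m′ ℕ.* suc a) ≡ coeff (j ℕ.+ z ℕ.* m′ ℕ.* a)
          step a = begin
            coeff (j ℕ.+ z ℕ.* m′ ℕ.* suc a) ≡⟨ coeff-Cong m period cg ⟩
            coeff (y ℕ.* (j ℕ.+ z ℕ.* m′ ℕ.* a)) ≡⟨ power (d ℕ.* u) _ ⟨
            S (d ℕ.* u) (coeff (j ℕ.+ z ℕ.* m′ ℕ.* a)) ≡⟨ Fix-∣ (m∣m*n u) (coeff-Fix _) ⟩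
            coeff (j ℕ.+ z ℕ.* m′ ℕ.* a) ∎
            where
            open ≡-Reasoning
            g = quotient one-r
            cg : Cong m (j ℕ.+ z ℕ.* m′ ℕ.* suc a) (y ℕ.* (j ℕ.+ z ℕ.* m′ ℕ.* a))
            cg = g ℕ.* z ℕ.* a , 0 , trans (cong (λ w → j ℕ.+ z ℕ.* m′ ℕ.* suc a ℕ.+ g ℕ.* z ℕ.* a ℕ.* w) m≡)
               (trans (lem1 j z m′ a g r) (trans (cong₂ (λ v w → j ℕ.+ v ℕ.+ z ℕ.* m′ ℕ.* a ℕ.+ w ℕ.* (z ℕ.* m′ ℕ.* a)) (sym z≡) (sym (_∣_.equality one-r)))
                 (trans (lem2 j (pred y) (z ℕ.* m′ ℕ.* a)) (trans (cong (ℕ._* (j ℕ.+ z ℕ.* m′ ℕ.* a)) (sym y≡)) (sym (ℕₚ.+-identityʳ _))))))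
              where
              lem1 : ∀ j z m a g r → j ℕ.+ z ℕ.* m ℕ.* suc a ℕ.+ g ℕ.* z ℕ.* a ℕ.* (m ℕ.* r) ≡ j ℕ.+ z ℕ.* m ℕ.+ z ℕ.* m ℕ.* a ℕ.+ g ℕ.* r ℕ.* (z ℕ.* m ℕ.* a)
              lem1 = solve-∀
              lem2 : ∀ j p w → j ℕ.+ p ℕ.* j ℕ.+ w ℕ.+ p ℕ.* w ≡ suc p ℕ.* (j ℕ.+ w)
              lem2 = solve-∀
          steps : ∀ a → coeff (j ℕ.+ z ℕ.* m′ ℕ.* a) ≡ coeff j
          steps zero = cong coeff (trans (cong (j ℕ.+_) (ℕₚ.*-zeroʳ (z ℕ.* m′))) (ℕₚ.+-identityʳ j))
          steps (suc a) = trans (step a) (steps a)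
          constant : ∀ a → coeff (j ℕ.+ m′ ℕ.* a) ≡ coeff j
          constant a = go (linear-solve z r 1 (prime≥1 R) (subst (_∣ 1) (sym (Cop.coprime⇒gcd≡1 (Cop.sym (prime-coprime R r∤z)))) ∣-refl))
           where
           go : (∃ λ v → ∃ λ w → ∃ λ w′ → z ℕ.* v ℕ.+ r ℕ.* w ≡ 1 ℕ.+ r ℕ.* w′) → coeff (j ℕ.+ m′ ℕ.* a) ≡ coeff j
           go (v , w , w′ , eq) = trans (coeff-Cong m period (a ℕ.* w′ , a ℕ.* w , cg)) (steps (v ℕ.* a))
            where
            cg : j ℕ.+ m′ ℕ.* a ℕ.+ a ℕ.* w′ ℕ.* m ≡ j ℕ.+ z ℕ.* m′ ℕ.* (v ℕ.* a) ℕ.+ a ℕ.* w ℕ.* m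
            cg = trans (cong (λ x → j ℕ.+ m′ ℕ.* a ℕ.+ a ℕ.* w′ ℕ.* x) m≡) (trans (lem1 j m′ a w′ r) (trans (cong (λ x → j ℕ.+ m′ ℕ.* a ℕ.* x) (sym eq))
               (trans (lem2 j m′ a z v r w) (cong (λ x → j ℕ.+ z ℕ.* m′ ℕ.* (v ℕ.* a) ℕ.+ a ℕ.* w ℕ.* x) (sym m≡)))))
              where
              lem1 : ∀ j m a w r → j ℕ.+ m ℕ.* a ℕ.+ a ℕ.* w ℕ.* (m ℕ.* r) ≡ j ℕ.+ m ℕ.* a ℕ.* (1 ℕ.+ r ℕ.* w)
              lem1 = solve-∀
              lem2 : ∀ j m a z v r w → j ℕ.+ m ℕ.* a ℕ.* (z ℕ.* v ℕ.+ r ℕ.* w) ≡ j ℕ.+ z ℕ.* m ℕ.* (v ℕ.* a) ℕ.+ a ℕ.* w ℕ.* (m ℕ.* r)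
              lem2 = solve-∀
          r∣k : r ∣ k
          r∣k = subst (r ∣_) (sym k≡k′r) (n∣m*n k′)
          k÷r : k ÷ r ≡ k′
          k÷r = trans (cong (_÷ r) k≡k′r) (*-÷ k′ (prime≥1 R))
          k′∣n : k′ ∣ n
          k′∣n = ∣-trans (subst (k′ ∣_) (sym k≡k′r) (m∣m*n r)) k∣n
          M = n ÷ k′
          X : Op
          X x = ∑ (downFrom M) (λ i → S (k′ ℕ.* i) x)
          fX : ∀ x → f (X x) ≡ 0#
          fX x = *-cancelˡ ρ (λ e → 1≢0 (trans (sym (recip-spec _ (M·1≢0 k′∣n))) (trans (cong ((M · 1#) *_) e) (zeroʳ _))))
            (trans (trans (sym (A-comm ∣-refl (1∣ d) fA (scal {1} {d} (recip-Fix k′∣n 1)) (X x))) (fAvg x)) (sym (zeroʳ ρ)))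
            where
            ρ = recip (M · 1#)
            fAvg : ∀ x → f (Avg k′ x) ≡ 0#
            fAvg x = trans (sym (f≼E _)) (trans (cong f (trans (commute₁ Cmp.E∈A₁ (Avg∈A k′∣n (1∣ k′)) x) (subst (λ w → Avg w (E k x) ≡ 0#) k÷r (Cmp.Avg÷-E r R r∣k x)))) (A-0 fA))
          D : ℕ → F
          D j = ∑ (downFrom M) (λ i → coeff (j ℕ.+ (N ∸ 1) ℕ.* (m′ ℕ.* i)))
          fX-comb : ∀ x → f (X x) ≡ comb d N D x
          fX-comb x = trans (∑-A fA (downFrom M) (λ i → S (k′ ℕ.* i) x)) (trans (S.Big-cong (downFrom M) (λ {i} _ → trans (cong (λ w → f (S w x)) (trans (cong (ℕ._* i) k′≡) (ℕₚ.*-assoc d m′ i))) (coeff-shift (m′ ℕ.* i) x)))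
            (trans (∑-swap (downFrom M) (downFrom N) _) (S.Big-cong (downFrom N) (λ {j} _ → sym (∑-*ʳ (downFrom M) _ (S (d ℕ.* j) x))))))
          D-const : D (j % N) ≡ M · coeff j
          D-const = trans (S.Big-cong (downFrom M) (λ {i} _ → trans (sym (coeff-N _ (j / N))) (trans (cong coeff (lem i)) (constant ((N ∸ 1) ℕ.* i)))))
            (trans (∑-const (downFrom M) (coeff j)) (cong (_· coeff j) (length-downFrom M)))
            where
            lem : ∀ i → j % N ℕ.+ (N ∸ 1) ℕ.* (m′ ℕ.* i) ℕ.+ j / N ℕ.* N ≡ j ℕ.+ m′ ℕ.* ((N ∸ 1) ℕ.* i)
            lem i = trans (l1 (j % N) (N ∸ 1) m′ i (j / N ℕ.* N)) (cong (ℕ._+ m′ ℕ.* ((N ∸ 1) ℕ.* i)) (sym (m≡m%n+[m/n]*n j N)))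
              where
              l1 : ∀ a b m i c → a ℕ.+ b ℕ.* (m ℕ.* i) ℕ.+ c ≡ a ℕ.+ c ℕ.+ m ℕ.* (b ℕ.* i)
              l1 = solve-∀
          sum0 : M · coeff j ≡ 0#
          sum0 = trans (sym D-const) (comb-unique d N Nd D (λ _ → 0#) (λ x → trans (sym (fX-comb x)) (trans (fX x) (sym (trans (S.Big-cong (downFrom N) (λ _ → zeroˡ _)) (∑-zero (downFrom N)))))) (j % N) (m%n<n j N))
          finish : coeff j ≡ 0#
          finish = *-cancelˡ (M · 1#) (M·1≢0 k′∣n) (trans (trans (×-assoc-* M 1# (coeff j)) (trans (cong (M ·_) (*-identityˡ (coeff j))) sum0)) (sym (zeroʳ _)))

        support : ∀ j → ¬ s ∣ d ℕ.* j → coeff j ≡ 0#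
        support j s∤ = go (Target.moves target (d ℕ.* j) (m∣m*n j) s∤)
          where
          go : Mover d (d ℕ.* j) → coeff j ≡ 0#
          go (u , r , k′ , R , k≡k′r , k′∣ , k∤ , one-r) = Move.finish j u r k′ R k≡k′r k′∣ k∤ one-r

      concentrated : Idem s s f
      concentrated = ext (λ x → sym (coeff-eq x)) (∑A (downFrom N) (λ j x → coeff j * S (d ℕ.* j) x) (λ {j} _ → term j)) , ff
        where
        term : ∀ j → InA s s (λ x → coeff j * S (d ℕ.* j) x)
        term j = dec (s ∣? d ℕ.* j)
          where
          dec : Dec (s ∣ d ℕ.* j) → InA s s (λ x → coeff j * S (d ℕ.* j) x)
          dec (yes s∣) = comp (scal (fixes j)) (S∈A s∣)
          dec (no s∤) = ext (λ x → sym (trans (cong (_* S (d ℕ.* j) x) (support j s∤)) (zeroˡ _))) zeroA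

    Good : (Op → Set) → Op → F → Set
    Good 𝒯 f w = Im f w × (∀ h → 𝒯 h → ¬ h ≐ zeroOp → h ≼ f → ¬ h w ≡ 0#)

    record Sum (f g h : Op) : Set where
      field
        g+ : ∀ x y → g (x + y) ≡ g x + g y
        h+ : ∀ x y → h (x + y) ≡ h x + h y
        gh : ∀ x → g (h x) ≡ 0#
        hg : ∀ x → h (g x) ≡ 0#
        gg : ∀ x → g (g x) ≡ g x
        hh : ∀ x → h (h x) ≡ h x
        f≡ : ∀ x → f x ≡ g x + h x

      left : ∀ {a b} → Im g a → Im h b → g (a + b) ≡ a
      left {a} {b} ga hb = trans (g+ a b) (trans (cong₂ _+_ ga (trans (cong g (sym hb)) (gh b))) (+-identityʳ a))
      right : ∀ {a b} → Im g a → Im h b → h (a + b) ≡ b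
      right {a} {b} ga hb = trans (h+ a b) (trans (cong₂ _+_ (trans (cong h (sym ga)) (hg a)) hb) (+-identityˡ b))
      whole : ∀ {a b} → Im g a → Im h b → Im f (a + b)
      whole ga hb = trans (f≡ _) (cong₂ _+_ (left ga hb) (right ga hb))

      card-sum : ∀ {G H K : F → Set} {a b} → (∀ {x} → G x → Im g x) → (∀ {x} → H x → Im h x) → (∀ {x} → K x → Im f x) →
        (∀ {x y} → G x → H y → K (x + y)) → (∀ {x} → K x → G (g x)) → (∀ {x} → K x → H (h x)) → Card G a → Card H b → Card K (a ℕ.* b)
      card-sum gi hi ki to fg fh c d = card-bij (λ (x , y) → x + y) (λ x → g x , h x) (λ (a , b) → to a b) (λ k → fg k , fh k)
        (λ (a , b) → cong₂ _,_ (left (gi a) (hi b)) (right (gi a) (hi b))) (λ {x} k → trans (sym (f≡ x)) (ki k)) (card-× c d)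

      card-Im-sum : ∀ {a b} → Card (Im g) a → Card (Im h) b → Card (Im f) (a ℕ.* b)
      card-Im-sum = card-sum (λ x → x) (λ x → x) (λ x → x) whole (λ {x} _ → gg x) (λ {x} _ → hh x)

    module Family (s t N : ℕ) (s∣t : s ∣ t) (Nt : N ℕ.* t ≡ n) (𝒯 : Op → Set)
      (𝒯-+ : ∀ {h} → 𝒯 h → ∀ x y → h (x + y) ≡ h x + h y) (𝒯-0 : ∀ {h} → 𝒯 h → h 0# ≡ 0#)
      (𝒯-comm : ∀ {h f} → 𝒯 h → Idem s t f → ∀ x → h (f x) ≡ f (h x))
      (𝒯-comp : ∀ {h f} → 𝒯 h → Idem s t f → 𝒯 (λ x → h (f x)))
      (E₀ : Op) (X Y : ℕ)
      (minimal : ∀ f → Idem s t f → Minimal s t f → f ≼ E₀ → Card (Im f) X × Card (Good 𝒯 f) Y) where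
      open WithA s t N s∣t Nt

      Pr : Op → Set
      Pr f = f ≼ E₀ → ∃ λ m → Card (Im f) (X ℕ.^ m) × Card (Good 𝒯 f) (Y ℕ.^ m)

      count : ∀ f → Idem s t f → Pr f
      count = idem-ind Pr zero-case (λ f fI fM le → 1 , let (a , b) = minimal f fI fM le in
          subst (Card (Im f)) (sym (ℕₚ.*-identityʳ X)) a , subst (Card (Good 𝒯 f)) (sym (ℕₚ.*-identityʳ Y)) b) join
        where
        zero-case : ∀ {f} → f ≐ zeroOp → Pr f
        zero-case {f} z _ = 0 , card-cong (λ { refl → z 0# }) (λ h → trans (sym h) (z _)) (card-one 0#) ,
          card-cong (λ { refl → z 0# , λ h hT hz le _ → hz (λ x → trans (sym (le x)) (trans (cong h (z x)) (𝒯-0 hT))) }) (λ (h , _) → trans (sym h) (z _)) (card-one 0#)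
        join : ∀ f g h → Idem s t f → Idem s t g → Idem s t h → g ≼ f → h ≼ f → (∀ x → g (h x) ≡ 0#) → (∀ x → h (g x) ≡ 0#) →
           (∀ x → f x ≡ g x + h x) → Pr g → Pr h → Pr f
        join f g h fI gI hI g≼f h≼f gh hg fgh pg ph f≼E = combine (pg (below g≼f gI)) (ph (below h≼f hI))
          where
          below : ∀ {g} → g ≼ f → Idem s t g → g ≼ E₀
          below {g} g≼f gI x = trans (sym (g≼f (E₀ x))) (trans (cong g (f≼E x)) (g≼f x))
          Sm : Sum f g h
          Sm = record { g+ = A-+ (proj₁ gI) ; h+ = A-+ (proj₁ hI) ; gh = gh ; hg = hg ; gg = proj₂ gI ; hh = proj₂ hI ; f≡ = fgh }
          open Sum Sm using (card-sum; card-Im-sum; whole; left; right)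
          part : ∀ {g w} → Idem s t g → g ≼ f → Good 𝒯 f w → Good 𝒯 g (g w)
          part {g} {w} gI le (fw , avoid) = proj₂ gI w , λ k kT kz k≼g z → avoid k kT kz
            (λ x → trans (sym (k≼g (f x))) (trans (cong k (le x)) (k≼g x))) (trans (sym (k≼g w)) z)
          whole-good : ∀ {a b} → Good 𝒯 g a → Good 𝒯 h b → Good 𝒯 f (a + b)
          whole-good {a} {b} (ga , an) (hb , bn) = whole ga hb , λ k kT kz k≼f z → decide k kT kz k≼f z (≐? (λ x → k (g x)) zeroOp)
            where
            decide : ∀ k → 𝒯 k → ¬ k ≐ zeroOp → k ≼ f → k (a + b) ≡ 0# → Dec ((λ x → k (g x)) ≐ zeroOp) → ⊥
            decide k kT kz k≼f z (no ne) = an (λ x → k (g x)) (𝒯-comp kT gI) ne (λ x → cong k (proj₂ gI x))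
               (trans (cong k (trans ga (sym (left ga hb)))) (trans (𝒯-comm kT gI (a + b)) (trans (cong g z) (A-0 (proj₁ gI)))))
            decide k kT kz k≼f z (yes e) = bn (λ x → k (h x)) (𝒯-comp kT hI)
               (λ e′ → kz (λ x → trans (sym (k≼f x)) (trans (cong k (fgh x)) (trans (𝒯-+ kT _ _) (trans (cong₂ _+_ (e x) (e′ x)) (+-identityˡ 0#))))))
               (λ x → cong k (proj₂ hI x))
               (trans (cong k (trans hb (sym (right ga hb)))) (trans (𝒯-comm kT hI (a + b)) (trans (cong h z) (A-0 (proj₁ hI)))))
          combine : (∃ λ m → Card (Im g) (X ℕ.^ m) × Card (Good 𝒯 g) (Y ℕ.^ m)) → (∃ λ m → Card (Im h) (X ℕ.^ m) × Card (Good 𝒯 h) (Y ℕ.^ m)) →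
            ∃ λ m → Card (Im f) (X ℕ.^ m) × Card (Good 𝒯 f) (Y ℕ.^ m)
          combine (a , ia , ga) (b , ib , gb) = a ℕ.+ b ,
            subst (Card (Im f)) (sym (ℕₚ.^-distribˡ-+-* X a b)) (card-Im-sum ia ib) ,
            subst (Card (Good 𝒯 f)) (sym (ℕₚ.^-distribˡ-+-* Y a b))
              (card-sum proj₁ proj₁ proj₁ whole-good (part gI g≼f) (part hI h≼f) ga gb)

    module SizeAt {k} (k∣n : k ∣ n) (s N : ℕ) (s≥1 : 1 ≤ s) (s∣k : s ∣ k) (s∣÷ : ∀ r → Prime r → r ∣ k → s ∣ k ÷ r) (Ns : N ℕ.* s ≡ n) where
      private
        module Cmp = Comp k∣n
      N∣n : N ∣ n
      N∣n = divides s (trans (sym Ns) (ℕₚ.*-comm N s))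
      copN : Coprime N q
      copN = coprime-∣ q-coprime N∣n ∣-refl
      private
        module W = WithA s s N ∣-refl Ns
        module R = WithA.Regular s s N ∣-refl Ns copN s≥1
      open W using (splits) public
      open R using (_^A_; ^A-congˡ) public
      open W hiding (splits)
      open R hiding (_^A_; ^A-congˡ)

      E∈ : InA 1 s (E k)
      E∈ = Cmp.E∈A s∣k s∣÷

      module Below {f : Op} (fA : InA s s f) (f≼E : f ≼ E k) where
        E-f : ∀ x → E k (f x) ≡ f x
        E-f x = trans (A-comm (1∣ s) ∣-refl E∈ fA x) (f≼E x)

        fixK : ∀ x → Fix k (f x)
        fixK x = subst (Fix k) (E-f x) (Cmp.E-Fix (f x))

        order∣ : ¬ f ≐ zeroOp → ∀ a → (∀ x → Fix a (f x)) → k ∣ a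
        order∣ nz a h = decide (k ∣? gcd a k)
          where
          decide : Dec (k ∣ gcd a k) → k ∣ a
          decide (yes d) = ∣-trans d (gcd[m,n]∣m a k)
          decide (no nd) = ⊥-elim (nz λ x → trans (sym (Avg-id g∣n (Fix-gcd a k (h x) (fixK x)))) (trans (cong (Avg (gcd a k)) (sym (E-f x))) (Cmp.E-kill g∣n nd (f x))))
            where
            g∣n : gcd a k ∣ n
            g∣n = ∣-trans (gcd[m,n]∣n a k) k∣n

        agree : ¬ f ≐ zeroOp → ∀ c t D → (∀ u → k ∣ c ℕ.* pred (q ℕ.^ (t ℕ.* u)) → D ∣ u) → ∀ i j → i < D → j < D →
          (∀ x → S (c ℕ.* q ℕ.^ (t ℕ.* i)) (f x) ≡ S (c ℕ.* q ℕ.^ (t ℕ.* j)) (f x)) → i ≡ j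
        agree nz c t D ord i j i<D j<D h = either (ℕₚ.≤-total i j)
          where
          copow : ∀ i → Coprime k (q ℕ.^ i)
          copow zero (_ , d) = ℕₚ.≤-antisym (∣⇒≤ d) (∣⇒≥1 (s≤s z≤n) d)
          copow (suc i) = coprime-*ʳ Cmp.k≥1 (coprime-∣ q-coprime k∣n ∣-refl) (copow i)
          small : ∀ {u} → D ∣ u → u < D → u ≡ 0
          small {zero} _ _ = refl
          small {suc u} a b = ⊥-elim (ℕₚ.<⇒≱ b (∣⇒≤ a))
          go : ∀ i j → i ≤ j → j < D → (∀ x → S (c ℕ.* q ℕ.^ (t ℕ.* i)) (f x) ≡ S (c ℕ.* q ℕ.^ (t ℕ.* j)) (f x)) → i ≡ j
          go i j le lt h = ℕₚ.≤-antisym le (ℕₚ.m∸n≡0⇒m≤n (small (ord (j ∸ i) (coprime-divisor (copow (t ℕ.* i)) (order∣ nz _ fixed))) (ℕₚ.≤-<-trans (ℕₚ.m∸n≤m j i) lt)))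
            where
            a = q ℕ.^ (t ℕ.* i)
            b = q ℕ.^ (t ℕ.* (j ∸ i))
            b≡ : b ≡ suc (pred b)
            b≡ = sym (ℕₚ.suc-pred b {{ℕₚ.m^n≢0 q (t ℕ.* (j ∸ i))}})
            qj : q ℕ.^ (t ℕ.* j) ≡ a ℕ.* b
            qj = trans (cong (λ w → q ℕ.^ (t ℕ.* w)) (sym (ℕₚ.m+[n∸m]≡n le))) (trans (cong (q ℕ.^_) (ℕₚ.*-distribˡ-+ t i (j ∸ i))) (ℕₚ.^-distribˡ-+-* q (t ℕ.* i) _))
            exp : c ℕ.* q ℕ.^ (t ℕ.* j) ≡ c ℕ.* a ℕ.+ a ℕ.* (c ℕ.* pred b)
            exp = trans (cong (c ℕ.*_) (trans qj (cong (a ℕ.*_) b≡))) (lem c a (pred b))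
              where
              lem : ∀ c a b → c ℕ.* (a ℕ.* suc b) ≡ c ℕ.* a ℕ.+ a ℕ.* (c ℕ.* b)
              lem = solve-∀
            fixed : ∀ x → Fix (a ℕ.* (c ℕ.* pred b)) (f x)
            fixed x = S-inj (c ℕ.* a) (trans (sym (S-+ (c ℕ.* a) _ (f x))) (trans (cong (λ w → S w (f x)) (sym exp)) (sym (h x))))
          either : i ≤ j ⊎ j ≤ i → i ≡ j
          either (inj₁ le) = go i j le j<D h
          either (inj₂ le) = sym (go j i le i<D (λ x → sym (h x)))

      module Size {f : Op} (fI : Idem s s f) (fM : Minimal s s f) (f≼E : f ≼ E k) where
        private
          module M = AtMinimal fI fM
        open M using (Endo; ⟦_⟧; fixf; im-lower; Separated; X) public
        open M hiding (Endo; ⟦_⟧; fixf; im-lower; Separated; X)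
        open Below (proj₁ fI) f≼E public
        private
          fA = proj₁ fI
          ff = proj₂ fI
        open import Algebra.Properties.CommutativeSemiring.Exp Ring.commutativeSemiring using () renaming (^-distrib-* to ^A-distrib-*)

        scal-power : ∀ {a} (h : Fix s a) m → 1 ≤ m → ∀ x → proj₁ (scalEl h ^A m) x ≡ a ^ m * f x
        scal-power {a} h (suc zero) _ x = cong (_* f x) (sym (*-identityʳ a))
        scal-power {a} h (suc (suc m)) _ x = trans (cong (λ w → a * f w) (scal-power h (suc m) (s≤s z≤n) x))
           (trans (cong (a *_) (trans (A-comm₁ ∣-refl fA (scal (fixp (suc m))) (f x)) (cong (a ^ suc m *_) (ff x)))) (sym (*-assoc a (a ^ suc m) (f x))))
          where
          fixp : ∀ m → Fix s (a ^ m)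
          fixp zero = S-1# s
          fixp (suc m) = Fix-mul h (fixp m)

        power-+ : ∀ i (a b : El) x → proj₁ ((a Ring.+ b) ^A (q ℕ.^ i)) x ≡ proj₁ (a ^A (q ℕ.^ i)) x + proj₁ (b ^A (q ℕ.^ i)) x
        power-+ i a b = subst (λ m → ∀ x → proj₁ ((a Ring.+ b) ^A m) x ≡ proj₁ (a ^A m) x + proj₁ (b ^A m) x) (sym (q^≡ i))
          (CharP.frobenius^-+ ringA p P (λ f x → trans (·A-eval p f x) (char _)) (e ℕ.* i) a b)

        power-* : ∀ m (a b : El) x → proj₁ ((a Ring.* b) ^A m) x ≡ proj₁ (a ^A m) (proj₁ (b ^A m) x)
        power-* m a b = ^A-distrib-* a b m

        power-0 : ∀ m → 1 ≤ m → ∀ x → proj₁ (Ring.0# ^A m) x ≡ 0#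
        power-0 (suc m) _ x = refl

        X-power : ∀ m x → proj₁ (X ^A m) x ≡ S (s ℕ.* m) x
        X-power zero x = sym (trans (cong (λ w → S w x) (ℕₚ.*-zeroʳ s)) (S-0 x))
        X-power (suc m) x = trans (cong (S s) (X-power m x)) (trans (sym (S-+ s (s ℕ.* m) x)) (cong (λ w → S w x) (sym (ℕₚ.*-suc s m))))

        frobEndo : ℕ → Endo
        frobEndo j = record
          { ⟦_⟧ = λ a → a ^A (q ℕ.^ (s ℕ.* j))
          ; hom≈ = λ {a} {b} h → ^A-congˡ (q ℕ.^ (s ℕ.* j)) {a} {b} h
          ; hom+ = power-+ (s ℕ.* j)
          ; hom* = power-* (q ℕ.^ (s ℕ.* j))
          ; hom0 = power-0 (q ℕ.^ (s ℕ.* j)) (ℕₚ.m^n>0 q (s ℕ.* j))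
          ; fixf = λ {a} h x → trans (scal-power h (q ℕ.^ (s ℕ.* j)) (ℕₚ.m^n>0 q (s ℕ.* j)) x) (cong (_* f x) (trans (sym (S-def (s ℕ.* j) a)) (Fix-∣ (m∣m*n j) h))) }

        downFrom-pairs : ∀ {Q : ℕ → ℕ → Set} D → (∀ {i j} → i < D → j < D → ¬ i ≡ j → Q i j) → AllPairs Q (downFrom D)
        downFrom-pairs zero h = []
        downFrom-pairs (suc D) h = All.tabulate (λ z → h ℕₚ.≤-refl (ℕₚ.m≤n⇒m≤1+n (∈-downFrom⁻ z)) (λ e → ℕₚ.<⇒≢ (∈-downFrom⁻ z) (sym e)))
            ∷ downFrom-pairs D (λ a b → h (ℕₚ.m≤n⇒m≤1+n a) (ℕₚ.m≤n⇒m≤1+n b))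
          where open import Data.List.Membership.Propositional.Properties using (∈-downFrom⁻)

        frobEndo-X : ∀ j x → proj₁ (⟦ frobEndo j ⟧ X) (f x) ≡ S (s ℕ.* q ℕ.^ (s ℕ.* j)) (f x)
        frobEndo-X j x = X-power (q ℕ.^ (s ℕ.* j)) (f x)

        upper : ∀ D → 1 ≤ D → k ∣ s ℕ.* pred (q ℕ.^ (s ℕ.* D)) → ∀ {m} → Card (Im f) m → m ≤ q ℕ.^ (s ℕ.* D)
        upper D D≥1 k∣ = im-upper refl (s ℕ.* D) (ℕₚ.*-mono-≤ s≥1 D≥1) (m∣m*n D) red
          where
          Q = q ℕ.^ (s ℕ.* D)
          red : ∀ x j → S (s ℕ.* (Q ℕ.* j)) (f x) ≡ S (s ℕ.* j) (f x)
          red x j = trans (cong (λ w → S w (f x)) (trans (cong (λ w → s ℕ.* (w ℕ.* j)) (sym (ℕₚ.suc-pred Q {{ℕₚ.m^n≢0 q (s ℕ.* D)}}))) (lem s (pred Q) j)))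
             (trans (S-+ (s ℕ.* j) _ (f x)) (cong (S (s ℕ.* j)) (Fix-∣ (∣m⇒∣m*n j k∣) (fixK x))))
            where
            lem : ∀ s Q j → s ℕ.* (suc Q ℕ.* j) ≡ s ℕ.* j ℕ.+ s ℕ.* Q ℕ.* j
            lem = solve-∀

        card-minimal : ∀ D → 1 ≤ D → k ∣ s ℕ.* pred (q ℕ.^ (s ℕ.* D)) → (∀ u → k ∣ s ℕ.* pred (q ℕ.^ (s ℕ.* u)) → D ∣ u) → Card (Im f) (q ℕ.^ (s ℕ.* D))
        card-minimal D D≥1 k∣ ord = subst (Card (Im f)) (ℕₚ.≤-antisym (upper D D≥1 k∣ c)
            (subst (_≤ proj₁ (card-Im f)) (trans (cong ((q ℕ.^ s) ℕ.^_) (trans (length-map frobEndo (downFrom D)) (length-downFrom D))) (ℕₚ.^-*-assoc q s D))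
              (im-lower (map frobEndo (downFrom D)) (APP.map⁺ (downFrom-pairs D (λ {i} {j} a b ne z → ne (sym (agree (proj₁ fM) s s D ord j i b a
                 (λ x → trans (sym (frobEndo-X j x)) (trans (-‿cancel (z x)) (frobEndo-X i x)))))))) c))) c
          where
          c = proj₂ (card-Im f)

    -- The count on a component where all relevant idempotents lie in one ring 𝔽_{q^s}[σ^s].
    module Single {k} (k∣n : k ∣ n) (s N : ℕ) (s≥1 : 1 ≤ s) (s∣k : s ∣ k) (s∣÷ : ∀ r → Prime r → r ∣ k → s ∣ k ÷ r) (Ns : N ℕ.* s ≡ n)
      (D : ℕ) (D≥1 : 1 ≤ D) (D⇐ : k ∣ s ℕ.* pred (q ℕ.^ (s ℕ.* D))) (D⇒ : ∀ u → k ∣ s ℕ.* pred (q ℕ.^ (s ℕ.* u)) → D ∣ u) where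
      private
        module Sz = SizeAt k∣n s N s≥1 s∣k s∣÷ Ns
        X = q ℕ.^ (s ℕ.* D)

      minimal-count : ∀ f → Idem s s f → Minimal s s f → f ≼ E k → Card (Im f) X × Card (Good (Idem s s) f) (X ∸ 1)
      minimal-count f fI fM f≼E = c , good (card-minus {P = Im f} {Q = _≡ 0#} (λ { refl → A-0 (proj₁ fI) }) (_≟ 0#) c (card-one 0#))
        where
        c : Card (Im f) X
        c = Sz.Size.card-minimal fI fM f≼E D D≥1 D⇐ D⇒
        good : (∃ λ l → Card (λ x → Im f x × ¬ x ≡ 0#) l × 1 ℕ.+ l ≡ X) → Card (Good (Idem s s) f) (X ∸ 1)
        good (l , d , eq) = subst (Card (Good (Idem s s) f)) (cong (_∸ 1) eq) (card-cong
           (λ { {x} (fx , nz) → fx , λ h hI hz le → avoid x fx nz h hI hz (proj₂ fM h hI le) })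
           (λ { {x} (fx , av) → fx , λ x0 → av f fI (proj₁ fM) (proj₂ fI) (trans fx x0) }) d)
          where
          avoid : ∀ x → Im f x → ¬ x ≡ 0# → ∀ h → Idem s s h → ¬ h ≐ zeroOp → h ≐ zeroOp ⊎ h ≐ f → ¬ h x ≡ 0#
          avoid x fx nz h hI hz (inj₁ z) = ⊥-elim (hz z)
          avoid x fx nz h hI hz (inj₂ e) h0 = nz (trans (sym fx) (trans (sym (e x)) h0))

      component-count : ∃ λ m → Card (Im (E k)) (X ℕ.^ m) × Card (Good (Idem s s) (E k)) ((X ∸ 1) ℕ.^ m)
      component-count = Family.count s s N ∣-refl Ns (Idem s s) (λ h → A-+ (proj₁ h)) (λ h → A-0 (proj₁ h))
        (λ h f → A-comm₁ ∣-refl (proj₁ h) (proj₁ f)) (λ {h} {f} (hA , hh) (fA , ff) → comp hA fA , λ x → trans (cong h (trans (A-comm₁ ∣-refl fA hA (f x)) (cong h (ff x)))) (hh (f x)))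
        (E k) X (X ∸ 1) minimal-count (E k) (A-mono (1∣ s) ∣-refl Sz.E∈ , Comp.E-idem k∣n) (Comp.E-idem k∣n)

    module Conj (g g⁻ : Op) (gg⁻ : ∀ x → g (g⁻ x) ≡ x) (g⁻g : ∀ x → g⁻ (g x) ≡ x) (g+ : ∀ x y → g (x + y) ≡ g x + g y) where
      γ : Op → Op
      γ h x = g (h (g⁻ x))

      conjA : ∀ {s t} → (∀ {a} → Fix s a → InA s t (γ (a *_))) → InA s t (γ (S t)) → ∀ {h} → InA s t h → InA s t (γ h)
      conjA sc fr (scal a) = sc a
      conjA sc fr frob = fr
      conjA sc fr (add i j) = ext (λ x → sym (g+ _ _)) (add (conjA sc fr i) (conjA sc fr j))
      conjA sc fr (comp {f} i j) = ext (λ x → cong (λ w → g (f w)) (g⁻g _)) (comp (conjA sc fr i) (conjA sc fr j))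
      conjA sc fr (ext e i) = ext (λ x → cong g (e _)) (conjA sc fr i)

      γ-cong : ∀ {h h′} → h ≐ h′ → γ h ≐ γ h′
      γ-cong e x = cong g (e (g⁻ x))

      module Halving (b : ℕ) (γA : ∀ {h} → InA b b h → InA b b (γ h)) (γγ : ∀ {h} → InA b b h → γ (γ h) ≐ h)
        (f : Op) (fI : Idem b b f) (γf : γ f ≐ f)
        (fmin : ∀ h → Idem b b h → γ h ≐ h → h ≼ f → h ≐ zeroOp ⊎ h ≐ f) where

        g0 : g 0# ≡ 0#
        g0 = +-cancelˡ (g 0#) _ _ (trans (sym (g+ 0# 0#)) (trans (cong g (+-identityˡ 0#)) (sym (+-identityʳ _))))

        Proper : Op → Set
        Proper h = Idem b b h × h ≼ f × ¬ h ≐ zeroOp × ¬ h ≐ f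

        γ-proper : ∀ {h} → Proper h → Proper (γ h)
        γ-proper {h} ((hA , hh) , le , nz , ne) = (γA hA , λ x → trans (cong (λ w → g (h w)) (g⁻g _)) (cong g (hh _))) ,
          (λ x → trans (cong (λ w → g (h w)) (trans (cong g⁻ (sym (γf x))) (g⁻g _))) (cong g (le _))) ,
          (λ z → nz (λ x → trans (sym (γγ hA x)) (trans (γ-cong {γ h} {zeroOp} z x) g0))) ,
          (λ z → ne (λ x → trans (sym (γγ hA x)) (trans (γ-cong {γ h} {f} z x) (γf x))))

        bcomm : ∀ {h k} → InA b b h → InA b b k → ∀ x → h (k x) ≡ k (h x)
        bcomm = A-comm₁ ∣-refl

        orthogonal : ∀ {h} → Proper h → ∀ x → h (γ h x) ≡ 0#
        orthogonal {h} pr@((hA , hh) , le , nz , ne) = either (fmin m mI γm (λ x → cong h (proj₁ (proj₂ (γ-proper pr)) x)))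
          where
          m : Op
          m x = h (γ h x)
          c : ∀ x → γ h (h x) ≡ h (γ h x)
          c = bcomm (γA hA) hA
          mI : Idem b b m
          mI = comp hA (γA hA) , λ x → trans (cong h (c (γ h x))) (trans (hh _) (cong h (proj₂ (proj₁ (γ-proper pr)) x)))
          γm : γ m ≐ m
          γm x = trans (cong (λ w → g (h w)) (sym (g⁻g _))) (trans (cong (γ h) (γγ hA x)) (c x))
          either : m ≐ zeroOp ⊎ m ≐ f → m ≐ zeroOp
          either (inj₁ z) = z
          either (inj₂ z) = ⊥-elim (ne λ x → trans (sym (le x)) (trans (bcomm hA (proj₁ fI) x) (trans (sym (z (h x))) (trans (cong h (c x)) (trans (hh _) (z x))))))

        sum≐f : ∀ {h} → Proper h → ∀ x → f x ≡ h x + γ h x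
        sum≐f {h} pr@((hA , hh) , le , nz , ne) = either (fmin m (add hA hA′ , mm) γm (λ x → cong₂ _+_ (le x) (proj₁ (proj₂ pr′) x)))
          where
          pr′ = γ-proper pr
          hA′ = γA hA
          m : Op
          m x = h x + γ h x
          o₁ = orthogonal pr
          o₂ : ∀ x → γ h (h x) ≡ 0#
          o₂ x = trans (bcomm hA′ hA x) (o₁ x)
          hm : ∀ x → h (m x) ≡ h x
          hm x = trans (A-+ hA _ _) (trans (cong₂ _+_ (hh x) (o₁ x)) (+-identityʳ _))
          mm : ∀ x → m (m x) ≡ m x
          mm x = cong₂ _+_ (hm x) (trans (A-+ hA′ _ _) (trans (cong₂ _+_ (o₂ x) (proj₂ (proj₁ pr′) x)) (+-identityˡ _)))
          γm : γ m ≐ m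
          γm x = trans (g+ _ _) (trans (cong (γ h x +_) (γγ hA x)) (+-comm _ _))
          either : m ≐ zeroOp ⊎ m ≐ f → ∀ x → f x ≡ m x
          either (inj₂ z) x = sym (z x)
          either (inj₁ z) x = ⊥-elim (nz λ x → trans (sym (hm x)) (trans (cong h (z x)) (A-0 hA)))

        proper-minimal : ∀ {h} → Proper h → Minimal b b h
        proper-minimal {h} pr@(hI@(hA , hh) , le , nz , ne) = nz , λ k kI k≼h → decide k kI k≼h (≐? k zeroOp)
          where
          decide : ∀ k → Idem b b k → k ≼ h → Dec (k ≐ zeroOp) → k ≐ zeroOp ⊎ k ≐ h
          decide k kI k≼h (yes z) = inj₁ z
          decide k kI@(kA , kk) k≼h (no kz) = inj₂ λ x → sym (trans (sym (hfx x)) (trans (sum≐f kpr (h x)) (trans (cong₂ _+_ (k≼h x) (γkh x)) (+-identityʳ _))))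
            where
            hfx : ∀ x → f (h x) ≡ h x
            hfx x = trans (bcomm (proj₁ fI) hA x) (le x)
            k≼f : k ≼ f
            k≼f x = trans (sym (k≼h (f x))) (trans (cong k (le x)) (k≼h x))
            kpr : Proper k
            kpr = kI , k≼f , kz , λ z → ne λ x → trans (sym (hfx x)) (trans (sym (z (h x))) (trans (k≼h x) (z x)))
            γkh : ∀ x → γ k (h x) ≡ 0#
            γkh x = trans (sym (trans (cong (λ w → g (k w)) (g⁻g _)) (cong g (k≼h _))))
              (trans (cong (γ k) (trans (bcomm (γA hA) hA x) (orthogonal pr x))) (A-0 (γA kA)))

        halves : ∀ {h} → Proper h → Sum f h (γ h)
        halves {h} pr@((hA , hh) , _) = record { g+ = A-+ hA ; h+ = A-+ (γA hA) ; gh = orthogonal pr ; hg = λ x → trans (bcomm (γA hA) hA x) (orthogonal pr x)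
          ; gg = hh ; hh = proj₂ (proj₁ (γ-proper pr)) ; f≡ = sum≐f pr }

        avoid : ∀ {h} → Proper h → ∀ k → Idem b b k → ¬ k ≐ zeroOp → k ≼ f → ∀ {w} → Im f w → ¬ Im h w → ¬ Im (γ h) w → ¬ k w ≡ 0#
        avoid {h} pr@((hA , hh) , le , nz , ne) k (kA , kk) kz k≼f {w} fw n₁ n₂ z =
          either (proj₂ (proper-minimal pr) (λ x → k (h x)) (below hA hh) (λ x → cong k (hh x)))
                 (proj₂ (proper-minimal pr′) (λ x → k (γ h x)) (below hA′ hh′) (λ x → cong k (hh′ x)))
          where
          pr′ = γ-proper pr
          hA′ = γA hA
          hh′ = proj₂ (proj₁ pr′)
          below : ∀ {h} → InA b b h → (∀ x → h (h x) ≡ h x) → Idem b b (λ x → k (h x))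
          below {h} hA hh = comp kA hA , λ x → trans (cong k (trans (bcomm hA kA (h x)) (cong k (hh x)))) (kk (h x))
          kills : ∀ {h} → InA b b h → (λ x → k (h x)) ≐ h → h w ≡ 0#
          kills {h} hA e = trans (sym (e w)) (trans (bcomm kA hA w) (trans (cong h z) (A-0 hA)))
          either : ((λ x → k (h x)) ≐ zeroOp ⊎ (λ x → k (h x)) ≐ h) → ((λ x → k (γ h x)) ≐ zeroOp ⊎ (λ x → k (γ h x)) ≐ γ h) → ⊥
          either (inj₂ e) _ = n₂ (sym (trans (sym fw) (trans (sum≐f pr w) (trans (cong (_+ γ h w) (kills hA e)) (+-identityˡ _)))))
          either (inj₁ _) (inj₂ e) = n₁ (sym (trans (sym fw) (trans (sum≐f pr w) (trans (cong (h w +_) (kills hA′ e)) (+-identityʳ _)))))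
          either (inj₁ e) (inj₁ e′) = kz λ x → trans (sym (k≼f x)) (trans (cong k (sum≐f pr x)) (trans (A-+ kA _ _) (trans (cong₂ _+_ (e x) (e′ x)) (+-identityˡ 0#))))

        im⇒f : ∀ {h} → Proper h → ∀ {w} → Im h w → Im f w
        im⇒f {h} ((hA , hh) , le , _) {w} hw = trans (cong f (sym hw)) (trans (bcomm (proj₁ fI) hA w) (trans (le w) hw))

        im⇒γ0 : ∀ {h} → Proper h → ∀ {w} → Im h w → γ h w ≡ 0#
        im⇒γ0 {h} pr@((hA , hh) , _) {w} hw = trans (cong (γ h) (sym hw)) (trans (bcomm (γA hA) hA w) (orthogonal pr w))

        γim⇒0 : ∀ {h} → Proper h → ∀ {w} → Im (γ h) w → h w ≡ 0#
        γim⇒0 {h} pr {w} hw = trans (cong h (sym hw)) (orthogonal pr w)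

    fourLines : ∀ (f a b c d : Op) X → 1 ≤ X → f 0# ≡ 0# → (∀ {x} → Im a x → Im f x) → (∀ {x} → Im b x → Im f x) → (∀ {x} → Im c x → Im f x) → (∀ {x} → Im d x → Im f x) →
      a 0# ≡ 0# → b 0# ≡ 0# → c 0# ≡ 0# → d 0# ≡ 0# →
      (∀ {x} → Im a x → Im b x → x ≡ 0#) → (∀ {x} → Im a x → Im c x → x ≡ 0#) → (∀ {x} → Im a x → Im d x → x ≡ 0#) →
      (∀ {x} → Im b x → Im c x → x ≡ 0#) → (∀ {x} → Im b x → Im d x → x ≡ 0#) → (∀ {x} → Im c x → Im d x → x ≡ 0#) →
      Card (Im a) X → Card (Im b) X → Card (Im c) X → Card (Im d) X → Card (Im f) (X ℕ.* X) →
      Card (λ x → Im f x × ¬ (Im a x ⊎ Im b x ⊎ Im c x ⊎ Im d x)) ((X ℕ.* X ℕ.+ 3) ∸ 4 ℕ.* X)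
    fourLines f a b c d X X≥1 f0 af bf cf df a0 b0 c0 d0 ab ac ad bc bd cd ca cb cc cd′ cF =
      fin X X≥1 (pt ca a0) (pt cb b0) (pt cc c0) (pt cd′ d0)
      where
      Pt : Op → F → Set
      Pt a x = Im a x × ¬ x ≡ 0#
      pt : ∀ {a} → Card (Im a) X → a 0# ≡ 0# → ∃ λ l → Card (Pt a) l × 1 ℕ.+ l ≡ X
      pt c h = card-minus (λ { refl → h }) (_≟ 0#) c (card-one 0#)
      im? : ∀ a x → Dec (Im a x)
      im? a x = a x ≟ x
      fin : ∀ X′ → 1 ≤ X′ → (∃ λ l → Card (Pt a) l × 1 ℕ.+ l ≡ X) → (∃ λ l → Card (Pt b) l × 1 ℕ.+ l ≡ X) →
        (∃ λ l → Card (Pt c) l × 1 ℕ.+ l ≡ X) → (∃ λ l → Card (Pt d) l × 1 ℕ.+ l ≡ X) →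
        Card (λ x → Im f x × ¬ (Im a x ⊎ Im b x ⊎ Im c x ⊎ Im d x)) ((X ℕ.* X ℕ.+ 3) ∸ 4 ℕ.* X)
      fin X′ _ (l₁ , p₁ , e₁) (l₂ , p₂ , e₂) (l₃ , p₃ , e₃) (l₄ , p₄ , e₄) = count rest
        where
        U : F → Set
        U x = Im a x ⊎ Im b x ⊎ Im c x ⊎ Im d x
        U₀ : F → Set
        U₀ x = x ≡ 0# ⊎ Pt a x ⊎ Pt b x ⊎ Pt c x ⊎ Pt d x
        cU₀ : Card U₀ (1 ℕ.+ (l₁ ℕ.+ (l₂ ℕ.+ (l₃ ℕ.+ l₄))))
        cU₀ = card-⊎ (λ { refl (inj₁ (_ , z)) → z refl ; refl (inj₂ (inj₁ (_ , z))) → z refl ; refl (inj₂ (inj₂ (inj₁ (_ , z)))) → z refl ; refl (inj₂ (inj₂ (inj₂ (_ , z)))) → z refl })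
          (card-one 0#) (card-⊎ (λ { (i , z) (inj₁ (j , _)) → z (ab i j) ; (i , z) (inj₂ (inj₁ (j , _))) → z (ac i j) ; (i , z) (inj₂ (inj₂ (j , _))) → z (ad i j) })
          p₁ (card-⊎ (λ { (i , z) (inj₁ (j , _)) → z (bc i j) ; (i , z) (inj₂ (j , _)) → z (bd i j) }) p₂
             (card-⊎ (λ { (i , z) (j , _) → z (cd i j) }) p₃ p₄)))
        to : ∀ {x} → U₀ x → U x
        to (inj₁ refl) = inj₁ a0
        to (inj₂ (inj₁ (i , _))) = inj₁ i
        to (inj₂ (inj₂ (inj₁ (i , _)))) = inj₂ (inj₁ i)
        to (inj₂ (inj₂ (inj₂ (inj₁ (i , _))))) = inj₂ (inj₂ (inj₁ i))
        to (inj₂ (inj₂ (inj₂ (inj₂ (i , _))))) = inj₂ (inj₂ (inj₂ i))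
        from : ∀ {x} → U x → U₀ x
        from {x} u = decide u (x ≟ 0#)
          where
          decide : U x → Dec (x ≡ 0#) → U₀ x
          decide u (yes z) = inj₁ z
          decide (inj₁ i) (no z) = inj₂ (inj₁ (i , z))
          decide (inj₂ (inj₁ i)) (no z) = inj₂ (inj₂ (inj₁ (i , z)))
          decide (inj₂ (inj₂ (inj₁ i))) (no z) = inj₂ (inj₂ (inj₂ (inj₁ (i , z))))
          decide (inj₂ (inj₂ (inj₂ i))) (no z) = inj₂ (inj₂ (inj₂ (inj₂ (i , z))))
        sub : ∀ {x} → U x → Im f x
        sub (inj₁ i) = af i
        sub (inj₂ (inj₁ i)) = bf i
        sub (inj₂ (inj₂ (inj₁ i))) = cf i
        sub (inj₂ (inj₂ (inj₂ i))) = df i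
        rest = card-minus {P = Im f} {Q = U} sub (λ x → im? a x ⊎-dec (im? b x ⊎-dec (im? c x ⊎-dec im? d x))) cF (card-cong to from cU₀)
        arith : ∀ X l₁ l₂ l₃ l₄ r → 1 ℕ.+ l₁ ≡ X → 1 ℕ.+ l₂ ≡ X → 1 ℕ.+ l₃ ≡ X → 1 ℕ.+ l₄ ≡ X →
          1 ℕ.+ (l₁ ℕ.+ (l₂ ℕ.+ (l₃ ℕ.+ l₄))) ℕ.+ r ≡ X ℕ.* X → r ≡ (X ℕ.* X ℕ.+ 3) ∸ 4 ℕ.* X
        arith X l l₂ l₃ l₄ r refl refl refl refl eq = sym (trans (cong (_∸ 4 ℕ.* suc l) (trans (cong (ℕ._+ 3) (sym eq)) (lem l r))) (ℕₚ.m+n∸n≡m r (4 ℕ.* suc l)))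
          where
          lem : ∀ l r → 1 ℕ.+ (l ℕ.+ (l ℕ.+ (l ℕ.+ l))) ℕ.+ r ℕ.+ 3 ≡ r ℕ.+ 4 ℕ.* suc l
          lem = solve-∀
        count : (∃ λ r → Card (λ x → Im f x × ¬ U x) r × 1 ℕ.+ (l₁ ℕ.+ (l₂ ℕ.+ (l₃ ℕ.+ l₄))) ℕ.+ r ≡ X ℕ.* X) → _
        count (r , cr , eq) = subst (Card (λ x → Im f x × ¬ U x)) (arith X l₁ l₂ l₃ l₄ r e₁ e₂ e₃ e₄ eq) cr

    neg-neg-mul : ∀ x y → (- x) * (- y) ≡ x * y
    neg-neg-mul x y = trans (sym (-‿distribˡ-* x (- y))) (trans (cong -_ (sym (-‿distribʳ-* x y))) (-‿involutive _))

    module At {k} (k∣n : k ∣ n) (τ N₂ : ℕ) (τ≥1 : 1 ≤ τ) (N₂t : N₂ ℕ.* (2 ℕ.* τ) ≡ n) (t∣k : 2 ℕ.* τ ∣ k)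
      (t∣÷ : ∀ r → Prime r → r ∣ k → 2 ℕ.* τ ∣ k ÷ r)
      (D D₂ : ℕ) (D₂≥1 : 1 ≤ D₂) (D≡ : D ≡ 2 ℕ.* D₂) (D⇐ : k ∣ τ ℕ.* pred (q ℕ.^ (τ ℕ.* D)))
      (D⇒ : ∀ u → k ∣ τ ℕ.* pred (q ℕ.^ (τ ℕ.* u)) → D ∣ u) (D⇒₂ : ∀ u → k ∣ 2 ℕ.* τ ℕ.* pred (q ℕ.^ (τ ℕ.* u)) → D ∣ u)
      (β β⁻ : F) (β≢0 : ¬ β ≡ 0#) (ββ⁻ : β * β⁻ ≡ 1#) (Sβ : S τ β ≡ - β) where

      t = 2 ℕ.* τ
      X₀ = q ℕ.^ (τ ℕ.* D)

      D≥1 : 1 ≤ D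
      D≥1 = subst (1 ≤_) (sym D≡) (ℕₚ.≤-trans D₂≥1 (ℕₚ.m≤m+n D₂ _))
      t≥1 : 1 ≤ t
      t≥1 = ℕₚ.≤-trans τ≥1 (ℕₚ.m≤m+n τ _)
      τ∣t : τ ∣ t
      τ∣t = n∣m*n 2
      N = N₂ ℕ.* 2
      Nτ : N ℕ.* τ ≡ n
      Nτ = trans (ℕₚ.*-assoc N₂ 2 τ) N₂t

      module S₁ = SizeAt k∣n τ N τ≥1 (∣-trans τ∣t t∣k) (λ r R d → ∣-trans τ∣t (t∣÷ r R d)) Nτ
      module S₂ = SizeAt k∣n t N₂ t≥1 t∣k t∣÷ N₂t

      2∣n : 2 ∣ n
      2∣n = ∣-trans (m∣m*n τ) (∣-trans t∣k k∣n)

      p≢2 : ¬ 2 ∣ p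
      p≢2 d = p∤n (subst (_∣ n) (prime∣prime prime[2] P d) 2∣n)

      halve : ∀ {y} → y + y ≡ 0# → y ≡ 0#
      halve {y} h = *-cancelˡ (2 · 1#) (nonzero-characteristic p 2 P char (λ d → p≢2 (subst (2 ∣_) (sym (prime∣prime P prime[2] d)) ∣-refl)))
        (trans (×-assoc-* 2 1# y) (trans (cong (2 ·_) (*-identityˡ y)) (trans (trans (cong (y +_) (+-identityʳ y)) h) (sym (zeroʳ _)))))

      neg-self : ∀ {y} → y ≡ - y → y ≡ 0#
      neg-self {y} h = halve (trans (cong (y +_) h) (-‿inverseʳ y))

      S-t : ∀ x → S t x ≡ S τ (S τ x)
      S-t x = trans (cong (λ w → S w x) (cong (τ ℕ.+_) (ℕₚ.+-identityʳ τ))) (S-+ τ τ x)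

      Fixβ : Fix t β
      Fixβ = trans (S-t β) (trans (cong (S τ) Sβ) (trans (S-neg τ β) (trans (cong -_ Sβ) (-‿involutive β))))

      Fixβ⁻ : Fix t β⁻
      Fixβ⁻ = Fix-inv β≢0 ββ⁻ Fixβ

      β⁻β : β⁻ * β ≡ 1#
      β⁻β = trans (*-comm β⁻ β) ββ⁻

      Sβ⁻ : S τ β⁻ ≡ - β⁻
      Sβ⁻ = *-cancelˡ β β≢0 (begin
        β * S τ β⁻ ≡⟨ cong (_* S τ β⁻) (trans (sym (-‿involutive β)) (cong -_ (sym Sβ))) ⟩
        - S τ β * S τ β⁻ ≡⟨ -‿distribˡ-* _ _ ⟨
        - (S τ β * S τ β⁻) ≡⟨ cong -_ (trans (sym (S-mul τ β β⁻)) (trans (cong (S τ) ββ⁻) (trans (S-1# τ) (sym ββ⁻)))) ⟩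
        - (β * β⁻) ≡⟨ -‿distribʳ-* β β⁻ ⟩
        β * - β⁻ ∎)
        where open ≡-Reasoning

      τ-even : ∀ c → t ∣ τ ℕ.* (c ℕ.* 2)
      τ-even c = divides c (lem τ c)
        where
        lem : ∀ τ c → τ ℕ.* (c ℕ.* 2) ≡ c ℕ.* (2 ℕ.* τ)
        lem = solve-∀

      Sβ⁻-odd : ∀ c → S (τ ℕ.* suc (c ℕ.* 2)) β⁻ ≡ - β⁻
      Sβ⁻-odd c = trans (cong (λ w → S w β⁻) (ℕₚ.*-suc τ (c ℕ.* 2))) (trans (S-+ τ _ β⁻) (trans (cong (S τ) (Fix-∣ (τ-even c) Fixβ⁻)) Sβ⁻))

      mulβ : ∀ x → β * (β⁻ * x) ≡ x
      mulβ x = trans (sym (*-assoc β β⁻ x)) (trans (cong (_* x) ββ⁻) (*-identityˡ x))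
      mulβ⁻ : ∀ x → β⁻ * (β * x) ≡ x
      mulβ⁻ x = trans (sym (*-assoc β⁻ β x)) (trans (cong (_* x) β⁻β) (*-identityˡ x))

      module Θ = Conj (β *_) (β⁻ *_) mulβ mulβ⁻ (distribˡ β)

      S⁻ : Op
      S⁻ = S ((n ∸ 1) ℕ.* τ)
      S⁻S : ∀ x → S⁻ (S τ x) ≡ x
      S⁻S = S-inverse τ
      SS⁻ : ∀ x → S τ (S⁻ x) ≡ x
      SS⁻ x = trans (S-comm τ _ x) (S⁻S x)

      module Ψ = Conj (S τ) S⁻ SS⁻ S⁻S (S-add τ)

      negβ : ∀ y → β * (- β⁻ * y) ≡ - y
      negβ y = trans (cong (β *_) (sym (-‿distribˡ-* β⁻ y))) (trans (sym (-‿distribʳ-* β _)) (cong -_ (mulβ y)))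

      θA : ∀ {h} → InA τ τ h → InA τ τ (Θ.γ h)
      θA = Θ.conjA (λ {a} fa → ext (λ x → sym (trans (cong (β *_) (trans (sym (*-assoc a β⁻ x)) (trans (cong (_* x) (*-comm a β⁻)) (*-assoc β⁻ a x)))) (mulβ _))) (scal fa))
        (ext (λ x → sym (trans (cong (β *_) (trans (S-mul τ β⁻ x) (cong (_* S τ x) Sβ⁻))) (negβ _))) (negA frob))

      θθ : ∀ {h} → InA τ τ h → Θ.γ (Θ.γ h) ≐ h
      θθ {h} hA x = begin
        β * (β * h (β⁻ * (β⁻ * x))) ≡⟨ cong (λ w → β * (β * h w)) (sym (*-assoc β⁻ β⁻ x)) ⟩
        β * (β * h (β⁻ * β⁻ * x)) ≡⟨ cong (λ w → β * (β * w)) (A-comm₁ ∣-refl hA (scal fx) x) ⟩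
        β * (β * (β⁻ * β⁻ * h x)) ≡⟨ cong (λ w → β * (β * w)) (*-assoc β⁻ β⁻ (h x)) ⟩
        β * (β * (β⁻ * (β⁻ * h x))) ≡⟨ cong (β *_) (mulβ _) ⟩
        β * (β⁻ * h x) ≡⟨ mulβ _ ⟩
        h x ∎
        where
        open ≡-Reasoning
        fx : Fix τ (β⁻ * β⁻)
        fx = trans (S-mul τ β⁻ β⁻) (trans (cong₂ _*_ Sβ⁻ Sβ⁻) (neg-neg-mul β⁻ β⁻))

      ψA : ∀ {h} → InA t t h → InA t t (Ψ.γ h)
      ψA = Ψ.conjA (λ {a} fa → ext (λ x → sym (trans (S-mul τ a _) (cong (S τ a *_) (SS⁻ x)))) (scal (Fix-S τ fa)))
        (ext (λ x → sym (trans (S-comm τ t _) (cong (S t) (SS⁻ x)))) frob)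

      ψψ : ∀ {h} → InA t t h → Ψ.γ (Ψ.γ h) ≐ h
      ψψ {h} hA x = begin
        S τ (S τ (h (S⁻ (S⁻ x)))) ≡⟨ S-t _ ⟨
        S t (h (S⁻ (S⁻ x))) ≡⟨ A-comm₁ ∣-refl hA (frob {t} {t}) _ ⟨
        h (S t (S⁻ (S⁻ x))) ≡⟨ cong h (trans (S-t _) (trans (cong (S τ) (SS⁻ _)) (SS⁻ x))) ⟩
        h x ∎
        where open ≡-Reasoning

      θ-fixed : ∀ {h} → InA τ τ h → Θ.γ h ≐ h → InA τ t h
      θ-fixed {h} hA fixed = ext (λ x → sym (eq x)) (∑A (downFrom N) (λ j x → c j * S (τ ℕ.* j) x) (λ {j} j∈ → term j (∈-downFrom⁻ j∈) (even-or-odd j)))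
        where
        z = nf N ∣-refl Nτ hA
        c = proj₁ z
        fx = proj₁ (proj₂ z)
        eq = proj₂ (proj₂ z)
        ε : ℕ → F
        ε j = β * S (τ ℕ.* j) β⁻
        θcomb : ∀ x → Θ.γ h x ≡ comb τ N (λ j → c j * ε j) x
        θcomb x = trans (cong (β *_) (eq _)) (trans (∑-*ˡ (downFrom N) _ β) (S.Big-cong (downFrom N) (λ {j} _ →
            trans (cong (λ w → β * (c j * w)) (S-mul (τ ℕ.* j) β⁻ x)) (lem β (c j) (S (τ ℕ.* j) β⁻) (S (τ ℕ.* j) x)))))
          where
          lem : ∀ a b c d → a * (b * (c * d)) ≡ b * (a * c) * d
          lem a b c d = trans (sym (*-assoc a b _)) (trans (cong (_* (c * d)) (*-comm a b)) (trans (sym (*-assoc (b * a) c d)) (cong (_* d) (*-assoc b a c))))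
        same : ∀ j → j < N → c j ≡ c j * ε j
        same = comb-unique τ N Nτ c (λ j → c j * ε j) (λ x → trans (sym (eq x)) (trans (sym (fixed x)) (θcomb x)))
        term : ∀ j → j < N → (∃ λ i → j ≡ i ℕ.* 2) ⊎ (∃ λ i → j ≡ suc (i ℕ.* 2)) → InA τ t (λ x → c j * S (τ ℕ.* j) x)
        term j l (inj₁ (i , e)) = comp (scal (fx j)) (S∈A (subst (λ w → t ∣ τ ℕ.* w) (sym e) (τ-even i)))
        term j l (inj₂ (i , e)) = ext (λ x → sym (trans (cong (_* S (τ ℕ.* j) x) c0) (zeroˡ _))) zeroA
          where
          c0 : c j ≡ 0#
          c0 = neg-self (trans (same j l) (trans (cong (λ w → c j * (β * S (τ ℕ.* w) β⁻)) e) (trans (cong (λ w → c j * (β * w)) (Sβ⁻-odd i))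
            (trans (cong (c j *_) (trans (sym (-‿distribʳ-* β β⁻)) (cong -_ ββ⁻))) (trans (sym (-‿distribʳ-* (c j) 1#)) (cong -_ (*-identityʳ (c j))))))))

      ψ-fixed : ∀ {h} → InA t t h → Ψ.γ h ≐ h → InA τ t h
      ψ-fixed {h} hA fixed = ext (λ x → sym (eq x)) (combA N₂ c same)
        where
        z = nf N₂ ∣-refl N₂t hA
        c = proj₁ z
        eq = proj₂ (proj₂ z)
        ψcomb : ∀ x → Ψ.γ h x ≡ comb t N₂ (λ j → S τ (c j)) x
        ψcomb x = trans (cong (S τ) (eq _)) (trans (S-∑ τ (downFrom N₂) _) (S.Big-cong (downFrom N₂) (λ {j} _ → trans (S-mul τ (c j) _) (cong (S τ (c j) *_) (trans (S-comm τ (t ℕ.* j) _) (cong (S (t ℕ.* j)) (SS⁻ x)))))))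
        same : ∀ j → j < N₂ → S τ (c j) ≡ c j
        same j l = sym (comb-unique t N₂ N₂t c (λ j → S τ (c j)) (λ x → trans (sym (eq x)) (trans (sym (fixed x)) (ψcomb x))) j l)

      θ-central : ∀ {h} → InA τ t h → Θ.γ h ≐ h
      θ-central {h} hA x = trans (sym (A-comm τ∣t ∣-refl hA (scal {t} {t} Fixβ) (β⁻ * x))) (cong h (mulβ x))

      ψ-central : ∀ {h} → InA τ t h → Ψ.γ h ≐ h
      ψ-central {h} hA x = trans (sym (A-comm ∣-refl (1∣ t) hA (frob {1} {τ}) (S⁻ x))) (cong h (SS⁻ x))

      q-odd : ∀ i → ∃ λ c → q ℕ.^ i ≡ suc (c ℕ.* 2)
      q-odd i = pick (even-or-odd (q ℕ.^ i))
        where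
        pick : (∃ λ c → q ℕ.^ i ≡ c ℕ.* 2) ⊎ (∃ λ c → q ℕ.^ i ≡ suc (c ℕ.* 2)) → ∃ λ c → q ℕ.^ i ≡ suc (c ℕ.* 2)
        pick (inj₂ z) = z
        pick (inj₁ (c , eq)) = ⊥-elim (p≢2 (prime∣^ p e prime[2] (subst (2 ∣_) q≡ (prime∣^ q i prime[2] (divides c eq)))))

      power-contradiction : ∀ {a b m} → q ℕ.^ a ≤ m → m ≤ q ℕ.^ b → b < a → ⊥
      power-contradiction l u lt = ℕₚ.<⇒≱ (ℕₚ.^-monoʳ-< q q≥2 lt) (ℕₚ.≤-trans l u)

      t*≡ : ∀ m → t ℕ.* m ≡ τ ℕ.* m ℕ.+ τ ℕ.* m
      t*≡ m = lem τ m
        where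
        lem : ∀ τ m → 2 ℕ.* τ ℕ.* m ≡ τ ℕ.* m ℕ.+ τ ℕ.* m
        lem = solve-∀

      module Atom (f : Op) (fI : Idem τ t f) (fM : Minimal τ t f) (f≼E : f ≼ E k) where
        fZ = proj₁ fI
        ff = proj₂ fI
        fI₁ : Idem τ τ f
        fI₁ = A-mono ∣-refl τ∣t fZ , ff
        fI₂ : Idem t t f
        fI₂ = A-mono τ∣t ∣-refl fZ , ff
        f≢0 = proj₁ fM

        -- f splits in 𝔽_{q^τ}[σ^τ]: otherwise ±σ^(τ q^(τ j)), j < D, would be 2D conjugates in a field of order q^(τ D).
        not-minimal₁ : ¬ Minimal τ τ f
        not-minimal₁ mi = power-contradiction {τ ℕ.* (D ℕ.+ D)} {τ ℕ.* D}
            (subst (_≤ X₀) (trans (cong ((q ℕ.^ τ) ℕ.^_) len) (ℕₚ.^-*-assoc q τ (D ℕ.+ D)))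
              (im-lower (map frobEndo (downFrom D) ++ map θEndo (downFrom D)) separated (card-minimal D D≥1 D⇐ D⇒)))
            ℕₚ.≤-refl (ℕₚ.*-monoʳ-< τ {{>-nonZero τ≥1}} (ℕₚ.m<m+n D D≥1))
          where
          open S₁.Size fI₁ mi f≼E
          pw : ℕ → ℕ
          pw j = q ℕ.^ (τ ℕ.* j)
          β⁻f : ∀ x → f (β⁻ * x) ≡ β⁻ * f x
          β⁻f x = A-comm τ∣t ∣-refl fZ (scal {t} {t} Fixβ⁻) x
          θEndo : ℕ → Endo
          θEndo j = record
            { ⟦_⟧ = λ a → Θ.γ (proj₁ (a S₁.^A pw j)) , θA (proj₂ (a S₁.^A pw j))
            ; hom≈ = λ {a} {b} h x → cong (β *_) (S₁.^A-congˡ (pw j) {a} {b} h (β⁻ * x))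
            ; hom+ = λ a b x → trans (cong (β *_) (power-+ (τ ℕ.* j) a b (β⁻ * x))) (distribˡ β _ _)
            ; hom* = λ a b x → cong (β *_) (trans (power-* (pw j) a b (β⁻ * x)) (cong (proj₁ (a S₁.^A pw j)) (sym (mulβ⁻ _))))
            ; hom0 = λ x → trans (cong (β *_) (power-0 (pw j) (ℕₚ.m^n>0 q (τ ℕ.* j)) (β⁻ * x))) (zeroʳ β)
            ; fixf = λ {a} h x → trans (cong (β *_) (trans (fixf (frobEndo j) h (β⁻ * x)) (trans (cong (a *_) (β⁻f x)) (trans (sym (*-assoc a β⁻ _)) (trans (cong (_* f x) (*-comm a β⁻)) (*-assoc β⁻ a _)))))) (mulβ _) }
          A : ℕ → Op
          A j = S (τ ℕ.* pw j)
          θEndo-X : ∀ j x → proj₁ (⟦ θEndo j ⟧ X) (f x) ≡ - A j (f x)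
          θEndo-X j x = trans (cong (β *_) (trans (X-power (pw j) (β⁻ * f x)) (trans (S-mul (τ ℕ.* pw j) β⁻ (f x)) (cong (_* A j (f x)) (trans (cong (λ w → S (τ ℕ.* w) β⁻) (proj₂ (q-odd (τ ℕ.* j)))) (Sβ⁻-odd (proj₁ (q-odd (τ ℕ.* j)))))))))
              (negβ (A j (f x)))
          A-f : ∀ j x → A j (f x) ≡ f (A j x)
          A-f j x = A-comm₁ ∣-refl (S∈A {τ} (m∣m*n (pw j))) (proj₁ fI₁) x
          len : length (map frobEndo (downFrom D) ++ map θEndo (downFrom D)) ≡ D ℕ.+ D
          len = trans (length-++ (map frobEndo (downFrom D))) (cong₂ ℕ._+_ (trans (length-map frobEndo (downFrom D)) (length-downFrom D)) (trans (length-map θEndo (downFrom D)) (length-downFrom D)))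
          neg-inj : ∀ {x y} → - x ≡ - y → x ≡ y
          neg-inj {x} {y} h = trans (sym (-‿involutive x)) (trans (cong -_ h) (-‿involutive y))
          sep₁ : ∀ {i j} → i < D → j < D → ¬ i ≡ j → Separated (frobEndo i) (frobEndo j)
          sep₁ {i} {j} a b ne z = ne (sym (agree f≢0 τ τ D D⇒ j i b a (λ x → trans (sym (frobEndo-X j x)) (trans (-‿cancel (z x)) (frobEndo-X i x)))))
          sep₂ : ∀ {i j} → i < D → j < D → ¬ i ≡ j → Separated (θEndo i) (θEndo j)
          sep₂ {i} {j} a b ne z = ne (sym (agree f≢0 τ τ D D⇒ j i b a (λ x → neg-inj (trans (sym (θEndo-X j x)) (trans (-‿cancel (z x)) (θEndo-X i x))))))
          sep₃ : ∀ {i j} → i < D → j < D → Separated (frobEndo i) (θEndo j)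
          sep₃ {i} {j} a b z = f≢0 (λ x → S-inj (τ ℕ.* pw i) (trans (neg-self (trans (opp x) (cong (λ w → - A w (f x)) (sym i≡j)))) (sym (S-0# (τ ℕ.* pw i)))))
            where
            opp : ∀ x → A i (f x) ≡ - A j (f x)
            opp x = trans (sym (frobEndo-X i x)) (trans (sym (-‿cancel (z x))) (θEndo-X j x))
            square : ∀ x → A i (A i (f x)) ≡ A j (A j (f x))
            square x = begin
              A i (A i (f x)) ≡⟨ cong (A i) (A-f i x) ⟩
              A i (f (A i x)) ≡⟨ opp (A i x) ⟩
              - A j (f (A i x)) ≡⟨ cong (λ w → - A j w) (trans (sym (A-f i x)) (opp x)) ⟩
              - A j (- A j (f x)) ≡⟨ cong -_ (S-neg (τ ℕ.* pw j) _) ⟩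
              - (- A j (A j (f x))) ≡⟨ -‿involutive _ ⟩
              A j (A j (f x)) ∎
              where open ≡-Reasoning
            double : ∀ j x → S (t ℕ.* pw j) (f x) ≡ A j (A j (f x))
            double j x = trans (cong (λ w → S w (f x)) (t*≡ (pw j))) (S-+ (τ ℕ.* pw j) _ (f x))
            i≡j : i ≡ j
            i≡j = agree f≢0 t τ D D⇒₂ i j a b (λ x → trans (double i x) (trans (square x) (sym (double j x))))
          separated : AllPairs Separated (map frobEndo (downFrom D) ++ map θEndo (downFrom D))
          separated = APP.++⁺ (APP.map⁺ (downFrom-pairs D sep₁)) (APP.map⁺ (downFrom-pairs D sep₂))
            (AllP.map⁺ (All.tabulate (λ i∈ → AllP.map⁺ (All.tabulate (λ j∈ → sep₃ (∈-downFrom⁻ i∈) (∈-downFrom⁻ j∈))))))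

        D₂⇐ : k ∣ t ℕ.* pred (q ℕ.^ (t ℕ.* D₂))
        D₂⇐ = subst (λ w → k ∣ t ℕ.* pred (q ℕ.^ w)) (trans (cong (τ ℕ.*_) D≡) (lem τ D₂)) (subst (k ∣_) (sym (ℕₚ.*-assoc 2 τ _)) (∣n⇒∣m*n 2 D⇐))
          where
          lem : ∀ τ d → τ ℕ.* (2 ℕ.* d) ≡ 2 ℕ.* τ ℕ.* d
          lem = solve-∀
        D₂⇒ : ∀ u → k ∣ t ℕ.* pred (q ℕ.^ (t ℕ.* u)) → D₂ ∣ u
        D₂⇒ u h = *-cancelˡ-∣ 2 (subst (_∣ 2 ℕ.* u) D≡ (D⇒₂ (2 ℕ.* u) (subst (λ w → k ∣ t ℕ.* pred (q ℕ.^ w)) (lem τ u) h)))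
          where
          lem : ∀ τ d → 2 ℕ.* τ ℕ.* d ≡ τ ℕ.* (2 ℕ.* d)
          lem = solve-∀

        -- Likewise σ^(2τ q^(τ j)), j < D, are conjugate over the subring fixed by conjugation with σ^τ.
        not-minimal₂ : ¬ Minimal t t f
        not-minimal₂ mi = power-contradiction {t ℕ.* D} {t ℕ.* D₂}
            (subst (_≤ q ℕ.^ (t ℕ.* D₂)) (trans (cong ((q ℕ.^ t) ℕ.^_) (trans (length-map χ (downFrom D)) (length-downFrom D))) (ℕₚ.^-*-assoc q t D))
              (im-lower (map χ (downFrom D)) (APP.map⁺ (downFrom-pairs D sep)) (card-minimal D₂ D₂≥1 D₂⇐ D₂⇒)))
            ℕₚ.≤-refl (ℕₚ.*-monoʳ-< t {{>-nonZero t≥1}} (subst (D₂ <_) (sym D≡) (ℕₚ.m<m+n D₂ (ℕₚ.≤-trans D₂≥1 (ℕₚ.m≤m+n D₂ 0)))))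
          where
          open S₂.Size fI₂ mi f≼E
          pw : ℕ → ℕ
          pw j = q ℕ.^ (τ ℕ.* j)
          inv : ℕ → Op
          inv j = S ((n ∸ 1) ℕ.* (τ ℕ.* j))
          inv-S : ∀ j x → inv j (S (τ ℕ.* j) x) ≡ x
          inv-S j = S-inverse (τ ℕ.* j)
          S-inv : ∀ j x → S (τ ℕ.* j) (inv j x) ≡ x
          S-inv j x = trans (S-comm (τ ℕ.* j) _ x) (inv-S j x)
          module C j = Conj (inv j) (S (τ ℕ.* j)) (inv-S j) (S-inv j) (S-add ((n ∸ 1) ℕ.* (τ ℕ.* j)))
          CA : ∀ j {h} → InA t t h → InA t t (C.γ j h)
          CA j = C.conjA j (λ {a} fa → ext (λ x → sym (trans (S-mul _ a _) (cong (inv j a *_) (inv-S j x)))) (scal (Fix-S _ fa)))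
            (ext (λ x → sym (trans (S-comm _ t _) (cong (S t) (inv-S j x)))) frob)
          Sf : ∀ j x → f (S (τ ℕ.* j) x) ≡ S (τ ℕ.* j) (f x)
          Sf j x = A-comm ∣-refl (1∣ t) fZ (S∈A {1} {τ} (m∣m*n j)) x
          χ : ℕ → Endo
          χ j = record
            { ⟦_⟧ = λ a → C.γ j (proj₁ (a S₂.^A pw j)) , CA j (proj₂ (a S₂.^A pw j))
            ; hom≈ = λ {a} {b} h x → cong (inv j) (S₂.^A-congˡ (pw j) {a} {b} h (S (τ ℕ.* j) x))
            ; hom+ = λ a b x → trans (cong (inv j) (power-+ (τ ℕ.* j) a b _)) (S-add _ _ _)
            ; hom* = λ a b x → cong (inv j) (trans (power-* (pw j) a b _) (cong (proj₁ (a S₂.^A pw j)) (sym (S-inv j _))))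
            ; hom0 = λ x → trans (cong (inv j) (power-0 (pw j) (ℕₚ.m^n>0 q (τ ℕ.* j)) _)) (S-0# _)
            ; fixf = λ {a} h x → trans (cong (inv j) (trans (scal-power h (pw j) (ℕₚ.m^n>0 q (τ ℕ.* j)) _) (trans (cong₂ _*_ (sym (S-def (τ ℕ.* j) a)) (Sf j x)) (sym (S-mul (τ ℕ.* j) a (f x)))))) (inv-S j _) }
          χ-X : ∀ j x → proj₁ (⟦ χ j ⟧ X) (f x) ≡ S (t ℕ.* pw j) (f x)
          χ-X j x = trans (cong (inv j) (trans (X-power (pw j) _) (S-comm (t ℕ.* pw j) (τ ℕ.* j) (f x)))) (inv-S j _)
          sep : ∀ {i j} → i < D → j < D → ¬ i ≡ j → Separated (χ i) (χ j)
          sep {i} {j} a b ne z = ne (sym (agree f≢0 t τ D D⇒₂ j i b a (λ x → trans (sym (χ-X j x)) (trans (-‿cancel (z x)) (χ-X i x)))))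

        module H₁ = Θ.Halving τ θA θθ f fI₁ (θ-central fZ) (λ h hI hθ le → proj₂ fM h (θ-fixed (proj₁ hI) hθ , proj₂ hI) le)
        module H₂ = Ψ.Halving t ψA ψψ f fI₂ (ψ-central fZ) (λ h hI hψ le → proj₂ fM h (ψ-fixed (proj₁ hI) hψ , proj₂ hI) le)

        half₁ : ∃ λ h → H₁.Proper h
        half₁ = pick (S₁.splits f fI₁ f≢0)
          where
          pick : Minimal τ τ f ⊎ (∃ λ g → Idem τ τ g × g ≼ f × ¬ g ≐ zeroOp × ¬ g ≐ f) → ∃ λ h → H₁.Proper h
          pick (inj₁ mi) = ⊥-elim (not-minimal₁ mi)
          pick (inj₂ h) = h

        half₂ : ∃ λ h → H₂.Proper h
        half₂ = pick (S₂.splits f fI₂ f≢0)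
          where
          pick : Minimal t t f ⊎ (∃ λ g → Idem t t g × g ≼ f × ¬ g ≐ zeroOp × ¬ g ≐ f) → ∃ λ h → H₂.Proper h
          pick (inj₁ mi) = ⊥-elim (not-minimal₂ mi)
          pick (inj₂ h) = h

        module Halved (a c : Op) (pa : H₁.Proper a) (pc : H₂.Proper c) where
          b = Θ.γ a
          d = Ψ.γ c
          pb = H₁.γ-proper pa
          pd = H₂.γ-proper pc
          below : ∀ {h} → h ≼ f → h ≼ E k
          below {h} le x = trans (sym (le (E k x))) (trans (cong h (f≼E x)) (le x))
          X₂≡ : q ℕ.^ (t ℕ.* D₂) ≡ X₀
          X₂≡ = cong (q ℕ.^_) (trans (lem τ D₂) (cong (τ ℕ.*_) (sym D≡)))
            where
            lem : ∀ τ d → 2 ℕ.* τ ℕ.* d ≡ τ ℕ.* (2 ℕ.* d)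
            lem = solve-∀
          card₁ : ∀ {h} → H₁.Proper h → Card (Im h) X₀
          card₁ {h} pr@(hI , le , _) = S₁.Size.card-minimal hI (H₁.proper-minimal pr) (below {h} le) D D≥1 D⇐ D⇒
          card₂ : ∀ {h} → H₂.Proper h → Card (Im h) X₀
          card₂ {h} pr@(hI , le , _) = subst (Card (Im h)) X₂≡ (S₂.Size.card-minimal hI (H₂.proper-minimal pr) (below {h} le) D₂ D₂≥1 D₂⇐ D₂⇒)
          card-f : Card (Im f) (X₀ ℕ.* X₀)
          card-f = Sum.card-Im-sum (H₁.halves pa) (card₁ pa) (card₁ pb)

          aA = proj₁ (proj₁ pa)
          bA = proj₁ (proj₁ pb)
          cA = proj₁ (proj₁ pc)
          dA = proj₁ (proj₁ pd)
          u v : Op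
          u x = a x - b x
          v x = c x - d x
          uA : InA τ τ u
          uA = subA aA bA
          vA : InA t t v
          vA = subA cA dA
          swap-neg : ∀ x y → x - y ≡ - (y - x)
          swap-neg x y = sym (trans (sym (-‿+-comm y (- x))) (trans (cong (- y +_) (-‿involutive x)) (+-comm (- y) x)))
          θu : ∀ x → Θ.γ u x ≡ - u x
          θu x = trans (distribˡ β _ _) (trans (cong (b x +_) (trans (sym (-‿distribʳ-* β _)) (cong -_ (θθ aA x)))) (swap-neg (b x) (a x)))
          ψv : ∀ x → Ψ.γ v x ≡ - v x
          ψv x = trans (S-add τ _ _) (trans (cong (d x +_) (trans (S-neg τ _) (cong -_ (ψψ cA x)))) (swap-neg (d x) (c x)))
          u′ v′ : Op
          u′ x = S⁻ (u x)
          v′ x = β⁻ * v x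
          S⁻β⁻ : S⁻ β⁻ ≡ - β⁻
          S⁻β⁻ = trans (cong S⁻ (sym (trans (S-neg τ β⁻) (trans (cong -_ Sβ⁻) (-‿involutive β⁻))))) (S⁻S (- β⁻))
          u′Z : InA τ t u′
          u′Z = θ-fixed (comp (S∈A (n∣m*n (n ∸ 1))) uA) λ x → begin
            β * S⁻ (u (β⁻ * x)) ≡⟨ cong (λ w → β * S⁻ w) (trans (sym (mulβ⁻ _)) (cong (β⁻ *_) (θu x))) ⟩
            β * S⁻ (β⁻ * - u x) ≡⟨ cong (β *_) (trans (S-mul _ β⁻ _) (cong (_* S⁻ (- u x)) S⁻β⁻)) ⟩
            β * (- β⁻ * S⁻ (- u x)) ≡⟨ negβ _ ⟩
            - S⁻ (- u x) ≡⟨ trans (cong -_ (S-neg _ (u x))) (-‿involutive _) ⟩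
            S⁻ (u x) ∎
            where open ≡-Reasoning
          v′Z : InA τ t v′
          v′Z = ψ-fixed (comp (scal Fixβ⁻) vA) λ x → begin
            S τ (β⁻ * v (S⁻ x)) ≡⟨ S-mul τ β⁻ _ ⟩
            S τ β⁻ * S τ (v (S⁻ x)) ≡⟨ cong₂ _*_ Sβ⁻ (ψv x) ⟩
            - β⁻ * - v x ≡⟨ neg-neg-mul β⁻ (v x) ⟩
            β⁻ * v x ∎
            where open ≡-Reasoning
          u≡ : ∀ x → u x ≡ S τ (u′ x)
          u≡ x = sym (SS⁻ (u x))
          v≡ : ∀ x → v x ≡ β * v′ x
          v≡ x = sym (mulβ (v x))
          anticommute : ∀ x → u (v x) ≡ - v (u x)
          anticommute x = begin
            u (v x) ≡⟨ trans (u≡ _) (cong (λ w → S τ (u′ w)) (v≡ x)) ⟩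
            S τ (u′ (β * v′ x)) ≡⟨ cong (S τ) (A-comm τ∣t ∣-refl u′Z (scal {t} {t} Fixβ) (v′ x)) ⟩
            S τ (β * u′ (v′ x)) ≡⟨ trans (S-mul τ β _) (cong (_* S τ (u′ (v′ x))) Sβ) ⟩
            - β * S τ (u′ (v′ x)) ≡⟨ -‿distribˡ-* β _ ⟨
            - (β * S τ (u′ (v′ x))) ≡⟨ cong (λ w → - (β * w)) (trans (cong (S τ) (A-comm₁ τ∣t u′Z v′Z x)) (sym (A-comm ∣-refl (1∣ t) v′Z (frob {1} {τ}) (u′ x)))) ⟩
            - (β * v′ (S τ (u′ x))) ≡⟨ cong -_ (trans (sym (v≡ _)) (cong v (sym (u≡ x)))) ⟩
            - v (u x) ∎
            where open ≡-Reasoning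
          Sign : Op → F → Set
          Sign w y = w y ≡ y ⊎ w y ≡ - y
          sign-a : ∀ {y} → Im a y → Sign u y
          sign-a {y} h = inj₁ (trans (cong₂ _-_ h (H₁.im⇒γ0 pa h)) (trans (cong (y +_) -0#≈0#) (+-identityʳ y)))
          sign-b : ∀ {y} → Im b y → Sign u y
          sign-b {y} h = inj₂ (trans (cong₂ _-_ (H₁.γim⇒0 pa h) h) (+-identityˡ _))
          sign-c : ∀ {y} → Im c y → Sign v y
          sign-c {y} h = inj₁ (trans (cong₂ _-_ h (H₂.im⇒γ0 pc h)) (trans (cong (y +_) -0#≈0#) (+-identityʳ y)))
          sign-d : ∀ {y} → Im d y → Sign v y
          sign-d {y} h = inj₂ (trans (cong₂ _-_ (H₂.γim⇒0 pc h) h) (+-identityˡ _))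
          meet : ∀ {y} → Sign u y → Sign v y → y ≡ 0#
          meet {y} (inj₁ a) (inj₁ b) = neg-self (trans (sym (trans (cong u b) a)) (trans (anticommute y) (cong -_ (trans (cong v a) b))))
          meet {y} (inj₁ a) (inj₂ b) = neg-zero (neg-self (trans (sym (trans (cong u b) (trans (A-neg uA y) (cong -_ a)))) (trans (anticommute y) (cong -_ (trans (cong v a) b)))))
            where
            neg-zero : - y ≡ 0# → y ≡ 0#
            neg-zero h = trans (sym (-‿involutive y)) (trans (cong -_ h) -0#≈0#)
          meet {y} (inj₂ a) (inj₁ b) = neg-zero (neg-self (trans (sym (trans (cong u b) a)) (trans (anticommute y) (cong -_ (trans (cong v a) (trans (A-neg vA y) (cong -_ b)))))))
            where
            neg-zero : - y ≡ 0# → y ≡ 0#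
            neg-zero h = trans (sym (-‿involutive y)) (trans (cong -_ h) -0#≈0#)
          meet {y} (inj₂ a) (inj₂ b) = neg-self (trans (sym (trans (cong u b) (trans (A-neg uA y) (trans (cong -_ a) (-‿involutive y))))) (trans (anticommute y) (cong -_ (trans (cong v a) (trans (A-neg vA y) (trans (cong -_ b) (-‿involutive y)))))))

          𝒯 : Op → Set
          𝒯 h = Idem τ τ h ⊎ Idem t t h
          Lines : F → Set
          Lines x = Im a x ⊎ Im b x ⊎ Im c x ⊎ Im d x
          to : ∀ {x} → Im f x × ¬ Lines x → Good 𝒯 f x
          to (fx , nl) = fx , λ { h (inj₁ hI) hz le → H₁.avoid pa h hI hz le fx (λ z → nl (inj₁ z)) (λ z → nl (inj₂ (inj₁ z)))
                                ; h (inj₂ hI) hz le → H₂.avoid pc h hI hz le fx (λ z → nl (inj₂ (inj₂ (inj₁ z)))) (λ z → nl (inj₂ (inj₂ (inj₂ z)))) }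
          from : ∀ {x} → Good 𝒯 f x → Im f x × ¬ Lines x
          from (fx , av) = fx , λ { (inj₁ z) → av b (inj₁ (proj₁ pb)) (proj₁ (proj₂ (proj₂ pb))) (proj₁ (proj₂ pb)) (H₁.im⇒γ0 pa z)
                                  ; (inj₂ (inj₁ z)) → av a (inj₁ (proj₁ pa)) (proj₁ (proj₂ (proj₂ pa))) (proj₁ (proj₂ pa)) (H₁.γim⇒0 pa z)
                                  ; (inj₂ (inj₂ (inj₁ z))) → av d (inj₂ (proj₁ pd)) (proj₁ (proj₂ (proj₂ pd))) (proj₁ (proj₂ pd)) (H₂.im⇒γ0 pc z)
                                  ; (inj₂ (inj₂ (inj₂ z))) → av c (inj₂ (proj₁ pc)) (proj₁ (proj₂ (proj₂ pc))) (proj₁ (proj₂ pc)) (H₂.γim⇒0 pc z) }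
          card-good : Card (Good 𝒯 f) ((X₀ ℕ.* X₀ ℕ.+ 3) ∸ 4 ℕ.* X₀)
          card-good = card-cong to from (fourLines f a b c d X₀ (ℕₚ.m^n>0 q (τ ℕ.* D)) (A-0 fZ) (H₁.im⇒f pa) (H₁.im⇒f pb) (H₂.im⇒f pc) (H₂.im⇒f pd)
            (A-0 aA) (A-0 bA) (A-0 cA) (A-0 dA)
            (λ x y → trans (sym x) (H₁.γim⇒0 pa y)) (λ x y → meet (sign-a x) (sign-c y)) (λ x y → meet (sign-a x) (sign-d y))
            (λ x y → meet (sign-b x) (sign-c y)) (λ x y → meet (sign-b x) (sign-d y)) (λ x y → trans (sym x) (H₂.γim⇒0 pc y))
            (card₁ pa) (card₁ pb) (card₂ pc) (card₂ pd) card-f)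

        atom-count : Card (Im f) (X₀ ℕ.* X₀) × Card (Good (λ h → Idem τ τ h ⊎ Idem t t h) f) ((X₀ ℕ.* X₀ ℕ.+ 3) ∸ 4 ℕ.* X₀)
        atom-count = Halved.card-f (proj₁ half₁) (proj₁ half₂) (proj₂ half₁) (proj₂ half₂) , Halved.card-good (proj₁ half₁) (proj₁ half₂) (proj₂ half₁) (proj₂ half₂)

      component-count : ∃ λ m → Card (Im (E k)) ((X₀ ℕ.* X₀) ℕ.^ m) × Card (Good (λ h → Idem τ τ h ⊎ Idem t t h) (E k)) (((X₀ ℕ.* X₀ ℕ.+ 3) ∸ 4 ℕ.* X₀) ℕ.^ m)
      component-count = Family.count τ t N₂ τ∣t N₂t (λ h → Idem τ τ h ⊎ Idem t t h)
        (λ { (inj₁ h) → A-+ (proj₁ h) ; (inj₂ h) → A-+ (proj₁ h) }) (λ { (inj₁ h) → A-0 (proj₁ h) ; (inj₂ h) → A-0 (proj₁ h) })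
        (λ { (inj₁ h) f → A-comm₁ ∣-refl (proj₁ h) (proj₁ (embed₁ f)) ; (inj₂ h) f → A-comm₁ ∣-refl (proj₁ h) (proj₁ (embed₂ f)) })
        (λ { (inj₁ h) f → inj₁ (times h (embed₁ f)) ; (inj₂ h) f → inj₂ (times h (embed₂ f)) })
        (E k) (X₀ ℕ.* X₀) ((X₀ ℕ.* X₀ ℕ.+ 3) ∸ 4 ℕ.* X₀) (λ f fI fM f≼E → Atom.atom-count f fI fM f≼E)
        (E k) (A-mono (1∣ τ) ∣-refl S₂.E∈ , Comp.E-idem k∣n) (Comp.E-idem k∣n)
        where
        embed₁ : ∀ {f} → Idem τ t f → Idem τ τ f
        embed₁ (i , h) = A-mono ∣-refl τ∣t i , h
        embed₂ : ∀ {f} → Idem τ t f → Idem t t f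
        embed₂ (i , h) = A-mono τ∣t ∣-refl i , h
        times : ∀ {s h f} → Idem s s h → Idem s s f → Idem s s (λ x → h (f x))
        times {s} {h} {f} (hA , hh) (fA , ff) = comp hA fA , λ x → trans (cong h (trans (A-comm₁ ∣-refl fA hA (f x)) (cong h (ff x)))) (hh (f x))

    anti-invariant : ∀ τ → 1 ≤ τ → 2 ℕ.* τ ∣ n → ∃ λ β → ¬ β ≡ 0# × S τ β ≡ - β
    anti-invariant τ τ≥1 d = search (Any.any? (λ x → (S (2 ℕ.* τ) x ≟ x) ×-dec ¬? (S τ x ≟ x)) (elems enum))
      where
      search : Dec (Any (λ x → Fix (2 ℕ.* τ) x × ¬ Fix τ x) (elems enum)) → ∃ λ β → ¬ β ≡ 0# × S τ β ≡ - β
      search (yes a) = from (find a)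
        where
        from : (∃ λ x → x ∈ elems enum × Fix (2 ℕ.* τ) x × ¬ Fix τ x) → ∃ λ β → ¬ β ≡ 0# × S τ β ≡ - β
        from (x , _ , fx , nf) = x - S τ x , (λ z → nf (sym (-‿cancel z))) , (begin
          S τ (x - S τ x) ≡⟨ trans (S-add τ x _) (cong (S τ x +_) (S-neg τ (S τ x))) ⟩
          S τ x - S τ (S τ x) ≡⟨ cong (λ w → S τ x - w) (trans (sym (trans (cong (λ w → S w x) (cong (τ ℕ.+_) (ℕₚ.+-identityʳ τ))) (S-+ τ τ x))) fx) ⟩
          S τ x - x ≡⟨ trans (+-comm _ _) (cong (- x +_) (sym (-‿involutive (S τ x)))) ⟩
          - x - (- S τ x) ≡⟨ -‿+-comm x (- S τ x) ⟩
          - (x - S τ x) ∎)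
          where open ≡-Reasoning
      search (no na) = ⊥-elim (ℕₚ.<⇒≱ (ℕₚ.^-monoʳ-< q q≥2 (ℕₚ.m<m+n τ (ℕₚ.≤-trans τ≥1 (ℕₚ.m≤m+n τ 0))))
          (card-inj (λ x → x) (λ {x} fx → decide x fx (S τ x ≟ x)) (λ _ _ e → e) (card-Fix (2 ℕ.* τ) d) (card-Fix τ (∣-trans (n∣m*n 2) d))))
        where
        decide : ∀ x → Fix (2 ℕ.* τ) x → Dec (Fix τ x) → Fix τ x
        decide x fx (yes z) = z
        decide x fx (no z) = ⊥-elim (na (lose (complete enum tt) (fx , z)))

    tests : Bool → ℕ → Op → Set
    tests false t h = Idem t t h
    tests true t h = Idem t t h ⊎ Idem (2 ℕ.* t) (2 ℕ.* t) h

    Avoids : ℕ → F → Set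
    Avoids k y = ∀ h → tests (exceptional q k) (τ q k) h → ¬ h ≐ zeroOp → h ≼ E k → ¬ h y ≡ 0#

    divides-÷ : ∀ {a r k} → Prime r → a ℕ.* r ∣ k → r ∣ k → 1 ≤ k → a ∣ k ÷ r
    divides-÷ {a} {r} {k} R d r∣k h = *-cancelʳ-∣ r {{prime⇒nonZero R}} (subst (a ℕ.* r ∣_) (sym (÷-∣ (prime≥1 R) r∣k)) d)

    module Component (k : ℕ) (k∣n : k ∣ n) where
      open Divisor.C reg k∣n using (D; D≥1; K≡τ²D; D-order⇒; D-order⇐; τ∣k; τr∣k; module Exceptional)
      open Divisor reg k∣n using (τ≥1)
      private
        t = τ q k
        k≥1 = ∣⇒≥1 n≥1 k∣n
        t∣n : t ∣ n
        t∣n = ∣-trans τ∣k k∣n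

      o÷t : ord k q ÷ t ≡ t ℕ.* D
      o÷t = trans (cong (_÷ t) (trans K≡τ²D (lem t D))) (*-÷ (t ℕ.* D) τ≥1)
        where
        lem : ∀ t D → t ℕ.* t ℕ.* D ≡ t ℕ.* D ℕ.* t
        lem = solve-∀

      ord≥1 : 1 ≤ ord k q
      ord≥1 = subst (1 ≤_) (sym K≡τ²D) (ℕₚ.*-mono-≤ (ℕₚ.*-mono-≤ τ≥1 τ≥1) D≥1)

      card-nonexceptional : exceptional q k ≡ false → Card (Good (Idem t t) (E k)) (factor q 1 k)
      card-nonexceptional ex = finish (Single.component-count k∣n t (quotient t∣n) τ≥1 τ∣k (λ r R d → divides-÷ R (τr∣k r R d) d k≥1) (sym (_∣_.equality t∣n))
          D D≥1 (D-order⇐ D ∣-refl) D-order⇒)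
        where
        finish : (∃ λ m → Card (Im (E k)) ((q ℕ.^ (t ℕ.* D)) ℕ.^ m) × Card (Good (Idem t t) (E k)) ((q ℕ.^ (t ℕ.* D) ∸ 1) ℕ.^ m)) → Card (Good (Idem t t) (E k)) (factor q 1 k)
        finish (m , cI , cG) = subst (Card (Good (Idem t t) (E k))) (sym (trans (factor-nonexceptional q k ex) (trans (ℕₚ.*-identityʳ _)
            (cong₂ (λ a b → (q ℕ.^ a ∸ 1) ℕ.^ b) o÷t exponent)))) cG
          where
          φ≡ : φ k ≡ t ℕ.* D ℕ.* m
          φ≡ = exponent-unique q _ _ q≥2 (trans (card-unique (card-E k k∣n) cI (λ x → x) (λ x → x)) (ℕₚ.^-*-assoc q (t ℕ.* D) m))
          exponent : (t ℕ.* φ k) ÷ ord k q ≡ m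
          exponent = trans (cong (_÷ ord k q) (trans (cong (t ℕ.*_) φ≡) (trans (lem t D m) (cong (m ℕ.*_) (sym K≡τ²D))))) (*-÷ m ord≥1)
            where
            lem : ∀ t D m → t ℕ.* (t ℕ.* D ℕ.* m) ≡ m ℕ.* (t ℕ.* t ℕ.* D)
            lem = solve-∀

      card-exceptional : exceptional q k ≡ true → Card (Good (λ h → Idem t t h ⊎ Idem (2 ℕ.* t) (2 ℕ.* t) h) (E k)) (factor q 1 k)
      card-exceptional ex = construct (anti-invariant t τ≥1 2t∣n)
        where
        parts = Divisor.exceptional-parts reg k∣n ex
        module X = Exceptional (proj₁ parts) (proj₁ (proj₂ parts)) (proj₂ (proj₂ parts))
        2t∣n : 2 ℕ.* t ∣ n
        2t∣n = ∣-trans X.2τ∣k k∣n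
        D₂ = quotient X.2∣D
        D≡ : D ≡ 2 ℕ.* D₂
        D≡ = trans (_∣_.equality X.2∣D) (ℕₚ.*-comm D₂ 2)
        Gd : F → Set
        Gd = Good (λ h → Idem t t h ⊎ Idem (2 ℕ.* t) (2 ℕ.* t) h) (E k)
        finish : (∃ λ m → Card (Im (E k)) ((q ℕ.^ (t ℕ.* D) ℕ.* q ℕ.^ (t ℕ.* D)) ℕ.^ m) × Card Gd (((q ℕ.^ (t ℕ.* D) ℕ.* q ℕ.^ (t ℕ.* D) ℕ.+ 3) ∸ 4 ℕ.* q ℕ.^ (t ℕ.* D)) ℕ.^ m)) → Card Gd (factor q 1 k)
        finish (m , cI , cG) = subst (Card Gd) (sym (trans (factor-exceptional q k ex) (trans (ℕₚ.*-identityʳ _)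
            (trans (cong₂ (λ a b → ((q ℕ.^ (2 ℕ.* a) ℕ.+ 3) ∸ 4 ℕ.* q ℕ.^ a) ℕ.^ b) o÷t exponent)
              (cong (λ w → ((w ℕ.+ 3) ∸ 4 ℕ.* q ℕ.^ (t ℕ.* D)) ℕ.^ m) (double (t ℕ.* D))))))) cG
          where
          double : ∀ a → q ℕ.^ (2 ℕ.* a) ≡ q ℕ.^ a ℕ.* q ℕ.^ a
          double a = trans (cong (λ w → q ℕ.^ (a ℕ.+ w)) (ℕₚ.+-identityʳ a)) (ℕₚ.^-distribˡ-+-* q a a)
          φ≡ : φ k ≡ 2 ℕ.* (t ℕ.* D) ℕ.* m
          φ≡ = exponent-unique q _ _ q≥2 (trans (card-unique (card-E k k∣n) cI (λ x → x) (λ x → x)) (trans (cong (ℕ._^ m) (sym (double (t ℕ.* D)))) (ℕₚ.^-*-assoc q (2 ℕ.* (t ℕ.* D)) m)))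
          exponent : (t ℕ.* φ k) ÷ (2 ℕ.* ord k q) ≡ m
          exponent = trans (cong (_÷ (2 ℕ.* ord k q)) (trans (cong (t ℕ.*_) φ≡) (trans (lem t D m) (cong (λ w → m ℕ.* (2 ℕ.* w)) (sym K≡τ²D))))) (*-÷ m (ℕₚ.*-mono-≤ {1} {2} (s≤s z≤n) ord≥1))
            where
            lem : ∀ t D m → t ℕ.* (2 ℕ.* (t ℕ.* D) ℕ.* m) ≡ m ℕ.* (2 ℕ.* (t ℕ.* t ℕ.* D))
            lem = solve-∀
        construct : (∃ λ β → ¬ β ≡ 0# × S t β ≡ - β) → Card Gd (factor q 1 k)
        construct (β , β≢0 , Sβ) = finish (At.component-count k∣n t (quotient 2t∣n) τ≥1 (sym (_∣_.equality 2t∣n)) X.2τ∣k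
          (λ r R d → divides-÷ R (X.2τr∣k r R d) d k≥1) D D₂ (∣⇒≥1 D≥1 (subst (D₂ ∣_) (sym D≡) (n∣m*n 2))) D≡ (D-order⇐ D ∣-refl) D-order⇒ (λ u d → D-order⇒ u (X.half⇒ u d))
          β (proj₁ (inverse β β≢0)) β≢0 (proj₂ (inverse β β≢0)) Sβ)

      card-component : Card (λ y → E k y ≡ y × Avoids k y) (factor q 1 k)
      card-component = byCase (exceptional q k) refl
        where
        byCase : ∀ b → exceptional q k ≡ b → Card (λ y → E k y ≡ y × Avoids k y) (factor q 1 k)
        byCase false ex = subst (λ b → Card (λ y → E k y ≡ y × (∀ h → tests b t h → ¬ h ≐ zeroOp → h ≼ E k → ¬ h y ≡ 0#)) (factor q 1 k)) (sym ex) (card-nonexceptional ex)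
        byCase true ex = subst (λ b → Card (λ y → E k y ≡ y × (∀ h → tests b t h → ¬ h ≐ zeroOp → h ≼ E k → ¬ h y ≡ 0#)) (factor q 1 k)) (sym ex) (card-exceptional ex)

      CN⇒Avoids : ∀ {w} → CN w → Avoids k (E k w)
      CN⇒Avoids {w} cn h hT hz h≼E z = byCase (exceptional q k) refl hT
        where
        hw : h w ≡ 0#
        hw = trans (sym (h≼E w)) z
        contradict : ∀ s → s ∣ n → Idem s s h → ⊥
        contradict s s∣n (hA , _) = hz λ x → trans (proj₂ (proj₂ zf) x) (trans (S.Big-cong (downFrom N) (λ {j} j∈ → trans (cong (_* S (s ℕ.* j) x) (cn s N Ns (proj₁ zf) (λ j _ → proj₁ (proj₂ zf) j) (trans (sym (proj₂ (proj₂ zf) w)) hw) j (∈-downFrom⁻ j∈))) (zeroˡ _))) (∑-zero (downFrom N)))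
          where
          N = quotient s∣n
          Ns : N ℕ.* s ≡ n
          Ns = sym (_∣_.equality s∣n)
          zf = nf N ∣-refl Ns hA
        byCase : ∀ b → exceptional q k ≡ b → tests b t h → ⊥
        byCase false ex hI = contradict t t∣n hI
        byCase true ex (inj₁ hI) = contradict t t∣n hI
        byCase true ex (inj₂ hI) = contradict (2 ℕ.* t) (∣-trans (X.2τ∣k) k∣n) hI
          where
          parts = Divisor.exceptional-parts reg k∣n ex
          module X = Exceptional (proj₁ parts) (proj₁ (proj₂ parts)) (proj₂ (proj₂ parts))

      concentrate : ∀ d m → k ≡ d ℕ.* m → (∀ r → Prime r → r ∣ d → r ∣ m) → ∀ f → Idem d d f → f ≼ E k → tests (exceptional q k) t f
      concentrate d m k≡ pr f fI f≼E = byCase (exceptional q k) refl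
        where
        byCase : ∀ b → exceptional q k ≡ b → tests b t f
        byCase false ex = Concentrate.concentrated k∣n d m t k≡ pr (Divisor.C.nonexceptional-target reg k∣n (Divisor.nonexceptional reg k∣n ex) d m k≡ pr) t∣n f fI f≼E
        byCase true ex = parity (2 ∣? d)
          where
          parts = Divisor.exceptional-parts reg k∣n ex
          module X = Exceptional (proj₁ parts) (proj₁ (proj₂ parts)) (proj₂ (proj₂ parts))
          parity : Dec (2 ∣ d) → tests true t f
          parity (no odd) = inj₁ (Concentrate.concentrated k∣n d m t k≡ pr (X.exceptional-target-odd d m odd k≡ pr) t∣n f fI f≼E)
          parity (yes even) = inj₂ (Concentrate.concentrated k∣n d m (2 ℕ.* t) k≡ pr (X.exceptional-target-even d m even k≡ pr) (∣-trans X.2τ∣k k∣n) f fI f≼E)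

    Avoids⇒CN : ∀ {w} → (∀ {k} → k ∈ divisors n → Avoids k (E k w)) → CN w
    Avoids⇒CN {w} av d N Nd c cF sum0 = decide (≐? x zeroOp)
      where
      x : Op
      x = comb d N c
      xA : InA d d x
      xA = combA N c cF
      N∣n : N ∣ n
      N∣n = divides d (trans (sym Nd) (ℕₚ.*-comm N d))
      d≥1 : 1 ≤ d
      d≥1 = ∣⇒≥1 n≥1 (divides N (sym Nd))
      decide : Dec (x ≐ zeroOp) → ∀ j → j < N → c j ≡ 0#
      decide (yes z) = comb-unique d N Nd c (λ _ → 0#) (λ y → trans (z y) (sym (trans (S.Big-cong (downFrom N) (λ _ → zeroˡ _)) (∑-zero (downFrom N)))))
      decide (no nz) = ⊥-elim (invert (RingA.regular d d ∣-refl N Nd (coprime-∣ q-coprime N∣n ∣-refl) d≥1 x xA))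
        where
        invert : (∃ λ g → InA d d g × (∀ y → x (g (x y)) ≡ x y)) → ⊥
        invert (g , gA , xgx) = contradict (reduce d N Nd f fI f≢0)
          where
          f : Op
          f y = g (x y)
          fI : Idem d d f
          fI = comp gA xA , λ y → cong g (xgx y)
          f≢0 : ¬ f ≐ zeroOp
          f≢0 z = nz λ y → trans (sym (xgx y)) (trans (cong x (z y)) (A-0 xA))
          fw : f w ≡ 0#
          fw = trans (cong g sum0) (A-0 gA)
          contradict : Reduced f → ⊥
          contradict r = av (∈-divisors⁺ n≥1 R.m∣) R.f′ (Component.concentrate (R.d ℕ.* R.m) R.m∣ R.d R.m refl R.primes R.f′ R.f′I R.f′≼E) R.nonzero′ R.f′≼E
              (trans (R.f′≼E w) (trans (sym (R.f′≼f w)) (trans (cong R.f′ fw) (A-0 (proj₁ R.f′I)))))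
            where module R = Reduced r

    card-CN : Card CN (formula q 1 n)
    card-CN = card-cong to from
      (card-components (divisors n) (divisors-unique n) (∈-divisors⁻ {m = n}) Avoids (factor q 1) (λ k∈ → Component.card-component _ (∈-divisors⁻ {m = n} k∈)))
      where
      Components : F → Set
      Components w = ∑ (divisors n) (λ k → E k w) ≡ w × (∀ {k} → k ∈ divisors n → Avoids k (E k w))
      to : ∀ {w} → Components w → CN w
      to (_ , av) = Avoids⇒CN av
      from : ∀ {w} → CN w → Components w
      from {w} cn = E-sum ∣-refl w (S-n w) , λ {k} k∈ → Component.CN⇒Avoids k (∈-divisors⁻ {m = n} k∈) cn

module FiniteModels where

  open import Algebra.Bundles using (CommutativeRing; RawRing)
  open import Algebra.Morphism.Structures using (IsRingMonomorphism)
  import Algebra.Morphism.RingMonomorphism as RM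
  open import Data.Fin as Fin using (Fin; zero; suc)
  open import Data.List using (List; _∷_; length; lookup; allFin)
  open import Data.List.Properties using (length-tabulate)
  open import Data.List.Membership.Propositional.Properties using (∈-allFin)
  import Data.List.Relation.Unary.Unique.Propositional.Properties as Uniq
  open import Data.List.Relation.Unary.All as All using (All; _∷_)
  open import Data.List.Relation.Unary.AllPairs using (AllPairs; _∷_)
  open import Data.List.Relation.Unary.Any as Any using (Any)
  open import Data.List.Relation.Unary.Any.Properties using (lookup-index)
  open import Data.Product using (∃; _×_; _,_)
  open import Data.Empty using (⊥-elim)
  open import Data.Unit using (tt)
  open import Relation.Nullary using (¬_)
  open import Relation.Binary.PropositionalEquality as ≡ using (_≡_; cong)
  open Cardinality
  open FiniteFields using (FinField)

  -- A finite subfield of a commutative ring over a setoid, as a field with propositional equality on a Fin type.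
  module Subfield {c ℓ} (R : CommutativeRing c ℓ) where
    open CommutativeRing R

    module Finite {s} (Sub : Carrier → Set s)
      (sub-+ : ∀ {x y} → Sub x → Sub y → Sub (x + y)) (sub-* : ∀ {x y} → Sub x → Sub y → Sub (x * y)) (sub-neg : ∀ {x} → Sub x → Sub (- x))
      (sub-0 : Sub 0#) (sub-1 : Sub 1#) (1≉0 : ¬ 1# ≈ 0#)
      (inv : ∀ x → Sub x → ¬ x ≈ 0# → ∃ λ y → Sub y × x * y ≈ 1#)
      (xs : List Carrier) (distinct : AllPairs (λ x y → ¬ x ≈ y) xs) (members : All Sub xs) (covers : ∀ x → Sub x → Any (x ≈_) xs) where

      I : Set
      I = Fin (length xs)

      to : I → Carrier
      to = lookup xs

      to-Sub : ∀ i → Sub (to i)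
      to-Sub = go members
        where
        go : ∀ {ys} → All Sub ys → ∀ i → Sub (lookup ys i)
        go (p ∷ ps) zero = p
        go (p ∷ ps) (suc i) = go ps i

      to-injective : ∀ {i j} → to i ≈ to j → i ≡ j
      to-injective = go distinct
        where
        at : ∀ {Q : Carrier → Set ℓ} {ys} → All Q ys → ∀ i → Q (lookup ys i)
        at (p ∷ ps) zero = p
        at (p ∷ ps) (suc i) = at ps i
        go : ∀ {ys} → AllPairs (λ x y → ¬ x ≈ y) ys → ∀ {i j} → lookup ys i ≈ lookup ys j → i ≡ j
        go (a ∷ as) {zero} {zero} e = ≡.refl
        go (a ∷ as) {zero} {suc j} e = ⊥-elim (at a j e)
        go (a ∷ as) {suc i} {zero} e = ⊥-elim (at a i (sym e))
        go (a ∷ as) {suc i} {suc j} e = cong suc (go as e)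

      from : ∀ x → Sub x → I
      from x h = Any.index (covers x h)

      to-from : ∀ x h → to (from x h) ≈ x
      to-from x h = sym (lookup-index (covers x h))

      raw : RawRing _ _
      raw = record
        { Carrier = I ; _≈_ = _≡_
        ; _+_ = λ i j → from (to i + to j) (sub-+ (to-Sub i) (to-Sub j))
        ; _*_ = λ i j → from (to i * to j) (sub-* (to-Sub i) (to-Sub j))
        ; -_ = λ i → from (- to i) (sub-neg (to-Sub i))
        ; 0# = from 0# sub-0 ; 1# = from 1# sub-1 }

      to-mono : IsRingMonomorphism raw (CommutativeRing.rawRing R) to
      to-mono = record
        { isRingHomomorphism = record
          { isSemiringHomomorphism = record
            { isNearSemiringHomomorphism = record
              { +-isMonoidHomomorphism = record
                { isMagmaHomomorphism = record { isRelHomomorphism = record { cong = λ e → reflexive (cong to e) } ; homo = λ i j → to-from _ _ }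
                ; ε-homo = to-from _ _ }
              ; *-homo = λ i j → to-from _ _ }
            ; 1#-homo = to-from _ _ }
          ; -‿homo = λ i → to-from _ _ }
        ; injective = to-injective }

      model : FinField
      model = record
        { F = I ; _+_ = RawRing._+_ raw ; _*_ = RawRing._*_ raw ; -_ = RawRing.-_ raw ; 0# = RawRing.0# raw ; 1# = RawRing.1# raw
        ; isCommutativeRing = RM.isCommutativeRing to-mono isCommutativeRing
        ; 1≢0 = λ e → 1≉0 (trans (sym (to-from _ _)) (trans (reflexive (cong to e)) (to-from _ _)))
        ; inverse = λ i ne → let (y , sy , e) = inv (to i) (to-Sub i) (λ z → ne (to-injective (trans z (sym (to-from _ _))))) in
            from y sy , to-injective (trans (to-from _ _) (trans (*-congˡ (to-from y sy)) (trans e (sym (to-from _ _)))))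
        ; _≟_ = Fin._≟_
        ; order = length xs
        ; enum = mkCard (allFin (length xs)) (length-tabulate (λ i → i)) (Uniq.allFin⁺ (length xs)) (λ _ → tt) (λ {i} _ → ∈-allFin i) }

module TraceDescent where

  open import Algebra.Bundles using (CommutativeRing)
  open import Data.Nat as ℕ using (ℕ; zero; suc; _≤_; _<_; z≤n; s≤s; _∸_; >-nonZero)
  import Data.Nat.Properties as ℕₚ
  open import Data.Nat.Divisibility using (_∣_; _∣?_; divides; ∣⇒≤; ∣-refl; ∣-trans; m∣m*n; n∣m*n; 1∣_)
  open import Data.Nat.DivMod using (_%_; _/_; m≡m%n+[m/n]*n; m%n<n; m<n⇒m%n≡m; [m+kn]%n≡m%n)
  open import Data.Nat.Coprimality as Cop using (Coprime)
  open import Data.Nat.Primality using (prime⇒nonZero)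
  open import Data.Nat.Tactic.RingSolver using (solve-∀)
  open import Data.List using (List; []; _∷_; downFrom)
  open import Data.List.Membership.Propositional.Properties using (∈-downFrom⁺; ∈-downFrom⁻)
  open import Data.List.Relation.Unary.All as All using (All)
  open import Data.List.Relation.Unary.Any as Any using (Any)
  import Data.List.Relation.Unary.Unique.Propositional.Properties as Uniq
  open import Data.Product using (Σ; ∃; _×_; _,_; proj₁; proj₂)
  open import Data.Unit using (tt)
  open import Relation.Nullary using (¬_; Dec; yes; no)
  open import Relation.Binary.PropositionalEquality
  open Arithmetic
  open Orders
  open Cardinality
  open FiniteFields
  open FiniteModels
  open TwistedGroupRing

  module Step (Ω : Extension) (n₁ n' : ℕ) (pn₁ : Extension.p Ω ℕ.* n₁ ≡ Extension.n Ω) (reg : Reg (Extension.q Ω) (Extension.n Ω) n')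
    (p-free : ∀ N → N ∣ Extension.n Ω → ¬ Extension.p Ω ∣ N → N ∣ n') where

    open Setting Ω public
    open Reg reg using (q-coprime; o; o≥1; o-one; o-coprime)

    n₁∣n : n₁ ∣ n
    n₁∣n = divides p (sym pn₁)

    n₁≥1 : 1 ≤ n₁
    n₁≥1 = ∣⇒≥1 n≥1 n₁∣n

    fixed : Card (Fix n₁) (q ℕ.^ n₁)
    fixed = card-Fix n₁ n₁∣n

    module Descent (FF₁ : FinField) (order₁ : FinField.order FF₁ ≡ q ℕ.^ n₁) (ι : FinField.F FF₁ → F)
      (ι-inj : ∀ {x y} → ι x ≡ ι y → x ≡ y) (ι-0 : ι (FinField.0# FF₁) ≡ 0#) (ι-1 : ι (FinField.1# FF₁) ≡ 1#)
      (ι-+ : ∀ x y → ι (FinField._+_ FF₁ x y) ≡ ι x + ι y) (ι-* : ∀ x y → ι (FinField._*_ FF₁ x y) ≡ ι x * ι y)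
      (ι-fixed : ∀ x → Fix n₁ (ι x)) (from : ∀ x → Fix n₁ x → FinField.F FF₁) (to-from : ∀ x h → ι (from x h) ≡ x) where

      module O₁ = Setting (extension FF₁ p e n₁ P e≥1 n₁≥1 q q≡ order₁)

      ι-^ : ∀ x k → ι (x O₁.^ k) ≡ ι x ^ k
      ι-^ x zero = ι-1
      ι-^ x (suc k) = trans (ι-* x _) (cong (ι x *_) (ι-^ x k))

      ι-S : ∀ i x → ι (O₁.S i x) ≡ S i (ι x)
      ι-S i x = trans (cong ι (O₁.S-def i x)) (trans (ι-^ x (q ℕ.^ i)) (sym (S-def i (ι x))))

      ι-∑ : ∀ {I : Set} (L : List I) f → ι (O₁.∑ L f) ≡ ∑ L (λ i → ι (f i))
      ι-∑ [] f = ι-0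
      ι-∑ (x ∷ L) f = trans (ι-+ (f x) _) (cong (ι (f x) +_) (ι-∑ L f))

      ι-comb : ∀ d N c w → ι (O₁.comb d N c w) ≡ comb d N (λ j → ι (c j)) (ι w)
      ι-comb d N c w = trans (ι-∑ (downFrom N) _) (S.Big-cong (downFrom N) (λ {j} _ → trans (ι-* (c j) _) (cong (ι (c j) *_) (ι-S (d ℕ.* j) w))))

      ι-Fix : ∀ {i x} → O₁.Fix i x → Fix i (ι x)
      ι-Fix {i} {x} h = trans (sym (ι-S i x)) (cong ι h)

      Fix-ι : ∀ {i x} → Fix i (ι x) → O₁.Fix i x
      Fix-ι {i} {x} h = ι-inj (trans (ι-S i x) h)

      Tr : Op
      Tr x = ∑ (downFrom p) (λ i → S (n₁ ℕ.* i) x)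

      n₁p : n₁ ℕ.* p ≡ n
      n₁p = trans (ℕₚ.*-comm n₁ p) pn₁

      Tr-Fix : ∀ x → Fix n₁ (Tr x)
      Tr-Fix x = ∑-orbit-Fix n₁ p (subst (λ w → Fix w x) (sym n₁p) (S-n x))

      tr : F → O₁.F
      tr x = from (Tr x) (Tr-Fix x)

      ι-tr : ∀ x → ι (tr x) ≡ Tr x
      ι-tr x = to-from _ _

      comb-Tr : ∀ d N₁ → N₁ ℕ.* d ≡ n₁ → (c : ℕ → F) → (∀ j i → c (j ℕ.+ i ℕ.* N₁) ≡ c j) → ∀ v → comb d (p ℕ.* N₁) c v ≡ comb d N₁ c (Tr v)
      comb-Tr d N₁ N₁d c per v = begin
        comb d (p ℕ.* N₁) c v ≡⟨ ∑-blocks p N₁ (λ j → c j * S (d ℕ.* j) v) ⟩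
        ∑ (downFrom p) (λ i → ∑ (downFrom N₁) (λ j → c (j ℕ.+ i ℕ.* N₁) * S (d ℕ.* (j ℕ.+ i ℕ.* N₁)) v)) ≡⟨ ∑-swap (downFrom p) (downFrom N₁) _ ⟩
        ∑ (downFrom N₁) (λ j → ∑ (downFrom p) (λ i → c (j ℕ.+ i ℕ.* N₁) * S (d ℕ.* (j ℕ.+ i ℕ.* N₁)) v)) ≡⟨ S.Big-cong (downFrom N₁) (λ {j} _ →
            trans (S.Big-cong (downFrom p) (λ {i} _ → cong₂ _*_ (per j i) (trans (cong (λ w → S w v) (trans (lem d j i N₁) (cong (λ w → d ℕ.* j ℕ.+ w ℕ.* i) N₁d))) (S-+ (d ℕ.* j) _ v))))
              (trans (sym (∑-*ˡ (downFrom p) _ (c j))) (cong (c j *_) (sym (S-∑ (d ℕ.* j) (downFrom p) _))))) ⟩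
        comb d N₁ c (Tr v) ∎
        where
        open ≡-Reasoning
        lem : ∀ d j i N → d ℕ.* (j ℕ.+ i ℕ.* N) ≡ d ℕ.* j ℕ.+ N ℕ.* d ℕ.* i
        lem = solve-∀

      down : ∀ {v} → CN v → O₁.CN (tr v)
      down {v} cn d N₁ N₁d c cF sum0 j j<N₁ = ι-inj (trans (trans (sym (cong (λ w → ι (c w)) (m<n⇒m%n≡m j<N₁)))
          (cn d (p ℕ.* N₁) (trans (ℕₚ.*-assoc p N₁ d) (trans (cong (p ℕ.*_) N₁d) pn₁)) C (λ i _ → ι-Fix (cF (i % N₁) (m%n<n i N₁)))
            (trans (comb-Tr d N₁ N₁d C (λ j i → cong (λ w → ι (c w)) ([m+kn]%n≡m%n j i N₁)) v) (trans (S.Big-cong (downFrom N₁) (λ {i} i∈ → cong (λ w → ι (c w) * S (d ℕ.* i) (Tr v)) (m<n⇒m%n≡m (∈-downFrom⁻ i∈))))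
              (trans (cong (comb d N₁ (λ j → ι (c j))) (sym (ι-tr v))) (trans (sym (ι-comb d N₁ c (tr v))) (trans (cong ι sum0) ι-0)))))
            j (ℕₚ.<-≤-trans j<N₁ (ℕₚ.m≤n*m N₁ p {{prime⇒nonZero P}})))) (sym ι-0))
        where
        instance _ = >-nonZero (ℕₚ.≤-trans (s≤s z≤n) j<N₁)
        C : ℕ → F
        C i = ι (c (i % N₁))

      comb-zero : ∀ {d N} → N ℕ.* d ≡ n → ∀ {c} → comb d N c ≐ zeroOp → ∀ j → j < N → c j ≡ 0#
      comb-zero {d} {N} Nd {c} z = comb-unique d N Nd c (λ _ → 0#) (λ y → trans (z y) (sym (trans (S.Big-cong (downFrom N) (λ _ → zeroˡ _)) (∑-zero (downFrom N)))))

      zero-comb : ∀ {d N c} → (∀ j → j < N → c j ≡ 0#) → comb d N c ≐ zeroOp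
      zero-comb {d} {N} h x = trans (S.Big-cong (downFrom N) (λ {j} j∈ → trans (cong (_* S (d ℕ.* j) x) (h j (∈-downFrom⁻ j∈))) (zeroˡ _))) (∑-zero (downFrom N))

      -- If p divides the order of σ^d then (σ^n₁ − 1)^p = 0, so a nonzero annihilator can be made invariant under σ^n₁.
      module Divisible (d N₁ : ℕ) (N₁d : N₁ ℕ.* d ≡ n₁) (v : F) (cn : O₁.CN (tr v)) where
        private
          N = p ℕ.* N₁
          Nd : N ℕ.* d ≡ n
          Nd = trans (ℕₚ.*-assoc p N₁ d) (trans (cong (p ℕ.*_) N₁d) pn₁)
          N₁≥1 : 1 ≤ N₁
          N₁≥1 = ∣⇒≥1 n₁≥1 (divides d (trans (sym N₁d) (ℕₚ.*-comm N₁ d)))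
          instance
            _ = >-nonZero N₁≥1
            _ = >-nonZero (ℕₚ.*-mono-≤ (prime≥1 P) N₁≥1)
          d∣n₁ : d ∣ n₁
          d∣n₁ = divides N₁ (sym N₁d)

        invariant-zero : ∀ y → InA d d y → (∀ x → S n₁ (y x) ≡ y x) → y v ≡ 0# → y ≐ zeroOp
        invariant-zero y yA inv yv x = trans (coeff-eq x) (zero-comb {d} {N} (λ j _ → trans (coeff-Cong N₁ period (cg j)) (all0 (j % N₁) (m%n<n j N₁))) x)
          where
          open Coeff N ∣-refl Nd yA
          period : ∀ j → coeff (j ℕ.+ N₁) ≡ coeff j
          period = coeff-period N₁ λ x → trans (A-comm₁ ∣-refl yA (iterA {d} {d} N₁) x) (trans (cong (λ w → S w (y x)) (trans (ℕₚ.*-comm d N₁) N₁d)) (inv x))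
          cg : ∀ j → Cong N₁ j (j % N₁)
          cg j = 0 , j / N₁ , trans (ℕₚ.+-identityʳ j) (m≡m%n+[m/n]*n j N₁)
          c₁ : ℕ → O₁.F
          c₁ j = from (coeff j) (Fix-∣ d∣n₁ (coeff-Fix j))
          ιc₁ : ∀ j → ι (c₁ j) ≡ coeff j
          ιc₁ j = to-from _ _
          all0 : ∀ j → j < N₁ → coeff j ≡ 0#
          all0 j l = trans (sym (ιc₁ j)) (trans (cong ι (cn d N₁ N₁d c₁ (λ j _ → Fix-ι (subst (Fix d) (sym (ιc₁ j)) (coeff-Fix j))) (ι-inj (trans (ι-comb d N₁ c₁ (tr v))
             (trans (S.Big-cong (downFrom N₁) (λ {j} _ → cong₂ (λ a b → a * S (d ℕ.* j) b) (ιc₁ j) (ι-tr v)))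
               (trans (sym (comb-Tr d N₁ N₁d coeff (λ j i → coeff-Cong N₁ period (0 , i , ℕₚ.+-identityʳ _)) v)) (trans (sym (coeff-eq v)) (trans yv (sym ι-0))))))) j l)) ι-0)

        private
          module RA = RingA d d ∣-refl
          module R = CommutativeRing RA.ringA
        open RA using (_^A_)

        U a : RA.El
        U = S n₁ , S∈A d∣n₁
        a = U R.+ (R.- R.1#)

        a^p≐0 : proj₁ (a ^A p) ≐ zeroOp
        a^p≐0 x = +-cancelʳ x _ _ (begin
          proj₁ (a ^A p) x + x ≡⟨ cong (proj₁ (a ^A p) x +_) (one-power p) ⟨
          proj₁ (a ^A p) x + proj₁ (R.1# ^A p) x ≡⟨ CharP.frobenius-+ RA.ringA p P (λ f x → trans (RA.·A-eval p f x) (char _)) a R.1# x ⟨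
          proj₁ ((a R.+ R.1#) ^A p) x ≡⟨ RA.^A-congˡ p {a R.+ R.1#} {U} (λ y → trans (+-assoc _ _ _) (trans (cong (S n₁ y +_) (-‿inverseˡ y)) (+-identityʳ _))) x ⟩
          proj₁ (U ^A p) x ≡⟨ U-power p ⟩
          S (n₁ ℕ.* p) x ≡⟨ trans (cong (λ w → S w x) n₁p) (S-n x) ⟩
          x ≡⟨ +-identityˡ x ⟨
          0# + x ∎)
          where
          open ≡-Reasoning
          one-power : ∀ k → proj₁ (R.1# ^A k) x ≡ x
          one-power zero = refl
          one-power (suc k) = one-power k
          U-power : ∀ k → proj₁ (U ^A k) x ≡ S (n₁ ℕ.* k) x
          U-power zero = sym (trans (cong (λ w → S w x) (ℕₚ.*-zeroʳ n₁)) (S-0 x))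
          U-power (suc k) = trans (cong (S n₁) (U-power k)) (trans (sym (S-+ n₁ _ x)) (cong (λ w → S w x) (sym (ℕₚ.*-suc n₁ k))))

        annihilator-zero : ∀ x → InA d d x → x v ≡ 0# → x ≐ zeroOp
        annihilator-zero x xA xv = descend p (λ y → a^p≐0 (x y))
          where
          iter : ℕ → Op
          iter i y = proj₁ (a ^A i) (x y)
          descend : ∀ i → iter i ≐ zeroOp → x ≐ zeroOp
          descend zero z = z
          descend (suc i) z = descend i (invariant-zero (iter i) (comp (proj₂ (a ^A i)) xA) (λ y → -‿cancel (z y)) (trans (cong (proj₁ (a ^A i)) xv) (A-0 (proj₂ (a ^A i)))))

      -- If p does not divide the order N of σ^d, the annihilating idempotents already live over 𝔽_{q^(d/p)}.
      module Coprimal (d₁ N : ℕ) (Nd₁ : N ℕ.* d₁ ≡ n₁) (p∤N : ¬ p ∣ N) (v : F) (cn : O₁.CN (tr v)) where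
        private
          d = p ℕ.* d₁
          Nd : N ℕ.* d ≡ n
          Nd = trans (lem N p d₁) (trans (cong (p ℕ.*_) Nd₁) pn₁)
            where
            lem : ∀ N p d → N ℕ.* (p ℕ.* d) ≡ p ℕ.* (N ℕ.* d)
            lem = solve-∀
          N∣n₁ : N ∣ n₁
          N∣n₁ = divides d₁ (trans (sym Nd₁) (ℕₚ.*-comm N d₁))
          N≥1 : 1 ≤ N
          N≥1 = ∣⇒≥1 n₁≥1 N∣n₁
          instance _ = >-nonZero N≥1
          N∣n' : N ∣ n'
          N∣n' = p-free N (∣-trans N∣n₁ n₁∣n) p∤N
          copN : Coprime N q
          copN = coprime-∣ q-coprime N∣n' ∣-refl
          copp : Coprime N p
          copp = Cop.sym (prime-coprime P p∤N)
          d₁∣n₁ : d₁ ∣ n₁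
          d₁∣n₁ = divides N (sym Nd₁)
          d₁≥1 = ∣⇒≥1 n₁≥1 d₁∣n₁

        idempotent-zero : ∀ f → Idem d d f → f v ≡ 0# → f ≐ zeroOp
        idempotent-zero f (fA , ff) fv x = trans (coeff-eq x) (zero-comb {d} {N} all0 x)
          where
          open Coeff N ∣-refl Nd fA
          fix₁ : ∀ j → Fix d₁ (coeff j)
          fix₁ j = go (power-root (q ℕ.^ d₁) o p N (ℕₚ.m^n>0 q d₁) o≥1 N≥1 (prime≥1 P)
              (λ s S s∣N → subst (One s) (trans (ℕₚ.^-*-assoc q o d₁) (trans (cong (q ℕ.^_) (ℕₚ.*-comm o d₁)) (sym (ℕₚ.^-*-assoc q d₁ o)))) (One-^ s (q ℕ.^ o) d₁ (ℕₚ.m^n>0 q o) (o-one s S (∣-trans s∣N N∣n'))))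
              (Cop.sym (coprime-∣ o-coprime ∣-refl (divides n₁ (sym n₁p)))) (Cop.sym copp))
            where
            go : (∃ λ v → Cong N ((q ℕ.^ d₁) ℕ.^ (p ℕ.* v)) (q ℕ.^ d₁)) → Fix d₁ (coeff j)
            go (v , cg) = begin
              S d₁ (coeff j) ≡⟨ coeff-power copN ff d₁ j ⟩
              coeff (q ℕ.^ d₁ ℕ.* j) ≡⟨ coeff-Cong N (λ j → trans (cong coeff (cong (j ℕ.+_) (sym (ℕₚ.*-identityˡ N)))) (coeff-N j 1)) (Cong-* j (Cong-sym cg)) ⟩
              coeff ((q ℕ.^ d₁) ℕ.^ (p ℕ.* v) ℕ.* j) ≡⟨ cong (λ w → coeff (w ℕ.* j)) (trans (ℕₚ.^-*-assoc q d₁ (p ℕ.* v)) (cong (q ℕ.^_) (lem d₁ p v))) ⟩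
              coeff (q ℕ.^ (d ℕ.* v) ℕ.* j) ≡⟨ coeff-power copN ff (d ℕ.* v) j ⟨
              S (d ℕ.* v) (coeff j) ≡⟨ Fix-∣ (m∣m*n v) (coeff-Fix j) ⟩
              coeff j ∎
              where
              open ≡-Reasoning
              lem : ∀ d p v → d ℕ.* (p ℕ.* v) ≡ p ℕ.* d ℕ.* v
              lem = solve-∀
          fA₁ : InA d₁ d f
          fA₁ = ext (λ x → sym (coeff-eq x)) (combA N coeff (λ j _ → fix₁ j))
          fTr : f (Tr v) ≡ 0#
          fTr = trans (∑-hom (downFrom p) (λ i → S (n₁ ℕ.* i) v) f (A-0 fA) (A-+ fA)) (trans (S.Big-cong (downFrom p) (λ {i} _ →
              trans (A-comm ∣-refl (1∣ d) fA₁ (S∈A {1} {d₁} (∣-trans d₁∣n₁ (m∣m*n i))) v) (trans (cong (S (n₁ ℕ.* i)) fv) (S-0# _)))) (∑-zero (downFrom p)))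
          π : ℕ → ℕ
          π j = (p ℕ.* j) % N
          c₁ : ℕ → O₁.F
          c₁ j = from (coeff j) (Fix-∣ d₁∣n₁ (fix₁ j))
          ιc₁ : ∀ j → ι (c₁ j) ≡ coeff j
          ιc₁ j = to-from _ _
          c₁-Fix : ∀ j → O₁.Fix d₁ (c₁ j)
          c₁-Fix j = Fix-ι (subst (Fix d₁) (sym (ιc₁ j)) (fix₁ j))
          c₂ : ℕ → O₁.F
          c₂ m = O₁.∑ (downFrom N) (λ j → O₁.δ (π j) m (c₁ j))
          δ-Fix : ∀ i j {a} → O₁.Fix d₁ a → O₁.Fix d₁ (O₁.δ i j a)
          δ-Fix i j h with i ℕ.≟ j
          ... | yes _ = h
          ... | no _ = O₁.S-0# d₁
          S-π : ∀ j → S (d ℕ.* j) (ι (tr v)) ≡ S (d₁ ℕ.* π j) (ι (tr v))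
          S-π j = trans (cong (λ w → S w w₀) (trans (cong (ℕ._* j) (ℕₚ.*-comm p d₁)) (trans (ℕₚ.*-assoc d₁ p j) (trans (cong (d₁ ℕ.*_) (m≡m%n+[m/n]*n (p ℕ.* j) N))
              (trans (lem d₁ (π j) ((p ℕ.* j) / N) N) (cong (λ w → d₁ ℕ.* π j ℕ.+ ((p ℕ.* j) / N) ℕ.* w) Nd₁))))))
              (trans (S-+ (d₁ ℕ.* π j) _ w₀) (cong (S (d₁ ℕ.* π j)) (Fix-∣ (n∣m*n ((p ℕ.* j) / N)) (subst (Fix n₁) (sym (ι-tr v)) (Tr-Fix v)))))
            where
            w₀ = ι (tr v)
            lem : ∀ d a b N → d ℕ.* (a ℕ.+ b ℕ.* N) ≡ d ℕ.* a ℕ.+ b ℕ.* (N ℕ.* d)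
            lem = solve-∀
          sum0 : O₁.comb d₁ N c₂ (tr v) ≡ O₁.0#
          sum0 = trans (sym (O₁.collect d₁ N c₁ π (downFrom N) (λ j → m%n<n (p ℕ.* j) N) (tr v))) (ι-inj (trans (ι-∑ (downFrom N) _) (trans
             (S.Big-cong (downFrom N) (λ {j} _ → trans (ι-* (c₁ j) _) (cong₂ _*_ (ιc₁ j) (trans (ι-S (d₁ ℕ.* π j) (tr v)) (sym (S-π j))))))
             (trans (cong (comb d N coeff) (ι-tr v)) (trans (sym (coeff-eq (Tr v))) (trans fTr (sym ι-0)))))))
          all0 : ∀ j → j < N → coeff j ≡ 0#
          all0 j l = trans (sym (ιc₁ j)) (trans (cong ι (trans (sym (O₁.∑-single (downFrom N) π c₁ j (Uniq.downFrom⁺ N) (∈-downFrom⁺ l) (λ i∈ e → *%-injective N p copp (∈-downFrom⁻ i∈) l e)))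
              (cn d₁ N Nd₁ c₂ (λ m _ → O₁.Fix-∑ (downFrom N) _ (λ {i} _ → δ-Fix (π i) m (c₁-Fix i))) sum0 (π j) (m%n<n (p ℕ.* j) N)))) ι-0)

        annihilator-zero : ∀ x → InA d d x → x v ≡ 0# → x ≐ zeroOp
        annihilator-zero x xA xv = invert (RingA.regular d d ∣-refl N Nd copN (ℕₚ.*-mono-≤ (prime≥1 P) d₁≥1) x xA)
          where
          invert : (∃ λ g → InA d d g × (∀ y → x (g (x y)) ≡ x y)) → x ≐ zeroOp
          invert (g , gA , xgx) y = trans (sym (xgx y)) (trans (cong x (idempotent-zero (λ y → g (x y)) (comp gA xA , λ y → cong g (xgx y)) (trans (cong g xv) (A-0 gA)) y)) (A-0 xA))

      up : ∀ {v} → O₁.CN (tr v) → CN v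
      up {v} cn d N Nd c cF sum0 = comb-zero Nd (decide (p ∣? N))
        where
        decide : Dec (p ∣ N) → comb d N c ≐ zeroOp
        decide (yes (divides N₁ N≡)) = Divisible.annihilator-zero d N₁ (ℕₚ.*-cancelˡ-≡ (N₁ ℕ.* d) n₁ p {{prime⇒nonZero P}} (trans (lem p N₁ d) (trans (cong (ℕ._* d) (sym N≡)) (trans Nd (sym pn₁))))) v cn
            (comb d N c) (combA N c cF) sum0
          where
          lem : ∀ p N d → p ℕ.* (N ℕ.* d) ≡ N ℕ.* p ℕ.* d
          lem = solve-∀
        decide (no p∤N) = split coprime-p∣d
          where
          coprime-p∣d : p ∣ d
          coprime-p∣d = Cop.coprime-divisor (prime-coprime P p∤N) (subst (p ∣_) (sym Nd) (divides n₁ (sym n₁p)))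
          split : p ∣ d → comb d N c ≐ zeroOp
          split (divides d₁ d≡) = subst (λ w → comb w N c ≐ zeroOp) pd≡ (Coprimal.annihilator-zero d₁ N Nd₁ p∤N v cn (comb (p ℕ.* d₁) N c)
              (combA N c (λ j l → subst (λ w → Fix w (c j)) (sym pd≡) (cF j l))) (subst (λ w → comb w N c v ≡ 0#) (sym pd≡) sum0))
            where
            pd≡ : p ℕ.* d₁ ≡ d
            pd≡ = trans (ℕₚ.*-comm p d₁) (sym d≡)
            Nd₁ : N ℕ.* d₁ ≡ n₁
            Nd₁ = ℕₚ.*-cancelˡ-≡ (N ℕ.* d₁) n₁ p {{prime⇒nonZero P}} (trans (lem p N d₁) (trans (cong (N ℕ.*_) pd≡) (trans Nd (sym pn₁))))
              where
              lem : ∀ p N d → p ℕ.* (N ℕ.* d) ≡ N ℕ.* (p ℕ.* d)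
              lem = solve-∀

      Tr-+ : ∀ x y → Tr (x + y) ≡ Tr x + Tr y
      Tr-+ x y = trans (S.Big-cong (downFrom p) (λ {i} _ → S-add (n₁ ℕ.* i) x y)) (S.Big-∙ (downFrom p) _ _)

      Tr-Fix-* : ∀ {y} → Fix n₁ y → ∀ x → Tr (y * x) ≡ y * Tr x
      Tr-Fix-* {y} h x = trans (S.Big-cong (downFrom p) (λ {i} _ → trans (S-mul (n₁ ℕ.* i) y x) (cong (_* S (n₁ ℕ.* i) x) (Fix-∣ (m∣m*n i) h)))) (sym (∑-*ˡ (downFrom p) _ y))

      Tr-nonzero : ∃ λ z → ¬ Tr z ≡ 0#
      Tr-nonzero = nonzero-witness {Tr} λ h → 1≢0 (independence n₁ p pn₁ p ℕₚ.≤-refl (λ _ → 1#)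
        (λ x → trans (S.Big-cong (downFrom p) (λ _ → *-identityˡ _)) (h x)) 0 (prime≥1 P))

      card-fibred : ∀ {G : O₁.F → Set} {M κ} → Card G M → Card (λ x → Tr x ≡ 0#) κ → Card (λ v → G (tr v)) (M ℕ.* κ)
      card-fibred {G} cG cK = card-bij (λ (y , k) → section (ι y) + k) (λ v → tr v , v - section (Tr v))
          (λ {w} (g , k) → subst G (sym (tr-back (proj₁ w) (proj₂ w) k)) g)
          (λ {v} g → g , trans (Tr-+ v _) (trans (cong (Tr v +_) (trans (sym (Tr-neg _)) (cong -_ (Tr-section (Tr-Fix v))))) (-‿inverseʳ (Tr v))))
          (λ {w} (g , k) → cong₂ _,_ (tr-back (proj₁ w) (proj₂ w) k) (trans (cong (λ z → (section (ι (proj₁ w)) + proj₂ w) - section z) (trans (Tr-back (proj₁ w) (proj₂ w) k) refl)) (cancel (section (ι (proj₁ w))) (proj₂ w))))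
          (λ {v} _ → trans (cong (λ z → section z + (v - section (Tr v))) (ι-tr v)) (uncancel (section (Tr v)) v))
          (card-× cG cK)
        where
        z = proj₁ Tr-nonzero
        r = proj₁ (inverse (Tr z) (proj₂ Tr-nonzero))
        rz : Tr z * r ≡ 1#
        rz = proj₂ (inverse (Tr z) (proj₂ Tr-nonzero))
        rF : Fix n₁ r
        rF = Fix-inv (proj₂ Tr-nonzero) rz (Tr-Fix z)
        section : Op
        section y = (y * r) * z
        Tr-section : ∀ {y} → Fix n₁ y → Tr (section y) ≡ y
        Tr-section {y} h = trans (Tr-Fix-* (Fix-mul h rF) z) (trans (*-assoc y r _) (trans (cong (y *_) (trans (*-comm r _) rz)) (*-identityʳ y)))
        Tr-neg : ∀ x → - Tr x ≡ Tr (- x)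
        Tr-neg x = trans (∑-neg (downFrom p) _) (S.Big-cong (downFrom p) (λ {i} _ → sym (S-neg (n₁ ℕ.* i) x)))
        Tr-back : ∀ y k → Tr k ≡ 0# → Tr (section (ι y) + k) ≡ ι y
        Tr-back y k h = trans (Tr-+ _ k) (trans (cong₂ _+_ (Tr-section (ι-fixed y)) h) (+-identityʳ _))
        tr-back : ∀ y k → Tr k ≡ 0# → tr (section (ι y) + k) ≡ y
        tr-back y k h = ι-inj (trans (ι-tr _) (Tr-back y k h))
        cancel : ∀ s k → (s + k) - s ≡ k
        cancel s k = trans (cong (_- s) (+-comm s k)) (trans (+-assoc k s _) (trans (cong (k +_) (-‿inverseʳ s)) (+-identityʳ k)))
        uncancel : ∀ s v → s + (v - s) ≡ v
        uncancel s v = trans (+-comm s _) (trans (+-assoc v _ s) (trans (cong (v +_) (-‿inverseˡ s)) (+-identityʳ v)))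

      card-kernel : Card (λ x → Tr x ≡ 0#) (q ℕ.^ (n ∸ n₁))
      card-kernel = finish (card-filter (λ x → Tr x ≟ 0#) enum)
        where
        finish : (∃ λ κ → Card (λ x → _ × Tr x ≡ 0#) κ) → Card (λ x → Tr x ≡ 0#) (q ℕ.^ (n ∸ n₁))
        finish (κ , c) = subst (Card (λ x → Tr x ≡ 0#)) κ≡ c′
          where
          c′ : Card (λ x → Tr x ≡ 0#) κ
          c′ = card-cong proj₂ (tt ,_) c
          κ≡ : κ ≡ q ℕ.^ (n ∸ n₁)
          κ≡ = ℕₚ.*-cancelˡ-≡ κ _ (q ℕ.^ n₁) {{ℕₚ.m^n≢0 q n₁}} (trans (trans (cong (ℕ._* κ) (sym order₁)) (card-unique (card-fibred O₁.enum c′) enum (λ _ → tt) (λ _ → tt)))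
             (trans order≡ (trans (cong (q ℕ.^_) (sym (ℕₚ.m+[n∸m]≡n (∣⇒≤ {{>-nonZero n≥1}} n₁∣n)))) (ℕₚ.^-distribˡ-+-* q n₁ (n ∸ n₁)))))

      card-CN-step : ∀ {M} → Card O₁.CN M → Card CN (M ℕ.* q ℕ.^ (n ∸ n₁))
      card-CN-step c = card-cong up down (card-fibred c card-kernel)

    module Sub = Subfield.Finite ring (Fix n₁) Fix-+ Fix-mul Fix-neg (S-0# n₁) (S-1# n₁) 1≢0
      (λ x fx ne → proj₁ (inverse x ne) , Fix-inv ne (proj₂ (inverse x ne)) fx , proj₂ (inverse x ne))
      (elems fixed) (uniq fixed) (All.tabulate (sound fixed)) (λ x fx → complete fixed fx)

    abstract
      descent : Σ FinField λ FF₁ → Σ (1 ≤ n₁) λ n₁≥1 → Σ (FinField.order FF₁ ≡ q ℕ.^ n₁) λ order₁ →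
        ∀ {M} → Card (Setting.CN (extension FF₁ p e n₁ P e≥1 n₁≥1 q q≡ order₁)) M → Card (Setting.CN Ω) (M ℕ.* q ℕ.^ (n ∸ n₁))
      descent = Sub.model , n₁≥1 , size fixed , Descent.card-CN-step Sub.model (size fixed) Sub.to Sub.to-injective (Sub.to-from _ _) (Sub.to-from _ _)
        (λ x y → Sub.to-from _ _) (λ x y → Sub.to-from _ _) Sub.to-Sub Sub.from Sub.to-from

open import Defs
open import Level using (Level; Lift; lift; _⊔_)
open import Algebra.Bundles using (CommutativeRing)
open import Data.Nat as ℕ using (ℕ; zero; suc; _≤_; _<_; _≥_; _∸_; >-nonZero; _*_; _^_)
import Data.Nat.Properties as ℕₚ
open import Data.Nat.Divisibility using (_∣_; divides; ∣-refl; m∣m*n; n∣m*n)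
open import Data.Nat.Coprimality as Cop using (coprime-divisor)
open import Data.Nat.Tactic.RingSolver using (solve-∀)
open import Data.Nat.Primality using (Prime)
open import Data.Fin using (Fin; toℕ; fromℕ<) renaming (zero to fzero; suc to fsuc)
import Data.Fin.Properties as Fin
open import Data.List using (List; downFrom; map)
open import Data.List.Properties using (length-map)
open import Data.List.Relation.Unary.All as All using (All)
import Data.List.Relation.Unary.All.Properties as AllP
open import Data.List.Relation.Unary.AllPairs as AllPairs using (AllPairs)
import Data.List.Relation.Unary.AllPairs.Properties as APP
open import Data.List.Relation.Unary.Any as Any using (Any)
import Data.List.Relation.Unary.Any.Properties as AnyP
open import Data.Vec as Vec using (Vec)
import Data.Vec.Relation.Unary.All as VAll
open import Data.Product using (Σ; ∃; _×_; _,_; proj₁; proj₂)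
open import Data.Unit using (⊤; tt)
open import Relation.Nullary using (¬_)
open import Relation.Binary.PropositionalEquality as ≡ using (_≡_; cong; subst)
open Arithmetic
open Orders
open ComponentArithmetic using (÷-∣; *-÷)
open Totient using (formula-pa)
open Cardinality
open FiniteFields
open FiniteModels
open TwistedGroupRing using (extension)

module _ (p e q n' : ℕ) (P : Prime p) (e≥1 : 1 ≤ e) (q≡ : q ≡ p ^ e) (p∤n' : ¬ p ∣ n') where

  card-completely-normal : ∀ a (FF : FinField) n → n ≡ p ^ a * n' → (n≥1 : 1 ≤ n) (order≡ : FinField.order FF ≡ q ^ n) → Reg q n n' →
    Card (TwistedGroupRing.Setting.CN (extension FF p e n P e≥1 n≥1 q q≡ order≡)) (formula q 1 n' * q ^ (n ∸ n'))
  card-completely-normal zero FF n n≡ n≥1 order≡ reg = go n (≡.trans n≡ (ℕₚ.+-identityʳ n')) n≥1 order≡ reg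
    where
    go : ∀ n → n ≡ n' → (n≥1 : 1 ≤ n) (order≡ : FinField.order FF ≡ q ^ n) → Reg q n n' →
      Card (TwistedGroupRing.Setting.CN (extension FF p e n P e≥1 n≥1 q q≡ order≡)) (formula q 1 n' * q ^ (n ∸ n'))
    go n ≡.refl n≥1 order≡ reg = subst (Card (TwistedGroupRing.Setting.CN (extension FF p e n P e≥1 n≥1 q q≡ order≡))) (≡.sym (≡.trans (cong (λ w → formula q 1 n' * q ^ w) (ℕₚ.n∸n≡0 n')) (ℕₚ.*-identityʳ _)))
      (CoprimeDegree.CoprimeCase.card-CN (extension FF p e n P e≥1 n≥1 q q≡ order≡) p∤n' reg)
  card-completely-normal (suc a) FF n n≡ n≥1 order≡ reg = go (TraceDescent.Step.descent (extension FF p e n P e≥1 n≥1 q q≡ order≡) n₁ n' pn₁ reg p-free)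
    where
    n₁ = p ^ a * n'
    pn₁ : p * n₁ ≡ n
    pn₁ = ≡.trans (≡.sym (ℕₚ.*-assoc p (p ^ a) n')) (≡.sym n≡)
    p-free : ∀ N → N ∣ n → ¬ p ∣ N → N ∣ n'
    p-free N d h = coprime-divisor (Cop.sym (prime^-coprime (suc a) P h)) (subst (N ∣_) n≡ d)
    n₁≤n : n₁ ≤ n
    n₁≤n = subst (n₁ ≤_) pn₁ (ℕₚ.m≤n*m n₁ p {{>-nonZero (prime≥1 P)}})
    reg₁ : 1 ≤ n₁ → Reg q n₁ n'
    reg₁ n₁≥1 = record { q≥1 = R.q≥1 ; n≥1 = n₁≥1 ; n'≥1 = R.n'≥1 ; n'∣n = n∣m*n (p ^ a) ; q-coprime = R.q-coprime
      ; o = R.o ; o≥1 = R.o≥1 ; o-one = R.o-one ; o-coprime = coprime-∣ R.o-coprime ∣-refl (divides p (≡.sym pn₁)) }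
      where module R = Reg reg
    arith : 1 ≤ n₁ → formula q 1 n' * q ^ (n₁ ∸ n') * q ^ (n ∸ n₁) ≡ formula q 1 n' * q ^ (n ∸ n')
    arith n₁≥1 = ≡.trans (ℕₚ.*-assoc (formula q 1 n') _ _) (cong (formula q 1 n' *_) (≡.trans (≡.sym (ℕₚ.^-distribˡ-+-* q (n₁ ∸ n') (n ∸ n₁)))
      (cong (q ^_) (ℕₚ.+-cancelʳ-≡ n' _ _ (≡.trans (lem (n₁ ∸ n') (n ∸ n₁) n') (≡.trans (cong (ℕ._+ (n ∸ n₁)) (ℕₚ.m∸n+n≡m n'≤n₁))
        (≡.trans (ℕₚ.m+[n∸m]≡n n₁≤n) (≡.sym (ℕₚ.m∸n+n≡m (ℕₚ.≤-trans n'≤n₁ n₁≤n))))))))))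
      where
      n'≤n₁ : n' ≤ n₁
      n'≤n₁ = ℕₚ.m≤n*m n' (p ^ a) {{>-nonZero (∣⇒≥1 n₁≥1 (m∣m*n n'))}}
      lem : ∀ a b c → a ℕ.+ b ℕ.+ c ≡ a ℕ.+ c ℕ.+ b
      lem = solve-∀
    go : (Σ FinField λ FF₁ → Σ (1 ≤ n₁) λ n₁≥1 → Σ (FinField.order FF₁ ≡ q ^ n₁) λ order₁ →
      ∀ {M} → Card (TwistedGroupRing.Setting.CN (extension FF₁ p e n₁ P e≥1 n₁≥1 q q≡ order₁)) M → Card (TwistedGroupRing.Setting.CN (extension FF p e n P e≥1 n≥1 q q≡ order≡)) (M * q ^ (n ∸ n₁))) →
      Card (TwistedGroupRing.Setting.CN (extension FF p e n P e≥1 n≥1 q q≡ order≡)) (formula q 1 n' * q ^ (n ∸ n'))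
    go (FF₁ , n₁≥1 , order₁ , step) = subst (Card (TwistedGroupRing.Setting.CN (extension FF p e n P e≥1 n≥1 q q≡ order≡))) (arith n₁≥1)
      (step (card-completely-normal a FF₁ n₁ ≡.refl n₁≥1 order₁ (reg₁ n₁≥1)))

module Transfer {c ℓ} (K : Field c ℓ) (p e n : ℕ) (P : Prime p) (e≥1 : 1 ≤ e) (n≥1 : 1 ≤ n) (q : ℕ) (q≡ : q ≡ p ^ e)
  (FF : FinField) (order≡ : FinField.order FF ≡ q ^ n) where

  open Field K using (ring; Carrier; _≈_; 0#; 1#; _*ᴷ_; _+ᴷ_)
  open CommutativeRing ring using (refl; sym; trans; reflexive; *-cong; *-congˡ; +-cong)
  open FieldTheory K
  module O = TwistedGroupRing.Setting (extension FF p e n P e≥1 n≥1 q q≡ order≡)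
  open O using (F)

  module _ (to : F → Carrier) (to-injective : ∀ {i j} → to i ≈ to j → i ≡ j) (from : Carrier → F) (to-from : ∀ x → to (from x) ≈ x)
    (to-+ : ∀ i j → to (i O.+ j) ≈ (to i +ᴷ to j)) (to-* : ∀ i j → to (i O.* j) ≈ (to i *ᴷ to j)) (to-0 : to O.0# ≈ 0#) (to-1 : to O.1# ≈ 1#) where

    to-cong : ∀ {i j} → i ≡ j → to i ≈ to j
    to-cong h = reflexive (cong to h)

    to-pow : ∀ i k → to (i O.^ k) ≈ pow (to i) k
    to-pow i zero = to-1
    to-pow i (suc k) = trans (to-* i _) (*-congˡ (to-pow i k))

    pow-cong : ∀ {x y} k → x ≈ y → pow x k ≈ pow y k
    pow-cong zero h = refl
    pow-cong (suc k) h = *-cong h (pow-cong k h)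

    to-S : ∀ d {i x} → to i ≈ x → to (O.S d i) ≈ pow x (q ^ d)
    to-S d {i} h = trans (to-cong (O.S-def d i)) (trans (to-pow i (q ^ d)) (pow-cong (q ^ d) h))

    Fix⇒InSub : ∀ d {i} → O.Fix d i → InSub (q ^ d) (to i)
    Fix⇒InSub d h = trans (sym (to-S d refl)) (to-cong h)

    InSub⇒Fix : ∀ d {i x} → to i ≈ x → InSub (q ^ d) x → O.Fix d i
    InSub⇒Fix d h k = to-injective (trans (to-S d h) (trans k (sym h)))

    to-∑ : ∀ m (f g : ℕ → F) (a b : Fin m → Carrier) → (∀ j → to (f (toℕ j)) ≈ a j) → (∀ j → to (g (toℕ j)) ≈ b j) →
      to (O.∑ (downFrom m) (λ j → f j O.* g j)) ≈ lincomb m a b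
    to-∑ zero f g a b h k = to-0
    to-∑ (suc m) f g a b h k = trans (to-cong (O.∑-head m (λ j → f j O.* g j))) (trans (to-+ _ _)
      (+-cong (trans (to-* _ _) (*-cong (h fzero) (k fzero))) (to-∑ m (λ j → f (suc j)) (λ j → g (suc j)) (λ j → a (fsuc j)) (λ j → b (fsuc j)) (λ j → h (fsuc j)) (λ j → k (fsuc j)))))

    extend : ∀ m → (Fin m → Carrier) → ℕ → F
    extend zero a k = O.0#
    extend (suc m) a zero = from (a fzero)
    extend (suc m) a (suc k) = extend m (λ j → a (fsuc j)) k

    extend-toℕ : ∀ m a j → to (extend m a (toℕ j)) ≈ a j
    extend-toℕ (suc m) a fzero = to-from _
    extend-toℕ (suc m) a (fsuc j) = extend-toℕ m (λ j → a (fsuc j)) j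

    conjugates : ∀ d {i x} → to i ≈ x → ∀ {m} (j : Fin m) → to (O.S (d * toℕ j) i) ≈ pow x (q ^ (d * toℕ j))
    conjugates d h j = to-S (d * toℕ j) h

    CN⇒ : ∀ {i} → O.CN i → CompletelyNormal q n (to i)
    CN⇒ {i} cn d d∣n = independent , spans
      where
      m = n ÷ d
      md : m * d ≡ n
      md = ÷-∣ (∣⇒≥1 n≥1 d∣n) d∣n
      independent : ∀ (a : Fin m → Carrier) → (∀ j → InSub (q ^ d) (a j)) → lincomb m a (λ j → pow (to i) (q ^ (d * toℕ j))) ≈ 0# → ∀ j → a j ≈ 0#
      independent a aS h j = trans (sym (extend-toℕ m a j)) (trans (to-cong (cn d m md (extend m a) fixed
          (to-injective (trans (to-∑ m (extend m a) (λ j → O.S (d * j) i) a _ (extend-toℕ m a) (conjugates d refl)) (trans h (sym to-0)))) (toℕ j) (Fin.toℕ<n j))) to-0)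
        where
        fixed : ∀ k → k < m → O.Fix d (extend m a k)
        fixed k l = subst (λ w → O.Fix d (extend m a w)) (Fin.toℕ-fromℕ< l) (InSub⇒Fix d (extend-toℕ m a (fromℕ< l)) (aS (fromℕ< l)))
      surjective : ∀ y → ∃ λ v → VAll.All (O.Fix d) v × O.comb d m (O.at v) i ≡ y
      surjective y = card-surj (λ v → O.comb d m (O.at v) i) (λ _ → tt) inj (card-Vec (O.card-Fix d d∣n) m) O.enum
          (ℕₚ.≤-reflexive (≡.trans order≡ (≡.trans (cong (q ^_) (≡.trans (≡.sym md) (ℕₚ.*-comm m d))) (≡.sym (ℕₚ.^-*-assoc q d m))))) tt
        where
        inj : ∀ {v w : Vec F m} → VAll.All (O.Fix d) v → VAll.All (O.Fix d) w → O.comb d m (O.at v) i ≡ O.comb d m (O.at w) i → v ≡ w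
        inj {v} {w} hv hw eq = O.at-ext v w (λ j l → O.-‿cancel (cn d m md (λ j → O.at v j O.- O.at w j)
            (λ j _ → O.Fix-+ (O.at-All (O.S-0# d) hv j) (O.Fix-neg (O.at-All (O.S-0# d) hw j)))
            (≡.trans (O.S.Big-cong (downFrom m) (λ {j} _ → ≡.trans (O.distribʳ _ (O.at v j) (O.- O.at w j)) (cong (O.at v j O.* O.S (d * j) i O.+_) (≡.sym (O.-‿distribˡ-* (O.at w j) _)))))
              (≡.trans (O.S.Big-∙ (downFrom m) _ _) (≡.trans (cong (O.comb d m (O.at v) i O.+_) (≡.sym (O.∑-neg (downFrom m) _))) (O.x-x eq)))) j l))
      spans : ∀ x → ∃ λ (a : Fin m → Carrier) → (∀ j → InSub (q ^ d) (a j)) × lincomb m a (λ j → pow (to i) (q ^ (d * toℕ j))) ≈ x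
      spans x = combination (surjective (from x))
        where
        combination : (∃ λ v → VAll.All (O.Fix d) v × O.comb d m (O.at v) i ≡ from x) →
          ∃ λ (a : Fin m → Carrier) → (∀ j → InSub (q ^ d) (a j)) × lincomb m a (λ j → pow (to i) (q ^ (d * toℕ j))) ≈ x
        combination (v , hv , eq) = (λ j → to (O.at v (toℕ j))) , (λ j → Fix⇒InSub d (O.at-All (O.S-0# d) hv (toℕ j))) ,
          trans (sym (to-∑ m (O.at v) (λ j → O.S (d * j) i) _ _ (λ _ → refl) (conjugates d refl))) (trans (to-cong eq) (to-from x))

    CN⇐ : ∀ {i x} → to i ≈ x → CompletelyNormal q n x → O.CN i
    CN⇐ {i} {x} h cn d N Nd f fF sum0 j l = go (n ÷ d) (≡.trans (cong (_÷ d) (≡.sym Nd)) (*-÷ N (∣⇒≥1 n≥1 d∣n))) (proj₁ (cn d d∣n))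
      where
      d∣n : d ∣ n
      d∣n = divides N (≡.sym Nd)
      go : ∀ m → m ≡ N → (∀ (a : Fin m → Carrier) → (∀ j → InSub (q ^ d) (a j)) → lincomb m a (λ j → pow x (q ^ (d * toℕ j))) ≈ 0# → ∀ j → a j ≈ 0#) → f j ≡ O.0#
      go m ≡.refl ind = to-injective (trans (subst (λ w → to (f w) ≈ 0#) (Fin.toℕ-fromℕ< l)
        (ind (λ j → to (f (toℕ j))) (λ j → Fix⇒InSub d (fF (toℕ j) (Fin.toℕ<n j))) (trans (sym (to-∑ N f (λ j → O.S (d * j) i) _ _ (λ _ → refl) (conjugates d h))) (trans (to-cong sum0) to-0)) (fromℕ< l))) (sym to-0))

    hasCard : ∀ {M} → Card O.CN M → HasCard (CompletelyNormal q n) M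
    hasCard card = map to (elems card) , ≡.trans (length-map to (elems card)) (size card) ,
      APP.map⁺ (AllPairs.map (λ ne h → ne (to-injective h)) (uniq card)) ,
      AllP.map⁺ (All.tabulate (λ i∈ → CN⇒ (sound card i∈))) ,
      λ x cn → AnyP.map⁺ (Any.map (λ {y} eq → trans (sym (to-from x)) (to-cong eq)) (complete card (CN⇐ (to-from x) cn)))

theorem13p1 : ∀ {c ℓ : Level} (p e q n a n' : ℕ) → Prime p → e ≥ 1 → q ≡ p ^ e
    → n ≥ 1 → n ≡ p ^ a * n' → ¬ (p ∣ n') → Regular q n n'
    → (K : Field c ℓ) → FieldTheory.HasCard K (λ _ → Lift (c ⊔ ℓ) ⊤) (q ^ n)
    → FieldTheory.HasCard K (FieldTheory.CompletelyNormal K q n) (formula q (p ^ a) n')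
theorem13p1 {c} {ℓ} p e q n a n' P e≥1 q≡ n≥1 n≡ p∤n' regular K (xs , len , distinct , _ , covers) =
  Transfer.hasCard K p e n P e≥1 n≥1 q q≡ M.model len M.to M.to-injective (λ x → M.from x tt) (λ x → M.to-from x tt)
    (λ i j → M.to-from _ tt) (λ i j → M.to-from _ tt) (M.to-from _ tt) (M.to-from _ tt)
    (subst (Card _) count (card-completely-normal p e q n' P e≥1 q≡ p∤n' a M.model n n≡ n≥1 len reg))
  where
  module M = Subfield.Finite (Field.ring K) (λ _ → ⊤) (λ _ _ → tt) (λ _ _ → tt) (λ _ → tt) tt tt (Field.1≉0 K)
    (λ x _ ne → proj₁ (Field.inverse K x ne) , tt , proj₂ (Field.inverse K x ne))
    xs distinct (All.tabulate (λ _ → tt)) (λ x _ → covers x (lift tt))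
  n'∣n : n' ∣ n
  n'∣n = divides (p ^ a) n≡
  n'≥1 : 1 ≤ n'
  n'≥1 = ∣⇒≥1 n≥1 n'∣n
  q≥1 : 1 ≤ q
  q≥1 = subst (1 ≤_) (≡.sym q≡) (ℕₚ.m^n>0 p {{>-nonZero (prime≥1 P)}} e)
  reg : Reg q n n'
  reg = regular⇒Reg q≥1 n≥1 n'≥1 n'∣n (coprime-primes n'≥1 λ s S s∣n' s∣q →
    p∤n' (subst (_∣ n') (prime∣prime S P (prime∣^ p e S (subst (s ∣_) q≡ s∣q))) s∣n')) regular
  count : formula q 1 n' * q ^ (n ∸ n') ≡ formula q (p ^ a) n'
  count = ≡.trans (cong (λ w → formula q 1 n' * q ^ w) (≡.trans (cong (_∸ n') n≡) (≡.sym (≡.trans (ℕₚ.*-distribʳ-∸ n' (p ^ a) 1) (cong (p ^ a * n' ∸_) (ℕₚ.*-identityˡ n'))))))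
    (≡.sym (formula-pa q (p ^ a) n' n'≥1))
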